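{- Let $Q$ be the set of primes $q$ with $q\equiv 1\pmod 4$, and for $q\in Q$ let $P_q$ be the Paley graph of order $q$, with chromatic polynomial $$\chi_{P_q}(n)=\sum_{r=0}^{\infty}c_r(q)n^{q-r},\qquad c_r(q)=0\ \text{ for } r>q.$$ Then $\{\chi_{P_q}(n)\}_{q\in Q}$ is a two-level polynomial over $Q$ of degree function $q$ whose maximal constant depth is two. That is: there exist polynomials $\varphi_0,\varphi_1,\varphi_2$ such that $c_r(q)=\varphi_r(q)$ for all $q\in Q$ and $r\in\{0,1,2\}$, but there is no polynomial $\varphi_3$ such that $c_3(q)=\varphi_3(q)$ for all sufficiently large $q\in Q$.
   Context: For a prime $q\equiv 1\pmod 4$, the Paley graph $P_q$ is the graph with vertex set $\mathbb Z/q\mathbb Z$ in which two distinct vertices $x,y$ are adjacent if $x-y$ is a quadratic residue modulo $q$. The chromatic polynomial $\chi_G$ of a graph $G$ is the unique polynomial such that for each natural number $n$, $\chi_G(n)$ is the number of proper $n$-colorings of $G$. Two-level polynomial over $Q$: let $Q\subseteq\mathbb N$ be infinite, let $g\in\mathbb Q[q]$ take nonnegative integer values on $Q$, and let $e:Q\to\mathbb N\cup\{ -1,\infty\}$. A family of polynomials $(f_q(n))_{q\in Q}$ is a two-level polynomial over $Q$ of degree function $g$ and depth function $e$ if $f_q(n)$ has degree $g(q)$ for each $q\in Q$ and, writing $f_q(n)=\sum_{r=0}^{\infty}c_r(q)n^{g(q)-r}$ with $c_r(q)=0$ for $r>g(q)$, there exist polynomials $\{\varphi_r(q)\}_{r\ge0}$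 such that $c_r(q)=\varphi_r(q)$ for every $q\in Q$ and every $r\le e(q)$. -}

module Defs where

open import Data.Fin.Base using (Fin; toℕ; finToFun)
import Data.Fin.Properties as Fin
open import Data.Integer.Base as ℤ using (ℤ; +_)
open import Data.Integer.Divisibility.Signed using (_∣_; _∣?_)
open import Data.List.Base using (List; []; _∷_; foldr; filter; length; allFin)
open import Data.Nat.Base using (ℕ; zero; suc; _∸_; _^_; _≤_; _<_; _%_)
open import Data.Nat.Primality using (Prime)
open import Data.Nat.Properties using (_≤?_)
open import Data.Product.Base using (_×_; _,_; ∃-syntax)
open import Data.Rational.Base as ℚ using (ℚ; 0ℚ; 1ℚ; _/_)
open import Data.Sum.Base as Sum using (_⊎_)
open import Level using (0ℓ)
open import Relation.Binary.Core using (Rel)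
open import Relation.Binary.Definitions using (Decidable; Symmetric; Irreflexive)
open import Relation.Binary.Construct.Add.Extrema.NonStrict _≤_ using (_≤±_)
open import Relation.Binary.PropositionalEquality using (_≡_; _≢_; ≢-sym)
open import Relation.Nullary.Construct.Add.Extrema using (_±; [_])
open import Relation.Nullary.Decidable using (yes; no; _×-dec_; _⊎-dec_; _→-dec_; ¬?)
open import Relation.Unary using (Pred; _∈_)
import Relation.Unary as Unary

-- Polynomials in one variable over ℚ

-- Coefficient lists, constant term first.  Trailing zeros are allowed, so
-- one polynomial has many lists; everything below depends only on the
-- values of `coeff` and `⟦_⟧`.
ℚ[X] : Set
ℚ[X] = List ℚ

X : ℚ[X]
X = 0ℚ ∷ 1ℚ ∷ []

coeff : ℚ[X] → ℕ → ℚ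
coeff []      _       = 0ℚ
coeff (a ∷ p) zero    = a
coeff (a ∷ p) (suc i) = coeff p i

fromℕ : ℕ → ℚ
fromℕ n = + n / 1

⟦_⟧ : ℚ[X] → ℕ → ℚ
⟦ p ⟧ n = foldr (λ a y → a ℚ.+ fromℕ n ℚ.* y) 0ℚ p

HasDegree : ℚ[X] → ℕ → Set
HasDegree p d = coeff p d ≢ 0ℚ × (∀ i → d < i → coeff p i ≡ 0ℚ)

-- The number c_r in  p(n) = Σ_{r ≥ 0} c_r n^(d - r),  c_r = 0 for r > d,
-- where p has degree d.
coeffFromTop : ℚ[X] → ℕ → ℕ → ℚ
coeffFromTop p d r with r ≤? d
... | yes _ = coeff p (d ∸ r)
... | no  _ = 0ℚ

-- Graphs and chromatic polynomials

record SimpleGraph (v : ℕ) : Set₁ where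
  field
    Adj    : Rel (Fin v) 0ℓ
    adj?   : Decidable Adj
    sym    : Symmetric Adj
    irrefl : Irreflexive _≡_ Adj

-- Distinct x, y are joined when R holds between them in some order.
fromRel : ∀ {v} {R : Rel (Fin v) 0ℓ} → Decidable R → SimpleGraph v
fromRel {R = R} R? = record
  { Adj    = λ x y → x ≢ y × (R x y ⊎ R y x)
  ; adj?   = λ x y → ¬? (x Fin.≟ y) ×-dec (R? x y ⊎-dec R? y x)
  ; sym    = λ (x≢y , r) → ≢-sym x≢y , Sum.swap r
  ; irrefl = λ x≡y (x≢y , _) → x≢y x≡y
  }

Proper : ∀ {v n} → SimpleGraph v → Pred (Fin v → Fin n) 0ℓ
Proper G c = ∀ x y → Adj x y → c x ≢ c y
  where open SimpleGraph G

proper? : ∀ {v n} (G : SimpleGraph v) → Unary.Decidable (Proper {n = n} G)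
proper? G c = Fin.all? λ x → Fin.all? λ y → adj? x y →-dec ¬? (c x Fin.≟ c y)
  where open SimpleGraph G

-- `finToFun` enumerates all n ^ v maps Fin v → Fin n, each once.
#properColourings : ∀ {v} → SimpleGraph v → ℕ → ℕ
#properColourings {v} G n =
  length (filter (λ i → proper? G (finToFun {n} {v} i)) (allFin (n ^ v)))

-- At most one polynomial satisfies this, up to trailing zeros, as a
-- rational polynomial is determined by its values on ℕ.
IsChromaticPolynomial : ∀ {v} → SimpleGraph v → ℚ[X] → Set
IsChromaticPolynomial G χ = ∀ n → ⟦ χ ⟧ n ≡ fromℕ (#properColourings G n)

-- Paley graphs

IsSquareMod : ℕ → ℤ → Set
IsSquareMod q a = ∃[ z ] + q ∣ (+ toℕ {q} z ℤ.* + toℕ z) ℤ.- a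

isSquareMod? : ∀ q → Unary.Decidable (IsSquareMod q)
isSquareMod? q a = Fin.any? λ z → + q ∣? (+ toℕ z ℤ.* + toℕ z) ℤ.- a

-- Fin q stands for ℤ/qℤ.  Distinct vertices have nonzero difference mod q,
-- so being a square mod q is the same as being a quadratic residue for it.
-- When q is a prime ≡ 1 mod 4, -1 is a square, so x - y is a square mod q
-- exactly when y - x is, and the order chosen in `fromRel` is immaterial.
paley : (q : ℕ) → SimpleGraph q
paley q = fromRel λ x y → isSquareMod? q (+ toℕ x ℤ.- + toℕ y)

PrimeOneModFour : Pred ℕ 0ℓ
PrimeOneModFour q = Prime q × q % 4 ≡ 1

-- Two-level polynomials

-- ℕ ± is ℕ with a bottom, playing the role of -1, and a top, playing the
-- role of ∞.  The functions e and f only matter on Q.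
record IsTwoLevelPolynomial
  (Q : Pred ℕ 0ℓ) (g : ℚ[X]) (e : ℕ → ℕ ±) (f : ℕ → ℚ[X]) : Set where
  field
    Q-infinite : ∀ N → ∃[ q ] N < q × q ∈ Q
    degree     : ∀ {q} → q ∈ Q → ∃[ d ] ⟦ g ⟧ q ≡ fromℕ d × HasDegree (f q) d
    φ          : ℕ → ℚ[X]
    agrees     : ∀ {q d} → q ∈ Q → ⟦ g ⟧ q ≡ fromℕ d →
                 ∀ r → [ r ] ≤± e q → coeffFromTop (f q) d r ≡ ⟦ φ r ⟧ q

{-# OPTIONS --safe #-}
-- By induction on vertices, the coefficients c₀, …, c₃ of a chromatic polynomial are polynomials in
-- the numbers of edges, triangles, induced 4-cycles and 4-cliques: summing over the colours of one
-- vertex expresses the proper colourings through those of smaller graphs.  For the Paley graph P_q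
-- these numbers are polynomials in q, except for the 4-cliques.  Their number is a character sum
-- that a Landen transformation turns into the square of a Jacobsthal sum: it is a polynomial in q
-- plus a nonzero multiple of q (q − 1) a², where q = a² + b² and a is odd.  If c₃ were a polynomial
-- in q, then, since a² ≤ q, a² and hence b² would be linear in q for large q.  This fails 2-adically for
-- three primes q ≡ 5 mod 8, 9 mod 16 and 17 mod 32, which occur arbitrarily far out among the
-- prime divisors of the numbers (1 + y^(2^i)) / 2.
module Submission where

open import Defs
open import Data.Nat.Base using (ℕ; _≤_)
open import Data.Product.Base using (_×_; Σ-syntax; ∃-syntax)
open import Relation.Binary.PropositionalEquality using (_≡_)
open import Relation.Nullary.Construct.Add.Extrema using ([_])
open import Relation.Nullary.Negation using (¬_)
open import Relation.Unary using (_∈_)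

open import Algebra.Bundles using (CommutativeRing; CommutativeSemiring)
import Algebra.Properties.CommutativeMonoid.Sum as CommutativeMonoidSum
import Algebra.Properties.CommutativeSemiring.Exp as Exponentiation
import Algebra.Solver.Ring as RingSolver
import Algebra.Solver.Ring.AlmostCommutativeRing as ACR
open import Algebra.Structures using (IsCommutativeRing)
open import Data.Bool.Base using (if_then_else_)
open import Data.Fin.Base as Fin using (Fin; zero; suc; toℕ; fromℕ<; combine; finToFun; _↑ˡ_; _↑ʳ_)
import Data.Fin.Permutation as Perm
import Data.Fin.Properties as Fin
open import Data.Integer.Base as ℤ using (ℤ; +_; -_; _+_; _*_; _-_; 0ℤ; 1ℤ)
open import Data.Integer.DivMod using (n%ℕd<d; a≡a%ℕn+[a/ℕn]*n; _%ℕ_; _/ℕ_)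
open import Data.Integer.Divisibility.Signed using (_∣_; divides; ∣⇒∣ᵤ; ∣ᵤ⇒∣)
import Data.Integer.Properties as ℤ
open import Data.Integer.Tactic.RingSolver using (solve-∀)
open import Data.List.Base using (List; []; _∷_; length; filter; tabulate; map)
open import Data.List.Relation.Unary.All using (All; []; _∷_)
open import Data.Maybe.Base using (Maybe; just; nothing)
open import Data.Nat.Base as ℕ using (zero; suc)
import Data.Nat.Coprimality as Coprime
import Data.Nat.Divisibility as ℕ
import Data.Nat.DivMod as ℕ
open import Data.Nat.GCD using (module Bézout)
open import Data.Nat.ListAction using (product)
open import Data.Nat.Primality using (Prime; prime⇒nonZero; prime⇒nonTrivial)
open import Data.Nat.Primality.Factorisation using (factorise; module PrimeFactorisation)
import Data.Nat.Properties as ℕ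
import Data.Nat.Tactic.RingSolver as ℕ
open import Data.Product.Base using (_,_; proj₁; proj₂)
import Data.Rational.Base as ℚ
open ℚ using (ℚ; 0ℚ; 1ℚ)
import Data.Rational.Properties as ℚ
open import Data.Rational.Solver using (module +-*-Solver)
import Data.Rational.Unnormalised.Base as ℚᵘ
import Data.Rational.Unnormalised.Properties as ℚᵘ
open import Data.Sum.Base using (_⊎_; inj₁; inj₂)
open import Data.Vec.Functional using () renaming (_∷_ to _◂_)
open import Function.Base using (_∘_; case_of_)
open import Relation.Binary.Construct.Add.Extrema.NonStrict ℕ._≤_ using (_≤±_) renaming ([_] to [_]≤)
open import Relation.Binary.PropositionalEquality
  using (_≢_; _≗_; refl; sym; trans; cong; cong₂; subst; subst₂; isEquivalence; module ≡-Reasoning)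
open import Relation.Nullary.Decidable using (Dec; yes; no; does)
open import Relation.Nullary.Negation using (contradiction)
open import Algebra.Properties.Semiring.Sum (CommutativeSemiring.semiring ℤ.+-*-commutativeSemiring)
  using (sum; ∑-distrib-+; ∑-comm; *-distribˡ-sum; *-distribʳ-sum; sum-permute)
  renaming (sum-cong-≗ to sum-cong)
open CommutativeMonoidSum ℤ.*-1-commutativeMonoid using ()
  renaming (sum to prod; sum-cong-≗ to prod-cong; ∑-distrib-+ to prod-distrib-*)
open ≡-Reasoning

-- Summing over the colours of a vertex gives n minus the number of colours on its neighbourhood,
-- and each colour present there is counted at the last neighbour that carries it. That y is last in
-- its colour is enforced by adding edges from y to the later neighbours. Vertices are never
-- identified, so all graphs stay 0-1 matrices on some `Fin v` and every step is a ring identity.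
-- Strong regularity of P_q makes the edges and triangles polynomial in q and turns the induced
-- 4-cycles into a polynomial plus the 4-cliques. In `chromCoeff-3` these two counts have the
-- weights 6 and -4, so the cliques do not cancel from c₃. A line has two unknown parameters, so
-- three primes are taken to refute it. Comparing 2-adic valuations in the collinearity relation
-- constrains only the power of 2 in q - 1, and this power can be controlled for prime divisors of
-- numbers 1 + y^(2^i).

private
  variable
    m n v : ℕ

-- Finite sums over ℤ

sum-linear : ∀ α β (f g : Fin n → ℤ) →
             sum (λ i → α * f i + β * g i) ≡ α * sum f + β * sum g
sum-linear α β f g =
  trans (∑-distrib-+ (λ i → α * f i) (λ i → β * g i))
        (cong₂ _+_ (sym (*-distribˡ-sum α f)) (sym (*-distribˡ-sum β g)))

sum-scale : ∀ α (f : Fin n → ℤ) → sum (λ i → α * f i) ≡ α * sum f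
sum-scale α f = sym (*-distribˡ-sum α f)

sum-scaleʳ : ∀ α (f : Fin n → ℤ) → sum (λ i → f i * α) ≡ sum f * α
sum-scaleʳ α f = sym (*-distribʳ-sum α f)

sum-+ : ∀ (f g : Fin n → ℤ) → sum (λ i → f i + g i) ≡ sum f + sum g
sum-+ = ∑-distrib-+

sum-neg : ∀ (f : Fin n → ℤ) → sum (λ i → - f i) ≡ - sum f
sum-neg {zero}  f = refl
sum-neg {suc n} f = trans (cong (λ u → - f zero + u) (sum-neg (f ∘ suc)))
                          (sym (ℤ.neg-distrib-+ (f zero) (sum (f ∘ suc))))

sum-sub : ∀ (f g : Fin n → ℤ) → sum (λ i → f i - g i) ≡ sum f - sum g
sum-sub f g = trans (∑-distrib-+ f (λ i → - g i)) (cong (λ u → sum f + u) (sum-neg g))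

sum-0 : sum {n} (λ _ → 0ℤ) ≡ 0ℤ
sum-0 {zero}  = refl
sum-0 {suc n} = trans (ℤ.+-identityˡ _) (sum-0 {n})

sum-const : ∀ n k → sum {n} (λ _ → k) ≡ + n * k
sum-const zero    k = sym (ℤ.*-zeroˡ k)
sum-const (suc n) k = trans (cong (λ u → k + u) (sum-const n k)) (sym (ℤ.suc-* (+ n) k))

prod-1 : prod {n} (λ _ → 1ℤ) ≡ 1ℤ
prod-1 {zero}  = refl
prod-1 {suc n} = trans (ℤ.*-identityˡ _) (prod-1 {n})

δ : Fin n → Fin n → ℤ
δ zero    zero    = 1ℤ
δ zero    (suc j) = 0ℤ
δ (suc i) zero    = 0ℤ
δ (suc i) (suc j) = δ i j

δ-refl : (i : Fin n) → δ i i ≡ 1ℤ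
δ-refl zero    = refl
δ-refl (suc i) = δ-refl i

δ-≢ : {i j : Fin n} → i ≢ j → δ i j ≡ 0ℤ
δ-≢ {i = zero}  {zero}  i≢j = contradiction refl i≢j
δ-≢ {i = zero}  {suc j} i≢j = refl
δ-≢ {i = suc i} {zero}  i≢j = refl
δ-≢ {i = suc i} {suc j} i≢j = δ-≢ (i≢j ∘ cong suc)

δ-sym : (i j : Fin n) → δ i j ≡ δ j i
δ-sym zero    zero    = refl
δ-sym zero    (suc j) = refl
δ-sym (suc i) zero    = refl
δ-sym (suc i) (suc j) = δ-sym i j

δ-subst : ∀ (f : Fin n → ℤ) i j → δ i j * f j ≡ δ i j * f i
δ-subst f i j with i Fin.≟ j
... | yes refl = refl
... | no  i≢j  = trans (cong (_* f j) (δ-≢ i≢j)) (sym (cong (_* f i) (δ-≢ i≢j)))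

δ-idem : (i j : Fin n) → δ i j * δ i j ≡ δ i j
δ-idem i j = trans (δ-subst (δ i) i j) (trans (cong (δ i j *_) (δ-refl i)) (ℤ.*-identityʳ _))

sum-δ : ∀ (f : Fin n → ℤ) i → sum (λ j → δ i j * f j) ≡ f i
sum-δ {suc n} f zero = begin
  1ℤ * f zero + sum {n} (λ _ → 0ℤ)  ≡⟨ cong₂ _+_ (ℤ.*-identityˡ (f zero)) (sum-0 {n}) ⟩
  f zero + 0ℤ                        ≡⟨ ℤ.+-identityʳ (f zero) ⟩
  f zero ∎
sum-δ {suc n} f (suc i) = trans (ℤ.+-identityˡ _) (sum-δ (f ∘ suc) i)

sum-δʳ : ∀ (f : Fin n → ℤ) i → sum (λ j → δ j i * f j) ≡ f i
sum-δʳ f i = trans (sum-cong λ j → cong (_* f j) (δ-sym j i)) (sum-δ f i)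

sum-δ-1 : (i : Fin n) → sum (δ i) ≡ 1ℤ
sum-δ-1 i = trans (sum-cong λ j → sym (ℤ.*-identityʳ (δ i j))) (sum-δ (λ _ → 1ℤ) i)

-- Chromatic polynomials by adding a vertex

-- The indicator of x < y. The recursion makes it compute on `zero` and `suc`, so that splitting off
-- the first vertex needs no case distinctions.
o : Fin n → Fin n → ℤ
o zero    zero    = 0ℤ
o zero    (suc y) = 1ℤ
o (suc x) zero    = 0ℤ
o (suc x) (suc y) = o x y

o-idem : (x y : Fin n) → o x y * o x y ≡ o x y
o-idem zero    zero    = refl
o-idem zero    (suc y) = refl
o-idem (suc x) zero    = refl
o-idem (suc x) (suc y) = o-idem x y

o-asym : (x y : Fin n) → o x y * o y x ≡ 0ℤ
o-asym zero    zero    = refl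
o-asym zero    (suc y) = refl
o-asym (suc x) zero    = refl
o-asym (suc x) (suc y) = o-asym x y

o-total : (x y : Fin n) → o x y + o y x ≡ 1ℤ - δ x y
o-total zero    zero    = refl
o-total zero    (suc y) = refl
o-total (suc x) zero    = refl
o-total (suc x) (suc y) = o-total x y

o-irrefl : (x : Fin n) → o x x ≡ 0ℤ
o-irrefl zero    = refl
o-irrefl (suc x) = o-irrefl x

Weights : ℕ → Set
Weights v = Fin v → Fin v → ℤ

-- For a 0-1 matrix this is the indicator of proper colourings, written as a product: `o` gives each
-- pair a single factor, which vanishes exactly on a monochromatic edge.
weight : Weights v → (Fin v → Fin n) → ℤ
weight A c = prod λ x → prod λ z → 1ℤ - o x z * A x z * δ (c x) (c z)

sumF : ∀ v n → ((Fin v → Fin n) → ℤ) → ℤ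
sumF zero    n f = f (λ ())
sumF (suc v) n f = sum λ i → sumF v n λ c → f (i ◂ c)

sumF-cong : ∀ v n {f g} → (∀ c → f c ≡ g c) → sumF v n f ≡ sumF v n g
sumF-cong zero    n f≡g = f≡g _
sumF-cong (suc v) n f≡g = sum-cong λ i → sumF-cong v n λ c → f≡g (i ◂ c)

sumF-sum : ∀ v n {m} (f : Fin m → (Fin v → Fin n) → ℤ) →
           sumF v n (λ c → sum λ i → f i c) ≡ sum λ i → sumF v n (f i)
sumF-sum zero    n f = refl
sumF-sum (suc v) n f = trans (sum-cong λ j → sumF-sum v n λ i c → f i (j ◂ c))
                             (∑-comm λ j i → sumF v n λ c → f i (j ◂ c))

sumF-linear : ∀ v n α β f g → sumF v n (λ c → α * f c + β * g c) ≡ α * sumF v n f + β * sumF v n g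
sumF-linear zero    n α β f g = refl
sumF-linear (suc v) n α β f g =
  trans (sum-cong λ i → sumF-linear v n α β (λ c → f (i ◂ c)) (λ c → g (i ◂ c)))
        (sum-linear α β (λ i → sumF v n λ c → f (i ◂ c)) (λ i → sumF v n λ c → g (i ◂ c)))

sumF-scale : ∀ v n α f → sumF v n (λ c → α * f c) ≡ α * sumF v n f
sumF-scale zero    n α f = refl
sumF-scale (suc v) n α f =
  trans (sum-cong λ i → sumF-scale v n α (λ c → f (i ◂ c)))
        (sum-scale α (λ i → sumF v n λ c → f (i ◂ c)))

weightedCount : Weights v → ℕ → ℤ
weightedCount {v} A n = sumF v n (weight A)

rest : Weights (suc v) → Weights v
rest A x z = A (suc x) (suc z)

star : Weights (suc v) → Fin v → ℤ
star A y = A zero (suc y)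

-- glue a y A joins y to those later vertices z with a z = 1.
newEdge : (Fin v → ℤ) → Fin v → Weights v → Fin v → ℤ
newEdge a y A z = o y z * (a z * (1ℤ - A y z))

glue : (Fin v → ℤ) → Fin v → Weights v → Weights v
glue a y A x z = A x z + (δ x y * newEdge a y A z + δ z y * newEdge a y A x)

-- The sum telescopes: the term at y is the product over z > y minus the product over z ≥ y. For t
-- with values 0 and 1 the only surviving term sits at the last y with t y = 1.
1-prod : ∀ {n} (t : Fin n → ℤ) →
         prod (λ y → 1ℤ - t y) ≡ 1ℤ - sum λ y → t y * prod λ z → 1ℤ - o y z * t z
1-prod {zero}  t = refl
1-prod {suc n} t = begin
  (1ℤ - t zero) * R
    ≡⟨ step (t zero) R ⟩
  R - t zero * ((1ℤ - 0ℤ * t zero) * R)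
    ≡⟨ cong₂ (λ u r → u - t zero * ((1ℤ - 0ℤ * t zero) * r)) (1-prod (t ∘ suc))
         (prod-cong λ z → cong (λ u → 1ℤ - u) (sym (ℤ.*-identityˡ (t (suc z))))) ⟩
  (1ℤ - S) - t zero * ((1ℤ - 0ℤ * t zero) * R₁)
    ≡⟨ step₂ S (t zero * ((1ℤ - 0ℤ * t zero) * R₁)) ⟩
  1ℤ - (t zero * ((1ℤ - 0ℤ * t zero) * R₁) + S)
    ≡⟨ cong (λ u → 1ℤ - (t zero * ((1ℤ - 0ℤ * t zero) * R₁) + u))
         (sum-cong λ y → cong (t (suc y) *_) (step₃ (t zero) (prod λ z → 1ℤ - o y z * t (suc z)))) ⟩
  1ℤ - (sum λ y → t y * prod λ z → 1ℤ - o y z * t z) ∎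
  where
  R  = prod λ y → 1ℤ - t (suc y)
  R₁ = prod λ z → 1ℤ - 1ℤ * t (suc z)
  S  = sum λ y → t (suc y) * prod λ z → 1ℤ - o y z * t (suc z)
  step : ∀ t r → (1ℤ - t) * r ≡ r - t * ((1ℤ - 0ℤ * t) * r)
  step = solve-∀
  step₂ : ∀ s u → (1ℤ - s) - u ≡ 1ℤ - (u + s)
  step₂ = solve-∀
  step₃ : ∀ t r → r ≡ (1ℤ - 0ℤ * t) * r
  step₃ = solve-∀

weight-◂ : ∀ (A : Weights (suc v)) (i : Fin n) c →
           weight A (i ◂ c) ≡ prod (λ z → 1ℤ - star A z * δ i (c z)) * weight (rest A) c
weight-◂ {v} A i c = cong₂ _*_ first others
  where
  first : (1ℤ - 0ℤ * A zero zero * δ i i) * prod (λ z → 1ℤ - 1ℤ * star A z * δ i (c z)) ≡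
          prod (λ z → 1ℤ - star A z * δ i (c z))
  first = trans (l (A zero zero) (δ i i) _)
    (prod-cong λ z → cong (λ u → 1ℤ - u * δ i (c z)) (ℤ.*-identityˡ (star A z)))
    where
    l : ∀ a d p → (1ℤ - 0ℤ * a * d) * p ≡ p
    l = solve-∀
  others : _ ≡ weight (rest A) c
  others = prod-cong λ x → l (A (suc x) zero) (δ (c x) i) _
    where
    l : ∀ a d p → (1ℤ - 0ℤ * a * d) * p ≡ p
    l = solve-∀

prod-δ : ∀ (f : Fin n → ℤ) y → prod (λ x → 1ℤ - δ x y * f x) ≡ 1ℤ - f y
prod-δ {suc n} f zero = begin
  (1ℤ - 1ℤ * f zero) * prod {n} (λ x → 1ℤ - 0ℤ * f (suc x))
    ≡⟨ cong ((1ℤ - 1ℤ * f zero) *_) (trans (prod-cong λ x → l₁ (f (suc x))) (prod-1 {n})) ⟩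
  (1ℤ - 1ℤ * f zero) * 1ℤ ≡⟨ l₂ (f zero) ⟩
  1ℤ - f zero ∎
  where
  l₁ : ∀ a → 1ℤ - 0ℤ * a ≡ 1ℤ
  l₁ = solve-∀
  l₂ : ∀ a → (1ℤ - 1ℤ * a) * 1ℤ ≡ 1ℤ - a
  l₂ = solve-∀
prod-δ {suc n} f (suc y) =
  trans (cong₂ _*_ (l₁ (f zero)) (prod-δ (f ∘ suc) y)) (ℤ.*-identityˡ _)
  where
  l₁ : ∀ a → 1ℤ - 0ℤ * a ≡ 1ℤ
  l₁ = solve-∀

-- The extra factor forbids y to share its colour with a later neighbour, which is what the new
-- edges do. `newEdge` contains `1 - A y z`, so an edge already present is not doubled: its two
-- factors merge by idempotence of `o` and `δ`.
weight-glue : ∀ (a : Fin v → ℤ) y (A : Weights v) (c : Fin v → Fin n) →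
              weight (glue a y A) c ≡
              weight A c * prod (λ z → 1ℤ - o y z * (a z * δ (c y) (c z)))
weight-glue {v} a y A c = sym (begin
  weight A c * G
    -- The product over x has a single factor other than 1, at x = y, so that `G` can be absorbed
    -- row by row.
    ≡⟨ cong (weight A c *_) (sym (trans (prod-δ (λ _ → 1ℤ - G) y) (l G))) ⟩
  weight A c * prod (λ x → 1ℤ - δ x y * (1ℤ - G))
    ≡⟨ sym (prod-distrib-* (λ x → prod (λ z → 1ℤ - o x z * A x z * δ (c x) (c z)))
                           (λ x → 1ℤ - δ x y * (1ℤ - G))) ⟩
  prod (λ x → prod (λ z → 1ℤ - o x z * A x z * δ (c x) (c z)) * (1ℤ - δ x y * (1ℤ - G)))
    ≡⟨ prod-cong row ⟩
  weight (glue a y A) c ∎)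
  where
  G = prod (λ z → 1ℤ - o y z * (a z * δ (c y) (c z)))
  l : ∀ g → 1ℤ - (1ℤ - g) ≡ g
  l = solve-∀
  l₁ : ∀ p g → p * (1ℤ - 1ℤ * (1ℤ - g)) ≡ p * g
  l₁ = solve-∀
  l₀ : ∀ p g → p * (1ℤ - 0ℤ * (1ℤ - g)) ≡ p
  l₀ = solve-∀
  merge : ∀ o a A D δ t → o * o ≡ o → D * D ≡ D →
          (1ℤ - o * A * D) * (1ℤ - o * (a * D)) ≡
          1ℤ - o * (A + (1ℤ * (o * (a * (1ℤ - A))) + δ * (0ℤ * t))) * D
  merge o a A D δ t oo DD = begin
    (1ℤ - o * A * D) * (1ℤ - o * (a * D))
      ≡⟨ e₁ o a A D ⟩
    1ℤ - o * A * D - o * a * D + (o * o) * (D * D) * (A * a)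
      ≡⟨ cong (λ u → 1ℤ - o * A * D - o * a * D + u * (A * a)) (cong₂ _*_ oo DD) ⟩
    1ℤ - o * A * D - o * a * D + o * D * (A * a)
      ≡⟨ e₂ o a A D ⟩
    1ℤ - o * A * D - o * (a * (1ℤ - A)) * D
      ≡⟨ cong (λ u → 1ℤ - o * A * D - u * (a * (1ℤ - A)) * D) (sym oo) ⟩
    1ℤ - o * A * D - (o * o) * (a * (1ℤ - A)) * D
      ≡⟨ e₃ o a A D δ t ⟩
    1ℤ - o * (A + (1ℤ * (o * (a * (1ℤ - A))) + δ * (0ℤ * t))) * D ∎
    where
    e₁ : ∀ o a A D → (1ℤ - o * A * D) * (1ℤ - o * (a * D)) ≡ 1ℤ - o * A * D - o * a * D + (o * o) * (D * D) * (A * a)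
    e₁ = solve-∀
    e₂ : ∀ o a A D → 1ℤ - o * A * D - o * a * D + o * D * (A * a) ≡ 1ℤ - o * A * D - o * (a * (1ℤ - A)) * D
    e₂ = solve-∀
    e₃ : ∀ o a A D δ t → 1ℤ - o * A * D - (o * o) * (a * (1ℤ - A)) * D ≡
         1ℤ - o * (A + (1ℤ * (o * (a * (1ℤ - A))) + δ * (0ℤ * t))) * D
    e₃ = solve-∀
  -- Outside row y only the mirrored entries in column y change; they carry `o y x`, which the
  -- factor `o x y` of the weight kills.
  skip : ∀ x z → 1ℤ - o x z * A x z * δ (c x) (c z) ≡
         1ℤ - o x z * (A x z + (0ℤ * newEdge a y A z + δ z y * newEdge a y A x)) * δ (c x) (c z)
  skip x z with z Fin.≟ y
  ... | yes refl = begin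
    1ℤ - o x z * A x z * D                                       ≡⟨ e₁ (o x z) (A x z) D T ⟩
    1ℤ - (o x z * A x z + 0ℤ * T) * D
      ≡⟨ cong (λ u → 1ℤ - (o x z * A x z + u * T) * D) (sym (o-asym x z)) ⟩
    1ℤ - (o x z * A x z + o x z * o z x * T) * D
      ≡⟨ e₂ (o x z) (o z x) (A x z) D T (newEdge a z A z) ⟩
    1ℤ - o x z * (A x z + (0ℤ * newEdge a z A z + 1ℤ * newEdge a z A x)) * D
      ≡⟨ cong (λ u → 1ℤ - o x z * (A x z + (0ℤ * newEdge a z A z + u * newEdge a z A x)) * D) (sym (δ-refl z)) ⟩
    1ℤ - o x z * (A x z + (0ℤ * newEdge a z A z + δ z z * newEdge a z A x)) * D ∎
    where
    D = δ (c x) (c z)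
    T = a x * (1ℤ - A z x)
    e₁ : ∀ o A D T → 1ℤ - o * A * D ≡ 1ℤ - (o * A + 0ℤ * T) * D
    e₁ = solve-∀
    e₂ : ∀ o o′ A D T N → 1ℤ - (o * A + o * o′ * T) * D ≡ 1ℤ - o * (A + (0ℤ * N + 1ℤ * (o′ * T))) * D
    e₂ = solve-∀
  ... | no z≢y = trans (e (o x z) (A x z) (δ (c x) (c z)) (newEdge a y A z) (newEdge a y A x))
                       (cong (λ u → 1ℤ - o x z * (A x z + (0ℤ * newEdge a y A z + u * newEdge a y A x)) * δ (c x) (c z))
                             (sym (δ-≢ z≢y)))
    where
    e : ∀ o A D N M → 1ℤ - o * A * D ≡ 1ℤ - o * (A + (0ℤ * N + 0ℤ * M)) * D
    e = solve-∀
  row : ∀ x → prod (λ z → 1ℤ - o x z * A x z * δ (c x) (c z)) * (1ℤ - δ x y * (1ℤ - G)) ≡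
              prod (λ z → 1ℤ - o x z * glue a y A x z * δ (c x) (c z))
  row x with x Fin.≟ y
  ... | no x≢y rewrite δ-≢ x≢y =
    trans (l₀ (prod (λ z → 1ℤ - o x z * A x z * δ (c x) (c z))) G) (prod-cong (skip x))
  ... | yes refl = begin
    prod f * (1ℤ - δ x x * (1ℤ - G))  ≡⟨ cong (λ u → prod f * (1ℤ - u * (1ℤ - G))) (δ-refl x) ⟩
    prod f * (1ℤ - 1ℤ * (1ℤ - G))     ≡⟨ l₁ (prod f) G ⟩
    prod f * prod g                   ≡⟨ sym (prod-distrib-* f g) ⟩
    prod (λ z → f z * g z)
      ≡⟨ prod-cong (λ z → trans
           (merge (o x z) (a z) (A x z) (δ (c x) (c z)) (δ z x) (a x * (1ℤ - A x x)) (o-idem x z) (δ-idem (c x) (c z)))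
           (cong₂ (λ u w → 1ℤ - o x z * (A x z + (u * newEdge a x A z + δ z x * (w * (a x * (1ℤ - A x x))))) * δ (c x) (c z))
                  (sym (δ-refl x)) (sym (o-irrefl x)))) ⟩
    prod (λ z → 1ℤ - o x z * glue a x A x z * δ (c x) (c z)) ∎
    where
    f g : Fin v → ℤ
    f z = 1ℤ - o x z * A x z * δ (c x) (c z)
    g z = 1ℤ - o x z * (a z * δ (c x) (c z))

-- The colours i left for a new vertex are those absent from its neighbourhood; `1-prod` counts each
-- colour that does occur at its last bearer y.
sum-star : ∀ (a : Fin v → ℤ) (c : Fin v → Fin n) →
           sum (λ i → prod λ z → 1ℤ - a z * δ i (c z)) ≡
           + n - sum λ y → a y * prod λ z → 1ℤ - o y z * (a z * δ (c y) (c z))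
sum-star {v} {n} a c = begin
  sum (λ i → prod λ z → 1ℤ - a z * δ i (c z))
    ≡⟨ sum-cong (λ i → 1-prod λ z → a z * δ i (c z)) ⟩
  sum (λ i → 1ℤ - sum λ y → a y * δ i (c y) * R i y)
    ≡⟨ sum-sub (λ _ → 1ℤ) (λ i → sum λ y → a y * δ i (c y) * R i y) ⟩
  sum {n} (λ _ → 1ℤ) - sum (λ i → sum λ y → a y * δ i (c y) * R i y)
    ≡⟨ cong₂ _-_ (trans (sum-const n 1ℤ) (ℤ.*-identityʳ (+ n))) (∑-comm λ i y → a y * δ i (c y) * R i y) ⟩
  + n - sum (λ y → sum λ i → a y * δ i (c y) * R i y)
    ≡⟨ cong (λ u → + n - u) (sum-cong λ y → trans
         (sum-cong λ i → l (a y) (δ i (c y)) (R i y))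
         (sum-δʳ (λ i → a y * R i y) (c y))) ⟩
  + n - sum (λ y → a y * R (c y) y) ∎
  where
  R : Fin n → Fin v → ℤ
  R i y = prod λ z → 1ℤ - o y z * (a z * δ i (c z))
  l : ∀ a d r → a * d * r ≡ d * (a * r)
  l = solve-∀

-- This plays the role of deletion-contraction. Every graph on the right has one vertex fewer, and
-- gluing changes a matrix but not its size, so induction on v applies to all of them at once.
weightedCount-suc : ∀ (A : Weights (suc v)) n →
  weightedCount A n ≡
  + n * weightedCount (rest A) n - sum λ y → star A y * weightedCount (glue (star A) y (rest A)) n
weightedCount-suc {v} A n = begin
  sum (λ i → sumF v n λ c → weight A (i ◂ c))
    ≡⟨ sym (sumF-sum v n λ i c → weight A (i ◂ c)) ⟩
  sumF v n (λ c → sum λ i → weight A (i ◂ c))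
    ≡⟨ sumF-cong v n (λ c → begin
         sum (λ i → weight A (i ◂ c))
           ≡⟨ sum-cong (λ i → weight-◂ A i c) ⟩
         sum (λ i → prod (λ z → 1ℤ - a z * δ i (c z)) * weight B c)
           ≡⟨ sum-scaleʳ (weight B c) (λ i → prod (λ z → 1ℤ - a z * δ i (c z))) ⟩
         sum (λ i → prod (λ z → 1ℤ - a z * δ i (c z))) * weight B c
           ≡⟨ cong (_* weight B c) (sum-star a c) ⟩
         (+ n - sum (λ y → a y * G c y)) * weight B c
           ≡⟨ l (+ n) (sum (λ y → a y * G c y)) (weight B c) ⟩
         + n * weight B c + - 1ℤ * (sum (λ y → a y * G c y) * weight B c)
           ≡⟨ cong (λ u → + n * weight B c + - 1ℤ * u) (trans
                (sym (sum-scaleʳ (weight B c) (λ y → a y * G c y)))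
                (sum-cong λ y → trans (l₂ (a y) (G c y) (weight B c))
                                      (cong (a y *_) (sym (weight-glue a y B c))))) ⟩
         + n * weight B c + - 1ℤ * sum (λ y → a y * weight (glue a y B) c) ∎) ⟩
  sumF v n (λ c → + n * weight B c + - 1ℤ * sum (λ y → a y * weight (glue a y B) c))
    ≡⟨ sumF-linear v n (+ n) (- 1ℤ) (weight B) (λ c → sum (λ y → a y * weight (glue a y B) c)) ⟩
  + n * weightedCount B n + - 1ℤ * sumF v n (λ c → sum (λ y → a y * weight (glue a y B) c))
    ≡⟨ cong (λ u → + n * weightedCount B n + u) (trans (ℤ.-1*i≡-i _) (cong -_ (trans
         (sumF-sum v n λ y c → a y * weight (glue a y B) c)
         (sum-cong λ y → sumF-scale v n (a y) (weight (glue a y B)))))) ⟩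
  + n * weightedCount B n - sum (λ y → a y * weightedCount (glue a y B) n) ∎
  where
  a = star A
  B = rest A
  G : (Fin v → Fin n) → Fin v → ℤ
  G c y = prod λ z → 1ℤ - o y z * (a z * δ (c y) (c z))
  l : ∀ n s w → (n - s) * w ≡ n * w + - 1ℤ * (s * w)
  l = solve-∀
  l₂ : ∀ a g w → a * g * w ≡ a * (w * g)
  l₂ = solve-∀

-- The coefficient of n^(v - r), read off from `weightedCount-suc`: the factor n leaves the distance
-- r to the top unchanged, whereas the glued graphs come without it and enter with r lowered by one.
chromCoeff : ∀ {v} → Weights v → ℕ → ℤ
chromCoeff {zero}  A zero    = 1ℤ
chromCoeff {zero}  A (suc r) = 0ℤ
chromCoeff {suc v} A zero    = chromCoeff (rest A) zero
chromCoeff {suc v} A (suc r) =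
  chromCoeff (rest A) (suc r) - sum λ y → star A y * chromCoeff (glue (star A) y (rest A)) r

horner : (ℕ → ℤ) → ℕ → ℤ → ℤ
horner c zero    x = c zero
horner c (suc v) x = c (suc v) + x * horner c v x

chromCoeff-lead : ∀ {v} (A : Weights v) → chromCoeff A 0 ≡ 1ℤ
chromCoeff-lead {zero}  A = refl
chromCoeff-lead {suc v} A = chromCoeff-lead (rest A)

chromCoeff-beyond : ∀ {v} (A : Weights v) r → v ℕ.< r → chromCoeff A r ≡ 0ℤ
chromCoeff-beyond {zero}  A (suc r) _ = refl
chromCoeff-beyond {suc v} A (suc r) (ℕ.s≤s v<r) = begin
  chromCoeff (rest A) (suc r) - sum (λ y → star A y * chromCoeff (glue (star A) y (rest A)) r)
    ≡⟨ cong₂ _-_ (chromCoeff-beyond (rest A) (suc r) (ℕ.m≤n⇒m≤1+n v<r))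
         (trans (sum-cong λ y → trans (cong (star A y *_) (chromCoeff-beyond (glue (star A) y (rest A)) r v<r))
                                      (ℤ.*-zeroʳ (star A y)))
                (sum-0 {v})) ⟩
  0ℤ ∎

-- The recursion of `chromCoeff` holds in each degree separately, so it passes to every truncation
-- k, by induction on k.
horner-chromCoeff-suc : ∀ (A : Weights (suc v)) k x → horner (chromCoeff A) (suc k) x ≡
  horner (chromCoeff (rest A)) (suc k) x - sum λ y → star A y * horner (chromCoeff (glue (star A) y (rest A))) k x
horner-chromCoeff-suc {v} A zero x =
  l x (chromCoeff (rest A) 1) (chromCoeff (rest A) 0) (sum λ y → star A y * chromCoeff (glue (star A) y (rest A)) 0)
  where
  l : ∀ x a b s → (a - s) + x * b ≡ (a + x * b) - s
  l = solve-∀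
horner-chromCoeff-suc {v} A (suc k) x = begin
  (c′ (suc (suc k)) - sum (λ y → a y * g y (suc k))) + x * horner (chromCoeff A) (suc k) x
    ≡⟨ cong (λ u → (c′ (suc (suc k)) - sum (λ y → a y * g y (suc k))) + x * u) (horner-chromCoeff-suc A k x) ⟩
  (c′ (suc (suc k)) - sum (λ y → a y * g y (suc k))) + x * (horner c′ (suc k) x - sum (λ y → a y * horner (g y) k x))
    ≡⟨ l x (c′ (suc (suc k))) (sum (λ y → a y * g y (suc k))) (horner c′ (suc k) x) (sum (λ y → a y * horner (g y) k x)) ⟩
  horner c′ (suc (suc k)) x - (1ℤ * sum (λ y → a y * g y (suc k)) + x * sum (λ y → a y * horner (g y) k x))
    ≡⟨ cong (λ u → horner c′ (suc (suc k)) x - u) (trans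
         (sym (sum-linear 1ℤ x (λ y → a y * g y (suc k)) (λ y → a y * horner (g y) k x)))
         (sum-cong λ y → l₂ x (a y) (g y (suc k)) (horner (g y) k x))) ⟩
  horner c′ (suc (suc k)) x - sum (λ y → a y * horner (g y) (suc k) x) ∎
  where
  a = star A
  c′ = chromCoeff (rest A)
  g : Fin v → ℕ → ℤ
  g y = chromCoeff (glue a y (rest A))
  l : ∀ x c s h t → (c - s) + x * (h - t) ≡ (c + x * h) - (1ℤ * s + x * t)
  l = solve-∀
  l₂ : ∀ x a g h → 1ℤ * (a * g) + x * (a * h) ≡ a * (g + x * h)
  l₂ = solve-∀

weightedCount-horner : ∀ {v} (A : Weights v) n → weightedCount A n ≡ horner (chromCoeff A) v (+ n)
weightedCount-horner {zero}  A n = refl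
weightedCount-horner {suc v} A n = begin
  weightedCount A n
    ≡⟨ weightedCount-suc A n ⟩
  + n * weightedCount (rest A) n - sum (λ y → star A y * weightedCount (glue (star A) y (rest A)) n)
    ≡⟨ cong₂ (λ u w → + n * u - w) (weightedCount-horner (rest A) n)
         (sum-cong λ y → cong (star A y *_) (weightedCount-horner (glue (star A) y (rest A)) n)) ⟩
  + n * H - S
    -- `horner` of length `suc v` differs from n times `horner` of length v by the coefficient of
    -- index `suc v`, which vanishes for a graph on v vertices.
    ≡⟨ cong (λ u → u - S) (trans (sym (ℤ.+-identityˡ (+ n * H)))
         (cong (λ u → u + + n * H) (sym (chromCoeff-beyond (rest A) (suc v) ℕ.≤-refl)))) ⟩
  horner (chromCoeff (rest A)) (suc v) (+ n) - S
    ≡⟨ sym (horner-chromCoeff-suc A v (+ n)) ⟩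
  horner (chromCoeff A) (suc v) (+ n) ∎
  where
  H = horner (chromCoeff (rest A)) v (+ n)
  S = sum λ y → star A y * horner (chromCoeff (glue (star A) y (rest A))) v (+ n)

-- Multiple sums, symmetries of their indices, and splitting off one vertex

sum₂ : (Fin n → Fin n → ℤ) → ℤ
sum₂ f = sum λ x → sum (f x)

sum₃ : (Fin n → Fin n → Fin n → ℤ) → ℤ
sum₃ f = sum λ x → sum₂ (f x)

sum₄ : (Fin n → Fin n → Fin n → Fin n → ℤ) → ℤ
sum₄ f = sum λ x → sum₃ (f x)

sum₂-cong : {f g : Fin n → Fin n → ℤ} → (∀ x y → f x y ≡ g x y) → sum₂ f ≡ sum₂ g
sum₂-cong h = sum-cong λ x → sum-cong (h x)

sum₃-cong : {f g : Fin n → Fin n → Fin n → ℤ} → (∀ x y z → f x y z ≡ g x y z) → sum₃ f ≡ sum₃ g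
sum₃-cong h = sum-cong λ x → sum₂-cong (h x)

sum₂-+ : (f g : Fin n → Fin n → ℤ) → sum₂ (λ x y → f x y + g x y) ≡ sum₂ f + sum₂ g
sum₂-+ f g = trans (sum-cong λ x → sum-+ (f x) (g x)) (sum-+ (λ x → sum (f x)) (λ x → sum (g x)))

sum₃-+ : (f g : Fin n → Fin n → Fin n → ℤ) → sum₃ (λ x y z → f x y z + g x y z) ≡ sum₃ f + sum₃ g
sum₃-+ f g = trans (sum-cong λ x → sum₂-+ (f x) (g x)) (sum-+ (λ x → sum₂ (f x)) (λ x → sum₂ (g x)))

sum₂-scale : ∀ α (f : Fin n → Fin n → ℤ) → sum₂ (λ x y → α * f x y) ≡ α * sum₂ f
sum₂-scale α f = trans (sum-cong λ x → sum-scale α (f x)) (sum-scale α λ x → sum (f x))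

sum₂-sub : (f g : Fin n → Fin n → ℤ) → sum₂ (λ x y → f x y - g x y) ≡ sum₂ f - sum₂ g
sum₂-sub f g = trans (sum-cong λ x → sum-sub (f x) (g x)) (sum-sub (λ x → sum (f x)) (λ x → sum (g x)))

sum₂-swap : (f : Fin n → Fin n → ℤ) → sum₂ (λ x y → f y x) ≡ sum₂ f
sum₂-swap f = ∑-comm λ x y → f y x

sum₃-rotate : (f : Fin n → Fin n → Fin n → ℤ) → sum₃ (λ x y z → f y z x) ≡ sum₃ f
sum₃-rotate f = trans (∑-comm λ x y → sum λ z → f y z x) (sum-cong λ y → ∑-comm λ x z → f y z x)

sum₂-product : (f g : Fin n → ℤ) → sum₂ (λ x y → f x * g y) ≡ sum f * sum g
sum₂-product f g = trans (sum-cong λ x → sum-scale (f x) g) (sum-scaleʳ (sum g) f)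

sum₂-δ : (f : Fin n → Fin n → ℤ) → sum₂ (λ x y → δ x y * f x y) ≡ sum λ x → f x x
sum₂-δ f = sum-cong λ x → sum-δ (f x) x

sum₂-suc : (g : Fin (suc n) → Fin (suc n) → ℤ) → (∀ x y → g x y ≡ g y x) → g zero zero ≡ 0ℤ →
           sum₂ g ≡ sum₂ (λ x y → g (suc x) (suc y)) + + 2 * sum (λ y → g zero (suc y))
sum₂-suc g g-sym g₀₀ = begin
  (g zero zero + s) + sum (λ x → g (suc x) zero + sum (λ y → g (suc x) (suc y)))
    ≡⟨ cong₂ (λ u w → (u + s) + w) g₀₀ (trans (sum-+ (λ x → g (suc x) zero) (λ x → sum λ y → g (suc x) (suc y)))
         (cong (λ u → u + r) (sum-cong λ x → g-sym (suc x) zero))) ⟩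
  (0ℤ + s) + (s + r)  ≡⟨ l s r ⟩
  r + + 2 * s ∎
  where
  s = sum λ y → g zero (suc y)
  r = sum₂ λ x y → g (suc x) (suc y)
  l : ∀ s r → (0ℤ + s) + (s + r) ≡ r + + 2 * s
  l = solve-∀

sum-suc-vanish : (h : Fin (suc n) → ℤ) → h zero ≡ 0ℤ → sum h ≡ sum (h ∘ suc)
sum-suc-vanish h h₀ = trans (cong (λ u → u + sum (h ∘ suc)) h₀) (ℤ.+-identityˡ _)

sum₂-suc-vanish : (h : Fin (suc n) → Fin (suc n) → ℤ) → (∀ y → h zero y ≡ 0ℤ) → (∀ x → h x zero ≡ 0ℤ) →
                  sum₂ h ≡ sum₂ (λ x y → h (suc x) (suc y))
sum₂-suc-vanish {n} h h₀ h₁ =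
  trans (sum-suc-vanish (λ x → sum (h x)) (trans (sum-cong h₀) (sum-0 {suc n})))
        (sum-cong λ x → sum-suc-vanish (h (suc x)) (h₁ (suc x)))

sum₃-suc-vanish : (h : Fin (suc n) → Fin (suc n) → Fin (suc n) → ℤ) →
  (∀ y z → h zero y z ≡ 0ℤ) → (∀ x z → h x zero z ≡ 0ℤ) → (∀ x y → h x y zero ≡ 0ℤ) →
  sum₃ h ≡ sum₃ (λ x y z → h (suc x) (suc y) (suc z))
sum₃-suc-vanish {n} h h₀ h₁ h₂ =
  trans (sum-suc-vanish (λ x → sum₂ (h x))
          (trans (sum-cong λ y → trans (sum-cong (h₀ y)) (sum-0 {suc n})) (sum-0 {suc n})))
        (sum-cong λ x → sum₂-suc-vanish (h (suc x)) (h₁ (suc x)) (h₂ (suc x)))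

-- Any two positions of a 3-cycle are adjacent, so terms with two indices `zero` vanish; the three
-- families with one index `zero` are rotations of one another.
sum₃-suc : (g : Fin (suc n) → Fin (suc n) → Fin (suc n) → ℤ) →
  (∀ x y z → g x y z ≡ g y z x) → (∀ z → g zero zero z ≡ 0ℤ) →
  sum₃ g ≡ sum₃ (λ x y z → g (suc x) (suc y) (suc z)) + + 3 * sum₂ (λ y z → g zero (suc y) (suc z))
sum₃-suc {n} g rot g₀ = begin
  sum₂ (g zero) + sum (λ x → sum (g (suc x) zero) + sum (λ y → g (suc x) (suc y) zero + sum (λ z → g (suc x) (suc y) (suc z))))
    ≡⟨ cong₂ _+_ (sum₂-suc-vanish (g zero) g₀ (λ x → g₀₁ x))
         (trans (sum-+ (λ x → sum (g (suc x) zero)) (λ x → sum (λ y → g (suc x) (suc y) zero + sum (λ z → g (suc x) (suc y) (suc z)))))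
                (cong₂ _+_ t₂ (trans (sum₂-+ (λ x y → g (suc x) (suc y) zero) (λ x y → sum (λ z → g (suc x) (suc y) (suc z))))
                                     (cong (λ u → u + r) t₃)))) ⟩
  s + (s + (s + r))  ≡⟨ l s r ⟩
  r + + 3 * s ∎
  where
  s = sum₂ λ y z → g zero (suc y) (suc z)
  r = sum₃ λ x y z → g (suc x) (suc y) (suc z)
  g₀₁ : ∀ x → g zero x zero ≡ 0ℤ
  g₀₁ x = trans (rot zero x zero) (trans (rot x zero zero) (g₀ x))
  t₂ : sum (λ x → sum (g (suc x) zero)) ≡ s
  t₂ = trans (sum-cong λ x → trans (sum-suc-vanish (g (suc x) zero) (trans (rot (suc x) zero zero) (g₀ (suc x))))
                                   (sum-cong λ z → rot (suc x) zero (suc z)))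
             (sum₂-swap λ z x → g zero (suc z) (suc x))
  t₃ : sum₂ (λ x y → g (suc x) (suc y) zero) ≡ s
  t₃ = sum₂-cong λ x y → sym (rot zero (suc x) (suc y))
  l : ∀ s r → s + (s + (s + r)) ≡ r + + 3 * s
  l = solve-∀

-- As for three indices, but two positions on a 4-cycle can also be opposite, which is why a second
-- vanishing hypothesis appears.
sum₄-suc : (g : Fin (suc n) → Fin (suc n) → Fin (suc n) → Fin (suc n) → ℤ) →
  (∀ x y z w → g x y z w ≡ g y z w x) → (∀ z w → g zero zero z w ≡ 0ℤ) → (∀ y w → g zero y zero w ≡ 0ℤ) →
  sum₄ g ≡ sum₄ (λ x y z w → g (suc x) (suc y) (suc z) (suc w)) +
           + 4 * sum₃ (λ y z w → g zero (suc y) (suc z) (suc w))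
sum₄-suc {n} g rot g₀ g₁ = begin
  sum₃ (g zero) + sum (λ x → sum₂ (g (suc x) zero) + sum (λ y → sum (g (suc x) (suc y) zero) +
    sum (λ z → g (suc x) (suc y) (suc z) zero + sum (λ w → g (suc x) (suc y) (suc z) (suc w)))))
    ≡⟨ cong₂ _+_ (sum₃-suc-vanish (g zero) g₀ g₁ λ x y → g₃ x y)
         (trans (sum-+ (λ x → sum₂ (g (suc x) zero))
                       (λ x → sum (λ y → sum (g (suc x) (suc y) zero) +
                         sum (λ z → g (suc x) (suc y) (suc z) zero + sum (λ w → g (suc x) (suc y) (suc z) (suc w))))))
           (cong₂ _+_ t₂
             (trans (sum₂-+ (λ x y → sum (g (suc x) (suc y) zero))
                            (λ x y → sum (λ z → g (suc x) (suc y) (suc z) zero + sum (λ w → g (suc x) (suc y) (suc z) (suc w)))))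
               (cong₂ _+_ t₃
                 (trans (sum₃-+ (λ x y z → g (suc x) (suc y) (suc z) zero)
                                (λ x y z → sum (λ w → g (suc x) (suc y) (suc z) (suc w))))
                   (cong (λ u → u + r) t₄)))))) ⟩
  s + (s + (s + (s + r)))  ≡⟨ l s r ⟩
  r + + 4 * s ∎
  where
  s = sum₃ λ y z w → g zero (suc y) (suc z) (suc w)
  r = sum₄ λ x y z w → g (suc x) (suc y) (suc z) (suc w)
  g₃ : ∀ x y → g zero x y zero ≡ 0ℤ
  g₃ x y = trans (rot zero x y zero) (trans (rot x y zero zero) (trans (rot y zero zero x) (g₀ x y)))
  t₂ : sum (λ x → sum₂ (g (suc x) zero)) ≡ s
  t₂ = trans (sum-cong λ x → trans
               (sum₂-suc-vanish (g (suc x) zero)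
                 (λ w → trans (rot (suc x) zero zero w) (g₀ w (suc x)))
                 (λ z → trans (rot (suc x) zero z zero) (g₁ z (suc x))))
               (sum₂-cong λ z w → rot (suc x) zero (suc z) (suc w)))
             (sum₃-rotate λ z w x → g zero (suc z) (suc w) (suc x))
  t₃ : sum₂ (λ x y → sum (g (suc x) (suc y) zero)) ≡ s
  t₃ = trans (sum₂-cong λ x y → trans
               (sum-suc-vanish (g (suc x) (suc y) zero)
                 (trans (rot (suc x) (suc y) zero zero) (trans (rot (suc y) zero zero (suc x)) (g₀ (suc x) (suc y)))))
               (sum-cong λ w → trans (rot (suc x) (suc y) zero (suc w)) (rot (suc y) zero (suc w) (suc x))))
       (trans (sum₃-rotate λ y w x → g zero (suc w) (suc x) (suc y))
              (sum₃-rotate λ w x y → g zero (suc w) (suc x) (suc y)))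
  t₄ : sum₃ (λ x y z → g (suc x) (suc y) (suc z) zero) ≡ s
  t₄ = sum₃-cong λ x y z → sym (rot zero (suc x) (suc y) (suc z))
  l : ∀ s r → s + (s + (s + (s + r))) ≡ r + + 4 * s
  l = solve-∀

-- Edges, triangles, induced 4-cycles and 4-cliques when a vertex is added

record IsAdjacency (A : Weights v) : Set where
  field
    symm   : ∀ x y → A x y ≡ A y x
    -- Over ℤ this says that entries are 0 or 1, in a form that ring identities can use.
    idem   : ∀ x y → A x y * A x y ≡ A x y
    irrefl : ∀ x → A x x ≡ 0ℤ

  Aδ≡0 : ∀ x y → A x y * δ x y ≡ 0ℤ
  Aδ≡0 x y = trans (ℤ.*-comm (A x y) (δ x y)) (trans (δ-subst (A x) x y)
               (trans (cong (δ x y *_) (irrefl x)) (ℤ.*-zeroʳ (δ x y))))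

complement : Weights v → Weights v
complement A x y = 1ℤ - δ x y - A x y

edges : Weights v → ℤ
edges A = sum₂ A

triangles : Weights v → ℤ
triangles A = sum₃ λ x y z → A x y * A y z * A z x

-- cliques₄ and inducedSquares below count 4-cliques 24 times and induced 4-cycles 8 times.
quad : Weights v → Weights v → Fin v → Fin v → Fin v → Fin v → ℤ
quad A B x y z w = A x y * A y z * A z w * A w x * (B x z * B y w)

cliques₄ : Weights v → ℤ
cliques₄ A = sum₄ (quad A A)

inducedSquares : Weights v → ℤ
inducedSquares A = sum₄ (quad A (complement A))

rest-adj : {A : Weights (suc v)} → IsAdjacency A → IsAdjacency (rest A)
rest-adj adj = record
  { symm   = λ x y → symm (suc x) (suc y)
  ; idem   = λ x y → idem (suc x) (suc y)
  ; irrefl = λ x → irrefl (suc x)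
  }
  where open IsAdjacency adj

complement-adj : {A : Weights v} → IsAdjacency A → IsAdjacency (complement A)
complement-adj {A = A} adj = record
  { symm   = λ x y → cong₂ (λ d a → 1ℤ - d - a) (δ-sym x y) (symm x y)
  ; idem   = λ x y → trans (l (δ x y) (A x y)) (trans
               (cong₂ (λ d r → 1ℤ - + 2 * δ x y - + 2 * A x y + d + r) (δ-idem x y)
                 (cong₂ (λ a t → a + + 2 * t) (idem x y) (Aδ≡0 x y)))
               (l₂ (δ x y) (A x y)))
  ; irrefl = λ x → cong₂ (λ d a → 1ℤ - d - a) (δ-refl x) (irrefl x)
  }
  where
  open IsAdjacency adj
  l : ∀ d a → (1ℤ - d - a) * (1ℤ - d - a) ≡ 1ℤ - + 2 * d - + 2 * a + d * d + (a * a + + 2 * (a * d))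
  l = solve-∀
  l₂ : ∀ d a → 1ℤ - + 2 * d - + 2 * a + d + (a + + 2 * 0ℤ) ≡ 1ℤ - d - a
  l₂ = solve-∀

A-complement : {A : Weights v} → IsAdjacency A → ∀ x y → complement A x y * A x y ≡ 0ℤ
A-complement {A = A} adj x y = trans (l (δ x y) (A x y)) (trans
    (cong₂ (λ a t → A x y - t - a) (idem x y) (Aδ≡0 x y)) (l₂ (A x y)))
  where
  open IsAdjacency adj
  l : ∀ d a → (1ℤ - d - a) * a ≡ a - a * d - a * a
  l = solve-∀
  l₂ : ∀ a → a - 0ℤ - a ≡ 0ℤ
  l₂ = solve-∀

edges-suc : {A : Weights (suc v)} → IsAdjacency A → edges A ≡ edges (rest A) + + 2 * sum (star A)
edges-suc {A = A} adj = sum₂-suc A symm (irrefl zero)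
  where open IsAdjacency adj

triangles-suc : {A : Weights (suc v)} → IsAdjacency A →
  triangles A ≡ triangles (rest A) + + 3 * sum₂ (λ y z → star A y * rest A y z * star A z)
triangles-suc {v} {A} adj = trans
  (sum₃-suc (λ x y z → A x y * A y z * A z x) (λ x y z → l (A x y) (A y z) (A z x))
            (λ z → trans (cong (λ u → u * A zero z * A z zero) (irrefl zero)) (l₀ (A zero z) (A z zero))))
  (cong (λ u → triangles (rest A) + + 3 * u)
        (sum₂-cong λ y z → cong (λ u → star A y * rest A y z * u) (symm (suc z) zero)))
  where
  open IsAdjacency adj
  l : ∀ a b c → a * b * c ≡ b * c * a
  l = solve-∀
  l₀ : ∀ a b → 0ℤ * a * b ≡ 0ℤ
  l₀ = solve-∀

quad-suc : {A B : Weights (suc v)} → IsAdjacency A → IsAdjacency B →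
  sum₄ (quad A B) ≡ sum₄ (quad (rest A) (rest B)) +
    + 4 * sum₃ (λ y z w → star A y * rest A y z * rest A z w * star A w * (star B z * rest B y w))
quad-suc {v} {A} {B} adjA adjB = trans
  (sum₄-suc (quad A B)
    (λ x y z w → trans (l (A x y) (A y z) (A z w) (A w x) (B x z) (B y w))
                       (cong (λ u → A y z * A z w * A w x * A x y * (B y w * u)) (B.symm x z)))
    (λ z w → trans (cong (λ u → u * A zero z * A z w * A w zero * (B zero z * B zero w)) (A.irrefl zero))
                   (l₀ (A zero z) (A z w) (A w zero) (B zero z * B zero w)))
    (λ y w → trans (cong (λ u → A zero y * A y zero * A zero w * A w zero * (u * B y w)) (B.irrefl zero))
                   (l₁ (A zero y * A y zero * A zero w * A w zero) (B y w))))
  (cong (λ u → sum₄ (quad (rest A) (rest B)) + + 4 * u)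
        (sum₃-cong λ y z w → cong (λ u → star A y * rest A y z * rest A z w * u * (star B z * rest B y w))
                                  (A.symm (suc w) zero)))
  where
  module A = IsAdjacency adjA
  module B = IsAdjacency adjB
  l : ∀ a b c d e f → a * b * c * d * (e * f) ≡ b * c * d * a * (f * e)
  l = solve-∀
  l₀ : ∀ a b c d → 0ℤ * a * b * c * d ≡ 0ℤ
  l₀ = solve-∀
  l₁ : ∀ a b → a * (0ℤ * b) ≡ 0ℤ
  l₁ = solve-∀

o-δ : (x y : Fin n) → o x y * δ x y ≡ 0ℤ
o-δ x y = trans (ℤ.*-comm (o x y) (δ x y)) (trans (δ-subst (o x) x y)
            (trans (cong (δ x y *_) (o-irrefl x)) (ℤ.*-zeroʳ (δ x y))))

-- Inclusion-exclusion over which of the three indices equal p; rotation and `g₀` make the terms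
-- vanish where two of them do. This is the analogue of `sum₃-suc` for a vertex anywhere in the
-- order.
sum₃-through : ∀ (g : Fin n → Fin n → Fin n → ℤ) p →
  (∀ x y z → g x y z ≡ g y z x) → (∀ z → g p p z ≡ 0ℤ) →
  sum₃ g ≡ sum₃ (λ x y z → (1ℤ - δ p x) * ((1ℤ - δ p y) * ((1ℤ - δ p z) * g x y z))) +
           + 3 * sum₂ (λ y z → g p y z)
sum₃-through {n} g p rot g₀ = begin
  sum₃ g
    ≡⟨ sum₃-cong pointwise ⟩
  sum₃ (λ x y z → h x y z + (f x y z + (f y z x + f z x y)))
    ≡⟨ trans (sum₃-+ h (λ x y z → f x y z + (f y z x + f z x y)))
         (cong (λ u → sum₃ h + u) (trans (sum₃-+ f (λ x y z → f y z x + f z x y))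
           (cong (λ u → sum₃ f + u) (sum₃-+ (λ x y z → f y z x) (λ x y z → f z x y))))) ⟩
  sum₃ h + (sum₃ f + (sum₃ (λ x y z → f y z x) + sum₃ (λ x y z → f z x y)))
    ≡⟨ cong₂ (λ u w → sum₃ h + (sum₃ f + (u + w))) (sum₃-rotate f)
         (trans (sum₃-rotate λ x y z → f y z x) (sum₃-rotate f)) ⟩
  sum₃ h + (sum₃ f + (sum₃ f + sum₃ f))
    ≡⟨ cong (λ u → sum₃ h + (u + (u + u))) f-sum ⟩
  sum₃ h + (s + (s + s))
    ≡⟨ l (sum₃ h) s ⟩
  sum₃ h + + 3 * s ∎
  where
  s = sum₂ λ y z → g p y z
  h f : Fin n → Fin n → Fin n → ℤ
  h x y z = (1ℤ - δ p x) * ((1ℤ - δ p y) * ((1ℤ - δ p z) * g x y z))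
  f x y z = δ p x * g x y z
  l : ∀ h s → h + (s + (s + s)) ≡ h + + 3 * s
  l = solve-∀
  two : ∀ x y z → δ p x * (δ p y * g x y z) ≡ 0ℤ
  two x y z = trans (δ-subst (λ u → δ p y * g u y z) p x) (trans
    (cong (δ p x *_) (trans (δ-subst (λ u → g p u z) p y)
                            (trans (cong (δ p y *_) (g₀ z)) (ℤ.*-zeroʳ (δ p y)))))
    (ℤ.*-zeroʳ (δ p x)))
  e : ∀ a b c g → g ≡ (1ℤ - a) * ((1ℤ - b) * ((1ℤ - c) * g)) + (a * g + (b * g + c * g))
        - (a * (b * g) + (b * (c * g) + c * (a * g))) + c * (a * (b * g))
  e = solve-∀
  e₂ : ∀ u c → u - (0ℤ + (0ℤ + 0ℤ)) + c * 0ℤ ≡ u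
  e₂ = solve-∀
  pointwise : ∀ x y z → g x y z ≡ h x y z + (f x y z + (f y z x + f z x y))
  pointwise x y z = begin
    g x y z
      ≡⟨ e (δ p x) (δ p y) (δ p z) (g x y z) ⟩
    h x y z + (f x y z + (δ p y * g x y z + δ p z * g x y z))
        - (δ p x * (δ p y * g x y z) + (δ p y * (δ p z * g x y z) + δ p z * (δ p x * g x y z)))
        + δ p z * (δ p x * (δ p y * g x y z))
      ≡⟨ cong₂ (λ u w → h x y z + (f x y z + u) - w + δ p z * (δ p x * (δ p y * g x y z)))
           (cong₂ (λ u w → δ p y * u + δ p z * w) (rot x y z) (trans (rot x y z) (rot y z x)))
           (cong₂ _+_ (two x y z) (cong₂ _+_
             (trans (cong (λ u → δ p y * (δ p z * u)) (rot x y z)) (two y z x))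
             (trans (cong (λ u → δ p z * (δ p x * u)) (trans (rot x y z) (rot y z x))) (two z x y)))) ⟩
    h x y z + (f x y z + (f y z x + f z x y)) - (0ℤ + (0ℤ + 0ℤ)) + δ p z * (δ p x * (δ p y * g x y z))
      ≡⟨ cong (λ u → h x y z + (f x y z + (f y z x + f z x y)) - (0ℤ + (0ℤ + 0ℤ)) + δ p z * u) (two x y z) ⟩
    h x y z + (f x y z + (f y z x + f z x y)) - (0ℤ + (0ℤ + 0ℤ)) + δ p z * 0ℤ
      ≡⟨ e₂ (h x y z + (f x y z + (f y z x + f z x y))) (δ p z) ⟩
    h x y z + (f x y z + (f y z x + f z x y)) ∎
  f-sum : sum₃ f ≡ s
  f-sum = trans (sum-cong λ x → sum₂-scale (δ p x) (g x)) (sum-δ (λ x → sum₂ (g x)) p)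

-- Effect of gluing on edges and triangles

module Glue {v : ℕ} (a : Fin v → ℤ) (a-idem : ∀ y → a y * a y ≡ a y)
            {A : Weights v} (adj : IsAdjacency A) (p : Fin v) where
  open IsAdjacency adj

  private
    B = glue a p A

  new : Fin v → ℤ
  new = newEdge a p A

  new-p : new p ≡ 0ℤ
  new-p = trans (cong (_* (a p * (1ℤ - A p p))) (o-irrefl p)) (ℤ.*-zeroˡ (a p * (1ℤ - A p p)))

  A*new : ∀ z → A p z * new z ≡ 0ℤ
  A*new z = trans (l (A p z) (o p z) (a z)) (trans (cong (λ u → o p z * a z * (A p z - u)) (idem p z)) (l₂ (o p z * a z) (A p z)))
    where
    l : ∀ A o a → A * (o * (a * (1ℤ - A))) ≡ o * a * (A - A * A)
    l = solve-∀
    l₂ : ∀ c A → c * (A - A) ≡ 0ℤ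
    l₂ = solve-∀

  new-idem : ∀ z → new z * new z ≡ new z
  new-idem z = trans (l (o p z) (a z) (A p z)) (trans
    (cong₂ _*_ (cong₂ _*_ (o-idem p z) (a-idem z)) (cong (λ u → 1ℤ - + 2 * A p z + u) (idem p z)))
    (l₂ (o p z) (a z) (A p z)))
    where
    l : ∀ o a A → o * (a * (1ℤ - A)) * (o * (a * (1ℤ - A))) ≡ (o * o) * (a * a) * (1ℤ - + 2 * A + A * A)
    l = solve-∀
    l₂ : ∀ o a A → o * a * (1ℤ - + 2 * A + A) ≡ o * (a * (1ℤ - A))
    l₂ = solve-∀

  δ*new : ∀ z → δ z p * new z ≡ 0ℤ
  δ*new z with z Fin.≟ p
  ... | yes refl = trans (cong (δ z z *_) new-p) (ℤ.*-zeroʳ (δ z z))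
  ... | no  z≢p  = trans (cong (_* new z) (δ-≢ z≢p)) (ℤ.*-zeroˡ (new z))

  row : ∀ z → B p z ≡ A p z + new z
  row z = trans (cong₂ (λ u w → A p z + (u * new z + w)) (δ-refl p) (trans (cong (δ z p *_) new-p) (ℤ.*-zeroʳ (δ z p))))
                (l (A p z) (new z))
    where
    l : ∀ A n → A + (1ℤ * n + 0ℤ) ≡ A + n
    l = solve-∀

  off : ∀ x z → x ≢ p → z ≢ p → B x z ≡ A x z
  off x z x≢p z≢p = trans (cong₂ (λ u w → A x z + (u * new z + w * new x)) (δ-≢ x≢p) (δ-≢ z≢p))
                          (l (A x z) (new z) (new x))
    where
    l : ∀ A n m → A + (0ℤ * n + 0ℤ * m) ≡ A
    l = solve-∀

  B-sym : ∀ x y → B x y ≡ B y x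
  B-sym x y = cong₂ _+_ (symm x y) (ℤ.+-comm (δ x p * new y) (δ y p * new x))

  -- New edges are disjoint from old ones by `A*new`, so row p remains 0-1; a new edge is never a
  -- loop because `o p p` vanishes.
  glue-adj : IsAdjacency B
  glue-adj = record { symm = B-sym ; idem = B-idem ; irrefl = B-irrefl }
    where
    row-idem : ∀ z → B p z * B p z ≡ B p z
    row-idem z = begin
      B p z * B p z                        ≡⟨ cong₂ _*_ (row z) (row z) ⟩
      (A p z + new z) * (A p z + new z)    ≡⟨ l (A p z) (new z) ⟩
      A p z * A p z + + 2 * (A p z * new z) + new z * new z
        ≡⟨ cong₂ _+_ (cong₂ (λ u w → u + + 2 * w) (idem p z) (A*new z)) (new-idem z) ⟩
      A p z + + 2 * 0ℤ + new z             ≡⟨ l₂ (A p z) (new z) ⟩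
      A p z + new z                        ≡⟨ sym (row z) ⟩
      B p z ∎
      where
      l : ∀ A n → (A + n) * (A + n) ≡ A * A + + 2 * (A * n) + n * n
      l = solve-∀
      l₂ : ∀ A n → A + + 2 * 0ℤ + n ≡ A + n
      l₂ = solve-∀
    B-idem : ∀ x y → B x y * B x y ≡ B x y
    B-idem x y with x Fin.≟ p | y Fin.≟ p
    ... | yes refl | _        = row-idem y
    ... | no _     | yes refl = trans (cong₂ _*_ (B-sym x y) (B-sym x y)) (trans (row-idem x) (B-sym y x))
    ... | no x≢p   | no y≢p   = trans (cong₂ _*_ (off x y x≢p y≢p) (off x y x≢p y≢p))
                                      (trans (idem x y) (sym (off x y x≢p y≢p)))
    B-irrefl : ∀ x → B x x ≡ 0ℤ
    B-irrefl x = trans (cong₂ (λ u w → A x x + (u + w)) (δ*new x) (δ*new x))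
                       (trans (ℤ.+-identityʳ (A x x)) (irrefl x))

  edges-glue : edges B ≡ edges A + + 2 * sum new
  edges-glue = begin
    sum₂ (λ x z → A x z + (δ x p * new z + δ z p * new x))
      ≡⟨ trans (sum₂-+ A (λ x z → δ x p * new z + δ z p * new x))
           (cong (λ u → edges A + u) (sum₂-+ (λ x z → δ x p * new z) (λ x z → δ z p * new x))) ⟩
    edges A + (sum₂ (λ x z → δ x p * new z) + sum₂ (λ x z → δ z p * new x))
      ≡⟨ cong₂ (λ u w → edges A + (u + w))
           (trans (sum-cong λ x → sum-scale (δ x p) new) (sum-δʳ (λ _ → sum new) p))
           (sum-cong λ x → sum-δʳ (λ _ → new x) p) ⟩
    edges A + (sum new + sum new) ≡⟨ l (edges A) (sum new) ⟩
    edges A + + 2 * sum new ∎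
    where
    l : ∀ e s → e + (s + s) ≡ e + + 2 * s
    l = solve-∀

  private
    tri : Weights v → Fin v → Fin v → Fin v → ℤ
    tri M x y z = M x y * M y z * M z x

    rot : ∀ (M : Weights v) x y z → tri M x y z ≡ tri M y z x
    rot M x y z = l (M x y) (M y z) (M z x)
      where
      l : ∀ a b c → a * b * c ≡ b * c * a
      l = solve-∀

    agree : ∀ u w → (1ℤ - δ p p) * u ≡ (1ℤ - δ p p) * w
    agree u w = trans (kill u) (sym (kill w))
      where
      kill : ∀ u → (1ℤ - δ p p) * u ≡ 0ℤ
      kill u = trans (cong (λ d → (1ℤ - d) * u) (δ-refl p)) (ℤ.*-zeroˡ u)

    outside : ∀ x y z → (1ℤ - δ p x) * ((1ℤ - δ p y) * ((1ℤ - δ p z) * tri B x y z)) ≡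
                        (1ℤ - δ p x) * ((1ℤ - δ p y) * ((1ℤ - δ p z) * tri A x y z))
    outside x y z with x Fin.≟ p | y Fin.≟ p | z Fin.≟ p
    ... | yes refl | _ | _ = agree ((1ℤ - δ p y) * ((1ℤ - δ p z) * tri B x y z)) ((1ℤ - δ p y) * ((1ℤ - δ p z) * tri A x y z))
    ... | no _ | yes refl | _ = cong ((1ℤ - δ p x) *_) (agree ((1ℤ - δ p z) * tri B x y z) ((1ℤ - δ p z) * tri A x y z))
    ... | no _ | no _ | yes refl = cong (λ u → (1ℤ - δ p x) * ((1ℤ - δ p y) * u)) (agree (tri B x y z) (tri A x y z))
    ... | no x≢p | no y≢p | no z≢p = cong (λ u → (1ℤ - δ p x) * ((1ℤ - δ p y) * ((1ℤ - δ p z) * u)))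
          (cong₂ _*_ (cong₂ _*_ (off x y x≢p y≢p) (off y z y≢p z≢p)) (off z x z≢p x≢p))

    through : ∀ y z → tri B p y z ≡ (A p y + new y) * A y z * (A p z + new z)
    through y z with y Fin.≟ p | z Fin.≟ p
    ... | no y≢p | no z≢p = cong₂ _*_ (cong₂ _*_ (row y) (off y z y≢p z≢p)) (trans (B-sym z p) (row z))
    ... | yes refl | _ = trans (cong (λ u → u * B y z * B z y) (trans (row y) Bpp))
            (trans (l₀ (B y z) (B z y)) (sym (trans (cong (λ u → u * A y z * (A y z + new z)) Bpp) (l₀ (A y z) (A y z + new z)))))
      where
      Bpp : A p p + new p ≡ 0ℤ
      Bpp = cong₂ _+_ (irrefl p) new-p
      l₀ : ∀ a b → 0ℤ * a * b ≡ 0ℤ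
      l₀ = solve-∀
    ... | no _ | yes refl = trans (cong (λ u → B z y * B y z * u) (trans (row z) Bpp))
            (trans (l₀ (B z y) (B y z)) (sym (trans (cong (λ u → (A z y + new y) * A y z * u) Bpp) (l₀ (A z y + new y) (A y z)))))
      where
      Bpp : A p p + new p ≡ 0ℤ
      Bpp = cong₂ _+_ (irrefl p) new-p
      l₀ : ∀ a b → a * b * 0ℤ ≡ 0ℤ
      l₀ = solve-∀

  -- All new edges meet in p, so a new triangle contains p and its side opposite to p is old. At p
  -- it has one new and one old edge, in two orders, or two new ones; the factor 3 is the position
  -- of p in the triple.
  triangles-glue : triangles B ≡ triangles A +
    + 3 * (+ 2 * sum₂ (λ y z → A p y * A y z * new z) + sum₂ (λ y z → new y * new z * A y z))
  triangles-glue = begin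
    triangles B
      ≡⟨ sum₃-through (tri B) p (rot B) (λ z → trans (cong (λ u → u * B p z * B z p) Bpp) (l₀ (B p z) (B z p))) ⟩
    sum₃ (λ x y z → (1ℤ - δ p x) * ((1ℤ - δ p y) * ((1ℤ - δ p z) * tri B x y z))) + + 3 * sum₂ (tri B p)
      ≡⟨ cong₂ (λ u w → u + + 3 * w) (sum₃-cong outside) (sum₂-cong through) ⟩
    H + + 3 * sum₂ (λ y z → (A p y + new y) * A y z * (A p z + new z))
      ≡⟨ cong (λ u → H + + 3 * u) (begin
           sum₂ (λ y z → (A p y + new y) * A y z * (A p z + new z))
             ≡⟨ sum₂-cong (λ y z → trans (l (A p y) (new y) (A y z) (A p z) (new z))
                  (cong₂ (λ u w → A p y * A y z * u + (A p y * A y z * new z + (A p z * w * new y + new y * new z * A y z)))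
                         (symm p z) (symm y z))) ⟩
           sum₂ (λ y z → tri A p y z + (f y z + (f z y + g y z)))
             ≡⟨ trans (sum₂-+ (tri A p) (λ y z → f y z + (f z y + g y z)))
                  (cong (λ u → sum₂ (tri A p) + u) (trans (sum₂-+ f (λ y z → f z y + g y z))
                    (cong (λ u → sum₂ f + u) (trans (sum₂-+ (λ y z → f z y) g)
                      (cong (λ u → u + sum₂ g) (sum₂-swap f)))))) ⟩
           sum₂ (tri A p) + (sum₂ f + (sum₂ f + sum₂ g)) ∎) ⟩
    H + + 3 * (sum₂ (tri A p) + (sum₂ f + (sum₂ f + sum₂ g)))
      ≡⟨ l₂ H (sum₂ (tri A p)) (sum₂ f) (sum₂ g) ⟩
    (H + + 3 * sum₂ (tri A p)) + + 3 * (+ 2 * sum₂ f + sum₂ g)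
      ≡⟨ cong (λ u → u + + 3 * (+ 2 * sum₂ f + sum₂ g)) (sym (sum₃-through (tri A) p (rot A)
           (λ z → trans (cong (λ u → u * A p z * A z p) (irrefl p)) (l₀ (A p z) (A z p))))) ⟩
    triangles A + + 3 * (+ 2 * sum₂ f + sum₂ g) ∎
    where
    f g : Fin v → Fin v → ℤ
    f y z = A p y * A y z * new z
    g y z = new y * new z * A y z
    H = sum₃ (λ x y z → (1ℤ - δ p x) * ((1ℤ - δ p y) * ((1ℤ - δ p z) * tri A x y z)))
    l₀ : ∀ a b → 0ℤ * a * b ≡ 0ℤ
    l₀ = solve-∀
    Bpp = IsAdjacency.irrefl glue-adj p
    l : ∀ a n A b m → (a + n) * A * (b + m) ≡ a * A * b + (a * A * m + (b * A * n + n * m * A))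
    l = solve-∀
    l₂ : ∀ h t f g → h + + 3 * (t + (f + (f + g))) ≡ (h + + 3 * t) + + 3 * (+ 2 * f + g)
    l₂ = solve-∀

sum-o₂ : ∀ (f : Fin n → Fin n → ℤ) → (∀ x y → f x y ≡ f y x) → (∀ x → f x x ≡ 0ℤ) →
         + 2 * sum₂ (λ x y → o x y * f x y) ≡ sum₂ f
sum-o₂ f f-sym f₀ = begin
  + 2 * sum₂ g
    ≡⟨ l (sum₂ g) ⟩
  sum₂ g + sum₂ g
    ≡⟨ cong (λ u → sum₂ g + u) (sym (sum₂-swap g)) ⟩
  sum₂ g + sum₂ (λ x y → g y x)
    ≡⟨ sym (sum₂-+ g (λ x y → g y x)) ⟩
  sum₂ (λ x y → o x y * f x y + o y x * f y x)
    ≡⟨ sum₂-cong (λ x y → begin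
         o x y * f x y + o y x * f y x  ≡⟨ cong (λ u → o x y * f x y + o y x * u) (f-sym y x) ⟩
         o x y * f x y + o y x * f x y  ≡⟨ sym (ℤ.*-distribʳ-+ (f x y) (o x y) (o y x)) ⟩
         (o x y + o y x) * f x y        ≡⟨ cong (_* f x y) (o-total x y) ⟩
         (1ℤ - δ x y) * f x y           ≡⟨ l₂ (δ x y) (f x y) ⟩
         f x y - δ x y * f x y
           ≡⟨ cong (λ u → f x y - u) (trans (δ-subst (f x) x y) (trans (cong (δ x y *_) (f₀ x)) (ℤ.*-zeroʳ (δ x y)))) ⟩
         f x y - 0ℤ                     ≡⟨ ℤ.+-identityʳ (f x y) ⟩
         f x y ∎) ⟩
  sum₂ f ∎
  where
  g = λ x y → o x y * f x y
  l : ∀ s → + 2 * s ≡ s + s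
  l = solve-∀
  l₂ : ∀ d f → (1ℤ - d) * f ≡ f - d * f
  l₂ = solve-∀

-- Three distinct indices have exactly one least among them; the δ factors restrict the claim to
-- distinct triples.
o-least : ∀ (x y z : Fin n) →
  (o x y * o x z + o y z * o y x + o z x * o z y - 1ℤ) * ((1ℤ - δ x y) * ((1ℤ - δ x z) * (1ℤ - δ y z))) ≡ 0ℤ
o-least zero    zero    z       = ℤ.*-zeroʳ (0ℤ + o {suc _} zero z * 0ℤ + o z zero * o z zero - 1ℤ)
o-least zero    (suc y) zero    = refl
o-least zero    (suc y) (suc z) = l (o y z) (o z y) (δ y z)
  where
  l : ∀ a b d → (1ℤ * 1ℤ + a * 0ℤ + 0ℤ * b - 1ℤ) * ((1ℤ - 0ℤ) * ((1ℤ - 0ℤ) * (1ℤ - d))) ≡ 0ℤ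
  l = solve-∀
o-least (suc x) zero    zero    = refl
o-least (suc x) zero    (suc z) = l (o x z) (o z x) (δ x z)
  where
  l : ∀ a b d → (0ℤ * a + 1ℤ * 1ℤ + b * 0ℤ - 1ℤ) * ((1ℤ - 0ℤ) * ((1ℤ - d) * (1ℤ - 0ℤ))) ≡ 0ℤ
  l = solve-∀
o-least (suc x) (suc y) zero    = l (o x y) (o y x) (δ x y)
  where
  l : ∀ a b d → (a * 0ℤ + 0ℤ * b + 1ℤ * 1ℤ - 1ℤ) * ((1ℤ - d) * ((1ℤ - 0ℤ) * (1ℤ - 0ℤ))) ≡ 0ℤ
  l = solve-∀
o-least (suc x) (suc y) (suc z) = o-least x y z

-- Cyclic invariance suffices: exactly one of the three rotations of a triple of distinct indices
-- starts with the least one, and the other two may stand in either order.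
sum-o₃ : ∀ (f : Fin n → Fin n → Fin n → ℤ) → (∀ x y z → f x y z ≡ f y z x) → (∀ x z → f x x z ≡ 0ℤ) →
         + 3 * sum₃ (λ x y z → o x y * o x z * f x y z) ≡ sum₃ f
sum-o₃ f rot f₀ = begin
  + 3 * sum₃ g
    ≡⟨ l (sum₃ g) ⟩
  sum₃ g + (sum₃ g + sum₃ g)
    ≡⟨ cong₂ (λ u w → sum₃ g + (u + w)) (sym (sum₃-rotate g)) (sym (trans (sum₃-rotate λ x y z → g y z x) (sum₃-rotate g))) ⟩
  sum₃ g + (sum₃ (λ x y z → g y z x) + sum₃ (λ x y z → g z x y))
    ≡⟨ sym (trans (sum₃-+ g (λ x y z → g y z x + g z x y))
              (cong (λ u → sum₃ g + u) (sum₃-+ (λ x y z → g y z x) (λ x y z → g z x y)))) ⟩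
  sum₃ (λ x y z → g x y z + (g y z x + g z x y))
    ≡⟨ sum₃-cong pointwise ⟩
  sum₃ f ∎
  where
  g = λ x y z → o x y * o x z * f x y z
  l : ∀ s → + 3 * s ≡ s + (s + s)
  l = solve-∀
  δf : ∀ x y z → δ x y * f x y z ≡ 0ℤ
  δf x y z = trans (δ-subst (λ u → f x u z) x y) (trans (cong (δ x y *_) (f₀ x z)) (ℤ.*-zeroʳ (δ x y)))
  δf₂ : ∀ x y z → δ y z * f x y z ≡ 0ℤ
  δf₂ x y z = trans (cong (δ y z *_) (rot x y z)) (δf y z x)
  δf₁ : ∀ x y z → δ x z * f x y z ≡ 0ℤ
  δf₁ x y z = trans (cong₂ _*_ (δ-sym x z) (trans (rot x y z) (rot y z x))) (δf z x y)
  split : ∀ a b c f → f ≡ (1ℤ - a) * ((1ℤ - b) * (1ℤ - c)) * f + (a * f) * ((1ℤ - b) * (1ℤ - c)) + (b * f) * (1ℤ - c) + c * f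
  split = solve-∀
  off : ∀ x y z → f x y z ≡ (1ℤ - δ x y) * ((1ℤ - δ x z) * (1ℤ - δ y z)) * f x y z
  off x y z = trans (split (δ x y) (δ x z) (δ y z) (f x y z)) (trans
    (cong₂ (λ u w → F + u * ((1ℤ - δ x z) * (1ℤ - δ y z)) + w * (1ℤ - δ y z) + δ y z * f x y z) (δf x y z) (δf₁ x y z))
    (trans (cong (λ u → F + 0ℤ * ((1ℤ - δ x z) * (1ℤ - δ y z)) + 0ℤ * (1ℤ - δ y z) + u) (δf₂ x y z))
           (l₂ F (δ x z) (δ y z))))
    where
    F = (1ℤ - δ x y) * ((1ℤ - δ x z) * (1ℤ - δ y z)) * f x y z
    l₂ : ∀ F b c → F + 0ℤ * ((1ℤ - b) * (1ℤ - c)) + 0ℤ * (1ℤ - c) + 0ℤ ≡ F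
    l₂ = solve-∀
  pointwise : ∀ x y z → g x y z + (g y z x + g z x y) ≡ f x y z
  pointwise x y z = begin
    o x y * o x z * f x y z + (o y z * o y x * f y z x + o z x * o z y * f z x y)
      ≡⟨ cong₂ (λ u w → o x y * o x z * f x y z + (o y z * o y x * u + o z x * o z y * w))
           (sym (rot x y z)) (sym (trans (rot x y z) (rot y z x))) ⟩
    o x y * o x z * f x y z + (o y z * o y x * f x y z + o z x * o z y * f x y z)
      ≡⟨ e (o x y * o x z) (o y z * o y x) (o z x * o z y) (f x y z) ⟩
    f x y z + (Q - 1ℤ) * f x y z
      ≡⟨ cong (λ u → f x y z + (Q - 1ℤ) * u) (off x y z) ⟩
    f x y z + (Q - 1ℤ) * (D * f x y z)
      ≡⟨ cong (λ u → f x y z + u) (trans (sym (ℤ.*-assoc (Q - 1ℤ) D (f x y z)))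
           (trans (cong (_* f x y z) (o-least x y z)) (ℤ.*-zeroˡ (f x y z)))) ⟩
    f x y z + 0ℤ ≡⟨ ℤ.+-identityʳ (f x y z) ⟩
    f x y z ∎
    where
    Q = o x y * o x z + o y z * o y x + o z x * o z y
    D = (1ℤ - δ x y) * ((1ℤ - δ x z) * (1ℤ - δ y z))
    e : ∀ a b c f → a * f + (b * f + c * f) ≡ f + (a + b + c - 1ℤ) * f
    e = solve-∀

module Star {v : ℕ} (a : Fin v → ℤ) (a-idem : ∀ y → a y * a y ≡ a y)
            {A : Weights v} (adj : IsAdjacency A) where
  open IsAdjacency adj
  C : Weights v
  C = complement A
  module C = IsAdjacency (complement-adj adj)

  -- In the neighbourhood a of a vertex, τ, ω, κ and I₃ count ordered edges, non-edges,
  -- triangles and independent triples.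
  d τ ω κ σ ρ R R₀ I₃ : ℤ
  d  = sum a
  τ  = sum₂ λ y z → a y * A y z * a z
  ω  = sum₂ λ y z → a y * a z * C y z
  κ  = sum₃ λ y z w → a y * A y z * A z w * a w * (a z * A y w)
  ρ  = sum₃ λ y z w → a y * A y z * A z w * a w * (a z * C y w)
  R₀ = sum₃ λ y z w → a y * A y z * A z w * a w * ((1ℤ - a z) * C y w)
  R  = sum₃ λ y z w → a y * A y z * A z w * a w * C y w
  I₃ = sum₃ λ y z w → a y * a z * a w * (C y z * C y w * C z w)

  α : Fin v → ℤ
  α y = sum λ w → A y w * a w

  β : Fin v → Fin v → ℤ
  β y z = sum λ w → a w * A y w * A z w

  σ  = sum λ y → a y * (α y * α y)

  -- `R` runs over paths y z w with nonadjacent ends in the neighbourhood. Those with the middle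
  -- vertex outside it form induced 4-cycles together with the new vertex, so `R₀` is the part that
  -- has to survive in c₃.
  R-split : R ≡ R₀ + ρ
  R-split = trans (sum₃-cong λ y z w → l (a y * A y z * A z w * a w) (a z) (C y w))
    (sum₃-+ (λ y z w → a y * A y z * A z w * a w * ((1ℤ - a z) * C y w))
            (λ y z w → a y * A y z * A z w * a w * (a z * C y w)))
    where
    l : ∀ p a c → p * c ≡ p * ((1ℤ - a) * c) + p * (a * c)
    l = solve-∀

  τ-α : sum (λ y → a y * α y) ≡ τ
  τ-α = sum-cong λ y → trans (sym (sum-scale (a y) (λ z → A y z * a z)))
                             (sum-cong λ z → sym (ℤ.*-assoc (a y) (A y z) (a z)))

  C-row : ∀ y → sum (λ z → a z * C y z) ≡ d - a y - α y
  C-row y = begin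
    sum (λ z → a z * C y z)
      ≡⟨ sum-cong (λ z → l (a z) (δ y z) (A y z)) ⟩
    sum (λ z → a z - δ y z * a z - A y z * a z)
      ≡⟨ sum-sub (λ z → a z - δ y z * a z) (λ z → A y z * a z) ⟩
    sum (λ z → a z - δ y z * a z) - α y
      ≡⟨ cong (λ u → u - α y) (trans (sum-sub a (λ z → δ y z * a z)) (cong (λ u → d - u) (sum-δ a y))) ⟩
    d - a y - α y ∎
    where
    l : ∀ a d A → a * (1ℤ - d - A) ≡ a - d * a - A * a
    l = solve-∀

  ω-formula : ω ≡ d * d - d - τ
  ω-formula = begin
    ω
      ≡⟨ sum-cong (λ y → trans (sum-cong λ z → ℤ.*-assoc (a y) (a z) (C y z))
           (trans (sum-scale (a y) (λ z → a z * C y z)) (cong (a y *_) (C-row y)))) ⟩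
    sum (λ y → a y * (d - a y - α y))
      ≡⟨ sum-cong (λ y → trans (l (a y) d (α y)) (cong (λ u → d * a y - u - a y * α y) (a-idem y))) ⟩
    sum (λ y → d * a y - a y - a y * α y)
      ≡⟨ sum-sub (λ y → d * a y - a y) (λ y → a y * α y) ⟩
    sum (λ y → d * a y - a y) - sum (λ y → a y * α y)
      ≡⟨ cong₂ _-_ (trans (sum-sub (λ y → d * a y) a) (cong (λ u → u - d) (sum-scale d a))) τ-α ⟩
    d * d - d - τ ∎
    where
    l : ∀ a d α → a * (d - a - α) ≡ d * a - a * a - a * α
    l = solve-∀

  sum-Cα : sum₂ (λ y z → a y * a z * C y z * α y) ≡ d * τ - τ - σ
  sum-Cα = begin
    sum₂ (λ y z → a y * a z * C y z * α y)
      ≡⟨ sum-cong (λ y → trans (sum-cong λ z → l₁ (a y) (a z) (C y z) (α y))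
           (trans (sum-scale (a y * α y) (λ z → a z * C y z)) (cong (a y * α y *_) (C-row y)))) ⟩
    sum (λ y → a y * α y * (d - a y - α y))
      ≡⟨ sum-cong (λ y → trans (l (a y) d (α y)) (cong (λ u → d * (a y * α y) - u * α y - a y * (α y * α y)) (a-idem y))) ⟩
    sum (λ y → d * (a y * α y) - a y * α y - a y * (α y * α y))
      ≡⟨ sum-sub (λ y → d * (a y * α y) - a y * α y) (λ y → a y * (α y * α y)) ⟩
    sum (λ y → d * (a y * α y) - a y * α y) - σ
      ≡⟨ cong (λ u → u - σ) (trans (sum-sub (λ y → d * (a y * α y)) (λ y → a y * α y))
           (cong₂ _-_ (trans (sum-scale d (λ y → a y * α y)) (cong (d *_) τ-α)) τ-α)) ⟩
    d * τ - τ - σ ∎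
    where
    l₁ : ∀ a b c α → a * b * c * α ≡ a * α * (b * c)
    l₁ = solve-∀
    l : ∀ a d α → a * α * (d - a - α) ≡ d * (a * α) - a * a * α - a * (α * α)
    l = solve-∀

  sum-Cβ : sum₂ (λ y z → a y * a z * C y z * β y z) ≡ ρ
  sum-Cβ = trans (sum₂-cong λ y z → trans (sym (sum-scale (a y * a z * C y z) (λ w → a w * A y w * A z w)))
                   (sum-cong λ w → trans (cong (λ u → a y * a z * C y z * (a w * A y w * u)) (symm z w))
                     (l (a y) (a z) (a w) (C y z) (A y w) (A w z))))
                 (sum-cong λ y → ∑-comm λ z w → a y * A y w * A w z * a z * (a w * C y z))
    where
    l : ∀ y z w c p q → y * z * c * (w * p * q) ≡ y * p * q * z * (w * c)
    l = solve-∀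

  β-diag : ∀ y → β y y ≡ α y
  β-diag y = sum-cong λ w → trans (l (a w) (A y w)) (cong (_* a w) (idem y w))
    where
    l : ∀ a b → a * b * b ≡ b * b * a
    l = solve-∀

  -- σ counts triples in the neighbourhood whose middle vertex is adjacent to both ends. The ends
  -- coincide, which gives τ, or are adjacent, which gives κ, or are distinct and nonadjacent, which
  -- gives ρ.
  ρ-formula : ρ ≡ σ - τ - κ
  ρ-formula = begin
    ρ
      ≡⟨ sym sum-Cβ ⟩
    sum₂ (λ y z → a y * a z * C y z * β y z)
      ≡⟨ sum₂-cong (λ y z → l (a y) (a z) (δ y z) (A y z) (β y z)) ⟩
    sum₂ (λ y z → a y * a z * β y z - δ y z * (a y * a z * β y z) - a y * a z * A y z * β y z)
      ≡⟨ trans (sum₂-sub (λ y z → a y * a z * β y z - δ y z * (a y * a z * β y z)) (λ y z → a y * a z * A y z * β y z))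
           (cong (λ u → u - sum₂ (λ y z → a y * a z * A y z * β y z))
             (sum₂-sub (λ y z → a y * a z * β y z) (λ y z → δ y z * (a y * a z * β y z)))) ⟩
    sum₂ (λ y z → a y * a z * β y z) - sum₂ (λ y z → δ y z * (a y * a z * β y z)) - sum₂ (λ y z → a y * a z * A y z * β y z)
      ≡⟨ cong₂ _-_ (cong₂ _-_ first second) third ⟩
    σ - τ - κ ∎
    where
    l : ∀ a b d A β → a * b * (1ℤ - d - A) * β ≡ a * b * β - d * (a * b * β) - a * b * A * β
    l = solve-∀
    first : sum₂ (λ y z → a y * a z * β y z) ≡ σ
    first = begin
      sum₂ (λ y z → a y * a z * β y z)
        ≡⟨ sum₂-cong (λ y z → trans (sym (sum-scale (a y * a z) (λ w → a w * A y w * A z w)))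
             (sum-cong λ w → trans (cong₂ (λ u t → a y * a z * (a w * u * t)) (symm y w) (symm z w))
                                   (l₁ (a y) (a z) (a w) (A w y) (A w z)))) ⟩
      sum₃ (λ y z w → a w * (A w y * a y * (A w z * a z)))
        ≡⟨ sym (sum₃-rotate (λ y z w → a w * (A w y * a y * (A w z * a z)))) ⟩
      sum₃ (λ w y z → a w * (A w y * a y * (A w z * a z)))
        ≡⟨ sum-cong (λ w → trans (trans (sum-cong λ y → sum-scale (a w) (λ z → A w y * a y * (A w z * a z)))
             (sum-scale (a w) λ y → sum λ z → A w y * a y * (A w z * a z)))
             (cong (a w *_) (sum₂-product (λ y → A w y * a y) (λ z → A w z * a z)))) ⟩
      σ ∎
      where
      l₁ : ∀ y z w p q → y * z * (w * p * q) ≡ w * (p * y * (q * z))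
      l₁ = solve-∀
    second : sum₂ (λ y z → δ y z * (a y * a z * β y z)) ≡ τ
    second = trans (sum₂-δ λ y z → a y * a z * β y z)
                   (trans (sum-cong λ y → cong₂ _*_ (a-idem y) (β-diag y)) τ-α)
    third : sum₂ (λ y z → a y * a z * A y z * β y z) ≡ κ
    third = trans (sum₂-cong λ y z → trans (sym (sum-scale (a y * a z * A y z) (λ w → a w * A y w * A z w)))
                     (sum-cong λ w → trans (cong (λ u → a y * a z * A y z * (a w * A y w * u)) (symm z w))
                       (l₁ (a y) (a z) (a w) (A y z) (A y w) (A w z))))
                   (sum-cong λ y → ∑-comm λ z w → a y * A y w * A w z * a z * (a w * A y z))
      where
      l₁ : ∀ y z w c p q → y * z * c * (w * p * q) ≡ y * p * q * z * (w * c)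
      l₁ = solve-∀

  I₃-inner : ∀ y z → sum (λ w → a w * (C y w * C z w)) ≡
                     d - α y - α z + β y z - a y * C z y - a z * (1ℤ - A y z)
  I₃-inner y z = begin
    sum (λ w → a w * (C y w * C z w))
      ≡⟨ sum-cong (λ w → l (a w) (δ y w) (A y w) (δ z w) (A z w)) ⟩
    sum (λ w → a w - A y w * a w - A z w * a w + a w * A y w * A z w - δ y w * (a w * C z w) - δ z w * (a w * (1ℤ - A y w)))
      ≡⟨ trans (sum-sub (λ w → a w - A y w * a w - A z w * a w + a w * A y w * A z w - δ y w * (a w * C z w))
                      (λ w → δ z w * (a w * (1ℤ - A y w))))
         (cong₂ _-_
           (trans (sum-sub (λ w → a w - A y w * a w - A z w * a w + a w * A y w * A z w) (λ w → δ y w * (a w * C z w)))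
             (cong₂ _-_
               (trans (sum-+ (λ w → a w - A y w * a w - A z w * a w) (λ w → a w * A y w * A z w))
                 (cong (λ u → u + β y z)
                   (trans (sum-sub (λ w → a w - A y w * a w) (λ w → A z w * a w))
                     (cong (λ u → u - α z) (sum-sub a (λ w → A y w * a w))))))
               (sum-δ (λ w → a w * C z w) y)))
           (sum-δ (λ w → a w * (1ℤ - A y w)) z)) ⟩
    d - α y - α z + β y z - a y * C z y - a z * (1ℤ - A y z) ∎
    where
    l : ∀ a d A e B → a * ((1ℤ - d - A) * (1ℤ - e - B)) ≡
        a - A * a - B * a + a * A * B - d * (a * (1ℤ - e - B)) - e * (a * (1ℤ - A))
    l = solve-∀

  -- A non-edge y z is completed by any of the d - 2 other vertices of the neighbourhood, less those
  -- adjacent to y or to z, plus those adjacent to both.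
  I₃-formula : I₃ ≡ (d - + 2) * ω - + 2 * (d * τ - τ - σ) + ρ
  I₃-formula = begin
    I₃
      ≡⟨ sum₂-cong (λ y z → begin
           sum (λ w → a y * a z * a w * (C y z * C y w * C z w))
             ≡⟨ sum-cong (λ w → l₁ (a y) (a z) (a w) (C y z) (C y w) (C z w)) ⟩
           sum (λ w → a y * a z * C y z * (a w * (C y w * C z w)))
             ≡⟨ sum-scale (a y * a z * C y z) (λ w → a w * (C y w * C z w)) ⟩
           a y * a z * C y z * sum (λ w → a w * (C y w * C z w))
             ≡⟨ cong (a y * a z * C y z *_) (I₃-inner y z) ⟩
           a y * a z * C y z * (d - α y - α z + β y z - a y * C z y - a z * (1ℤ - A y z))
             ≡⟨ cong (λ u → a y * a z * C y z * (d - α y - α z + β y z - a y * u - a z * (1ℤ - A y z))) (C.symm z y) ⟩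
           a y * a z * C y z * (d - α y - α z + β y z - a y * C y z - a z * (1ℤ - A y z))
             ≡⟨ l₂ (a y) (a z) (C y z) (d - α y - α z + β y z) (A y z) ⟩
           a y * a z * C y z * (d - α y - α z + β y z) - (a y * a y) * a z * (C y z * C y z)
             - a y * (a z * a z) * (C y z - C y z * A y z)
             ≡⟨ cong₂ (λ u t → a y * a z * C y z * (d - α y - α z + β y z) - u - t)
                  (cong₂ (λ u t → u * a z * t) (a-idem y) (C.idem y z))
                  (cong₂ (λ u t → a y * u * (C y z - t)) (a-idem z) (A-complement adj y z)) ⟩
           a y * a z * C y z * (d - α y - α z + β y z) - a y * a z * C y z - a y * a z * (C y z - 0ℤ)
             ≡⟨ l₃ (a y) (a z) (C y z) d (α y) (α z) (β y z) ⟩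
           (d - + 2) * (a y * a z * C y z) - a y * a z * C y z * α y - a z * a y * C y z * α z + a y * a z * C y z * β y z
             ≡⟨ cong (λ u → (d - + 2) * (a y * a z * C y z) - a y * a z * C y z * α y - a z * a y * u * α z + a y * a z * C y z * β y z)
                  (C.symm y z) ⟩
           (d - + 2) * (a y * a z * C y z) - f y z - f z y + a y * a z * C y z * β y z ∎) ⟩
    sum₂ (λ y z → (d - + 2) * (a y * a z * C y z) - f y z - f z y + a y * a z * C y z * β y z)
      ≡⟨ trans (sum₂-+ (λ y z → (d - + 2) * (a y * a z * C y z) - f y z - f z y) (λ y z → a y * a z * C y z * β y z))
         (cong₂ _+_ (trans (sum₂-sub (λ y z → (d - + 2) * (a y * a z * C y z) - f y z) (λ y z → f z y))
             (cong₂ _-_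
               (trans (sum₂-sub (λ y z → (d - + 2) * (a y * a z * C y z)) f)
                 (cong₂ _-_ (sum₂-scale (d - + 2) (λ y z → a y * a z * C y z)) sum-Cα))
               (trans (sum₂-swap f) sum-Cα)))
           sum-Cβ) ⟩
    (d - + 2) * ω - (d * τ - τ - σ) - (d * τ - τ - σ) + ρ
      ≡⟨ l₄ ((d - + 2) * ω) (d * τ - τ - σ) ρ ⟩
    (d - + 2) * ω - + 2 * (d * τ - τ - σ) + ρ ∎
    where
    f : Fin v → Fin v → ℤ
    f y z = a y * a z * C y z * α y
    l₁ : ∀ y z w p q r → y * z * w * (p * q * r) ≡ y * z * p * (w * (q * r))
    l₁ = solve-∀
    l₂ : ∀ a b c t A → a * b * c * (t - a * c - b * (1ℤ - A)) ≡
         a * b * c * t - (a * a) * b * (c * c) - a * (b * b) * (c - c * A)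
    l₂ = solve-∀
    l₃ : ∀ a b c d α α′ β → a * b * c * (d - α - α′ + β) - a * b * c - a * b * (c - 0ℤ) ≡
         (d - + 2) * (a * b * c) - a * b * c * α - b * a * c * α′ + a * b * c * β
    l₃ = solve-∀
    l₄ : ∀ p q r → p - q - q + r ≡ p - + 2 * q + r
    l₄ = solve-∀

  new : Fin v → Fin v → ℤ
  new y z = newEdge a y A z

  -- Since `o` vanishes on the diagonal, `1 - A` may be replaced by the complement, which is
  -- symmetric and zero on the diagonal, as `sum-o₂` and `sum-o₃` require of a summand.
  new-C : ∀ y z → new y z ≡ o y z * (a z * C y z)
  new-C y z = begin
    o y z * (a z * (1ℤ - A y z))              ≡⟨ sym (l₁ (o y z) (a z) (A y z)) ⟩
    o y z * (a z * (1ℤ - A y z)) - 0ℤ * a z   ≡⟨ cong (λ u → o y z * (a z * (1ℤ - A y z)) - u * a z) (sym (o-δ y z)) ⟩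
    o y z * (a z * (1ℤ - A y z)) - o y z * δ y z * a z  ≡⟨ l₂ (o y z) (a z) (A y z) (δ y z) ⟩
    o y z * (a z * C y z) ∎
    where
    l₁ : ∀ o a A → o * (a * (1ℤ - A)) - 0ℤ * a ≡ o * (a * (1ℤ - A))
    l₁ = solve-∀
    l₂ : ∀ o a A d → o * (a * (1ℤ - A)) - o * d * a ≡ o * (a * (1ℤ - d - A))
    l₂ = solve-∀

  k : Fin v → ℤ
  k y = sum (new y)

  -- Gluing at y adds k y edges. Over all y in the neighbourhood every non-edge is added once, at
  -- its earlier end.
  sum-k : + 2 * sum (λ y → a y * k y) ≡ ω
  sum-k = trans (cong (+ 2 *_) (sum-cong λ y → trans (sym (sum-scale (a y) (new y)))
             (sum-cong λ z → trans (cong (a y *_) (new-C y z)) (l (a y) (o y z) (a z) (C y z)))))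
    (sum-o₂ (λ y z → a y * a z * C y z)
      (λ y z → cong₂ _*_ (ℤ.*-comm (a y) (a z)) (C.symm y z))
      (λ y → trans (cong (a y * a y *_) (C.irrefl y)) (ℤ.*-zeroʳ (a y * a y))))
    where
    l : ∀ a o b c → a * (o * (b * c)) ≡ o * (a * b * c)
    l = solve-∀

  -- The inner sum counts triangles with exactly one new edge y w, that is, paths y z w closed by
  -- it. Each path with nonadjacent ends in the neighbourhood is closed once, at its earlier end;
  -- its middle z is arbitrary.
  sum-P : + 2 * sum (λ y → a y * sum₂ (λ z w → A y z * A z w * new y w)) ≡ R
  sum-P = begin
    + 2 * sum (λ y → a y * sum₂ (λ z w → A y z * A z w * new y w))
      ≡⟨ cong (+ 2 *_) (trans (sum-cong λ y → trans (sym (sum₂-scale (a y) (λ z w → A y z * A z w * new y w)))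
           (trans (sum₂-cong λ z w → trans (cong (λ u → a y * (A y z * A z w * u)) (new-C y w))
                                    (l (a y) (A y z) (A z w) (o y w) (a w) (C y w)))
             (trans (∑-comm λ z w → o y w * (a y * A y z * A z w * a w * C y w))
               (sum-cong λ w → sum-scale (o y w) (λ z → a y * A y z * A z w * a w * C y w))))) refl) ⟩
    + 2 * sum₂ (λ y w → o y w * f y w)
      ≡⟨ sum-o₂ f f-sym (λ y → trans (sum-cong λ z → trans (cong (a y * A y z * A z y * a y *_) (C.irrefl y))
                                       (ℤ.*-zeroʳ (a y * A y z * A z y * a y))) (sum-0 {v})) ⟩
    sum₂ f
      ≡⟨ sum-cong (λ y → ∑-comm λ w z → a y * A y z * A z w * a w * C y w) ⟩
    R ∎
    where
    f : Fin v → Fin v → ℤ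
    f y w = sum λ z → a y * A y z * A z w * a w * C y w
    f-sym : ∀ y w → f y w ≡ f w y
    f-sym y w = sum-cong λ z → trans
      (cong₂ _*_ (cong₂ (λ p q → a y * p * q * a w) (symm y z) (symm z w)) (C.symm y w))
      (l₂ (a y) (A z y) (A w z) (a w) (C w y))
      where
      l₂ : ∀ a p q b c → a * p * q * b * c ≡ b * q * p * a * c
      l₂ = solve-∀
    l : ∀ y p q o w c → y * (p * q * (o * (w * c))) ≡ o * (y * p * q * w * c)
    l = solve-∀

  -- For fixed y the bracket counts ordered pairs of distinct nonadjacent endpoints of new edges.
  -- With y they form independent triples in which y is least, and `sum-o₃` removes this ordering.
  sum-I₃ : + 3 * sum (λ y → a y * (k y * k y - k y - sum₂ (λ z w → new y z * new y w * A z w))) ≡ I₃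
  sum-I₃ = trans (cong (+ 3 *_) (sum-cong λ y → begin
      a y * (k y * k y - k y - sum₂ (λ z w → new y z * new y w * A z w))
        ≡⟨ cong (a y *_) (cong₂ (λ u t → u - t - sum₂ (λ z w → new y z * new y w * A z w))
             (sym (sum₂-product (new y) (new y)))
             (sym (trans (sum₂-δ (λ z w → new y z * new y w))
                         (sum-cong λ z → Glue.new-idem a a-idem adj y z)))) ⟩
      a y * (sum₂ (λ z w → new y z * new y w) - sum₂ (λ z w → δ z w * (new y z * new y w)) - sum₂ (λ z w → new y z * new y w * A z w))
        ≡⟨ cong (a y *_) (sym (trans
             (sum₂-sub (λ z w → new y z * new y w - δ z w * (new y z * new y w)) (λ z w → new y z * new y w * A z w))
             (cong (λ u → u - sum₂ (λ z w → new y z * new y w * A z w))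
               (sum₂-sub (λ z w → new y z * new y w) (λ z w → δ z w * (new y z * new y w)))))) ⟩
      a y * sum₂ (λ z w → new y z * new y w - δ z w * (new y z * new y w) - new y z * new y w * A z w)
        ≡⟨ sym (sum₂-scale (a y) (λ z w → new y z * new y w - δ z w * (new y z * new y w) - new y z * new y w * A z w)) ⟩
      sum₂ (λ z w → a y * (new y z * new y w - δ z w * (new y z * new y w) - new y z * new y w * A z w))
        ≡⟨ sum₂-cong (λ z w → trans (l₁ (a y) (new y z) (new y w) (δ z w) (A z w))
             (trans (cong₂ (λ u t → a y * (u * t * C z w)) (new-C y z) (new-C y w))
                    (l₂ (a y) (o y z) (a z) (C y z) (o y w) (a w) (C y w) (C z w)))) ⟩
      sum₂ (λ z w → o y z * o y w * (a y * a z * a w * (C y z * C y w * C z w))) ∎))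
    (sum-o₃ (λ y z w → a y * a z * a w * (C y z * C y w * C z w))
      (λ y z w → trans (cong₂ (λ u t → a y * a z * a w * (u * t * C z w)) (C.symm y z) (C.symm y w))
                       (l₃ (a y) (a z) (a w) (C z y) (C w y) (C z w)))
      (λ y w → trans (cong (λ u → a y * a y * a w * (u * C y w * C y w)) (C.irrefl y))
                     (l₄ (a y * a y * a w) (C y w))))
    where
    l₁ : ∀ a n m d A → a * (n * m - d * (n * m) - n * m * A) ≡ a * (n * m * (1ℤ - d - A))
    l₁ = solve-∀
    l₂ : ∀ a o b c o′ b′ c′ e → a * (o * (b * c) * (o′ * (b′ * c′)) * e) ≡ o * o′ * (a * b * b′ * (c * c′ * e))
    l₂ = solve-∀
    l₃ : ∀ a b c p q r → a * b * c * (p * q * r) ≡ b * c * a * (r * p * q)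
    l₃ = solve-∀
    l₄ : ∀ p c → p * (0ℤ * c * c) ≡ 0ℤ
    l₄ = solve-∀

-- The coefficients c₁, c₂, c₃ of a graph

chromCoeff-1 : ∀ {v} {A : Weights v} → IsAdjacency A → + 2 * chromCoeff A 1 ≡ - edges A
chromCoeff-1 {zero}      adj = refl
chromCoeff-1 {suc v} {A} adj = begin
  + 2 * (c - sum (λ y → a y * chromCoeff (glue a y B) 0))
    ≡⟨ cong (λ u → + 2 * (c - u)) (sum-cong λ y →
         trans (cong (a y *_) (chromCoeff-lead (glue a y B))) (ℤ.*-identityʳ (a y))) ⟩
  + 2 * (c - sum a)             ≡⟨ l c (sum a) ⟩
  + 2 * c - + 2 * sum a         ≡⟨ cong (λ u → u - + 2 * sum a) (chromCoeff-1 (rest-adj adj)) ⟩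
  - edges B - + 2 * sum a       ≡⟨ l₂ (edges B) (sum a) ⟩
  - (edges B + + 2 * sum a)     ≡⟨ cong -_ (sym (edges-suc adj)) ⟩
  - edges A ∎
  where
  a = star A
  B = rest A
  c = chromCoeff B 1
  l : ∀ c s → + 2 * (c - s) ≡ + 2 * c - + 2 * s
  l = solve-∀
  l₂ : ∀ c s → - c - + 2 * s ≡ - (c + + 2 * s)
  l₂ = solve-∀

star-idem : {A : Weights (suc v)} → IsAdjacency A → ∀ y → star A y * star A y ≡ star A y
star-idem adj y = IsAdjacency.idem adj zero (suc y)

-- With e edges and t triangles, counted here 2 and 6 times, this is c₂ = e (e - 1) / 2 - t with
-- denominators cleared.
chromCoeff-2 : ∀ {v} {A : Weights v} → IsAdjacency A →
  + 24 * chromCoeff A 2 ≡ + 3 * (edges A * edges A) - + 6 * edges A - + 4 * triangles A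
chromCoeff-2 {zero}      adj = refl
chromCoeff-2 {suc v} {A} adj = begin
  + 24 * (c - sum (λ y → a y * c₁ y))
    ≡⟨ l c (sum (λ y → a y * c₁ y)) ⟩
  + 24 * c - + 24 * sum (λ y → a y * c₁ y)
    ≡⟨ cong₂ _-_ (chromCoeff-2 (rest-adj adj)) (begin
         + 24 * sum (λ y → a y * c₁ y)
           ≡⟨ sym (sum-scale (+ 24) (λ y → a y * c₁ y)) ⟩
         sum (λ y → + 24 * (a y * c₁ y))
           ≡⟨ sum-cong (λ y → trans (l₁ (a y) (c₁ y)) (trans
                (cong (λ u → + 12 * a y * u) (trans (chromCoeff-1 (Glue.glue-adj a (star-idem adj) (rest-adj adj) y))
                  (cong -_ (Glue.edges-glue a (star-idem adj) (rest-adj adj) y))))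
                (l₂ (a y) E (k y)))) ⟩
         sum (λ y → (- + 12 * E) * a y + (- + 24) * (a y * k y))
           ≡⟨ sum-linear (- + 12 * E) (- + 24) a (λ y → a y * k y) ⟩
         (- + 12 * E) * d + (- + 24) * sum (λ y → a y * k y)
           ≡⟨ trans (l₃ E d (sum (λ y → a y * k y))) (cong (λ u → - + 12 * E * d - + 12 * u) (trans sum-k ω-formula)) ⟩
         - + 12 * E * d - + 12 * (d * d - d - τ) ∎) ⟩
  + 3 * (E * E) - + 6 * E - + 4 * T - (- + 12 * E * d - + 12 * (d * d - d - τ))
    ≡⟨ l₄ E T d τ ⟩
  + 3 * ((E + + 2 * d) * (E + + 2 * d)) - + 6 * (E + + 2 * d) - + 4 * (T + + 3 * τ)
    ≡⟨ cong₂ (λ u w → + 3 * (u * u) - + 6 * u - + 4 * w) (sym (edges-suc adj)) (sym (triangles-suc adj)) ⟩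
  + 3 * (edges A * edges A) - + 6 * edges A - + 4 * triangles A ∎
  where
  a = star A
  B = rest A
  open Star a (star-idem adj) (rest-adj adj)
  c = chromCoeff B 2
  E = edges B
  T = triangles B
  c₁ : Fin v → ℤ
  c₁ y = chromCoeff (glue a y B) 1
  l : ∀ c s → + 24 * (c - s) ≡ + 24 * c - + 24 * s
  l = solve-∀
  l₁ : ∀ a c → + 24 * (a * c) ≡ + 12 * a * (+ 2 * c)
  l₁ = solve-∀
  l₂ : ∀ a e k → + 12 * a * - (e + + 2 * k) ≡ (- + 12 * e) * a + (- + 24) * (a * k)
  l₂ = solve-∀
  l₃ : ∀ e d s → (- + 12 * e) * d + (- + 24) * s ≡ - + 12 * e * d - + 12 * (+ 2 * s)
  l₃ = solve-∀
  l₄ : ∀ E T d τ → + 3 * (E * E) - + 6 * E - + 4 * T - (- + 12 * E * d - + 12 * (d * d - d - τ)) ≡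
       + 3 * ((E + + 2 * d) * (E + + 2 * d)) - + 6 * (E + + 2 * d) - + 4 * (T + + 3 * τ)
  l₄ = solve-∀

-- With e edges, t triangles, s induced 4-cycles and k 4-cliques, counted 2, 6, 8 and 24 times, this
-- says c₃ = - e (e - 1) (e - 2) / 6 + (e - 2) t + s - 2 k. The recursion calls for c₂ of the glued
-- graphs, hence for the increments of `Glue` summed over the neighbourhood.
chromCoeff-3 : ∀ {v} {A : Weights v} → IsAdjacency A →
  + 48 * chromCoeff A 3 ≡
  - (edges A * edges A * edges A) + + 6 * (edges A * edges A) - + 8 * edges A + + 4 * (edges A * triangles A)
    - + 16 * triangles A + + 6 * inducedSquares A - + 4 * cliques₄ A
chromCoeff-3 {zero}      adj = refl
chromCoeff-3 {suc v} {A} adj = begin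
  + 48 * (c - sum (λ y → a y * c₂ y))
    ≡⟨ l c (sum (λ y → a y * c₂ y)) ⟩
  + 48 * c - + 2 * (+ 24 * sum (λ y → a y * c₂ y))
    ≡⟨ cong₂ (λ u w → u - + 2 * w) (chromCoeff-3 adj′) (begin
         + 24 * sum (λ y → a y * c₂ y)
           ≡⟨ sym (sum-scale (+ 24) (λ y → a y * c₂ y)) ⟩
         sum (λ y → + 24 * (a y * c₂ y))
           ≡⟨ sum-cong (λ y → begin
                + 24 * (a y * c₂ y)
                  ≡⟨ l₁ (a y) (c₂ y) ⟩
                a y * (+ 24 * c₂ y)
                  ≡⟨ cong (a y *_) (trans (chromCoeff-2 (Glue.glue-adj a idem adj′ y))
                       (cong₂ (λ u w → + 3 * (u * u) - + 6 * u - + 4 * w)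
                         (Glue.edges-glue a idem adj′ y) (Glue.triangles-glue a idem adj′ y))) ⟩
                a y * (+ 3 * ((E + + 2 * k y) * (E + + 2 * k y)) - + 6 * (E + + 2 * k y) - + 4 * (T + + 3 * (+ 2 * P y + N y)))
                  ≡⟨ l₂ (a y) E T (k y) (P y) (N y) ⟩
                c₂′ * a y + (+ 12 * E) * (a y * k y) + (+ 12 * (a y * (k y * k y - k y - N y)) + (- + 24) * (a y * P y)) ∎) ⟩
         sum (λ y → c₂′ * a y + (+ 12 * E) * (a y * k y) + (+ 12 * (a y * (k y * k y - k y - N y)) + (- + 24) * (a y * P y)))
           ≡⟨ trans (sum-+ (λ y → c₂′ * a y + (+ 12 * E) * (a y * k y))
                           (λ y → + 12 * (a y * (k y * k y - k y - N y)) + (- + 24) * (a y * P y)))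
                (cong₂ _+_ (sum-linear c₂′ (+ 12 * E) a (λ y → a y * k y))
                           (sum-linear (+ 12) (- + 24) (λ y → a y * (k y * k y - k y - N y)) (λ y → a y * P y))) ⟩
         c₂′ * d + (+ 12 * E) * Sk + (+ 12 * Si + (- + 24) * Sp)
           ≡⟨ l₃ c₂′ d E Sk Si Sp ⟩
         c₂′ * d + + 6 * E * (+ 2 * Sk) + (+ 4 * (+ 3 * Si) - + 12 * (+ 2 * Sp))
           ≡⟨ cong₂ (λ u w → c₂′ * d + + 6 * E * u + w) (trans sum-k ω-formula)
                (cong₂ (λ u w → + 4 * u - + 12 * w)
                  (trans sum-I₃ (trans I₃-formula (cong₂ (λ u w → (d - + 2) * u - + 2 * (d * τ - τ - σ) + w) ω-formula ρ-formula)))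
                  (trans sum-P (trans R-split (cong (λ u → R₀ + u) ρ-formula)))) ⟩
         c₂′ * d + + 6 * E * (d * d - d - τ) +
           (+ 4 * ((d - + 2) * (d * d - d - τ) - + 2 * (d * τ - τ - σ) + (σ - τ - κ)) - + 12 * (R₀ + (σ - τ - κ))) ∎) ⟩
  - (E * E * E) + + 6 * (E * E) - + 8 * E + + 4 * (E * T) - + 16 * T + + 6 * inducedSquares B - + 4 * cliques₄ B
    - + 2 * (c₂′ * d + + 6 * E * (d * d - d - τ) +
        (+ 4 * ((d - + 2) * (d * d - d - τ) - + 2 * (d * τ - τ - σ) + (σ - τ - κ)) - + 12 * (R₀ + (σ - τ - κ))))
    -- The sum of squares σ is not part of the increment of any of the four counts. It cancels: the
    -- independent triples bring 12 σ and the paths -12 σ.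
    ≡⟨ l₄ E T d τ σ κ R₀ (inducedSquares B) (cliques₄ B) ⟩
  F (E + + 2 * d) (T + + 3 * τ) (inducedSquares B + + 4 * R₀) (cliques₄ B + + 4 * κ)
    ≡⟨ trans (cong₂ (λ u w → F u w (inducedSquares B + + 4 * R₀) (cliques₄ B + + 4 * κ))
                (sym (edges-suc adj)) (sym (triangles-suc adj)))
             (cong₂ (F (edges A) (triangles A)) (sym (quad-suc adj (complement-adj adj))) (sym (quad-suc adj adj))) ⟩
  F (edges A) (triangles A) (inducedSquares A) (cliques₄ A) ∎
  where
  a = star A
  B = rest A
  adj′ = rest-adj adj
  idem = star-idem adj
  open Star a (star-idem adj) (rest-adj adj)
  c = chromCoeff B 3
  E = edges B
  T = triangles B
  c₂′ = + 3 * (E * E) - + 6 * E - + 4 * T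
  F : ℤ → ℤ → ℤ → ℤ → ℤ
  F E T I K = - (E * E * E) + + 6 * (E * E) - + 8 * E + + 4 * (E * T) - + 16 * T + + 6 * I - + 4 * K
  c₂ P N : Fin v → ℤ
  c₂ y = chromCoeff (glue a y B) 2
  P y = sum₂ (λ z w → B y z * B z w * new y w)
  N y = sum₂ (λ z w → new y z * new y w * B z w)
  Sk = sum λ y → a y * k y
  Si = sum λ y → a y * (k y * k y - k y - N y)
  Sp = sum λ y → a y * P y
  l : ∀ c s → + 48 * (c - s) ≡ + 48 * c - + 2 * (+ 24 * s)
  l = solve-∀
  l₁ : ∀ a c → + 24 * (a * c) ≡ a * (+ 24 * c)
  l₁ = solve-∀
  l₂ : ∀ a E T k P N →
       a * (+ 3 * ((E + + 2 * k) * (E + + 2 * k)) - + 6 * (E + + 2 * k) - + 4 * (T + + 3 * (+ 2 * P + N))) ≡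
       (+ 3 * (E * E) - + 6 * E - + 4 * T) * a + (+ 12 * E) * (a * k) + (+ 12 * (a * (k * k - k - N)) + (- + 24) * (a * P))
  l₂ = solve-∀
  l₃ : ∀ c₂′ d E s i p → c₂′ * d + (+ 12 * E) * s + (+ 12 * i + (- + 24) * p) ≡
       c₂′ * d + + 6 * E * (+ 2 * s) + (+ 4 * (+ 3 * i) - + 12 * (+ 2 * p))
  l₃ = solve-∀
  l₄ : ∀ E T d τ σ κ R I K →
    - (E * E * E) + + 6 * (E * E) - + 8 * E + + 4 * (E * T) - + 16 * T + + 6 * I - + 4 * K
      - + 2 * ((+ 3 * (E * E) - + 6 * E - + 4 * T) * d + + 6 * E * (d * d - d - τ) +
          (+ 4 * ((d - + 2) * (d * d - d - τ) - + 2 * (d * τ - τ - σ) + (σ - τ - κ)) - + 12 * (R + (σ - τ - κ)))) ≡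
    - ((E + + 2 * d) * (E + + 2 * d) * (E + + 2 * d)) + + 6 * ((E + + 2 * d) * (E + + 2 * d)) - + 8 * (E + + 2 * d)
      + + 4 * ((E + + 2 * d) * (T + + 3 * τ)) - + 16 * (T + + 3 * τ) + + 6 * (I + + 4 * R) - + 4 * (K + + 4 * κ)
  l₄ = solve-∀

-- Chromatic polynomials of simple graphs

𝟙 : ∀ {p} {P : Set p} → Dec P → ℤ
𝟙 P? = if does P? then 1ℤ else 0ℤ

𝟙-yes : ∀ {p} {P : Set p} (P? : Dec P) → P → 𝟙 P? ≡ 1ℤ
𝟙-yes (yes _) _ = refl
𝟙-yes (no ¬p) p = contradiction p ¬p

𝟙-no : ∀ {p} {P : Set p} (P? : Dec P) → ¬ P → 𝟙 P? ≡ 0ℤ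
𝟙-no (yes p) ¬p = contradiction p ¬p
𝟙-no (no _)  _  = refl

𝟙-idem : ∀ {p} {P : Set p} (P? : Dec P) → 𝟙 P? * 𝟙 P? ≡ 𝟙 P?
𝟙-idem (yes _) = refl
𝟙-idem (no _)  = refl

𝟙-⇔ : ∀ {p q} {P : Set p} {Q : Set q} (P? : Dec P) (Q? : Dec Q) → (P → Q) → (Q → P) → 𝟙 P? ≡ 𝟙 Q?
𝟙-⇔ P? (yes q) f g = 𝟙-yes P? (g q)
𝟙-⇔ P? (no ¬q) f g = 𝟙-no P? (¬q ∘ f)

adjacencyMatrix : SimpleGraph v → Weights v
adjacencyMatrix G x y = 𝟙 (SimpleGraph.adj? G x y)

adjacencyMatrix-adj : (G : SimpleGraph v) → IsAdjacency (adjacencyMatrix G)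
adjacencyMatrix-adj G = record
  { symm   = λ x y → 𝟙-⇔ (G.adj? x y) (G.adj? y x) G.sym G.sym
  ; idem   = λ x y → 𝟙-idem (G.adj? x y)
  ; irrefl = λ x → 𝟙-no (G.adj? x x) (G.irrefl refl)
  }
  where module G = SimpleGraph G

prod-01 : (f : Fin n → ℤ) → (∀ i → f i ≡ 0ℤ ⊎ f i ≡ 1ℤ) →
          prod f ≡ 0ℤ ⊎ (prod f ≡ 1ℤ × ∀ i → f i ≡ 1ℤ)
prod-01 {zero}  f f01 = inj₂ (refl , λ ())
prod-01 {suc n} f f01 with f01 zero | prod-01 (f ∘ suc) (f01 ∘ suc)
... | inj₁ f₀ | _      = inj₁ (trans (cong (_* prod (f ∘ suc)) f₀) (ℤ.*-zeroˡ (prod (f ∘ suc))))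
... | inj₂ _  | inj₁ p = inj₁ (trans (cong (f zero *_) p) (ℤ.*-zeroʳ (f zero)))
... | inj₂ f₀ | inj₂ (p , q) = inj₂ (cong₂ _*_ f₀ p , λ { zero → f₀ ; (suc i) → q i })

o-01 : (x y : Fin n) → o x y ≡ 0ℤ ⊎ o x y ≡ 1ℤ
o-01 zero    zero    = inj₁ refl
o-01 zero    (suc y) = inj₂ refl
o-01 (suc x) zero    = inj₁ refl
o-01 (suc x) (suc y) = o-01 x y

module _ {v n : ℕ} (G : SimpleGraph v) (c : Fin v → Fin n) where
  private
    module G = SimpleGraph G

    factor : Fin v → Fin v → ℤ
    factor x z = 1ℤ - o x z * adjacencyMatrix G x z * δ (c x) (c z)

    factor-01 : ∀ x z → factor x z ≡ 0ℤ ⊎ factor x z ≡ 1ℤ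
    factor-01 x z with o-01 x z | G.adj? x z | c x Fin.≟ c z
    ... | inj₁ o≡0 | _     | _      rewrite o≡0 = inj₂ refl
    ... | inj₂ o≡1 | no _  | _      rewrite o≡1 = inj₂ refl
    ... | inj₂ o≡1 | yes _ | yes eq rewrite o≡1 | eq | δ-refl (c z) = inj₁ refl
    ... | inj₂ o≡1 | yes _ | no ne  rewrite o≡1 | δ-≢ ne = inj₂ refl

    row-01 : ∀ x → prod (factor x) ≡ 0ℤ ⊎ prod (factor x) ≡ 1ℤ
    row-01 x with prod-01 (factor x) (factor-01 x)
    ... | inj₁ p       = inj₁ p
    ... | inj₂ (p , _) = inj₂ p

    proper⇒factor≡1 : Proper G c → ∀ x z → factor x z ≡ 1ℤ
    proper⇒factor≡1 proper x z with G.adj? x z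
    ... | no _    rewrite ℤ.*-zeroʳ (o x z) = refl
    ... | yes adj rewrite δ-≢ (proper x z adj) | ℤ.*-zeroʳ (o x z * 1ℤ) = refl

    ordered : (∀ x z → factor x z ≡ 1ℤ) → ∀ x z → o x z ≡ 1ℤ → G.Adj x z → c x ≢ c z
    ordered h x z o≡1 adj cx≡cz = contradiction (trans (sym factor≡0) (h x z)) λ ()
      where
      factor≡0 : factor x z ≡ 0ℤ
      factor≡0 rewrite o≡1 | 𝟙-yes (G.adj? x z) adj | cx≡cz | δ-refl (c z) = refl

    -- Each pair is tested in increasing order only; symmetry of adjacency supplies the other order,
    -- and irreflexivity excludes x = z.
    factor≡1⇒proper : (∀ x z → factor x z ≡ 1ℤ) → Proper G c
    factor≡1⇒proper h x z adj cx≡cz with o-01 x z | o-01 z x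
    ... | inj₂ xz | _       = ordered h x z xz adj cx≡cz
    ... | inj₁ _  | inj₂ zx = ordered h z x zx (G.sym adj) (sym cx≡cz)
    ... | inj₁ xz | inj₁ zx = contradiction (trans (sym (cong₂ _+_ xz zx)) (trans (o-total x z)
                                (cong (λ u → 1ℤ - u) (δ-≢ λ x≡z → G.irrefl x≡z adj)))) λ ()

  weight-proper : weight (adjacencyMatrix G) c ≡ 𝟙 (proper? G c)
  weight-proper with prod-01 (λ x → prod (factor x)) row-01
  ... | inj₁ w≡0 = trans w≡0 (sym (𝟙-no (proper? G c) λ proper →
          contradiction (trans (sym w≡0) (w≡1 proper)) λ ()))
    where
    w≡1 : Proper G c → weight (adjacencyMatrix G) c ≡ 1ℤ
    w≡1 proper = trans (prod-cong λ x → trans (prod-cong (proper⇒factor≡1 proper x)) (prod-1 {v})) (prod-1 {v})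
  ... | inj₂ (w≡1 , rows) = trans w≡1 (sym (𝟙-yes (proper? G c) (factor≡1⇒proper factor≡1)))
    where
    factor≡1 : ∀ x z → factor x z ≡ 1ℤ
    factor≡1 x z with prod-01 (factor x) (factor-01 x)
    ... | inj₁ p       = contradiction (trans (sym p) (rows x)) λ ()
    ... | inj₂ (_ , q) = q z

length-filter : ∀ {a p} {A : Set a} {P : A → Set p} (P? : ∀ x → Dec (P x)) (f : Fin n → A) →
                + length (filter P? (tabulate f)) ≡ sum λ i → 𝟙 (P? (f i))
length-filter {zero}  P? f = refl
length-filter {suc n} P? f with P? (f zero)
... | yes _ = cong (λ u → 1ℤ + u) (length-filter P? (f ∘ suc))
... | no _  = trans (length-filter P? (f ∘ suc)) (sym (ℤ.+-identityˡ (sum λ i → 𝟙 (P? (f (suc i))))))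

sum-↑ : ∀ m {k} (f : Fin (m ℕ.+ k) → ℤ) → sum f ≡ sum (λ i → f (i ↑ˡ k)) + sum (λ j → f (m ↑ʳ j))
sum-↑ zero    f = sym (ℤ.+-identityˡ (sum f))
sum-↑ (suc m) {k} f = trans (cong (λ u → f zero + u) (sum-↑ m (f ∘ suc)))
  (sym (ℤ.+-assoc (f zero) (sum λ i → f (suc (i ↑ˡ k))) (sum λ j → f (suc (m ↑ʳ j)))))

sum-combine : ∀ m k (f : Fin (m ℕ.* k) → ℤ) → sum f ≡ sum λ i → sum λ j → f (combine {m} i j)
sum-combine zero    k f = refl
sum-combine (suc m) k f = trans (sum-↑ k f) (cong (λ u → sum (λ j → f (j ↑ˡ (m ℕ.* k))) + u) (sum-combine m k (λ i → f (k ↑ʳ i))))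

-- Extensionality of F is assumed because `finToFun (combine i j)` and `i ◂ finToFun j` are shown to
-- agree only pointwise.
sum-finToFun : ∀ v n (F : (Fin v → Fin n) → ℤ) → (∀ {c c′} → c ≗ c′ → F c ≡ F c′) →
               sum (λ i → F (finToFun {n} {v} i)) ≡ sumF v n F
sum-finToFun zero    n F F-ext = trans (ℤ.+-identityʳ (F (finToFun {n} {0} zero))) (F-ext λ ())
sum-finToFun (suc v) n F F-ext = trans (sum-combine n (n ℕ.^ v) (λ i → F (finToFun {n} {suc v} i)))
  (sum-cong λ i → trans
    (sum-cong λ j → F-ext {finToFun {n} {suc v} (combine i j)} {i ◂ finToFun j}
      λ { zero    → cong proj₁ (Fin.remQuot-combine i j)
        ; (suc x) → cong (λ u → finToFun {n} {v} (proj₂ u) x) (Fin.remQuot-combine {n} i j) })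
    (sum-finToFun v n (λ c → F (i ◂ c)) λ eq → F-ext λ { zero → refl ; (suc x) → eq x }))

#properColourings-weightedCount : (G : SimpleGraph v) (n : ℕ) →
  + #properColourings G n ≡ weightedCount (adjacencyMatrix G) n
#properColourings-weightedCount {v} G n = begin
  + #properColourings G n
    ≡⟨ length-filter (λ i → proper? G (finToFun {n} {v} i)) (λ i → i) ⟩
  sum (λ i → 𝟙 (proper? G (finToFun {n} {v} i)))
    ≡⟨ sum-cong (λ i → sym (weight-proper G (finToFun {n} {v} i))) ⟩
  sum (λ i → weight (adjacencyMatrix G) (finToFun {n} {v} i))
    ≡⟨ sum-finToFun v n (weight (adjacencyMatrix G)) (λ eq → prod-cong λ x → prod-cong λ z →
         cong₂ (λ p q → 1ℤ - o x z * adjacencyMatrix G x z * δ p q) (eq x) (eq z)) ⟩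
  weightedCount (adjacencyMatrix G) n ∎

-- Integer coefficient sequences as elements of `ℚ[X]`

ι : ℤ → ℚ
ι a = a ℚ./ 1

ι-injective : ∀ {a b} → ι a ≡ ι b → a ≡ b
ι-injective {a} {b} eq with ℚ.fromℚᵘ-injective {ℚᵘ.mkℚᵘ a 0} {ℚᵘ.mkℚᵘ b 0} eq
... | ℚᵘ.*≡* h = trans (sym (ℤ.*-identityʳ a)) (trans h (ℤ.*-identityʳ b))

ι-+ : ∀ a b → ι (a + b) ≡ ι a ℚ.+ ι b
ι-+ a b = ℚ.toℚᵘ-injective (ℚᵘ.≃-trans (ℚ.toℚᵘ-fromℚᵘ (ℚᵘ.mkℚᵘ (a + b) 0))
  (ℚᵘ.≃-sym (ℚᵘ.≃-trans (ℚ.toℚᵘ-homo-+ (ι a) (ι b))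
    (ℚᵘ.≃-trans (ℚᵘ.+-cong (ℚ.toℚᵘ-fromℚᵘ (ℚᵘ.mkℚᵘ a 0)) (ℚ.toℚᵘ-fromℚᵘ (ℚᵘ.mkℚᵘ b 0)))
      (ℚᵘ.*≡* (l a b))))))
  where
  l : ∀ a b → (a * 1ℤ + b * 1ℤ) * 1ℤ ≡ (a + b) * 1ℤ
  l = solve-∀

ι-* : ∀ a b → ι (a * b) ≡ ι a ℚ.* ι b
ι-* a b = ℚ.toℚᵘ-injective (ℚᵘ.≃-trans (ℚ.toℚᵘ-fromℚᵘ (ℚᵘ.mkℚᵘ (a * b) 0))
  (ℚᵘ.≃-sym (ℚᵘ.≃-trans (ℚ.toℚᵘ-homo-* (ι a) (ι b))
    (ℚᵘ.≃-trans (ℚᵘ.*-cong (ℚ.toℚᵘ-fromℚᵘ (ℚᵘ.mkℚᵘ a 0)) (ℚ.toℚᵘ-fromℚᵘ (ℚᵘ.mkℚᵘ b 0)))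
      (ℚᵘ.*≡* refl)))))

fromTop : (ℕ → ℤ) → ℕ → ℚ[X]
fromTop c zero    = ι (c 0) ∷ []
fromTop c (suc v) = ι (c (suc v)) ∷ fromTop c v

⟦fromTop⟧ : ∀ c v n → ⟦ fromTop c v ⟧ n ≡ ι (horner c v (+ n))
⟦fromTop⟧ c zero    n = trans (cong (ι (c 0) ℚ.+_) (ℚ.*-zeroʳ (fromℕ n))) (ℚ.+-identityʳ (ι (c 0)))
⟦fromTop⟧ c (suc v) n = begin
  ι (c (suc v)) ℚ.+ fromℕ n ℚ.* ⟦ fromTop c v ⟧ n
    ≡⟨ cong (λ u → ι (c (suc v)) ℚ.+ fromℕ n ℚ.* u) (⟦fromTop⟧ c v n) ⟩
  ι (c (suc v)) ℚ.+ ι (+ n) ℚ.* ι (horner c v (+ n))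
    ≡⟨ cong (ι (c (suc v)) ℚ.+_) (sym (ι-* (+ n) (horner c v (+ n)))) ⟩
  ι (c (suc v)) ℚ.+ ι (+ n * horner c v (+ n))
    ≡⟨ sym (ι-+ (c (suc v)) (+ n * horner c v (+ n))) ⟩
  ι (horner c (suc v) (+ n)) ∎

coeff-fromTop : ∀ c v i → i ℕ.≤ v → coeff (fromTop c v) i ≡ ι (c (v ℕ.∸ i))
coeff-fromTop c zero    zero    _           = refl
coeff-fromTop c (suc v) zero    _           = refl
coeff-fromTop c (suc v) (suc i) (ℕ.s≤s i≤v) = coeff-fromTop c v i i≤v

coeff-fromTop-beyond : ∀ c v i → v ℕ.< i → coeff (fromTop c v) i ≡ 0ℚ
coeff-fromTop-beyond c zero    (suc i) _           = refl
coeff-fromTop-beyond c (suc v) (suc i) (ℕ.s≤s v<i) = coeff-fromTop-beyond c v i v<i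

coeffFromTop-fromTop : ∀ c v r → (v ℕ.< r → c r ≡ 0ℤ) → coeffFromTop (fromTop c v) v r ≡ ι (c r)
coeffFromTop-fromTop c v r c≡0 with r ℕ.≤? v
... | yes r≤v = trans (coeff-fromTop c v (v ℕ.∸ r) (ℕ.m∸n≤m v r)) (cong (ι ∘ c) (ℕ.m∸[m∸n]≡n r≤v))
... | no  r≰v = cong ι (sym (c≡0 (ℕ.≰⇒> r≰v)))

chromaticPolynomial : SimpleGraph v → ℚ[X]
chromaticPolynomial {v} G = fromTop (chromCoeff (adjacencyMatrix G)) v

chromaticPolynomial-correct : (G : SimpleGraph v) → IsChromaticPolynomial G (chromaticPolynomial G)
chromaticPolynomial-correct {v} G n =
  trans (⟦fromTop⟧ (chromCoeff (adjacencyMatrix G)) v n)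
        (cong ι (trans (sym (weightedCount-horner (adjacencyMatrix G) n)) (sym (#properColourings-weightedCount G n))))

chromaticPolynomial-degree : (G : SimpleGraph v) → HasDegree (chromaticPolynomial G) v
chromaticPolynomial-degree {v} G =
  (λ c≡0 → contradiction (ι-injective {1ℤ} {0ℤ} (trans (sym lead) c≡0)) λ ()) ,
  λ i → coeff-fromTop-beyond (chromCoeff (adjacencyMatrix G)) v i
  where
  lead : coeff (chromaticPolynomial G) v ≡ ι 1ℤ
  lead = trans (coeff-fromTop (chromCoeff (adjacencyMatrix G)) v v ℕ.≤-refl)
    (cong ι (trans (cong (chromCoeff (adjacencyMatrix G)) (ℕ.n∸n≡0 v)) (chromCoeff-lead (adjacencyMatrix G))))

chromaticPolynomial-coeff : (G : SimpleGraph v) (r : ℕ) →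
  coeffFromTop (chromaticPolynomial G) v r ≡ ι (chromCoeff (adjacencyMatrix G) r)
chromaticPolynomial-coeff {v} G r = coeffFromTop-fromTop (chromCoeff (adjacencyMatrix G)) v r
  (chromCoeff-beyond (adjacencyMatrix G) r)

-- The field ℤ/qℤ

-- Later modules take such a record as a parameter, so field operations stay opaque instead of
-- unfolding to remainders. Reduction `⟨_⟩` of integers, with its kernel, is the bridge to
-- divisibility.
record PrimeField (q : ℕ) : Set where
  infixl 6 _⊕_
  infixl 7 _⊗_
  infix  8 ⊖_
  field
    _⊕_ _⊗_ : Fin q → Fin q → Fin q
    ⊖_      : Fin q → Fin q
    ⟨_⟩     : ℤ → Fin q
    isCommutativeRing : IsCommutativeRing _≡_ _⊕_ _⊗_ ⊖_ ⟨ 0ℤ ⟩ ⟨ 1ℤ ⟩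
    ⟨⟩-+ : ∀ a b → ⟨ a + b ⟩ ≡ ⟨ a ⟩ ⊕ ⟨ b ⟩
    ⟨⟩-* : ∀ a b → ⟨ a * b ⟩ ≡ ⟨ a ⟩ ⊗ ⟨ b ⟩
    ⟨⟩-neg : ∀ a → ⟨ - a ⟩ ≡ ⊖ ⟨ a ⟩
    ⟨⟩-toℕ : ∀ x → ⟨ + toℕ x ⟩ ≡ x
    kernel : ∀ a → ⟨ a ⟩ ≡ ⟨ 0ℤ ⟩ → + q ∣ a
    kernel⁻¹ : ∀ a → + q ∣ a → ⟨ a ⟩ ≡ ⟨ 0ℤ ⟩
    inverse : ∀ x → x ≢ ⟨ 0ℤ ⟩ → ∃[ y ] x ⊗ y ≡ ⟨ 1ℤ ⟩

module Residues (q : ℕ) .{{_ : ℕ.NonZero q}} where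

  res : ℤ → Fin q
  res x = fromℕ< (n%ℕd<d x q)

  val : Fin q → ℤ
  val i = + toℕ i

  val-res : ∀ x → x ≡ val (res x) + (x /ℕ q) * + q
  val-res x = trans (a≡a%ℕn+[a/ℕn]*n x q)
    (cong (λ r → + r + (x /ℕ q) * + q) (sym (Fin.toℕ-fromℕ< (n%ℕd<d x q))))

  remainder-unique : ∀ r s t → r ℕ.< q → s ℕ.< q → + r ≡ + s + t * + q → r ≡ s
  remainder-unique r s t r<q s<q eq = ℤ.+-injective
    (trans eq (trans (cong (λ u → + s + u * + q) (ℤ.∣i∣≡0⇒i≡0 {t} ∣t∣≡0)) (ℤ.+-identityʳ (+ s))))
    where
    l : ∀ s u → s + u - s ≡ u
    l = solve-∀
    ∣tq∣<q : ℤ.∣ t * + q ∣ ℕ.< q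
    ∣tq∣<q = subst (λ u → ℤ.∣ u ∣ ℕ.< q)
      (trans (sym (ℤ.[+m]-[+n]≡m⊖n r s)) (trans (cong (λ u → u - + s) eq) (l (+ s) (t * + q))))
      (ℕ.≤-<-trans (ℤ.∣m⊝n∣≤m⊔n r s) (ℕ.⊔-lub r<q s<q))
    ∣t∣≡0 : ℤ.∣ t ∣ ≡ 0
    ∣t∣≡0 = ℕ.n<1⇒n≡0 (ℕ.*-cancelʳ-< q ℤ.∣ t ∣ 1
      (subst₂ ℕ._<_ (ℤ.abs-* t (+ q)) (sym (ℕ.*-identityˡ q)) ∣tq∣<q))

  res-cong : ∀ x y t → x ≡ y + t * + q → res x ≡ res y
  res-cong x y t eq = Fin.toℕ-injective (remainder-unique (toℕ (res x)) (toℕ (res y)) ((y /ℕ q) + t - (x /ℕ q))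
    (Fin.toℕ<n (res x)) (Fin.toℕ<n (res y))
    (l (val (res x)) (val (res y)) (x /ℕ q) (y /ℕ q) t (+ q) (trans (sym (val-res x)) (trans eq (cong (λ u → u + t * + q) (val-res y))))))
    where
    e₁ : ∀ a x q → a ≡ a + x * q - x * q
    e₁ = solve-∀
    e₂ : ∀ b x y t q → b + y * q + t * q - x * q ≡ b + (y + t - x) * q
    e₂ = solve-∀
    l : ∀ a b x y t q → a + x * q ≡ b + y * q + t * q → a ≡ b + (y + t - x) * q
    l a b x y t q h = trans (e₁ a x q) (trans (cong (λ u → u - x * q) h) (e₂ b x y t q))

  res-val : ∀ i → res (val i) ≡ i
  res-val i = Fin.toℕ-injective (remainder-unique (toℕ (res (val i))) (toℕ i) (- (val i /ℕ q))
    (Fin.toℕ<n (res (val i))) (Fin.toℕ<n i)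
    (l (val (res (val i))) (val i) (val i /ℕ q) (+ q) (val-res (val i))))
    where
    e : ∀ a x q → a ≡ a + x * q + - x * q
    e = solve-∀
    l : ∀ a b x q → b ≡ a + x * q → a ≡ b + - x * q
    l a b x q h = trans (e a x q) (cong (λ u → u + - x * q) (sym h))

  _⊕_ _⊗_ : Fin q → Fin q → Fin q
  x ⊕ y = res (val x + val y)
  x ⊗ y = res (val x * val y)

  ⊖_ : Fin q → Fin q
  ⊖ x = res (- val x)

  res-+ : ∀ a b → res (a + b) ≡ res a ⊕ res b
  res-+ a b = res-cong (a + b) (val (res a) + val (res b)) (a /ℕ q + b /ℕ q)
    (trans (cong₂ _+_ (val-res a) (val-res b)) (l (val (res a)) (val (res b)) (a /ℕ q) (b /ℕ q) (+ q)))
    where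
    l : ∀ a b x y q → (a + x * q) + (b + y * q) ≡ (a + b) + (x + y) * q
    l = solve-∀

  res-* : ∀ a b → res (a * b) ≡ res a ⊗ res b
  res-* a b = res-cong (a * b) (val (res a) * val (res b))
    (val (res a) * (b /ℕ q) + (a /ℕ q) * val (res b) + (a /ℕ q) * (b /ℕ q) * + q)
    (trans (cong₂ _*_ (val-res a) (val-res b)) (l (val (res a)) (val (res b)) (a /ℕ q) (b /ℕ q) (+ q)))
    where
    l : ∀ a b x y q → (a + x * q) * (b + y * q) ≡ a * b + (a * y + x * b + x * y * q) * q
    l = solve-∀

  res-neg : ∀ a → res (- a) ≡ ⊖ res a
  res-neg a = res-cong (- a) (- val (res a)) (- (a /ℕ q))
    (trans (cong -_ (val-res a)) (l (val (res a)) (a /ℕ q) (+ q)))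
    where
    l : ∀ a x q → - (a + x * q) ≡ - a + - x * q
    l = solve-∀

  -- Every residue is the reduction of its representative, so ring laws have to be checked only on
  -- reductions, where they come from ℤ.
  lift₁ : ∀ {P : Fin q → Set} → (∀ a → P (res a)) → ∀ x → P x
  lift₁ {P} h x = subst P (res-val x) (h (val x))

  private
    assoc : ∀ (_∙_ : ℤ → ℤ → ℤ) (_∘′_ : Fin q → Fin q → Fin q) → (∀ a b → res (a ∙ b) ≡ res a ∘′ res b) →
            (∀ a b c → (a ∙ b) ∙ c ≡ a ∙ (b ∙ c)) → ∀ x y z → (x ∘′ y) ∘′ z ≡ x ∘′ (y ∘′ z)
    assoc _∙_ _∘′_ homo h = lift₁ λ a → lift₁ λ b → lift₁ λ c →
      trans (cong (_∘′ res c) (sym (homo a b))) (trans (sym (homo (a ∙ b) c))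
        (trans (cong res (h a b c)) (trans (homo a (b ∙ c)) (cong (res a ∘′_) (homo b c)))))

    comm : ∀ (_∙_ : ℤ → ℤ → ℤ) (_∘′_ : Fin q → Fin q → Fin q) → (∀ a b → res (a ∙ b) ≡ res a ∘′ res b) →
           (∀ a b → a ∙ b ≡ b ∙ a) → ∀ x y → x ∘′ y ≡ y ∘′ x
    comm _∙_ _∘′_ homo h = lift₁ λ a → lift₁ λ b →
      trans (sym (homo a b)) (trans (cong res (h a b)) (homo b a))

    idˡ : ∀ (_∙_ : ℤ → ℤ → ℤ) (_∘′_ : Fin q → Fin q → Fin q) e → (∀ a b → res (a ∙ b) ≡ res a ∘′ res b) →
          (∀ a → e ∙ a ≡ a) → ∀ x → res e ∘′ x ≡ x
    idˡ _∙_ _∘′_ e homo h = lift₁ λ a → trans (sym (homo e a)) (cong res (h a))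

    distribˡ : ∀ x y z → x ⊗ (y ⊕ z) ≡ (x ⊗ y) ⊕ (x ⊗ z)
    distribˡ = lift₁ λ a → lift₁ λ b → lift₁ λ c →
      trans (cong (res a ⊗_) (sym (res-+ b c))) (trans (sym (res-* a (b + c)))
        (trans (cong res (ℤ.*-distribˡ-+ a b c)) (trans (res-+ (a * b) (a * c)) (cong₂ _⊕_ (res-* a b) (res-* a c)))))

    invˡ : ∀ x → (⊖ x) ⊕ x ≡ res 0ℤ
    invˡ = lift₁ λ a → trans (cong (_⊕ res a) (sym (res-neg a))) (trans (sym (res-+ (- a) a)) (cong res (ℤ.+-inverseˡ a)))

  ⊕-comm = comm _+_ _⊕_ res-+ ℤ.+-comm
  ⊗-comm = comm _*_ _⊗_ res-* ℤ.*-comm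

  isCommutativeRing : IsCommutativeRing _≡_ _⊕_ _⊗_ ⊖_ (res 0ℤ) (res 1ℤ)
  isCommutativeRing = record
    { isRing = record
      { +-isAbelianGroup = record
        { isGroup = record
          { isMonoid = record
            { isSemigroup = record
              { isMagma = record { isEquivalence = isEquivalence ; ∙-cong = cong₂ _⊕_ }
              ; assoc = assoc _+_ _⊕_ res-+ ℤ.+-assoc }
            ; identity = idˡ _+_ _⊕_ 0ℤ res-+ ℤ.+-identityˡ ,
                         λ x → trans (⊕-comm x (res 0ℤ)) (idˡ _+_ _⊕_ 0ℤ res-+ ℤ.+-identityˡ x) }
          ; inverse = invˡ , λ x → trans (⊕-comm x (⊖ x)) (invˡ x)
          ; ⁻¹-cong = cong ⊖_ }
        ; comm = ⊕-comm }
      ; *-cong = cong₂ _⊗_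
      ; *-assoc = assoc _*_ _⊗_ res-* ℤ.*-assoc
      ; *-identity = idˡ _*_ _⊗_ 1ℤ res-* ℤ.*-identityˡ ,
                     λ x → trans (⊗-comm x (res 1ℤ)) (idˡ _*_ _⊗_ 1ℤ res-* ℤ.*-identityˡ x)
      ; distrib = distribˡ , λ x y z → trans (⊗-comm (y ⊕ z) x) (trans (distribˡ x y z) (cong₂ _⊕_ (⊗-comm x y) (⊗-comm x z))) }
    ; *-comm = ⊗-comm }

  kernel : ∀ a → res a ≡ res 0ℤ → + q ∣ a
  kernel a eq = divides (a /ℕ q - 0ℤ /ℕ q)
    (trans (val-res a) (trans (cong (λ u → val u + (a /ℕ q) * + q) eq)
      (trans (l (val (res 0ℤ)) (a /ℕ q) (0ℤ /ℕ q) (+ q)) (trans (cong (λ u → u + (a /ℕ q - 0ℤ /ℕ q) * + q) (sym (val-res 0ℤ)))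
        (ℤ.+-identityˡ ((a /ℕ q - 0ℤ /ℕ q) * + q))))))
    where
    l : ∀ r x y q → r + x * q ≡ (r + y * q) + (x - y) * q
    l = solve-∀

  kernel⁻¹ : ∀ a → + q ∣ a → res a ≡ res 0ℤ
  kernel⁻¹ a (divides t eq) = res-cong a 0ℤ t (trans eq (sym (ℤ.+-identityˡ (t * + q))))

  res-inverse : Prime q → ∀ x → x ≢ res 0ℤ → ∃[ y ] x ⊗ y ≡ res 1ℤ
  res-inverse q-prime x x≢0 with Coprime.coprime-Bézout (Coprime.sym
      (Coprime.prime⇒coprime q-prime {{ℕ.≢-nonZero (λ eq → x≢0 (trans (sym (res-val x)) (cong (res ∘ +_) eq)))}} (Fin.toℕ<n x)))
  ... | Bézout.+- a b eq = res (+ a) , trans (cong (_⊗ res (+ a)) (sym (res-val x)))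
          (trans (sym (res-* (val x) (+ a))) (res-cong (val x * + a) 1ℤ (+ b)
            (trans (ℤ.*-comm (val x) (+ a)) (trans (sym (ℤ.pos-* a (toℕ x))) (trans (cong +_ (sym eq))
              (trans (ℤ.pos-+ 1 (b ℕ.* q)) (cong (λ u → 1ℤ + u) (ℤ.pos-* b q))))))))
  ... | Bézout.-+ a b eq = res (- + a) , trans (cong (_⊗ res (- + a)) (sym (res-val x)))
          (trans (sym (res-* (val x) (- + a))) (res-cong (val x * - + a) 1ℤ (- + b)
            (l (val x) (+ a) (+ b) (+ q) (trans (cong (λ u → 1ℤ + u) (sym (ℤ.pos-* a (toℕ x))))
              (trans (sym (ℤ.pos-+ 1 (a ℕ.* toℕ x))) (trans (cong +_ eq) (ℤ.pos-* b q)))))))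
    where
    l₁ : ∀ x a → x * - a ≡ 1ℤ - (1ℤ + a * x)
    l₁ = solve-∀
    l₂ : ∀ b q → 1ℤ - b * q ≡ 1ℤ + - b * q
    l₂ = solve-∀
    l : ∀ x a b q → 1ℤ + a * x ≡ b * q → x * - a ≡ 1ℤ + - b * q
    l x a b q h = trans (l₁ x a) (trans (cong (λ u → 1ℤ - u) h) (l₂ b q))

residueField : ∀ {q} → Prime q → PrimeField q
residueField {q} q-prime = record
  { _⊕_ = _⊕_ ; _⊗_ = _⊗_ ; ⊖_ = ⊖_ ; ⟨_⟩ = res
  ; isCommutativeRing = isCommutativeRing
  ; ⟨⟩-+ = res-+ ; ⟨⟩-* = res-* ; ⟨⟩-neg = res-neg ; ⟨⟩-toℕ = res-val
  ; kernel = kernel ; kernel⁻¹ = kernel⁻¹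
  ; inverse = res-inverse q-prime }
  where
  instance _ = prime⇒nonZero q-prime
  open Residues q

-- Reindexing sums and arithmetic over a finite prime field

sum-bijection : ∀ {n} (g g⁻¹ : Fin n → Fin n) → (∀ x → g (g⁻¹ x) ≡ x) → (∀ x → g⁻¹ (g x) ≡ x) →
                ∀ f → sum (λ x → f (g x)) ≡ sum f
sum-bijection g g⁻¹ gg⁻¹ g⁻¹g f = sym (sum-permute f (Perm.permutation g g⁻¹ gg⁻¹ g⁻¹g))

sum-fibre : ∀ {m n} (g : Fin m → Fin n) f → sum (λ x → f (g x)) ≡ sum λ w → sum (λ x → δ (g x) w) * f w
sum-fibre g f = begin
  sum (λ x → f (g x))                         ≡⟨ sum-cong (λ x → sym (sum-δ f (g x))) ⟩
  sum (λ x → sum λ w → δ (g x) w * f w)       ≡⟨ ∑-comm (λ x w → δ (g x) w * f w) ⟩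
  sum (λ w → sum λ x → δ (g x) w * f w)       ≡⟨ sum-cong (λ w → sum-scaleʳ (f w) (λ x → δ (g x) w)) ⟩
  sum (λ w → sum (λ x → δ (g x) w) * f w) ∎

δ-⇔ : ∀ {m n} {a b : Fin m} {c d : Fin n} → (a ≡ b → c ≡ d) → (c ≡ d → a ≡ b) → δ a b ≡ δ c d
δ-⇔ {a = a} {b} {c} {d} f g with a Fin.≟ b
... | yes refl = trans (δ-refl a) (sym (trans (cong (δ c) (sym (f refl))) (δ-refl c)))
... | no a≢b   = trans (δ-≢ a≢b) (sym (δ-≢ (a≢b ∘ g)))

sum-nonneg-zero : ∀ {n} (f : Fin n → ℤ) → (∀ i → 0ℤ ℤ.≤ f i) → sum f ≡ 0ℤ → ∀ i → f i ≡ 0ℤ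
sum-nonneg-zero {suc n} f f≥0 Σ≡0 = λ { zero → f₀ ; (suc i) → sum-nonneg-zero (f ∘ suc) (f≥0 ∘ suc) rest≡0 i }
  where
  sum≥0 : ∀ {n} (f : Fin n → ℤ) → (∀ i → 0ℤ ℤ.≤ f i) → 0ℤ ℤ.≤ sum f
  sum≥0 {zero}  f _   = ℤ.≤-refl
  sum≥0 {suc n} f f≥0 = ℤ.+-mono-≤ (f≥0 zero) (sum≥0 (f ∘ suc) (f≥0 ∘ suc))
  f₀ : f zero ≡ 0ℤ
  f₀ = ℤ.≤-antisym (subst (f zero ℤ.≤_) Σ≡0 (subst (ℤ._≤ sum f) (ℤ.+-identityʳ (f zero))
         (ℤ.+-monoʳ-≤ (f zero) (sum≥0 (f ∘ suc) (f≥0 ∘ suc))))) (f≥0 zero)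
  rest≡0 : sum (f ∘ suc) ≡ 0ℤ
  rest≡0 = trans (sym (ℤ.+-identityˡ (sum (f ∘ suc)))) (trans (cong (λ u → u + sum (f ∘ suc)) (sym f₀)) Σ≡0)

module FieldArith {q : ℕ} (F : PrimeField q) where
  open PrimeField F public

  commutativeRing : CommutativeRing _ _
  commutativeRing = record { isCommutativeRing = isCommutativeRing }

  open CommutativeRing commutativeRing public
    using ()
    renaming (*-comm to ⊗-comm; *-assoc to ⊗-assoc; *-identityˡ to ⊗-identityˡ;
              *-identityʳ to ⊗-identityʳ; +-identityˡ to ⊕-identityˡ; zeroˡ to ⊗-zeroˡ; zeroʳ to ⊗-zeroʳ)

  private
    almost = ACR.fromCommutativeRing commutativeRing

    -- Coefficients are taken in ℤ, so that the solver computes with numerals before they are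
    -- reduced modulo q.
    morphism : CommutativeRing.rawRing ℤ.+-*-commutativeRing ACR.-Raw-AlmostCommutative⟶ almost
    morphism = record
      { ⟦_⟧ = ⟨_⟩ ; +-homo = ⟨⟩-+ ; *-homo = ⟨⟩-* ; -‿homo = ⟨⟩-neg ; 0-homo = refl ; 1-homo = refl }

    coeff≟ : ∀ a b → Maybe (⟨ a ⟩ ≡ ⟨ b ⟩)
    coeff≟ a b with a ℤ.≟ b
    ... | yes refl = just refl
    ... | no _     = nothing

  module 𝔽 = RingSolver (CommutativeRing.rawRing ℤ.+-*-commutativeRing) almost morphism coeff≟

  infixl 6 _⊝_
  _⊝_ : Fin q → Fin q → Fin q
  x ⊝ y = x ⊕ ⊖ y

  𝟎 𝟏 : Fin q
  𝟎 = ⟨ 0ℤ ⟩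
  𝟏 = ⟨ 1ℤ ⟩

  open 𝔽 using (solve; _:=_; _:+_; _:*_; _:-_; :-_; con)

  ⊝-≡0 : ∀ {x y} → x ⊝ y ≡ 𝟎 → x ≡ y
  ⊝-≡0 {x} {y} h = trans (solve 2 (λ x y → x := (x :- y) :+ y) refl x y) (trans (cong (_⊕ y) h) (⊕-identityˡ y))

  ⊝-self : ∀ x → x ⊝ x ≡ 𝟎
  ⊝-self x = solve 1 (λ x → x :- x := con 0ℤ) refl x

  ⊗-cancelˡ : ∀ {c x y} → c ≢ 𝟎 → c ⊗ x ≡ c ⊗ y → x ≡ y
  ⊗-cancelˡ {c} {x} {y} c≢0 h with inverse c c≢0
  ... | d , cd = trans (e x) (trans (cong (d ⊗_) h) (sym (e y)))
    where
    e : ∀ x → x ≡ d ⊗ (c ⊗ x)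
    e x = trans (sym (⊗-identityˡ x)) (trans (cong (_⊗ x) (sym cd)) (solve 3 (λ c d x → c :* d :* x := d :* (c :* x)) refl c d x))

  integral : ∀ {x y} → x ≢ 𝟎 → x ⊗ y ≡ 𝟎 → y ≡ 𝟎
  integral {x} {y} x≢0 h = ⊗-cancelˡ x≢0 (trans h (sym (⊗-zeroʳ x)))

  ⊗-≢0 : ∀ {x y} → x ≢ 𝟎 → y ≢ 𝟎 → x ⊗ y ≢ 𝟎
  ⊗-≢0 x≢0 y≢0 h = y≢0 (integral x≢0 h)

  -- The value `𝟎` at `𝟎` makes this an involution of the whole field, so sums can be reindexed by
  -- it without removing a point.
  inv : Fin q → Fin q
  inv x with x Fin.≟ 𝟎
  ... | yes _  = 𝟎
  ... | no x≢0 = proj₁ (inverse x x≢0)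

  inv-0 : inv 𝟎 ≡ 𝟎
  inv-0 with 𝟎 Fin.≟ 𝟎
  ... | yes _ = refl
  ... | no ≢  = contradiction refl ≢

  ⊗-inv : ∀ {x} → x ≢ 𝟎 → x ⊗ inv x ≡ 𝟏
  ⊗-inv {x} x≢0 with x Fin.≟ 𝟎
  ... | yes x≡0 = contradiction x≡0 x≢0
  ... | no x≢0  = proj₂ (inverse x x≢0)

  sum-shift : ∀ c f → sum (λ x → f (x ⊕ c)) ≡ sum f
  sum-shift c f = sum-bijection (_⊕ c) (_⊝ c)
    (λ x → solve 2 (λ x c → (x :- c) :+ c := x) refl x c)
    (λ x → solve 2 (λ x c → (x :+ c) :- c := x) refl x c) f

  sum-mul : ∀ {c} → c ≢ 𝟎 → ∀ f → sum (λ x → f (c ⊗ x)) ≡ sum f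
  sum-mul {c} c≢0 f = sum-bijection (c ⊗_) (inv c ⊗_)
    (λ x → trans (sym (⊗-assoc c (inv c) x)) (trans (cong (_⊗ x) (⊗-inv c≢0)) (⊗-identityˡ x)))
    (λ x → trans (solve 3 (λ c d x → d :* (c :* x) := c :* d :* x) refl c (inv c) x)
             (trans (cong (_⊗ x) (⊗-inv c≢0)) (⊗-identityˡ x))) f

  sum-reflect : ∀ c f → sum (λ x → f (c ⊝ x)) ≡ sum f
  sum-reflect c f = sum-bijection (c ⊝_) (c ⊝_)
    (λ x → solve 2 (λ x c → c :- (c :- x) := x) refl x c)
    (λ x → solve 2 (λ x c → c :- (c :- x) := x) refl x c) f

4m+1≥5 : ∀ {q} m → q ≡ 1 ℕ.+ 4 ℕ.* m → q ≢ 1 → 5 ℕ.≤ q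
4m+1≥5 zero    refl q≢1 = contradiction refl q≢1
4m+1≥5 (suc k) refl q≢1 = ℕ.s≤s (ℕ.*-monoʳ-≤ 4 {1} {suc k} (ℕ.s≤s ℕ.z≤n))

sum-fibre-weighted : ∀ {m n} (c : Fin m → ℤ) (g : Fin m → Fin n) f →
                     sum (λ x → c x * f (g x)) ≡ sum λ w → sum (λ x → c x * δ (g x) w) * f w
sum-fibre-weighted c g f = begin
  sum (λ x → c x * f (g x))
    ≡⟨ sum-cong (λ x → trans (cong (c x *_) (sym (sum-δ f (g x))))
         (trans (sym (sum-scale (c x) (λ w → δ (g x) w * f w))) (sum-cong λ w → sym (ℤ.*-assoc (c x) (δ (g x) w) (f w))))) ⟩
  sum (λ x → sum λ w → c x * δ (g x) w * f w)
    ≡⟨ ∑-comm (λ x w → c x * δ (g x) w * f w) ⟩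
  sum (λ w → sum λ x → c x * δ (g x) w * f w)
    ≡⟨ sum-cong (λ w → sum-scaleʳ (f w) (λ x → c x * δ (g x) w)) ⟩
  sum (λ w → sum (λ x → c x * δ (g x) w) * f w) ∎

quad₂ : ∀ {v} → Weights v → Weights v → Weights v → Fin v → Fin v → Fin v → Fin v → ℤ
quad₂ A B B′ x y z w = A x y * A y z * A z w * A w x * (B x z * B′ y w)

sum₄-rotate : ∀ {n} (f : Fin n → Fin n → Fin n → Fin n → ℤ) → sum₄ (λ x y z w → f y z w x) ≡ sum₄ f
sum₄-rotate f = trans (∑-comm λ x y → sum₂ λ z w → f y z w x)
  (sum-cong λ y → sum₃-rotate (λ z w x → f y z w x))

sum₄-swap : ∀ {n} (f : Fin n → Fin n → Fin n → Fin n → ℤ) → sum₄ (λ x z y w → f x y z w) ≡ sum₄ f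
sum₄-swap f = sum-cong λ x → ∑-comm λ z y → sum λ w → f x y z w

module Paley {q : ℕ} (F : PrimeField q) (m : ℕ) (q≡4m+1 : q ≡ 1 ℕ.+ 4 ℕ.* m) (q≢1 : q ≢ 1) where
  open FieldArith F public
  open 𝔽 using (solve; _:=_; _:+_; _:*_; _:-_; :-_; con)

  q≡ : + q ≡ 1ℤ + + 4 * + m
  q≡ = trans (cong +_ q≡4m+1) (cong (λ u → 1ℤ + u) (ℤ.pos-* 4 m))

  5≤q : 5 ℕ.≤ q
  5≤q = 4m+1≥5 m q≡4m+1 q≢1

  ⟨⟩-≢0 : ∀ n .{{_ : ℕ.NonZero n}} → n ℕ.< 5 → ⟨ + n ⟩ ≢ 𝟎
  ⟨⟩-≢0 n n<5 h = ℕ.<⇒≱ n<5 (ℕ.≤-trans 5≤q (ℕ.∣⇒≤ (∣⇒∣ᵤ (kernel (+ n) h))))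

  1≢0 : 𝟏 ≢ 𝟎
  1≢0 = ⟨⟩-≢0 1 (ℕ.s≤s (ℕ.s≤s ℕ.z≤n))

  2≢0 : ⟨ + 2 ⟩ ≢ 𝟎
  2≢0 = ⟨⟩-≢0 2 (ℕ.s≤s (ℕ.s≤s (ℕ.s≤s ℕ.z≤n)))

  4≢0 : ⟨ + 4 ⟩ ≢ 𝟎
  4≢0 = ⟨⟩-≢0 4 ℕ.≤-refl

  inv-inv : ∀ x → inv (inv x) ≡ x
  inv-inv x with x Fin.≟ 𝟎
  ... | yes x≡0 = trans inv-0 (sym x≡0)
  ... | no x≢0  = ⊗-cancelˡ {inverse x x≢0 .proj₁} y≢0
                    (trans (⊗-inv y≢0) (trans (sym (inverse x x≢0 .proj₂)) (⊗-comm x _)))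
    where
    y≢0 : inverse x x≢0 .proj₁ ≢ 𝟎
    y≢0 h = 1≢0 (trans (sym (inverse x x≢0 .proj₂)) (trans (cong (x ⊗_) h) (⊗-zeroʳ x)))

  sum-inv : ∀ f → sum (λ x → f (inv x)) ≡ sum f
  sum-inv f = sum-bijection inv inv inv-inv inv-inv f

  neg-fixed : ∀ {x} → x ≡ ⊖ x → x ≡ 𝟎
  neg-fixed {x} h = integral 2≢0 (trans (solve 1 (λ x → con (+ 2) :* x := x :- :- x) refl x)
                      (trans (cong (_⊝ ⊖ x) h) (⊝-self (⊖ x))))

  -- One element of each pair x, ⊖ x with x ≢ 𝟎.
  half : Fin q → ℤ
  half x = o x (⊖ x)

  half-sum : ∀ x → half x + half (⊖ x) ≡ 1ℤ - δ x 𝟎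
  half-sum x = trans (cong (λ u → o x (⊖ x) + o (⊖ x) u) (solve 1 (λ x → :- (:- x) := x) refl x))
    (trans (o-total x (⊖ x)) (cong (λ u → 1ℤ - u) (δ-⇔ {a = x} {⊖ x} {x} {𝟎} neg-fixed λ { refl → solve 0 (con 0ℤ := :- con 0ℤ) refl })))

  sum-even : ∀ f → (∀ x → f (⊖ x) ≡ f x) → sum f ≡ f 𝟎 + + 2 * sum (λ x → half x * f x)
  sum-even f even = begin
    sum f
      ≡⟨ sum-cong (λ x → trans (l₁ (δ x 𝟎) (f x)) (trans (cong (λ u → δ x 𝟎 * f x + u * f x) (sym (half-sum x)))
           (trans (l₂ (δ x 𝟎 * f x) (half x) (half (⊖ x)) (f x)) (cong (λ u → δ x 𝟎 * f x + (half x * f x + half (⊖ x) * u)) (sym (even x)))))) ⟩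
    sum (λ x → δ x 𝟎 * f x + (half x * f x + half (⊖ x) * f (⊖ x)))
      ≡⟨ trans (sum-+ (λ x → δ x 𝟎 * f x) (λ x → half x * f x + half (⊖ x) * f (⊖ x)))
           (cong₂ _+_ (sum-δʳ f 𝟎) (trans (sum-+ (λ x → half x * f x) (λ x → half (⊖ x) * f (⊖ x)))
             (cong (λ u → H + u) (sum-bijection ⊖_ ⊖_ neg-neg neg-neg (λ x → half x * f x))))) ⟩
    f 𝟎 + (H + H)
      ≡⟨ l₃ (f 𝟎) H ⟩
    f 𝟎 + + 2 * H ∎
    where
    H = sum λ x → half x * f x
    neg-neg : ∀ x → ⊖ (⊖ x) ≡ x
    neg-neg x = solve 1 (λ x → :- (:- x) := x) refl x
    l₁ : ∀ d f → f ≡ d * f + (1ℤ - d) * f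
    l₁ = solve-∀
    l₂ : ∀ d h k f → d + (h + k) * f ≡ d + (h * f + k * f)
    l₂ = solve-∀
    l₃ : ∀ f h → f + (h + h) ≡ f + + 2 * h
    l₃ = solve-∀

  sum-half : sum half ≡ + 2 * + m
  sum-half = ℤ.*-cancelˡ-≡ (+ 2) (sum half) (+ 2 * + m) (l (sum half) (+ m) (begin
    1ℤ + + 4 * + m                         ≡⟨ sym q≡ ⟩
    + q                                    ≡⟨ sym (trans (sum-const q 1ℤ) (ℤ.*-identityʳ (+ q))) ⟩
    sum {q} (λ _ → 1ℤ)                     ≡⟨ sum-even (λ _ → 1ℤ) (λ _ → refl) ⟩
    1ℤ + + 2 * sum (λ x → half x * 1ℤ)     ≡⟨ cong (λ u → 1ℤ + + 2 * u) (sum-cong λ x → ℤ.*-identityʳ (half x)) ⟩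
    1ℤ + + 2 * sum half ∎))
    where
    l₁ : ∀ s → + 2 * s ≡ (1ℤ + + 2 * s) - 1ℤ
    l₁ = solve-∀
    l₂ : ∀ m → (1ℤ + + 4 * m) - 1ℤ ≡ + 2 * (+ 2 * m)
    l₂ = solve-∀
    l : ∀ s m → 1ℤ + + 4 * m ≡ 1ℤ + + 2 * s → + 2 * s ≡ + 2 * (+ 2 * m)
    l s m h = trans (l₁ s) (trans (cong (λ u → u - 1ℤ) (sym h)) (l₂ m))

  -- Quadratic characters and Jacobsthal sums

  #√ : Fin q → ℤ
  #√ a = sum λ y → δ (y ⊗ y) a

  -- The quadratic character.
  s : Fin q → ℤ
  s a = #√ a - 1ℤ

  #√-s : ∀ a → #√ a ≡ 1ℤ + s a
  #√-s a = l (#√ a)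
    where
    l : ∀ n → n ≡ 1ℤ + (n - 1ℤ)
    l = solve-∀

  square-roots : ∀ {y t} → y ⊗ y ≡ t ⊗ t → y ≢ t → y ≡ ⊖ t
  square-roots {y} {t} h y≢t = ⊝-≡0 (integral {y ⊝ t} (λ e → y≢t (⊝-≡0 e))
    (trans (solve 2 (λ y t → (y :- t) :* (y :- :- t) := y :* y :- t :* t) refl y t)
           (trans (cong (_⊝ t ⊗ t) h) (⊝-self (t ⊗ t)))))

  s-0 : s 𝟎 ≡ 0ℤ
  s-0 = cong (λ u → u - 1ℤ) (trans (sum-cong λ y → δ-⇔ {a = y ⊗ y} {𝟎} {y} {𝟎}
      (λ h → case y Fin.≟ 𝟎 of λ { (yes p) → p ; (no y≢0) → integral y≢0 h })
      (λ { refl → ⊗-zeroˡ 𝟎 }))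
    (trans (sum-cong λ y → δ-sym y 𝟎) (sum-δ-1 𝟎)))

  δ-squares : ∀ {t} → t ≢ 𝟎 → ∀ y → δ (y ⊗ y) (t ⊗ t) ≡ δ t y + δ (⊖ t) y
  δ-squares {t} t≢0 y with y Fin.≟ t | y Fin.≟ ⊖ t
  ... | yes refl | _ = trans (δ-refl (y ⊗ y)) (sym (cong₂ _+_ (δ-refl y) (δ-≢ (t≢0 ∘ neg-fixed ∘ sym))))
  ... | no _ | yes refl = trans (cong (λ u → δ u (t ⊗ t)) (solve 1 (λ t → :- t :* :- t := t :* t) refl t))
        (trans (δ-refl (t ⊗ t)) (sym (cong₂ _+_ (δ-≢ (t≢0 ∘ neg-fixed)) (δ-refl (⊖ t)))))
  ... | no y≢t | no y≢-t = trans (δ-≢ λ h → y≢-t (square-roots h y≢t))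
        (sym (cong₂ _+_ (δ-≢ (y≢t ∘ sym)) (δ-≢ (y≢-t ∘ sym))))

  s-square : ∀ {t} → t ≢ 𝟎 → s (t ⊗ t) ≡ 1ℤ
  s-square {t} t≢0 = cong (λ u → u - 1ℤ) (trans (sum-cong (δ-squares t≢0))
    (trans (sum-+ (λ y → δ t y) (λ y → δ (⊖ t) y)) (cong₂ _+_ (sum-δ-1 t) (sum-δ-1 (⊖ t)))))

  s-nonsquare : ∀ {a} → (∀ t → t ⊗ t ≢ a) → s a ≡ - 1ℤ
  s-nonsquare h = cong (λ u → u - 1ℤ) (trans (sum-cong λ y → δ-≢ (h y)) (sum-0 {q}))

  data Class (a : Fin q) : Set where
    is-zero   : a ≡ 𝟎 → Class a
    is-square : ∀ t → t ≢ 𝟎 → t ⊗ t ≡ a → Class a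
    nonsquare : (∀ t → t ⊗ t ≢ a) → Class a

  classify : ∀ a → Class a
  classify a with a Fin.≟ 𝟎 | Fin.any? (λ t → t ⊗ t Fin.≟ a)
  ... | yes a≡0 | _ = is-zero a≡0
  ... | no a≢0  | yes (t , tt) = is-square t (λ { refl → a≢0 (trans (sym tt) (⊗-zeroˡ 𝟎)) }) tt
  ... | no _    | no ¬∃ = nonsquare λ t tt → ¬∃ (t , tt)

  s-squared : ∀ a → s a * s a ≡ 1ℤ - δ a 𝟎
  s-squared a with classify a
  ... | is-zero refl = trans (cong₂ _*_ s-0 s-0) (sym (cong (λ u → 1ℤ - u) (δ-refl 𝟎)))
  ... | is-square t t≢0 refl = trans (cong₂ _*_ (s-square t≢0) (s-square t≢0)) (sym (cong (λ u → 1ℤ - u) (δ-≢ (⊗-≢0 t≢0 t≢0))))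
  ... | nonsquare h = trans (cong₂ _*_ (s-nonsquare h) (s-nonsquare h))
        (sym (cong (λ u → 1ℤ - u) (δ-≢ {i = a} λ { refl → h 𝟎 (⊗-zeroˡ 𝟎) })))

  s-≤1 : ∀ a → s a ℤ.≤ 1ℤ
  s-≤1 a with classify a
  ... | is-zero refl = subst (ℤ._≤ 1ℤ) (sym s-0) (ℤ.+≤+ ℕ.z≤n)
  ... | is-square t t≢0 refl = ℤ.≤-reflexive (s-square t≢0)
  ... | nonsquare h = subst (ℤ._≤ 1ℤ) (sym (s-nonsquare h)) ℤ.-≤+

  sum-s : sum s ≡ 0ℤ
  sum-s = trans (sum-sub #√ (λ _ → 1ℤ)) (trans (cong (λ u → u - sum {q} (λ _ → 1ℤ))
    (trans (∑-comm (λ a y → δ (y ⊗ y) a)) (sum-cong λ y → sum-δ-1 (y ⊗ y)))) (ℤ.+-inverseʳ (sum {q} (λ _ → 1ℤ))))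

  s-square-mul : ∀ {t} → t ≢ 𝟎 → ∀ b → s (t ⊗ t ⊗ b) ≡ s b
  s-square-mul {t} t≢0 b = cong (λ u → u - 1ℤ) (trans (sym (sum-mul t≢0 (λ y → δ (y ⊗ y) (t ⊗ t ⊗ b))))
    (sum-cong λ y → δ-⇔ {a = t ⊗ y ⊗ (t ⊗ y)} {t ⊗ t ⊗ b} {y ⊗ y} {b}
      (λ h → ⊗-cancelˡ (⊗-≢0 t≢0 t≢0) (trans (e t y) h))
      (λ { refl → sym (e t y) })))
    where
    e : ∀ t y → t ⊗ t ⊗ (y ⊗ y) ≡ t ⊗ y ⊗ (t ⊗ y)
    e = solve 2 (λ t y → t :* t :* (y :* y) := t :* y :* (t :* y)) refl

  -- Each value s (n b) + s b is at most 0: it is 0 at zero and at squares, and at nonsquares s b is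
  -- -1 while s (n b) is at most 1. The values sum to 0, so all of them vanish.
  s-nonsquare-mul : ∀ {n} → (∀ t → t ⊗ t ≢ n) → ∀ b → s (n ⊗ b) ≡ - s b
  s-nonsquare-mul {n} n-nonsq b = l (s (n ⊗ b)) (s b)
    (sum-nonneg-zero (λ b → - (s (n ⊗ b) + s b)) nonneg total b)
    where
    n≢0 : n ≢ 𝟎
    n≢0 refl = n-nonsq 𝟎 (⊗-zeroˡ 𝟎)
    l₁ : ∀ x y → x ≡ - (- (x + y)) + - y
    l₁ = solve-∀
    l : ∀ x y → - (x + y) ≡ 0ℤ → x ≡ - y
    l x y h = trans (l₁ x y) (trans (cong (λ u → - u + - y) h) (ℤ.+-identityˡ (- y)))
    total : sum (λ b → - (s (n ⊗ b) + s b)) ≡ 0ℤ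
    total = trans (sum-neg (λ b → s (n ⊗ b) + s b)) (cong -_ (trans (sum-+ (λ b → s (n ⊗ b)) s)
      (cong₂ _+_ (trans (sum-mul n≢0 s) sum-s) sum-s)))
    nonneg : ∀ b → 0ℤ ℤ.≤ - (s (n ⊗ b) + s b)
    nonneg b with classify b
    ... | is-zero refl = subst (λ u → 0ℤ ℤ.≤ - (u + s 𝟎)) (cong s (sym (⊗-zeroʳ n))) (subst (λ u → 0ℤ ℤ.≤ - (u + u)) (sym s-0) ℤ.≤-refl)
    ... | is-square t t≢0 refl = ℤ.≤-reflexive (sym (cong -_ (cong₂ _+_
            (trans (cong s (⊗-comm n (t ⊗ t))) (trans (s-square-mul t≢0 n) (s-nonsquare n-nonsq))) (s-square t≢0))))
    ... | nonsquare h = ℤ.neg-mono-≤ (subst (λ u → s (n ⊗ b) + u ℤ.≤ 0ℤ) (sym (s-nonsquare h))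
            (ℤ.+-monoˡ-≤ (- 1ℤ) (s-≤1 (n ⊗ b))))

  s-mul : ∀ a b → s (a ⊗ b) ≡ s a * s b
  s-mul a b with classify a
  ... | is-zero refl = trans (cong s (⊗-zeroˡ b)) (trans s-0 (sym (trans (cong (_* s b) s-0) (ℤ.*-zeroˡ (s b)))))
  ... | is-square t t≢0 refl = trans (s-square-mul t≢0 b) (sym (trans (cong (_* s b) (s-square t≢0)) (ℤ.*-identityˡ (s b))))
  ... | nonsquare h = trans (s-nonsquare-mul h b) (sym (trans (cong (_* s b) (s-nonsquare h)) (ℤ.-1*i≡-i (s b))))

  s-1 : s 𝟏 ≡ 1ℤ
  s-1 = trans (cong s (sym (⊗-identityˡ 𝟏))) (s-square 1≢0)

  s-4 : s ⟨ + 4 ⟩ ≡ 1ℤ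
  s-4 = trans (cong s (⟨⟩-* (+ 2) (+ 2))) (s-square 2≢0)

  s-unit : ∀ {a} → a ≢ 𝟎 → s a * s a ≡ 1ℤ
  s-unit {a} a≢0 = trans (s-squared a) (cong (λ u → 1ℤ - u) (δ-≢ a≢0))

  s-inv : ∀ a → s (inv a) ≡ s a
  s-inv a = go (a Fin.≟ 𝟎)
    where
    go : Dec (a ≡ 𝟎) → s (inv a) ≡ s a
    go (yes refl) = cong s inv-0
    go (no a≢0)   = begin
      s (inv a)               ≡⟨ ℤ.*-identityˡ (s (inv a)) ⟨
      1ℤ * s (inv a)          ≡⟨ cong (_* s (inv a)) (s-unit a≢0) ⟨
      s a * s a * s (inv a)   ≡⟨ ℤ.*-assoc (s a) (s a) (s (inv a)) ⟩
      s a * (s a * s (inv a)) ≡⟨ cong (s a *_) (trans (sym (s-mul a (inv a))) (trans (cong s (⊗-inv a≢0)) s-1)) ⟩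
      s a * 1ℤ                ≡⟨ ℤ.*-identityʳ (s a) ⟩
      s a ∎

  sum-s-shift : ∀ c → sum (λ x → s (x ⊕ c)) ≡ 0ℤ
  sum-s-shift c = trans (sum-shift c s) sum-s

  -- For x ≠ 0 the square x² may be divided out, which leaves s (1 - c / x). At x = 0 this
  -- expression is s 1 = 1 because `inv 𝟎` is `𝟎`, while the product is 0; the term `δ x 𝟎` corrects
  -- this.
  jacobsthal-0 : ∀ c → sum (λ x → s x * s (x ⊝ c)) ≡ + q * δ c 𝟎 - 1ℤ
  jacobsthal-0 c = begin
    sum (λ x → s x * s (x ⊝ c))
      ≡⟨ sum-cong pointwise ⟩
    sum (λ x → s (𝟏 ⊝ c ⊗ inv x) - δ x 𝟎)
      ≡⟨ trans (sum-sub (λ x → s (𝟏 ⊝ c ⊗ inv x)) (λ x → δ x 𝟎))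
           (cong₂ _-_ (sum-inv (λ u → s (𝟏 ⊝ c ⊗ u))) (trans (sum-cong λ x → δ-sym x 𝟎) (sum-δ-1 𝟎))) ⟩
    sum (λ u → s (𝟏 ⊝ c ⊗ u)) - 1ℤ
      ≡⟨ cong (λ u → u - 1ℤ) total ⟩
    + q * δ c 𝟎 - 1ℤ ∎
    where
    pointwise : ∀ x → s x * s (x ⊝ c) ≡ s (𝟏 ⊝ c ⊗ inv x) - δ x 𝟎
    pointwise x = go (x Fin.≟ 𝟎)
     where
     go : Dec (x ≡ 𝟎) → s x * s (x ⊝ c) ≡ s (𝟏 ⊝ c ⊗ inv x) - δ x 𝟎
     go (yes refl) = trans (cong (_* s (𝟎 ⊝ c)) s-0) (trans (ℤ.*-zeroˡ (s (𝟎 ⊝ c)))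
          (sym (cong₂ _-_ (trans (cong (λ u → s (𝟏 ⊝ c ⊗ u)) inv-0)
            (trans (cong s (solve 1 (λ c → con 1ℤ :- c :* con 0ℤ := con 1ℤ) refl c)) s-1)) (δ-refl 𝟎))))
     go (no x≢0) = begin
      s x * s (x ⊝ c)
        ≡⟨ cong (λ u → s x * s u) (sym (trans
             (solve 3 (λ x c i → x :* (con 1ℤ :- c :* i) := x :- c :* (x :* i)) refl x c (inv x))
             (trans (cong (λ u → x ⊝ c ⊗ u) (⊗-inv x≢0)) (cong (x ⊝_) (⊗-identityʳ c))))) ⟩
      s x * s (x ⊗ (𝟏 ⊝ c ⊗ inv x))
        ≡⟨ cong (s x *_) (s-mul x (𝟏 ⊝ c ⊗ inv x)) ⟩
      s x * (s x * s (𝟏 ⊝ c ⊗ inv x))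
        ≡⟨ sym (ℤ.*-assoc (s x) (s x) (s (𝟏 ⊝ c ⊗ inv x))) ⟩
      s x * s x * s (𝟏 ⊝ c ⊗ inv x)
        ≡⟨ trans (cong (_* s (𝟏 ⊝ c ⊗ inv x)) (s-unit x≢0)) (ℤ.*-identityˡ (s (𝟏 ⊝ c ⊗ inv x))) ⟩
      s (𝟏 ⊝ c ⊗ inv x)
        ≡⟨ sym (trans (cong (λ u → s (𝟏 ⊝ c ⊗ inv x) - u) (δ-≢ x≢0)) (ℤ.+-identityʳ (s (𝟏 ⊝ c ⊗ inv x)))) ⟩
      s (𝟏 ⊝ c ⊗ inv x) - δ x 𝟎 ∎
    total : sum (λ u → s (𝟏 ⊝ c ⊗ u)) ≡ + q * δ c 𝟎
    total with c Fin.≟ 𝟎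
    ... | yes refl = trans (sum-cong λ u → trans (cong s (solve 1 (λ u → con 1ℤ :- con 0ℤ :* u := con 1ℤ) refl u)) s-1)
          (trans (sum-const q 1ℤ) (cong (+ q *_) (sym (δ-refl 𝟎))))
    ... | no c≢0 = trans (sum-mul c≢0 (λ u → s (𝟏 ⊝ u))) (trans (sum-reflect 𝟏 s)
          (trans sum-s (sym (trans (cong (+ q *_) (δ-≢ c≢0)) (ℤ.*-zeroʳ (+ q))))))

  jacobsthal : ∀ a b → sum (λ x → s (x ⊝ a) * s (x ⊝ b)) ≡ + q * δ a b - 1ℤ
  jacobsthal a b = begin
    sum (λ x → s (x ⊝ a) * s (x ⊝ b))
      ≡⟨ sum-cong (λ x → cong (λ u → s (x ⊝ a) * s u) (solve 3 (λ x a b → x :- b := (x :- a) :- (b :- a)) refl x a b)) ⟩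
    sum (λ x → s (x ⊝ a) * s (x ⊝ a ⊝ (b ⊝ a)))
      ≡⟨ sum-shift (⊖ a) (λ x → s x * s (x ⊝ (b ⊝ a))) ⟩
    sum (λ x → s x * s (x ⊝ (b ⊝ a)))
      ≡⟨ jacobsthal-0 (b ⊝ a) ⟩
    + q * δ (b ⊝ a) 𝟎 - 1ℤ
      ≡⟨ cong (λ u → + q * u - 1ℤ) (δ-⇔ {a = b ⊝ a} {𝟎} {a} {b} (λ h → sym (⊝-≡0 h)) λ { refl → ⊝-self a }) ⟩
    + q * δ a b - 1ℤ ∎

  sum-squares : ∀ f → sum (λ x → f (x ⊗ x)) ≡ sum (λ w → (1ℤ + s w) * f w)
  sum-squares f = trans (sum-fibre (λ x → x ⊗ x) f) (sum-cong λ w → cong (_* f w) (#√-s w))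

  s-half : ∀ {a} → a ≢ 𝟎 → Σ[ g ∈ ℤ ] s a ≡ 1ℤ - + 2 * g
  s-half {a} a≢0 with classify a
  ... | is-zero a≡0 = contradiction a≡0 a≢0
  ... | is-square t t≢0 refl = 0ℤ , s-square t≢0
  ... | nonsquare h = 1ℤ , s-nonsquare h

  -- If -1 were not a square, x² + 1 would never vanish. The sum of s (x² + 1) is then -1 by
  -- `jacobsthal-0`; but it is also 1, from x = 0, plus twice a sum of 2 m signs, hence 1 modulo 4.
  s-neg-1 : s (⊖ 𝟏) ≡ 1ℤ
  s-neg-1 with classify (⊖ 𝟏)
  ... | is-zero h = contradiction (trans (solve 1 (λ x → x := :- (:- x)) refl 𝟏) (trans (cong ⊖_ h) (solve 0 (:- con 0ℤ := con 0ℤ) refl))) 1≢0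
  ... | is-square t t≢0 h = trans (cong s (sym h)) (s-square t≢0)
  ... | nonsquare no-root = contradiction (ℕ.∣⇒≤ (∣⇒∣ᵤ {+ 4} {+ 2} (divides (G - + m) (l G (+ m) eq)))) λ { (ℕ.s≤s (ℕ.s≤s ())) }
    where
    f : Fin q → ℤ
    f x = s (x ⊗ x ⊕ 𝟏)
    f≢0 : ∀ x → x ⊗ x ⊕ 𝟏 ≢ 𝟎
    f≢0 x h = no-root x (⊝-≡0 {x ⊗ x} {⊖ 𝟏} (trans (solve 1 (λ x → x :* x :- :- con 1ℤ := x :* x :+ con 1ℤ) refl x) h))
    g : Fin q → ℤ
    g x = s-half (f≢0 x) .proj₁
    G = sum λ x → half x * g x
    total : sum f ≡ - 1ℤ
    total = begin
      sum (λ x → s (x ⊗ x ⊕ 𝟏))                       ≡⟨ sum-squares (λ w → s (w ⊕ 𝟏)) ⟩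
      sum (λ w → (1ℤ + s w) * s (w ⊕ 𝟏))              ≡⟨ sum-cong (λ w → l₁ (s w) (s (w ⊕ 𝟏))) ⟩
      sum (λ w → s (w ⊕ 𝟏) + s w * s (w ⊕ 𝟏))
        ≡⟨ trans (sum-+ (λ w → s (w ⊕ 𝟏)) (λ w → s w * s (w ⊕ 𝟏)))
             (cong₂ _+_ (sum-s-shift 𝟏) (trans
               (sum-cong λ w → cong (λ u → s w * s u) (solve 1 (λ w → w :+ con 1ℤ := w :- :- con 1ℤ) refl w))
               (trans (jacobsthal-0 (⊖ 𝟏)) (cong (λ u → + q * u - 1ℤ) (δ-≢ λ h → no-root 𝟎 (trans (⊗-zeroˡ 𝟎) (sym h))))))) ⟩
      0ℤ + (+ q * 0ℤ - 1ℤ)                            ≡⟨ cong (λ u → 0ℤ + (u - 1ℤ)) (ℤ.*-zeroʳ (+ q)) ⟩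
      - 1ℤ ∎
      where
      l₁ : ∀ a b → (1ℤ + a) * b ≡ b + a * b
      l₁ = solve-∀
    eq : - 1ℤ ≡ 1ℤ + + 2 * (+ 2 * + m - + 2 * G)
    eq = begin
      - 1ℤ                                     ≡⟨ sym total ⟩
      sum f                                    ≡⟨ sum-even f (λ x → cong s (solve 1 (λ x → :- x :* :- x :+ con 1ℤ := x :* x :+ con 1ℤ) refl x)) ⟩
      f 𝟎 + + 2 * sum (λ x → half x * f x)
        ≡⟨ cong₂ (λ u w → u + + 2 * w) (trans (cong s (solve 0 (con 0ℤ :* con 0ℤ :+ con 1ℤ := con 1ℤ) refl)) s-1)
             (trans (sum-cong λ x → trans (cong (half x *_) (s-half (f≢0 x) .proj₂)) (l₁ (half x) (g x)))
               (trans (sum-sub half (λ x → + 2 * (half x * g x))) (cong₂ _-_ sum-half (sum-scale (+ 2) (λ x → half x * g x))))) ⟩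
      1ℤ + + 2 * (+ 2 * + m - + 2 * G) ∎
      where
      l₁ : ∀ h g → h * (1ℤ - + 2 * g) ≡ h - + 2 * (h * g)
      l₁ = solve-∀
    l₂ : ∀ G m → (1ℤ + + 2 * (+ 2 * m - + 2 * G)) + + 4 * (G - m) ≡ 1ℤ
    l₂ = solve-∀
    l : ∀ G m → - 1ℤ ≡ 1ℤ + + 2 * (+ 2 * m - + 2 * G) → + 2 ≡ (G - m) * + 4
    l G m h = sym (trans (e (G - m)) (cong (λ u → 1ℤ + u) (trans (cong (λ u → u + + 4 * (G - m)) h) (l₂ G m))))
      where
      e : ∀ x → x * + 4 ≡ 1ℤ + (- 1ℤ + + 4 * x)
      e = solve-∀

  s-neg : ∀ a → s (⊖ a) ≡ s a
  s-neg a = trans (cong s (solve 1 (λ a → :- a := :- con 1ℤ :* a) refl a))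
    (trans (s-mul (⊖ 𝟏) a) (trans (cong (_* s a) s-neg-1) (ℤ.*-identityˡ (s a))))

  s-⊝-comm : ∀ a b → s (a ⊝ b) ≡ s (b ⊝ a)
  s-⊝-comm a b = trans (sym (s-neg (a ⊝ b))) (cong s (solve 2 (λ a b → :- (a :- b) := b :- a) refl a b))

  -- A Jacobsthal sum: for k ≠ 0 it is, up to sign, the Frobenius trace of y² = x³ - k x, a curve
  -- with complex multiplication by ℤ[i]. This is the source of the decomposition q = a² + b².
  S : Fin q → ℤ
  S k = sum λ x → s x * s (x ⊗ x ⊝ k)

  S-scale : ∀ {t} → t ≢ 𝟎 → ∀ k → S (t ⊗ t ⊗ k) ≡ s t * S k
  S-scale {t} t≢0 k = begin
    S (t ⊗ t ⊗ k)
      ≡⟨ sum-mul t≢0 (λ x → s x * s (x ⊗ x ⊝ t ⊗ t ⊗ k)) ⟨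
    sum (λ x → s (t ⊗ x) * s (t ⊗ x ⊗ (t ⊗ x) ⊝ t ⊗ t ⊗ k))
      ≡⟨ sum-cong (λ x → trans (cong₂ _*_ (s-mul t x) (trans
           (cong s (solve 3 (λ t x k → t :* x :* (t :* x) :- t :* t :* k := t :* t :* (x :* x :- k)) refl t x k))
           (s-square-mul t≢0 (x ⊗ x ⊝ k)))) (ℤ.*-assoc (s t) (s x) (s (x ⊗ x ⊝ k)))) ⟩
    sum (λ x → s t * (s x * s (x ⊗ x ⊝ k)))
      ≡⟨ sum-scale (s t) (λ x → s x * s (x ⊗ x ⊝ k)) ⟩
    s t * S k ∎

  S-0 : S 𝟎 ≡ 0ℤ
  S-0 = trans (sum-cong λ x → trans (cong (λ u → s x * s u) (solve 1 (λ x → x :* x :- con 0ℤ := x :* x) refl x))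
                 (trans (cong (s x *_) (trans (s-mul x x) (s-squared x)))
                 (trans (l (s x) (δ x 𝟎)) (cong (λ u → s x - u) (trans (cong (_* s x) (δ-sym x 𝟎)) (trans (δ-subst s 𝟎 x) (trans (cong (δ 𝟎 x *_) s-0) (ℤ.*-zeroʳ (δ 𝟎 x)))))))))
    (trans (sum-cong λ x → ℤ.+-identityʳ (s x)) sum-s)
    where
    l : ∀ a d → a * (1ℤ - d) ≡ a - d * a
    l = solve-∀

  sum-nonzero : sum (λ x → 1ℤ - δ x 𝟎) ≡ + q - 1ℤ
  sum-nonzero = trans (sum-sub (λ _ → 1ℤ) (λ x → δ x 𝟎))
    (cong₂ _-_ (trans (sum-const q 1ℤ) (ℤ.*-identityʳ (+ q))) (trans (sum-cong λ x → δ-sym x 𝟎) (sum-δ-1 𝟎)))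

  -- Summing over k first, `jacobsthal` leaves the pairs with x² = y², that is y = ± x, together
  -- with a product of full sums of s, which are 0.
  sum-S² : sum (λ k → S k * S k) ≡ + 2 * + q * (+ q - 1ℤ)
  sum-S² = begin
    sum (λ k → S k * S k)
      ≡⟨ sum-cong (λ k → sym (sum₂-product (f k) (f k))) ⟩
    sum (λ k → sum₂ λ x y → f k x * f k y)
      ≡⟨ trans (∑-comm λ k x → sum λ y → f k x * f k y) (sum-cong λ x → ∑-comm λ k y → f k x * f k y) ⟩
    sum₂ (λ x y → sum λ k → f k x * f k y)
      ≡⟨ sum₂-cong (λ x y → trans (sum-cong λ k → trans (l₁ (s x) (s (x ⊗ x ⊝ k)) (s y) (s (y ⊗ y ⊝ k)))
             (cong₂ (λ u w → s x * s y * (u * w)) (s-⊝-comm (x ⊗ x) k) (s-⊝-comm (y ⊗ y) k)))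
           (trans (sum-scale (s x * s y) (λ k → s (k ⊝ x ⊗ x) * s (k ⊝ y ⊗ y)))
             (trans (cong (s x * s y *_) (jacobsthal (x ⊗ x) (y ⊗ y))) (l₂ (s x) (s y) (+ q) (δ (x ⊗ x) (y ⊗ y)))))) ⟩
    sum₂ (λ x y → + q * (s x * (δ (x ⊗ x) (y ⊗ y) * s y)) - s x * s y)
      ≡⟨ trans (sum₂-sub (λ x y → + q * (s x * (δ (x ⊗ x) (y ⊗ y) * s y))) (λ x y → s x * s y))
           (cong₂ _-_ (trans (sum₂-scale (+ q) (λ x y → s x * (δ (x ⊗ x) (y ⊗ y) * s y)))
               (cong (+ q *_) (trans (sum-cong inner) (trans (sum-scale (+ 2) (λ x → 1ℤ - δ x 𝟎)) (cong (+ 2 *_) sum-nonzero)))))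
             (trans (sum₂-product s s) (cong₂ _*_ sum-s sum-s))) ⟩
    + q * (+ 2 * (+ q - 1ℤ)) - 0ℤ * 0ℤ
      ≡⟨ l₃ (+ q) ⟩
    + 2 * + q * (+ q - 1ℤ) ∎
    where
    f : Fin q → Fin q → ℤ
    f k x = s x * s (x ⊗ x ⊝ k)
    l₁ : ∀ a b c d → a * b * (c * d) ≡ a * c * (b * d)
    l₁ = solve-∀
    l₂ : ∀ a b q d → a * b * (q * d - 1ℤ) ≡ q * (a * (d * b)) - a * b
    l₂ = solve-∀
    l₃ : ∀ q → q * (+ 2 * (q - 1ℤ)) - 0ℤ * 0ℤ ≡ + 2 * q * (q - 1ℤ)
    l₃ = solve-∀
    inner : ∀ x → sum (λ y → s x * (δ (x ⊗ x) (y ⊗ y) * s y)) ≡ + 2 * (1ℤ - δ x 𝟎)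
    inner x = trans (sum-scale (s x) (λ y → δ (x ⊗ x) (y ⊗ y) * s y)) (go (x Fin.≟ 𝟎))
      where
      l₄ : ∀ a → a * (a + a) ≡ + 2 * (a * a)
      l₄ = solve-∀
      go : Dec (x ≡ 𝟎) → s x * sum (λ y → δ (x ⊗ x) (y ⊗ y) * s y) ≡ + 2 * (1ℤ - δ x 𝟎)
      go (yes refl) = trans (cong (_* T) s-0) (trans (ℤ.*-zeroˡ T) (sym (cong (λ u → + 2 * (1ℤ - u)) (δ-refl 𝟎))))
        where T = sum (λ y → δ (𝟎 ⊗ 𝟎) (y ⊗ y) * s y)
      go (no x≢0) = begin
        s x * sum (λ y → δ (x ⊗ x) (y ⊗ y) * s y)
          ≡⟨ cong (s x *_) (trans (sum-cong λ y → trans (cong (_* s y) (trans (δ-sym (x ⊗ x) (y ⊗ y)) (δ-squares x≢0 y)))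
               (ℤ.*-distribʳ-+ (s y) (δ x y) (δ (⊖ x) y)))
             (trans (sum-+ (λ y → δ x y * s y) (λ y → δ (⊖ x) y * s y)) (cong₂ _+_ (sum-δ s x) (trans (sum-δ s (⊖ x)) (s-neg x))))) ⟩
        s x * (s x + s x)   ≡⟨ l₄ (s x) ⟩
        + 2 * (s x * s x)   ≡⟨ cong (+ 2 *_) (s-squared x) ⟩
        + 2 * (1ℤ - δ x 𝟎) ∎

  nonsquare-exists : Σ[ n ∈ Fin q ] ∀ t → t ⊗ t ≢ n
  nonsquare-exists with Fin.any? (λ a → s a ℤ.≟ - 1ℤ)
  ... | yes (a , sa) = a , λ t tt → case t Fin.≟ 𝟎 of λ
          { (yes refl) → contradiction (trans (sym sa) (trans (cong s (trans (sym tt) (⊗-zeroˡ 𝟎))) s-0)) λ ()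
          ; (no t≢0)   → contradiction (trans (sym sa) (trans (cong s (sym tt)) (s-square t≢0))) λ () }
  ... | no ¬∃ = contradiction (trans (sym (sum-nonneg-zero s nonneg sum-s 𝟏)) s-1) λ ()
    where
    nonneg : ∀ a → 0ℤ ℤ.≤ s a
    nonneg a with classify a
    ... | is-zero refl = ℤ.≤-reflexive (sym s-0)
    ... | is-square t t≢0 refl = subst (0ℤ ℤ.≤_) (sym (s-square t≢0)) (ℤ.+≤+ ℕ.z≤n)
    ... | nonsquare h = contradiction (a , s-nonsquare h) ¬∃

  f₁ : Fin q → ℤ
  f₁ x = s x * s (x ⊗ x ⊝ 𝟏)

  S-half : ∀ k → S k ≡ + 2 * sum (λ x → half x * (s x * s (x ⊗ x ⊝ k)))
  S-half k = trans (sum-even (λ x → s x * s (x ⊗ x ⊝ k))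
      (λ x → cong₂ _*_ (s-neg x) (cong (λ u → s (u ⊝ k)) (solve 1 (λ x → :- x :* :- x := x :* x) refl x))))
    (trans (cong (λ u → u + H) (trans (cong (_* s (𝟎 ⊗ 𝟎 ⊝ k)) s-0) (ℤ.*-zeroˡ (s (𝟎 ⊗ 𝟎 ⊝ k))))) (ℤ.+-identityˡ H))
    where
    H = + 2 * sum (λ x → half x * (s x * s (x ⊗ x ⊝ k)))

  private
    -1≢0 : ⊖ 𝟏 ≢ 𝟎
    -1≢0 h = 1≢0 (trans (solve 1 (λ x → x := :- (:- x)) refl 𝟏) (trans (cong ⊖_ h) (solve 0 (:- con 0ℤ := con 0ℤ) refl)))

    1≢-1 : 𝟏 ≢ ⊖ 𝟏
    1≢-1 h = 1≢0 (neg-fixed h)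

  -- The character value is ± 1 except at 0, 1 and -1. The half-system has 2 m elements, omits 0 and
  -- contains exactly one of ± 1, so an odd number 2 m - 1 of signs is added.
  S₁-half-odd : Σ[ g ∈ ℤ ] sum (λ x → half x * (s x * s (x ⊗ x ⊝ 𝟏))) ≡ 1ℤ + + 2 * g
  S₁-half-odd = + m - 1ℤ - G , (begin
    sum (λ x → half x * f₁ x)
      ≡⟨ sum-cong (λ x → trans (cong (half x *_) (parity x .proj₂)) (l₁ (half x) (δ x 𝟎) (δ x 𝟏) (δ x (⊖ 𝟏)) (g x))) ⟩
    sum (λ x → half x - (δ x 𝟎 * half x + (δ x 𝟏 * half x + δ x (⊖ 𝟏) * half x)) - + 2 * (half x * g x))
      ≡⟨ trans (sum-sub (λ x → half x - (δ x 𝟎 * half x + (δ x 𝟏 * half x + δ x (⊖ 𝟏) * half x))) (λ x → + 2 * (half x * g x)))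
           (cong₂ _-_
             (trans (sum-sub half (λ x → δ x 𝟎 * half x + (δ x 𝟏 * half x + δ x (⊖ 𝟏) * half x)))
               (cong₂ _-_ sum-half
                 (trans (sum-+ (λ x → δ x 𝟎 * half x) (λ x → δ x 𝟏 * half x + δ x (⊖ 𝟏) * half x))
                   (cong₂ _+_ (trans (sum-δʳ half 𝟎) half-0)
                     (trans (sum-+ (λ x → δ x 𝟏 * half x) (λ x → δ x (⊖ 𝟏) * half x))
                       (trans (cong₂ _+_ (sum-δʳ half 𝟏) (sum-δʳ half (⊖ 𝟏))) (trans (half-sum 𝟏) (cong (λ u → 1ℤ - u) (δ-≢ 1≢0)))))))))
             (sum-scale (+ 2) (λ x → half x * g x))) ⟩
    + 2 * + m - (0ℤ + (1ℤ - 0ℤ)) - + 2 * G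
      ≡⟨ l₂ (+ m) G ⟩
    1ℤ + + 2 * (+ m - 1ℤ - G) ∎)
    where
    half-0 : half 𝟎 ≡ 0ℤ
    half-0 = trans (cong (o 𝟎) (solve 0 (:- con 0ℤ := con 0ℤ) refl)) (o-irrefl 𝟎)
    parity : ∀ x → Σ[ g ∈ ℤ ] f₁ x ≡ 1ℤ - (δ x 𝟎 + (δ x 𝟏 + δ x (⊖ 𝟏))) - + 2 * g
    parity x with x Fin.≟ 𝟎 | x Fin.≟ 𝟏 | x Fin.≟ ⊖ 𝟏
    ... | yes refl | _ | _ = 0ℤ , trans (cong (_* s (𝟎 ⊗ 𝟎 ⊝ 𝟏)) s-0) (trans (ℤ.*-zeroˡ (s (𝟎 ⊗ 𝟎 ⊝ 𝟏)))
          (sym (cong (λ u → 1ℤ - u - + 2 * 0ℤ) (cong₂ _+_ (δ-refl 𝟎) (cong₂ _+_ (δ-≢ (1≢0 ∘ sym)) (δ-≢ (-1≢0 ∘ sym)))))))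
    ... | no _ | yes refl | _ = 0ℤ , trans (cong (s 𝟏 *_) (trans (cong s (solve 0 (con 1ℤ :* con 1ℤ :- con 1ℤ := con 0ℤ) refl)) s-0))
          (trans (ℤ.*-zeroʳ (s 𝟏)) (sym (cong (λ u → 1ℤ - u - + 2 * 0ℤ) (cong₂ _+_ (δ-≢ 1≢0) (cong₂ _+_ (δ-refl 𝟏) (δ-≢ 1≢-1))))))
    ... | no _ | no _ | yes refl = 0ℤ , trans (cong (s (⊖ 𝟏) *_) (trans (cong s (solve 0 (:- con 1ℤ :* :- con 1ℤ :- con 1ℤ := con 0ℤ) refl)) s-0))
          (trans (ℤ.*-zeroʳ (s (⊖ 𝟏))) (sym (cong (λ u → 1ℤ - u - + 2 * 0ℤ) (cong₂ _+_ (δ-≢ -1≢0) (cong₂ _+_ (δ-≢ (1≢-1 ∘ sym)) (δ-refl (⊖ 𝟏)))))))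
    ... | no x≢0 | no x≢1 | no x≢-1 = g₀ .proj₁ , trans (sym (s-mul x (x ⊗ x ⊝ 𝟏))) (trans (g₀ .proj₂)
          (sym (cong (λ u → 1ℤ - u - + 2 * g₀ .proj₁) (cong₂ _+_ (δ-≢ x≢0) (cong₂ _+_ (δ-≢ x≢1) (δ-≢ x≢-1))))))
      where
      g₀ = s-half {x ⊗ (x ⊗ x ⊝ 𝟏)} (⊗-≢0 x≢0 λ h → x≢-1 (⊝-≡0 (integral {x ⊝ 𝟏} (λ e → x≢1 (⊝-≡0 e))
             (trans (solve 1 (λ x → (x :- con 1ℤ) :* (x :- :- con 1ℤ) := x :* x :- con 1ℤ) refl x) h))))
    g : Fin q → ℤ
    g x = parity x .proj₁
    G = sum λ x → half x * g x
    l₁ : ∀ h a b c g → h * (1ℤ - (a + (b + c)) - + 2 * g) ≡ h - (a * h + (b * h + c * h)) - + 2 * (h * g)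
    l₁ = solve-∀
    l₂ : ∀ m G → + 2 * m - (0ℤ + (1ℤ - 0ℤ)) - + 2 * G ≡ 1ℤ + + 2 * (m - 1ℤ - G)
    l₂ = solve-∀

  q-1≢0 : + q - 1ℤ ≢ 0ℤ
  q-1≢0 h = q≢1 (ℤ.+-injective (trans (l (+ q)) (cong (λ u → u + 1ℤ) h)))
    where
    l : ∀ q → q ≡ q - 1ℤ + 1ℤ
    l = solve-∀

  -- Jacobsthal's argument: by `S-scale`, S² takes one value on nonzero squares and one on
  -- nonsquares. Each class has (q - 1) / 2 elements, so `sum-S²` makes the two values add up to 4
  -- q, and `S-half` removes the factor 4.
  sum-two-squares : Σ[ a ∈ ℤ ] Σ[ b ∈ ℤ ] Σ[ g ∈ ℤ ] S 𝟏 ≡ + 2 * a × a * a + b * b ≡ + q × a ≡ 1ℤ + + 2 * g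
  sum-two-squares = a , b , S₁-half-odd .proj₁ , S-half 𝟏 , total , S₁-half-odd .proj₂
    where
    n₀ = nonsquare-exists .proj₁
    n-nonsq = nonsquare-exists .proj₂
    a = sum λ x → half x * (s x * s (x ⊗ x ⊝ 𝟏))
    b = sum λ x → half x * (s x * s (x ⊗ x ⊝ n₀))
    n≢0 : n₀ ≢ 𝟎
    n≢0 h = n-nonsq 𝟎 (trans (⊗-zeroˡ 𝟎) (sym h))
    l₀ : ∀ s x → s * x * (s * x) ≡ s * s * (x * x)
    l₀ = solve-∀
    S²-scale : ∀ {t} → t ≢ 𝟎 → ∀ k → S (t ⊗ t ⊗ k) * S (t ⊗ t ⊗ k) ≡ S k * S k
    S²-scale {t} t≢0 k = trans (cong₂ _*_ (S-scale t≢0 k) (S-scale t≢0 k)) (trans (l₀ (s t) (S k))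
      (trans (cong (_* (S k * S k)) (s-unit t≢0)) (ℤ.*-identityˡ (S k * S k))))
    -- The weights are twice the indicators of the nonzero squares and of the nonsquares.
    by-class : ∀ k → + 2 * (S k * S k) ≡ (1ℤ - δ k 𝟎 + s k) * (S 𝟏 * S 𝟏) + (1ℤ - δ k 𝟎 - s k) * (S n₀ * S n₀)
    by-class k with classify k
    ... | is-zero refl = trans (cong (λ u → + 2 * (u * u)) S-0)
          (sym (trans (cong₂ (λ d e → (1ℤ - d + e) * (S 𝟏 * S 𝟏) + (1ℤ - d - e) * (S n₀ * S n₀)) (δ-refl 𝟎) s-0) (l₁ (S 𝟏 * S 𝟏) (S n₀ * S n₀))))
      where
      l₁ : ∀ x y → (1ℤ - 1ℤ + 0ℤ) * x + (1ℤ - 1ℤ - 0ℤ) * y ≡ + 2 * (0ℤ * 0ℤ)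
      l₁ = solve-∀
    ... | is-square t t≢0 refl = trans (cong (+ 2 *_) (trans (cong (λ u → S u * S u) (sym (⊗-identityʳ (t ⊗ t)))) (S²-scale t≢0 𝟏)))
          (sym (trans (cong₂ (λ d e → (1ℤ - d + e) * (S 𝟏 * S 𝟏) + (1ℤ - d - e) * (S n₀ * S n₀)) (δ-≢ (⊗-≢0 t≢0 t≢0)) (s-square t≢0)) (l₁ (S 𝟏 * S 𝟏) (S n₀ * S n₀))))
      where
      l₁ : ∀ x y → (1ℤ - 0ℤ + 1ℤ) * x + (1ℤ - 0ℤ - 1ℤ) * y ≡ + 2 * x
      l₁ = solve-∀
    ... | nonsquare h = trans (cong (+ 2 *_) (ratio (classify (k ⊗ inv n₀))))
          (sym (trans (cong₂ (λ d e → (1ℤ - d + e) * (S 𝟏 * S 𝟏) + (1ℤ - d - e) * (S n₀ * S n₀)) (δ-≢ k≢0) (s-nonsquare h)) (l₁ (S 𝟏 * S 𝟏) (S n₀ * S n₀))))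
      where
      l₁ : ∀ x y → (1ℤ - 0ℤ + - 1ℤ) * x + (1ℤ - 0ℤ - - 1ℤ) * y ≡ + 2 * y
      l₁ = solve-∀
      k≢0 : k ≢ 𝟎
      k≢0 e = h 𝟎 (trans (⊗-zeroˡ 𝟎) (sym e))
      ratio-s : s (k ⊗ inv n₀) ≡ 1ℤ
      ratio-s = trans (s-mul k (inv n₀)) (cong₂ _*_ (s-nonsquare h) (trans (s-inv n₀) (s-nonsquare n-nonsq)))
      ratio : Class (k ⊗ inv n₀) → S k * S k ≡ S n₀ * S n₀
      ratio (is-zero e) = contradiction (trans (sym ratio-s) (trans (cong s e) s-0)) λ ()
      ratio (nonsquare e) = contradiction (trans (sym ratio-s) (s-nonsquare e)) λ ()
      ratio (is-square t t≢0 e) = trans (cong (λ u → S u * S u) k≡) (S²-scale t≢0 n₀)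
        where
        k≡ : k ≡ t ⊗ t ⊗ n₀
        k≡ = trans (sym (⊗-identityʳ k)) (trans (cong (k ⊗_) (sym (⊗-inv n≢0)))
          (trans (solve 3 (λ k n₀ i → k :* (n₀ :* i) := k :* i :* n₀) refl k n₀ (inv n₀)) (cong (_⊗ n₀) (sym e))))
    doubled : + 2 * (+ 2 * + q * (+ q - 1ℤ)) ≡ (+ q - 1ℤ) * (S 𝟏 * S 𝟏) + (+ q - 1ℤ) * (S n₀ * S n₀)
    doubled = begin
      + 2 * (+ 2 * + q * (+ q - 1ℤ))
        ≡⟨ cong (+ 2 *_) (sym sum-S²) ⟩
      + 2 * sum (λ k → S k * S k)
        ≡⟨ sym (sum-scale (+ 2) (λ k → S k * S k)) ⟩
      sum (λ k → + 2 * (S k * S k))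
        ≡⟨ sum-cong by-class ⟩
      sum (λ k → (1ℤ - δ k 𝟎 + s k) * (S 𝟏 * S 𝟏) + (1ℤ - δ k 𝟎 - s k) * (S n₀ * S n₀))
        ≡⟨ trans (sum-+ (λ k → (1ℤ - δ k 𝟎 + s k) * (S 𝟏 * S 𝟏)) (λ k → (1ℤ - δ k 𝟎 - s k) * (S n₀ * S n₀)))
             (cong₂ _+_ (trans (sum-scaleʳ (S 𝟏 * S 𝟏) (λ k → 1ℤ - δ k 𝟎 + s k))
                          (cong (_* (S 𝟏 * S 𝟏)) (trans (sum-+ (λ k → 1ℤ - δ k 𝟎) s) (trans (cong₂ _+_ sum-nonzero sum-s) (ℤ.+-identityʳ (+ q - 1ℤ))))))
                        (trans (sum-scaleʳ (S n₀ * S n₀) (λ k → 1ℤ - δ k 𝟎 - s k))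
                          (cong (_* (S n₀ * S n₀)) (trans (sum-sub (λ k → 1ℤ - δ k 𝟎) s) (trans (cong₂ _-_ sum-nonzero sum-s) (ℤ.+-identityʳ (+ q - 1ℤ))))))) ⟩
      (+ q - 1ℤ) * (S 𝟏 * S 𝟏) + (+ q - 1ℤ) * (S n₀ * S n₀) ∎
    total : a * a + b * b ≡ + q
    total = ℤ.*-cancelˡ-≡ (+ 4) (a * a + b * b) (+ q)
      (ℤ.*-cancelˡ-≡ (+ q - 1ℤ) (+ 4 * (a * a + b * b)) (+ 4 * + q) {{ℤ.≢-nonZero q-1≢0}} (begin
        (+ q - 1ℤ) * (+ 4 * (a * a + b * b))
          ≡⟨ l₁ (+ q) a b ⟩
        (+ q - 1ℤ) * (+ 2 * a * (+ 2 * a)) + (+ q - 1ℤ) * (+ 2 * b * (+ 2 * b))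
          ≡⟨ cong₂ (λ u w → (+ q - 1ℤ) * (u * u) + (+ q - 1ℤ) * (w * w)) (sym (S-half 𝟏)) (sym (S-half n₀)) ⟩
        (+ q - 1ℤ) * (S 𝟏 * S 𝟏) + (+ q - 1ℤ) * (S n₀ * S n₀)
          ≡⟨ sym doubled ⟩
        + 2 * (+ 2 * + q * (+ q - 1ℤ))
          ≡⟨ l₂ (+ q) ⟩
        (+ q - 1ℤ) * (+ 4 * + q) ∎))
      where
      l₁ : ∀ q a b → (q - 1ℤ) * (+ 4 * (a * a + b * b)) ≡ (q - 1ℤ) * (+ 2 * a * (+ 2 * a)) + (q - 1ℤ) * (+ 2 * b * (+ 2 * b))
      l₁ = solve-∀
      l₂ : ∀ q → + 2 * (+ 2 * q * (q - 1ℤ)) ≡ (q - 1ℤ) * (+ 4 * q)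
      l₂ = solve-∀

  -- A hypergeometric character sum

  s-cube : ∀ a → s a * (s a * s a) ≡ s a
  s-cube a = trans (cong (s a *_) (s-squared a)) (trans (l (s a) (δ a 𝟎)) (trans
      (cong (λ u → s a - u) (trans (cong (_* s a) (δ-sym a 𝟎)) (trans (δ-subst s 𝟎 a) (trans (cong (δ 𝟎 a *_) s-0) (ℤ.*-zeroʳ (δ 𝟎 a))))))
      (ℤ.+-identityʳ (s a))))
    where
    l : ∀ a d → a * (1ℤ - d) ≡ a - d * a
    l = solve-∀

  -- Completing the square: 4 a times the quadratic is (2 a z + b)² minus the discriminant, and z ↦
  -- 2 a z + b is a bijection.
  quadratic-count : ∀ {a} → a ≢ 𝟎 → ∀ b c →
    sum (λ z → δ (a ⊗ (z ⊗ z) ⊕ b ⊗ z ⊕ c) 𝟎) ≡ #√ (b ⊗ b ⊝ ⟨ + 4 ⟩ ⊗ (a ⊗ c))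
  quadratic-count {a} a≢0 b c = begin
    sum (λ z → δ (a ⊗ (z ⊗ z) ⊕ b ⊗ z ⊕ c) 𝟎)
      ≡⟨ sum-cong (λ z → δ-⇔ {a = a ⊗ (z ⊗ z) ⊕ b ⊗ z ⊕ c} {𝟎} {Y z ⊗ Y z} {D} (fwd z) (bwd z)) ⟩
    sum (λ z → δ (Y z ⊗ Y z) D)
      ≡⟨ sum-mul (⊗-≢0 2≢0 a≢0) (λ y → δ ((y ⊕ b) ⊗ (y ⊕ b)) D) ⟩
    sum (λ y → δ ((y ⊕ b) ⊗ (y ⊕ b)) D)
      ≡⟨ sum-shift b (λ y → δ (y ⊗ y) D) ⟩
    #√ D ∎
    where
    D = b ⊗ b ⊝ ⟨ + 4 ⟩ ⊗ (a ⊗ c)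
    Y : Fin q → Fin q
    Y z = ⟨ + 2 ⟩ ⊗ a ⊗ z ⊕ b
    e : ∀ z → ⟨ + 4 ⟩ ⊗ a ⊗ (a ⊗ (z ⊗ z) ⊕ b ⊗ z ⊕ c) ≡ Y z ⊗ Y z ⊝ D
    e z = solve 4 (λ a b c z → con (+ 4) :* a :* (a :* (z :* z) :+ b :* z :+ c) :=
      (con (+ 2) :* a :* z :+ b) :* (con (+ 2) :* a :* z :+ b) :- (b :* b :- con (+ 4) :* (a :* c))) refl a b c z
    fwd : ∀ z → a ⊗ (z ⊗ z) ⊕ b ⊗ z ⊕ c ≡ 𝟎 → Y z ⊗ Y z ≡ D
    fwd z h = ⊝-≡0 (trans (sym (e z)) (trans (cong (⟨ + 4 ⟩ ⊗ a ⊗_) h) (⊗-zeroʳ (⟨ + 4 ⟩ ⊗ a))))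
    bwd : ∀ z → Y z ⊗ Y z ≡ D → a ⊗ (z ⊗ z) ⊕ b ⊗ z ⊕ c ≡ 𝟎
    bwd z h = integral (⊗-≢0 4≢0 a≢0) (trans (e z) (trans (cong (_⊝ D) h) (⊝-self D)))

  -- Frobenius trace (up to sign) of the Legendre curve y² = z(z−1)(z−w).
  lam : Fin q → ℤ
  lam w = sum λ z → s z * (s (z ⊝ 𝟏) * s (z ⊝ w))

  -- `W`, a finite-field analogue of a hypergeometric 3F2 value, is what the 4-cliques lead to. `V`,
  -- taken over square parameters, is what the square of a Jacobsthal sum leads to.
  V W : ℤ
  V = sum λ d → s d * lam (d ⊗ d)
  W = sum λ w → s w * (s (w ⊝ 𝟏) * lam w)

  -- After y = x e the product s x s y becomes s e s (x²), so x occurs only through x². Writing w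
  -- for x² and inverting w gives the Legendre form with parameter e²; the 2 q stems from e = ± 1,
  -- where `jacobsthal` has its diagonal term.
  S₁²≡2q+V : S 𝟏 * S 𝟏 ≡ + 2 * + q + V
  S₁²≡2q+V = begin
    S 𝟏 * S 𝟏
      ≡⟨ sym (sum₂-product f₁ f₁) ⟩
    sum₂ (λ x y → f₁ x * f₁ y)
      ≡⟨ sum-cong (λ x → substitute x (x Fin.≟ 𝟎)) ⟩
    sum₂ (λ x e → f₁ x * f₁ (x ⊗ e))
      ≡⟨ sum₂-cong (λ x e → trans (cong (λ u → f₁ x * (u * s (x ⊗ e ⊗ (x ⊗ e) ⊝ 𝟏))) (s-mul x e))
           (trans (l₁ (s x) (s (x ⊗ x ⊝ 𝟏)) (s e) (s (x ⊗ e ⊗ (x ⊗ e) ⊝ 𝟏)))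
             (cong₂ (λ u w → s e * (u * (s (x ⊗ x ⊝ 𝟏) * w))) (sym (s-mul x x))
               (cong s (solve 2 (λ x e → x :* e :* (x :* e) :- con 1ℤ := e :* e :* (x :* x) :- con 1ℤ) refl x e))))) ⟩
    sum₂ (λ x e → s e * h e (x ⊗ x))
      ≡⟨ trans (∑-comm (λ x e → s e * h e (x ⊗ x))) (sum-cong λ e → trans (sum-scale (s e) (λ x → h e (x ⊗ x))) (cong (s e *_) (inner e))) ⟩
    sum (λ e → s e * (lam (e ⊗ e) + (+ q * δ (e ⊗ e) 𝟏 - 1ℤ - s e * s e)))
      ≡⟨ sum-cong (λ e → trans (l₂ (s e) (lam (e ⊗ e)) (+ q) (δ (e ⊗ e) 𝟏))
           (cong (λ u → s e * lam (e ⊗ e) + (+ q * (δ (e ⊗ e) 𝟏 * s e) - (s e + u))) (s-cube e))) ⟩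
    sum (λ e → s e * lam (e ⊗ e) + (+ q * (δ (e ⊗ e) 𝟏 * s e) - (s e + s e)))
      ≡⟨ trans (sum-+ (λ e → s e * lam (e ⊗ e)) (λ e → + q * (δ (e ⊗ e) 𝟏 * s e) - (s e + s e)))
           (cong (λ u → V + u) (trans (sum-sub (λ e → + q * (δ (e ⊗ e) 𝟏 * s e)) (λ e → s e + s e))
             (cong₂ _-_ (trans (sum-scale (+ q) (λ e → δ (e ⊗ e) 𝟏 * s e)) (cong (+ q *_) at-±1))
               (trans (sum-+ s s) (cong₂ _+_ sum-s sum-s))))) ⟩
    V + (+ q * + 2 - (0ℤ + 0ℤ))
      ≡⟨ l₃ V (+ q) ⟩
    + 2 * + q + V ∎
    where
    h : Fin q → Fin q → ℤ
    h e w = s w * (s (w ⊝ 𝟏) * s (e ⊗ e ⊗ w ⊝ 𝟏))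
    l₁ : ∀ a b c d → a * b * (a * c * d) ≡ c * (a * a * (b * d))
    l₁ = solve-∀
    l₂ : ∀ s l q d → s * (l + (q * d - 1ℤ - s * s)) ≡ s * l + (q * (d * s) - (s + s * (s * s)))
    l₂ = solve-∀
    l₃ : ∀ v q → v + (q * + 2 - (0ℤ + 0ℤ)) ≡ + 2 * q + v
    l₃ = solve-∀
    -- Multiplication by x is a bijection only for x ≠ 0; at 0 both sides vanish because `f₁` does.
    substitute : ∀ x → Dec (x ≡ 𝟎) → sum (λ y → f₁ x * f₁ y) ≡ sum (λ e → f₁ x * f₁ (x ⊗ e))
    substitute x (no x≢0)   = sym (sum-mul x≢0 (λ y → f₁ x * f₁ y))
    substitute x (yes refl) = trans (sum-cong λ y → vanish (f₁ y)) (sym (sum-cong λ e → vanish (f₁ (𝟎 ⊗ e))))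
      where
      vanish : ∀ u → f₁ 𝟎 * u ≡ 0ℤ
      vanish u = trans (cong (λ w → w * s (𝟎 ⊗ 𝟎 ⊝ 𝟏) * u) s-0) (l₀ (s (𝟎 ⊗ 𝟎 ⊝ 𝟏)) u)
        where
        l₀ : ∀ a b → 0ℤ * a * b ≡ 0ℤ
        l₀ = solve-∀
    at-±1 : sum (λ e → δ (e ⊗ e) 𝟏 * s e) ≡ + 2
    at-±1 = trans (sum-cong λ e → trans (cong (_* s e) (trans (cong (δ (e ⊗ e)) (sym (⊗-identityˡ 𝟏))) (δ-squares 1≢0 e)))
        (ℤ.*-distribʳ-+ (s e) (δ 𝟏 e) (δ (⊖ 𝟏) e)))
      (trans (sum-+ (λ e → δ 𝟏 e * s e) (λ e → δ (⊖ 𝟏) e * s e)) (cong₂ _+_ (trans (sum-δ s 𝟏) s-1) (trans (sum-δ s (⊖ 𝟏)) s-neg-1)))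
    h-inv : ∀ e u → h e (inv u) ≡ s u * (s (u ⊝ 𝟏) * s (u ⊝ e ⊗ e))
    h-inv e u = go (u Fin.≟ 𝟎)
      where
      go : Dec (u ≡ 𝟎) → h e (inv u) ≡ s u * (s (u ⊝ 𝟏) * s (u ⊝ e ⊗ e))
      go (yes refl) = trans (cong (_* (s (inv 𝟎 ⊝ 𝟏) * s (e ⊗ e ⊗ inv 𝟎 ⊝ 𝟏))) (trans (s-inv 𝟎) s-0))
        (trans (ℤ.*-zeroˡ (s (inv 𝟎 ⊝ 𝟏) * s (e ⊗ e ⊗ inv 𝟎 ⊝ 𝟏)))
          (sym (trans (cong (_* (s (𝟎 ⊝ 𝟏) * s (𝟎 ⊝ e ⊗ e))) s-0) (ℤ.*-zeroˡ (s (𝟎 ⊝ 𝟏) * s (𝟎 ⊝ e ⊗ e))))))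
      go (no u≢0) = begin
        s u⁻¹ * (s (u⁻¹ ⊝ 𝟏) * s (e ⊗ e ⊗ u⁻¹ ⊝ 𝟏))
          ≡⟨ cong₂ (λ a b → s u⁻¹ * (s a * s b)) (factor 𝟏 (⊗-identityˡ u⁻¹)) (factor (e ⊗ e) refl) ⟩
        s u⁻¹ * (s (u⁻¹ ⊗ (𝟏 ⊝ u)) * s (u⁻¹ ⊗ (e ⊗ e ⊝ u)))
          ≡⟨ cong₂ (λ a b → s u⁻¹ * (a * b)) (trans (s-mul u⁻¹ (𝟏 ⊝ u)) (cong (s u⁻¹ *_) (s-⊝-comm 𝟏 u)))
               (trans (s-mul u⁻¹ (e ⊗ e ⊝ u)) (cong (s u⁻¹ *_) (s-⊝-comm (e ⊗ e) u))) ⟩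
        s u⁻¹ * (s u⁻¹ * s (u ⊝ 𝟏) * (s u⁻¹ * s (u ⊝ e ⊗ e)))
          ≡⟨ l₄ (s u⁻¹) (s (u ⊝ 𝟏)) (s (u ⊝ e ⊗ e)) ⟩
        s u⁻¹ * (s u⁻¹ * s u⁻¹) * (s (u ⊝ 𝟏) * s (u ⊝ e ⊗ e))
          ≡⟨ cong (_* (s (u ⊝ 𝟏) * s (u ⊝ e ⊗ e))) (trans (s-cube u⁻¹) (s-inv u)) ⟩
        s u * (s (u ⊝ 𝟏) * s (u ⊝ e ⊗ e)) ∎
        where
        u⁻¹ = inv u
        factor : ∀ c {c′} → c ⊗ u⁻¹ ≡ c′ → c′ ⊝ 𝟏 ≡ u⁻¹ ⊗ (c ⊝ u)
        factor c refl = trans (cong (λ t → c ⊗ u⁻¹ ⊝ t) (sym (⊗-inv u≢0)))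
          (solve 3 (λ c u⁻¹ u → c :* u⁻¹ :- u :* u⁻¹ := u⁻¹ :* (c :- u)) refl c u⁻¹ u)
        l₄ : ∀ a b c → a * (a * b * (a * c)) ≡ a * (a * a) * (b * c)
        l₄ = solve-∀
    inner : ∀ e → sum (λ x → h e (x ⊗ x)) ≡ lam (e ⊗ e) + (+ q * δ (e ⊗ e) 𝟏 - 1ℤ - s e * s e)
    inner e = begin
      sum (λ x → h e (x ⊗ x))
        ≡⟨ sum-squares (h e) ⟩
      sum (λ w → (1ℤ + s w) * h e w)
        ≡⟨ sym (sum-inv (λ w → (1ℤ + s w) * h e w)) ⟩
      sum (λ u → (1ℤ + s (inv u)) * h e (inv u))
        ≡⟨ sum-cong (λ u → trans (cong₂ (λ a b → (1ℤ + a) * b) (s-inv u) (h-inv e u))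
             (trans (l₄ (s u) (s (u ⊝ 𝟏)) (s (u ⊝ e ⊗ e)))
               (cong (λ a → s u * (s (u ⊝ 𝟏) * s (u ⊝ e ⊗ e)) + a * (s (u ⊝ 𝟏) * s (u ⊝ e ⊗ e))) (s-squared u)))) ⟩
      sum (λ u → s u * (s (u ⊝ 𝟏) * s (u ⊝ e ⊗ e)) + (1ℤ - δ u 𝟎) * (s (u ⊝ 𝟏) * s (u ⊝ e ⊗ e)))
        ≡⟨ trans (sum-+ (λ u → s u * (s (u ⊝ 𝟏) * s (u ⊝ e ⊗ e))) (λ u → (1ℤ - δ u 𝟎) * (s (u ⊝ 𝟏) * s (u ⊝ e ⊗ e))))
             (cong (λ a → lam (e ⊗ e) + a) (trans (sum-cong λ u → l₅ (δ u 𝟎) (s (u ⊝ 𝟏) * s (u ⊝ e ⊗ e)))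
               (trans (sum-sub (λ u → s (u ⊝ 𝟏) * s (u ⊝ e ⊗ e)) (λ u → δ u 𝟎 * (s (u ⊝ 𝟏) * s (u ⊝ e ⊗ e))))
                 (cong₂ _-_ (trans (jacobsthal 𝟏 (e ⊗ e)) (cong (λ a → + q * a - 1ℤ) (δ-sym 𝟏 (e ⊗ e))))
                   (trans (sum-δʳ (λ u → s (u ⊝ 𝟏) * s (u ⊝ e ⊗ e)) 𝟎) at-0))))) ⟩
      lam (e ⊗ e) + (+ q * δ (e ⊗ e) 𝟏 - 1ℤ - s e * s e) ∎
      where
      l₄ : ∀ a b c → (1ℤ + a) * (a * (b * c)) ≡ a * (b * c) + a * a * (b * c)
      l₄ = solve-∀
      l₅ : ∀ d a → (1ℤ - d) * a ≡ a - d * a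
      l₅ = solve-∀
      at-0 : s (𝟎 ⊝ 𝟏) * s (𝟎 ⊝ e ⊗ e) ≡ s e * s e
      at-0 = trans (cong₂ _*_ (trans (cong s (⊕-identityˡ (⊖ 𝟏))) s-neg-1)
          (trans (cong s (⊕-identityˡ (⊖ (e ⊗ e)))) (trans (s-neg (e ⊗ e)) (s-mul e e))))
        (ℤ.*-identityˡ (s e * s e))

  -- The map v = z + w / z underlies a 2-isogeny: z (z - 1) (z - w) is z² (v - 1 - w), and v has 1 +
  -- s (v² - 4 w) preimages, the roots of z² - v z + w. The constant 1 contributes a full character
  -- sum, which is 0.
  lam-isogeny : ∀ {w} → w ≢ 𝟎 → lam w ≡ sum λ v → s (v ⊗ v ⊝ ⟨ + 4 ⟩ ⊗ w) * s (v ⊝ 𝟏 ⊝ w)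
  lam-isogeny {w} w≢0 = begin
    lam w
      ≡⟨ sum-cong (λ z → pointwise z (z Fin.≟ 𝟎)) ⟩
    sum (λ z → (1ℤ - δ z 𝟎) * s (g z ⊝ 𝟏 ⊝ w))
      ≡⟨ sum-fibre-weighted (λ z → 1ℤ - δ z 𝟎) g (λ v → s (v ⊝ 𝟏 ⊝ w)) ⟩
    sum (λ v → sum (λ z → (1ℤ - δ z 𝟎) * δ (g z) v) * s (v ⊝ 𝟏 ⊝ w))
      ≡⟨ sum-cong (λ v → trans (cong (_* s (v ⊝ 𝟏 ⊝ w)) (fibre v)) (ℤ.*-distribʳ-+ (s (v ⊝ 𝟏 ⊝ w)) 1ℤ (s (v ⊗ v ⊝ ⟨ + 4 ⟩ ⊗ w)))) ⟩
    sum (λ v → 1ℤ * s (v ⊝ 𝟏 ⊝ w) + s (v ⊗ v ⊝ ⟨ + 4 ⟩ ⊗ w) * s (v ⊝ 𝟏 ⊝ w))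
      ≡⟨ trans (sum-+ (λ v → 1ℤ * s (v ⊝ 𝟏 ⊝ w)) (λ v → s (v ⊗ v ⊝ ⟨ + 4 ⟩ ⊗ w) * s (v ⊝ 𝟏 ⊝ w)))
           (trans (cong (λ u → u + R) (trans (sum-cong λ v → trans (ℤ.*-identityˡ (s (v ⊝ 𝟏 ⊝ w)))
                     (cong s (solve 2 (λ v w → v :- con 1ℤ :- w := v :+ (:- con 1ℤ :- w)) refl v w)))
                   (sum-s-shift (⊖ 𝟏 ⊝ w)))) (ℤ.+-identityˡ R)) ⟩
    R ∎
    where
    R = sum λ v → s (v ⊗ v ⊝ ⟨ + 4 ⟩ ⊗ w) * s (v ⊝ 𝟏 ⊝ w)
    g : Fin q → Fin q
    g z = z ⊕ w ⊗ inv z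
    pointwise : ∀ z → Dec (z ≡ 𝟎) → s z * (s (z ⊝ 𝟏) * s (z ⊝ w)) ≡ (1ℤ - δ z 𝟎) * s (g z ⊝ 𝟏 ⊝ w)
    pointwise z (yes refl) = trans (cong (_* (s (𝟎 ⊝ 𝟏) * s (𝟎 ⊝ w))) s-0) (trans (ℤ.*-zeroˡ (s (𝟎 ⊝ 𝟏) * s (𝟎 ⊝ w)))
      (sym (trans (cong (λ u → (1ℤ - u) * s (g 𝟎 ⊝ 𝟏 ⊝ w)) (δ-refl 𝟎)) (ℤ.*-zeroˡ (s (g 𝟎 ⊝ 𝟏 ⊝ w))))))
    pointwise z (no z≢0) = begin
      s z * (s (z ⊝ 𝟏) * s (z ⊝ w))
        ≡⟨ trans (cong (s z *_) (sym (s-mul (z ⊝ 𝟏) (z ⊝ w)))) (sym (s-mul z ((z ⊝ 𝟏) ⊗ (z ⊝ w)))) ⟩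
      s (z ⊗ ((z ⊝ 𝟏) ⊗ (z ⊝ w)))
        ≡⟨ cong s (trans (solve 2 (λ z w → z :* ((z :- con 1ℤ) :* (z :- w)) := z :* (z :* (z :- con 1ℤ :- w) :+ w :* con 1ℤ)) refl z w)
             (trans (cong (λ u → z ⊗ (z ⊗ (z ⊝ 𝟏 ⊝ w) ⊕ w ⊗ u)) (sym (⊗-inv z≢0)))
               (solve 3 (λ z w i → z :* (z :* (z :- con 1ℤ :- w) :+ w :* (z :* i)) := z :* z :* (z :+ w :* i :- con 1ℤ :- w)) refl z w (inv z)))) ⟩
      s (z ⊗ z ⊗ (g z ⊝ 𝟏 ⊝ w))
        ≡⟨ s-square-mul z≢0 (g z ⊝ 𝟏 ⊝ w) ⟩
      s (g z ⊝ 𝟏 ⊝ w)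
        ≡⟨ sym (trans (cong (λ u → (1ℤ - u) * s (g z ⊝ 𝟏 ⊝ w)) (δ-≢ z≢0)) (ℤ.*-identityˡ (s (g z ⊝ 𝟏 ⊝ w)))) ⟩
      (1ℤ - δ z 𝟎) * s (g z ⊝ 𝟏 ⊝ w) ∎
    fibre : ∀ v → sum (λ z → (1ℤ - δ z 𝟎) * δ (g z) v) ≡ 1ℤ + s (v ⊗ v ⊝ ⟨ + 4 ⟩ ⊗ w)
    fibre v = begin
      sum (λ z → (1ℤ - δ z 𝟎) * δ (g z) v)
        ≡⟨ sum-cong (λ z → root z (z Fin.≟ 𝟎)) ⟩
      sum (λ z → δ (𝟏 ⊗ (z ⊗ z) ⊕ ⊖ v ⊗ z ⊕ w) 𝟎)
        ≡⟨ quadratic-count 1≢0 (⊖ v) w ⟩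
      #√ (⊖ v ⊗ ⊖ v ⊝ ⟨ + 4 ⟩ ⊗ (𝟏 ⊗ w))
        ≡⟨ cong #√ (solve 2 (λ v w → :- v :* :- v :- con (+ 4) :* (con 1ℤ :* w) := v :* v :- con (+ 4) :* w) refl v w) ⟩
      #√ (v ⊗ v ⊝ ⟨ + 4 ⟩ ⊗ w)
        ≡⟨ #√-s (v ⊗ v ⊝ ⟨ + 4 ⟩ ⊗ w) ⟩
      1ℤ + s (v ⊗ v ⊝ ⟨ + 4 ⟩ ⊗ w) ∎
      where
      root : ∀ z → Dec (z ≡ 𝟎) → (1ℤ - δ z 𝟎) * δ (g z) v ≡ δ (𝟏 ⊗ (z ⊗ z) ⊕ ⊖ v ⊗ z ⊕ w) 𝟎
      root z (yes refl) = trans (cong (λ u → (1ℤ - u) * δ (g 𝟎) v) (δ-refl 𝟎)) (trans (ℤ.*-zeroˡ (δ (g 𝟎) v))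
        (sym (δ-≢ λ h → w≢0 (trans (solve 2 (λ v w → w := con 1ℤ :* (con 0ℤ :* con 0ℤ) :+ :- v :* con 0ℤ :+ w) refl v w) h))))
      root z (no z≢0) = trans (cong (λ u → (1ℤ - u) * δ (g z) v) (δ-≢ z≢0)) (trans (ℤ.*-identityˡ (δ (g z) v))
        (δ-⇔ {a = g z} {v} {𝟏 ⊗ (z ⊗ z) ⊕ ⊖ v ⊗ z ⊕ w} {𝟎}
          (λ h → trans e (trans (cong (z ⊗_) (trans (cong (_⊝ v) h) (⊝-self v))) (⊗-zeroʳ z)))
          (λ h → ⊝-≡0 (integral z≢0 (trans (sym e) h)))))
        where
        e : 𝟏 ⊗ (z ⊗ z) ⊕ ⊖ v ⊗ z ⊕ w ≡ z ⊗ (g z ⊝ v)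
        e = trans (solve 3 (λ z v w → con 1ℤ :* (z :* z) :+ :- v :* z :+ w := z :* (z :- v) :+ w :* con 1ℤ) refl z v w)
          (trans (cong (λ u → z ⊗ (z ⊝ v) ⊕ w ⊗ u) (sym (⊗-inv z≢0)))
            (solve 4 (λ z v w i → z :* (z :- v) :+ w :* (z :* i) := z :* (z :+ w :* i :- v)) refl z v w (inv z)))

  -- Landen's transformation.
  lam-landen : ∀ {d} → d ≢ 𝟎 → 𝟏 ⊕ d ≢ 𝟎 →
               lam (d ⊗ d) ≡ lam (⟨ + 4 ⟩ ⊗ d ⊗ inv ((𝟏 ⊕ d) ⊗ (𝟏 ⊕ d)))
  lam-landen {d} d≢0 1+d≢0 = begin
    lam (d ⊗ d)
      ≡⟨ lam-isogeny (⊗-≢0 d≢0 d≢0) ⟩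
    sum (λ v → s (v ⊗ v ⊝ ⟨ + 4 ⟩ ⊗ (d ⊗ d)) * s (v ⊝ 𝟏 ⊝ d ⊗ d))
      -- For w = d² the quadratic v² - 4 d² splits. The shift v = u - 2 d moves one root to 0 and
      -- turns v - 1 - d² into u - (1 + d)²; scaling by (1 + d)² then restores the Legendre form.
      ≡⟨ sum-shift (⊖ (⟨ + 2 ⟩ ⊗ d)) (λ v → s (v ⊗ v ⊝ ⟨ + 4 ⟩ ⊗ (d ⊗ d)) * s (v ⊝ 𝟏 ⊝ d ⊗ d)) ⟨
    sum (λ u → s ((u ⊝ ⟨ + 2 ⟩ ⊗ d) ⊗ (u ⊝ ⟨ + 2 ⟩ ⊗ d) ⊝ ⟨ + 4 ⟩ ⊗ (d ⊗ d)) * s (u ⊝ ⟨ + 2 ⟩ ⊗ d ⊝ 𝟏 ⊝ d ⊗ d))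
      ≡⟨ sum-cong (λ u → cong₂ (λ a b → s a * s b)
           (solve 2 (λ u d → (u :- con (+ 2) :* d) :* (u :- con (+ 2) :* d) :- con (+ 4) :* (d :* d) := u :* (u :- con (+ 4) :* d)) refl u d)
           (solve 2 (λ u d → u :- con (+ 2) :* d :- con 1ℤ :- d :* d := u :- (con 1ℤ :+ d) :* (con 1ℤ :+ d)) refl u d)) ⟩
    sum (λ u → s (u ⊗ (u ⊝ ⟨ + 4 ⟩ ⊗ d)) * s (u ⊝ c))
      ≡⟨ sym (sum-mul c≢0 (λ u → s (u ⊗ (u ⊝ ⟨ + 4 ⟩ ⊗ d)) * s (u ⊝ c))) ⟩
    sum (λ u → s (c ⊗ u ⊗ (c ⊗ u ⊝ ⟨ + 4 ⟩ ⊗ d)) * s (c ⊗ u ⊝ c))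
      ≡⟨ sum-cong rescale ⟩
    lam w ∎
    where
    c = (𝟏 ⊕ d) ⊗ (𝟏 ⊕ d)
    w = ⟨ + 4 ⟩ ⊗ d ⊗ inv c
    c≢0 : c ≢ 𝟎
    c≢0 = ⊗-≢0 1+d≢0 1+d≢0
    4d : ⟨ + 4 ⟩ ⊗ d ≡ c ⊗ w
    4d = trans (sym (⊗-identityʳ (⟨ + 4 ⟩ ⊗ d))) (trans (cong (⟨ + 4 ⟩ ⊗ d ⊗_) (sym (⊗-inv c≢0)))
      (solve 3 (λ x c i → x :* (c :* i) := c :* (x :* i)) refl (⟨ + 4 ⟩ ⊗ d) c (inv c)))
    rescale : ∀ u → s (c ⊗ u ⊗ (c ⊗ u ⊝ ⟨ + 4 ⟩ ⊗ d)) * s (c ⊗ u ⊝ c) ≡ s u * (s (u ⊝ 𝟏) * s (u ⊝ w))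
    rescale u = begin
      s (c ⊗ u ⊗ (c ⊗ u ⊝ ⟨ + 4 ⟩ ⊗ d)) * s (c ⊗ u ⊝ c)
        ≡⟨ cong₂ (λ a b → s a * s b)
             (trans (cong (λ t → c ⊗ u ⊗ (c ⊗ u ⊝ t)) 4d) (solve 3 (λ c u w → c :* u :* (c :* u :- c :* w) := c :* c :* (u :* (u :- w))) refl c u w))
             (solve 2 (λ c u → c :* u :- c := c :* (u :- con 1ℤ)) refl c u) ⟩
      s (c ⊗ c ⊗ (u ⊗ (u ⊝ w))) * s (c ⊗ (u ⊝ 𝟏))
        ≡⟨ cong₂ _*_ (trans (s-square-mul c≢0 (u ⊗ (u ⊝ w))) (s-mul u (u ⊝ w))) (s-square-mul 1+d≢0 (u ⊝ 𝟏)) ⟩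
      s u * s (u ⊝ w) * s (u ⊝ 𝟏)
        ≡⟨ l (s u) (s (u ⊝ w)) (s (u ⊝ 𝟏)) ⟩
      s u * (s (u ⊝ 𝟏) * s (u ⊝ w)) ∎
      where
      l : ∀ a b c → a * b * c ≡ a * (c * b)
      l = solve-∀

  sum-s-s₁ : sum (λ z → s z * s (z ⊝ 𝟏)) ≡ - 1ℤ
  sum-s-s₁ = trans (jacobsthal-0 𝟏) (trans (cong (λ u → + q * u - 1ℤ) (δ-≢ 1≢0)) (cong (λ u → u - 1ℤ) (ℤ.*-zeroʳ (+ q))))

  sum-s-lam : sum (λ w → s w * lam w) ≡ 1ℤ
  sum-s-lam = begin
    sum (λ w → s w * lam w)
      ≡⟨ trans (sum-cong λ w → sym (sum-scale (s w) (λ z → s z * (s (z ⊝ 𝟏) * s (z ⊝ w)))))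
           (∑-comm λ w z → s w * (s z * (s (z ⊝ 𝟏) * s (z ⊝ w)))) ⟩
    sum₂ (λ z w → s w * (s z * (s (z ⊝ 𝟏) * s (z ⊝ w))))
      ≡⟨ sum-cong (λ z → trans (sum-cong λ w → trans (cong (λ u → s w * (s z * (s (z ⊝ 𝟏) * u))) (s-⊝-comm z w))
                                                     (l₁ (s w) (s z) (s (z ⊝ 𝟏)) (s (w ⊝ z))))
           (trans (sum-scale (s z * s (z ⊝ 𝟏)) (λ w → s w * s (w ⊝ z)))
             (trans (cong (s z * s (z ⊝ 𝟏) *_) (jacobsthal-0 z)) (l₂ (s z) (s (z ⊝ 𝟏)) (+ q) (δ z 𝟎))))) ⟩
    sum (λ z → + q * (δ z 𝟎 * (s z * s (z ⊝ 𝟏))) - s z * s (z ⊝ 𝟏))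
      ≡⟨ trans (sum-sub (λ z → + q * (δ z 𝟎 * (s z * s (z ⊝ 𝟏)))) (λ z → s z * s (z ⊝ 𝟏)))
           (cong₂ _-_
             (trans (sum-scale (+ q) (λ z → δ z 𝟎 * (s z * s (z ⊝ 𝟏))))
               (cong (+ q *_) (trans (sum-δʳ (λ z → s z * s (z ⊝ 𝟏)) 𝟎) (trans (cong (_* s (𝟎 ⊝ 𝟏)) s-0) (ℤ.*-zeroˡ (s (𝟎 ⊝ 𝟏)))))))
             sum-s-s₁) ⟩
    + q * 0ℤ - - 1ℤ
      ≡⟨ cong (λ u → u - - 1ℤ) (ℤ.*-zeroʳ (+ q)) ⟩
    1ℤ ∎
    where
    l₁ : ∀ a b c d → a * (b * (c * d)) ≡ b * c * (a * d)
    l₁ = solve-∀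
    l₂ : ∀ a b q d → a * b * (q * d - 1ℤ) ≡ q * (d * (a * b)) - a * b
    l₂ = solve-∀

  lam-1 : lam 𝟏 ≡ - 1ℤ
  lam-1 = trans (sum-cong λ z → trans (cong (s z *_) (s-squared (z ⊝ 𝟏)))
        (trans (l (s z) (δ (z ⊝ 𝟏) 𝟎)) (cong (λ u → s z - u * s z) (δ-⇔ {a = z ⊝ 𝟏} {𝟎} {z} {𝟏} ⊝-≡0 λ { refl → ⊝-self 𝟏 }))))
    (trans (sum-sub s (λ z → δ z 𝟏 * s z)) (cong₂ _-_ sum-s (trans (sum-δʳ s 𝟏) s-1)))
    where
    l : ∀ a d → a * (1ℤ - d) ≡ a - d * a
    l = solve-∀

  -- `lam-landen` replaces d² by r = 4 d / (1 + d)², with s r = s d. For w ≠ 0 the d with r = w are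
  -- the roots of a quadratic of discriminant 16 (1 - w), so there are 1 + s (w - 1) of them; the
  -- second summand produces `W`.
  V≡W : V ≡ W
  V≡W = begin
    V
      ≡⟨ sum-cong (λ d → pointwise d (d Fin.≟ ⊖ 𝟏) (d Fin.≟ 𝟎)) ⟩
    sum (λ d → δ d (⊖ 𝟏) * lam 𝟏 + h (r d))
      ≡⟨ trans (sum-+ (λ d → δ d (⊖ 𝟏) * lam 𝟏) (λ d → h (r d))) (cong₂ _+_ (trans (sum-δʳ (λ _ → lam 𝟏) (⊖ 𝟏)) lam-1) (sum-fibre r h)) ⟩
    - 1ℤ + sum (λ w → sum (λ d → δ (r d) w) * h w)
      ≡⟨ cong (λ u → - 1ℤ + u) (sum-cong λ w → fibre w (w Fin.≟ 𝟎)) ⟩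
    - 1ℤ + sum (λ w → s w * lam w + s w * (s (w ⊝ 𝟏) * lam w))
      -- The exceptional point d = -1, where Landen's parameter degenerates, has contributed lam 1 =
      -- -1. This cancels the sum of s w lam w, which is 1.
      ≡⟨ cong (λ u → - 1ℤ + u) (trans (sum-+ (λ w → s w * lam w) (λ w → s w * (s (w ⊝ 𝟏) * lam w))) (cong (λ u → u + W) sum-s-lam)) ⟩
    - 1ℤ + (1ℤ + W)
      ≡⟨ l W ⟩
    W ∎
    where
    l : ∀ w → - 1ℤ + (1ℤ + w) ≡ w
    l = solve-∀
    h : Fin q → ℤ
    h w = s w * lam w
    h-0 : h 𝟎 ≡ 0ℤ
    h-0 = trans (cong (_* lam 𝟎) s-0) (ℤ.*-zeroˡ (lam 𝟎))
    c : Fin q → Fin q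
    c d = (𝟏 ⊕ d) ⊗ (𝟏 ⊕ d)
    r : Fin q → Fin q
    r d = ⟨ + 4 ⟩ ⊗ d ⊗ inv (c d)
    1+d≡0 : ∀ {d} → 𝟏 ⊕ d ≡ 𝟎 → d ≡ ⊖ 𝟏
    1+d≡0 {d} e = ⊝-≡0 (trans (solve 1 (λ d → d :- :- con 1ℤ := con 1ℤ :+ d) refl d) e)
    r-neg-1 : r (⊖ 𝟏) ≡ 𝟎
    r-neg-1 = trans (cong (λ u → ⟨ + 4 ⟩ ⊗ ⊖ 𝟏 ⊗ inv u) (solve 0 ((con 1ℤ :- con 1ℤ) :* (con 1ℤ :- con 1ℤ) := con 0ℤ) refl))
      (trans (cong (⟨ + 4 ⟩ ⊗ ⊖ 𝟏 ⊗_) inv-0) (⊗-zeroʳ (⟨ + 4 ⟩ ⊗ ⊖ 𝟏)))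
    pointwise : ∀ d → Dec (d ≡ ⊖ 𝟏) → Dec (d ≡ 𝟎) → s d * lam (d ⊗ d) ≡ δ d (⊖ 𝟏) * lam 𝟏 + h (r d)
    pointwise d (yes refl) _ = begin
      s (⊖ 𝟏) * lam (⊖ 𝟏 ⊗ ⊖ 𝟏)
        ≡⟨ cong₂ (λ u w → u * lam w) s-neg-1 (solve 0 (:- con 1ℤ :* :- con 1ℤ := con 1ℤ) refl) ⟩
      1ℤ * lam 𝟏
        ≡⟨ sym (ℤ.+-identityʳ (1ℤ * lam 𝟏)) ⟩
      1ℤ * lam 𝟏 + 0ℤ
        ≡⟨ sym (cong₂ (λ u w → u * lam 𝟏 + w) (δ-refl (⊖ 𝟏)) (trans (cong h r-neg-1) h-0)) ⟩
      δ (⊖ 𝟏) (⊖ 𝟏) * lam 𝟏 + h (r (⊖ 𝟏)) ∎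
    pointwise d (no d≢-1) (yes refl) = trans (trans (cong (_* lam (𝟎 ⊗ 𝟎)) s-0) (ℤ.*-zeroˡ (lam (𝟎 ⊗ 𝟎))))
      (sym (cong₂ (λ u w → u * lam 𝟏 + w) (δ-≢ d≢-1) (trans (cong h (solve 1 (λ i → con (+ 4) :* con 0ℤ :* i := con 0ℤ) refl (inv (c 𝟎)))) h-0)))
    pointwise d (no d≢-1) (no d≢0) = begin
      s d * lam (d ⊗ d)
        ≡⟨ cong₂ _*_ (sym s-r) (lam-landen d≢0 (d≢-1 ∘ 1+d≡0)) ⟩
      h (r d)
        ≡⟨ sym (trans (cong (λ u → u * lam 𝟏 + h (r d)) (δ-≢ d≢-1)) (ℤ.+-identityˡ (h (r d)))) ⟩
      δ d (⊖ 𝟏) * lam 𝟏 + h (r d) ∎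
      where
      s-r : s (r d) ≡ s d
      s-r = trans (s-mul (⟨ + 4 ⟩ ⊗ d) (inv (c d))) (trans
        (cong₂ _*_ (trans (s-mul ⟨ + 4 ⟩ d) (trans (cong (_* s d) s-4) (ℤ.*-identityˡ (s d))))
                   (trans (s-inv (c d)) (s-square (d≢-1 ∘ 1+d≡0))))
        (ℤ.*-identityʳ (s d)))
    root : ∀ {w} → w ≢ 𝟎 → ∀ d → Dec (d ≡ ⊖ 𝟏) → δ (r d) w ≡ δ (w ⊗ (d ⊗ d) ⊕ (⟨ + 2 ⟩ ⊗ w ⊝ ⟨ + 4 ⟩) ⊗ d ⊕ w) 𝟎
    root {w} w≢0 d (yes refl) = trans (δ-≢ λ e → w≢0 (trans (sym e) r-neg-1)) (sym (δ-≢ λ e → 4≢0 (trans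
      (solve 1 (λ w → con (+ 4) := w :* (:- con 1ℤ :* :- con 1ℤ) :+ (con (+ 2) :* w :- con (+ 4)) :* :- con 1ℤ :+ w) refl w) e)))
    root {w} w≢0 d (no d≢-1) = δ-⇔ {a = r d} {w} {w ⊗ (d ⊗ d) ⊕ (⟨ + 2 ⟩ ⊗ w ⊝ ⟨ + 4 ⟩) ⊗ d ⊕ w} {𝟎}
      (λ e → trans expand (trans (cong (c d ⊗_) (trans (cong (w ⊝_) e) (⊝-self w))) (⊗-zeroʳ (c d))))
      (λ e → sym (⊝-≡0 (integral c≢0 (trans (sym expand) e))))
      where
      c≢0 : c d ≢ 𝟎
      c≢0 = ⊗-≢0 (d≢-1 ∘ 1+d≡0) (d≢-1 ∘ 1+d≡0)
      expand : w ⊗ (d ⊗ d) ⊕ (⟨ + 2 ⟩ ⊗ w ⊝ ⟨ + 4 ⟩) ⊗ d ⊕ w ≡ c d ⊗ (w ⊝ r d)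
      expand = trans (solve 2 (λ w d → w :* (d :* d) :+ (con (+ 2) :* w :- con (+ 4)) :* d :+ w :=
                                      (con 1ℤ :+ d) :* (con 1ℤ :+ d) :* w :- con (+ 4) :* d :* con 1ℤ) refl w d)
        (trans (cong (λ u → c d ⊗ w ⊝ ⟨ + 4 ⟩ ⊗ d ⊗ u) (sym (⊗-inv c≢0)))
          (solve 4 (λ c w x i → c :* w :- x :* (c :* i) := c :* (w :- x :* i)) refl (c d) w (⟨ + 4 ⟩ ⊗ d) (inv (c d))))
    fibre : ∀ w → Dec (w ≡ 𝟎) → sum (λ d → δ (r d) w) * h w ≡ s w * lam w + s w * (s (w ⊝ 𝟏) * lam w)
    fibre w (yes refl) = trans (cong (sum (λ d → δ (r d) 𝟎) *_) h-0) (trans (ℤ.*-zeroʳ (sum (λ d → δ (r d) 𝟎)))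
      (sym (cong₂ _+_ h-0 (trans (cong (_* (s (𝟎 ⊝ 𝟏) * lam 𝟎)) s-0) (ℤ.*-zeroˡ (s (𝟎 ⊝ 𝟏) * lam 𝟎))))))
    fibre w (no w≢0) = trans (cong (_* h w) count) (l₁ (s w) (lam w) (s (w ⊝ 𝟏)))
      where
      b = ⟨ + 2 ⟩ ⊗ w ⊝ ⟨ + 4 ⟩
      l₁ : ∀ a b c → (1ℤ + c) * (a * b) ≡ a * b + a * (c * b)
      l₁ = solve-∀
      count : sum (λ d → δ (r d) w) ≡ 1ℤ + s (w ⊝ 𝟏)
      count = begin
        sum (λ d → δ (r d) w)
          ≡⟨ sum-cong (λ d → root w≢0 d (d Fin.≟ ⊖ 𝟏)) ⟩
        sum (λ d → δ (w ⊗ (d ⊗ d) ⊕ b ⊗ d ⊕ w) 𝟎)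
          ≡⟨ quadratic-count w≢0 b w ⟩
        #√ (b ⊗ b ⊝ ⟨ + 4 ⟩ ⊗ (w ⊗ w))
          ≡⟨ #√-s (b ⊗ b ⊝ ⟨ + 4 ⟩ ⊗ (w ⊗ w)) ⟩
        1ℤ + s (b ⊗ b ⊝ ⟨ + 4 ⟩ ⊗ (w ⊗ w))
          ≡⟨ cong (λ u → 1ℤ + u) (trans (cong s (solve 1 (λ w → (con (+ 2) :* w :- con (+ 4)) :* (con (+ 2) :* w :- con (+ 4)) :- con (+ 4) :* (w :* w) :=
                                                   con (+ 4) :* con (+ 4) :* (con 1ℤ :- w)) refl w))
               (trans (s-square-mul 4≢0 (𝟏 ⊝ w)) (s-⊝-comm 𝟏 w))) ⟩
        1ℤ + s (w ⊝ 𝟏) ∎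

  W-value : W ≡ S 𝟏 * S 𝟏 - + 2 * + q
  W-value = trans (sym V≡W) (trans (l V (+ 2 * + q)) (cong (λ u → u - + 2 * + q) (sym S₁²≡2q+V)))
    where
    l : ∀ v q → v ≡ q + v - q
    l = solve-∀

  -- Subgraph counts of Paley graphs

  -- 4 times the indicator of the common neighbours of 𝟎 and 𝟏 in the Paley graph.
  β : Fin q → ℤ
  β y = (1ℤ - δ y 𝟏 + s (y ⊝ 𝟏)) * (1ℤ - δ y 𝟎 + s y)

  -- Products of δ with a character value collapse because s (-1) and s 1 are both 1; this is the
  -- origin of the two coefficients -2.
  β-expand : ∀ y → β y ≡ 1ℤ + s y + s (y ⊝ 𝟏) + s y * s (y ⊝ 𝟏) - + 2 * δ y 𝟎 - + 2 * δ y 𝟏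
  β-expand y = trans (l (δ y 𝟎) (δ y 𝟏) (s y) (s (y ⊝ 𝟏)))
    (trans (cong₂ (λ u w → 1ℤ + s y + s (y ⊝ 𝟏) + s y * s (y ⊝ 𝟏) - (δ y 𝟎 + u) - (δ y 𝟏 + w) + δ y 𝟏 * δ y 𝟎) at-0 at-1)
    (trans (cong (λ u → 1ℤ + s y + s (y ⊝ 𝟏) + s y * s (y ⊝ 𝟏) - (δ y 𝟎 + δ y 𝟎) - (δ y 𝟏 + δ y 𝟏) + u) disjoint)
      (l₂ (1ℤ + s y + s (y ⊝ 𝟏) + s y * s (y ⊝ 𝟏)) (δ y 𝟎) (δ y 𝟏))))
    where
    at : ∀ c (f : Fin q → ℤ) k → f c ≡ k → δ y c * f y ≡ δ y c * k
    at c f k h = trans (cong (_* f y) (δ-sym y c)) (trans (δ-subst f c y) (cong₂ _*_ (δ-sym c y) h))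
    at-0 : δ y 𝟎 * s (y ⊝ 𝟏) ≡ δ y 𝟎
    at-0 = trans (at 𝟎 (λ y → s (y ⊝ 𝟏)) 1ℤ (trans (cong s (⊕-identityˡ (⊖ 𝟏))) s-neg-1)) (ℤ.*-identityʳ (δ y 𝟎))
    at-1 : δ y 𝟏 * s y ≡ δ y 𝟏
    at-1 = trans (at 𝟏 s 1ℤ s-1) (ℤ.*-identityʳ (δ y 𝟏))
    disjoint : δ y 𝟏 * δ y 𝟎 ≡ 0ℤ
    disjoint = trans (at 𝟏 (λ y → δ y 𝟎) 0ℤ (δ-≢ 1≢0)) (ℤ.*-zeroʳ (δ y 𝟏))
    l : ∀ d e a b → (1ℤ - e + b) * (1ℤ - d + a) ≡ 1ℤ + a + b + a * b - (d + d * b) - (e + e * a) + e * d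
    l = solve-∀
    l₂ : ∀ t d e → t - (d + d) - (e + e) + 0ℤ ≡ t - + 2 * d - + 2 * e
    l₂ = solve-∀

  sum-β : ∀ f → sum (λ y → β y * f y) ≡
    sum f + sum (λ y → s y * f y) + sum (λ y → s (y ⊝ 𝟏) * f y) + sum (λ y → s y * s (y ⊝ 𝟏) * f y) - + 2 * f 𝟎 - + 2 * f 𝟏
  sum-β f = begin
    sum (λ y → β y * f y)
      ≡⟨ sum-cong (λ y → trans (cong (_* f y) (β-expand y)) (l (s y) (s (y ⊝ 𝟏)) (δ y 𝟎) (δ y 𝟏) (f y))) ⟩
    sum (λ y → f y + s y * f y + s (y ⊝ 𝟏) * f y + s y * s (y ⊝ 𝟏) * f y - + 2 * (δ y 𝟎 * f y) - + 2 * (δ y 𝟏 * f y))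
      ≡⟨ trans (sum-sub (λ y → f y + s y * f y + s (y ⊝ 𝟏) * f y + s y * s (y ⊝ 𝟏) * f y - + 2 * (δ y 𝟎 * f y)) (λ y → + 2 * (δ y 𝟏 * f y)))
         (cong₂ _-_
           (trans (sum-sub (λ y → f y + s y * f y + s (y ⊝ 𝟏) * f y + s y * s (y ⊝ 𝟏) * f y) (λ y → + 2 * (δ y 𝟎 * f y)))
             (cong₂ _-_
               (trans (sum-+ (λ y → f y + s y * f y + s (y ⊝ 𝟏) * f y) (λ y → s y * s (y ⊝ 𝟏) * f y))
                 (cong (λ u → u + sum (λ y → s y * s (y ⊝ 𝟏) * f y))
                   (trans (sum-+ (λ y → f y + s y * f y) (λ y → s (y ⊝ 𝟏) * f y))
                     (cong (λ u → u + sum (λ y → s (y ⊝ 𝟏) * f y)) (sum-+ f (λ y → s y * f y))))))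
               (trans (sum-scale (+ 2) (λ y → δ y 𝟎 * f y)) (cong (+ 2 *_) (sum-δʳ f 𝟎)))))
           (trans (sum-scale (+ 2) (λ y → δ y 𝟏 * f y)) (cong (+ 2 *_) (sum-δʳ f 𝟏)))) ⟩
    sum f + sum (λ y → s y * f y) + sum (λ y → s (y ⊝ 𝟏) * f y) + sum (λ y → s y * s (y ⊝ 𝟏) * f y) - + 2 * f 𝟎 - + 2 * f 𝟏 ∎
    where
    l : ∀ a b d e f → (1ℤ + a + b + a * b - + 2 * d - + 2 * e) * f ≡
        f + a * f + b * f + a * b * f - + 2 * (d * f) - + 2 * (e * f)
    l = solve-∀

  sum-s² : sum (λ y → s y * s y) ≡ + q - 1ℤ
  sum-s² = trans (sum-cong s-squared) sum-nonzero

  sum-s₁² : sum (λ y → s (y ⊝ 𝟏) * s (y ⊝ 𝟏)) ≡ + q - 1ℤ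
  sum-s₁² = trans (sum-shift (⊖ 𝟏) (λ y → s y * s y)) sum-s²

  sum-s₁ : sum (λ y → s (y ⊝ 𝟏)) ≡ 0ℤ
  sum-s₁ = sum-s-shift (⊖ 𝟏)

  s-neg1 : s (𝟎 ⊝ 𝟏) ≡ 1ℤ
  s-neg1 = trans (cong s (⊕-identityˡ (⊖ 𝟏))) s-neg-1

  s-self : ∀ x → s (x ⊝ x) ≡ 0ℤ
  s-self x = trans (cong s (⊝-self x)) s-0

  sum-punctured : ∀ c (f : Fin q → ℤ) → sum (λ x → (1ℤ - δ x c) * f x) ≡ sum f - f c
  sum-punctured c f = trans (sum-cong λ x → l (δ x c) (f x))
    (trans (sum-sub f (λ x → δ x c * f x)) (cong (λ u → sum f - u) (sum-δʳ f c)))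
    where
    l : ∀ d f → (1ℤ - d) * f ≡ f - d * f
    l = solve-∀

  sum-s-s₁-s : sum (λ y → s y * s (y ⊝ 𝟏) * s y) ≡ - 1ℤ
  sum-s-s₁-s = trans (sum-cong λ y → trans (l (s y) (s (y ⊝ 𝟏))) (cong (_* s (y ⊝ 𝟏)) (s-squared y)))
    (trans (sum-punctured 𝟎 (λ y → s (y ⊝ 𝟏))) (cong₂ _-_ sum-s₁ s-neg1))
    where
    l : ∀ a b → a * b * a ≡ a * a * b
    l = solve-∀

  sum-s-s₁-s₁ : sum (λ y → s y * s (y ⊝ 𝟏) * s (y ⊝ 𝟏)) ≡ - 1ℤ
  sum-s-s₁-s₁ = trans (sum-cong λ y → trans (l (s y) (s (y ⊝ 𝟏))) (cong (_* s y) (trans (s-squared (y ⊝ 𝟏))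
        (cong (λ u → 1ℤ - u) (δ-⇔ {a = y ⊝ 𝟏} {𝟎} {y} {𝟏} ⊝-≡0 λ { refl → ⊝-self 𝟏 })))))
    (trans (sum-punctured 𝟏 s) (cong₂ _-_ sum-s s-1))
    where
    l : ∀ a b → a * b * b ≡ b * b * a
    l = solve-∀

  β-total : sum β ≡ + q - + 5
  β-total = trans (sum-cong λ y → sym (ℤ.*-identityʳ (β y))) (trans (sum-β (λ _ → 1ℤ)) (trans
    (cong (λ u → u - + 2 * 1ℤ - + 2 * 1ℤ)
      (cong₂ _+_ (cong₂ _+_ (cong₂ _+_ (trans (sum-const q 1ℤ) (ℤ.*-identityʳ (+ q)))
          (trans (sum-cong λ y → ℤ.*-identityʳ (s y)) sum-s))
        (trans (sum-cong λ y → ℤ.*-identityʳ (s (y ⊝ 𝟏))) sum-s₁))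
        (trans (sum-cong λ y → ℤ.*-identityʳ (s y * s (y ⊝ 𝟏))) sum-s-s₁)))
    (l (+ q))))
    where
    l : ∀ q → q + 0ℤ + 0ℤ + - 1ℤ - + 2 * 1ℤ - + 2 * 1ℤ ≡ q - + 5
    l = solve-∀

  β-s : sum (λ y → β y * s y) ≡ + q - + 5
  β-s = trans (sum-β s) (trans
    (cong₂ (λ u w → u - + 2 * proj₁ w - + 2 * proj₂ w)
      (cong₂ _+_ (cong₂ _+_ (cong₂ _+_ sum-s sum-s²)
        (trans (sum-cong λ y → ℤ.*-comm (s (y ⊝ 𝟏)) (s y)) sum-s-s₁)) sum-s-s₁-s)
      (cong₂ _,_ s-0 s-1))
    (l (+ q)))
    where
    l : ∀ q → 0ℤ + (q - 1ℤ) + - 1ℤ + - 1ℤ - + 2 * 0ℤ - + 2 * 1ℤ ≡ q - + 5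
    l = solve-∀

  β-s₁ : sum (λ y → β y * s (y ⊝ 𝟏)) ≡ + q - + 5
  β-s₁ = trans (sum-β (λ y → s (y ⊝ 𝟏))) (trans
    (cong₂ (λ u w → u - + 2 * proj₁ w - + 2 * proj₂ w)
      (cong₂ _+_ (cong₂ _+_ (cong₂ _+_ sum-s₁ sum-s-s₁) sum-s₁²) sum-s-s₁-s₁)
      (cong₂ _,_ s-neg1 (s-self 𝟏)))
    (l (+ q)))
    where
    l : ∀ q → 0ℤ + - 1ℤ + (q - 1ℤ) + - 1ℤ - + 2 * 1ℤ - + 2 * 0ℤ ≡ q - + 5
    l = solve-∀

  lam-0 : lam 𝟎 ≡ - 1ℤ
  lam-0 = trans (sum-cong λ z → trans (cong (λ u → s z * (s (z ⊝ 𝟏) * s u)) (solve 1 (λ z → z :- con 0ℤ := z) refl z))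
                                      (l (s z) (s (z ⊝ 𝟏)))) sum-s-s₁-s
    where
    l : ∀ a b → a * (b * a) ≡ a * b * a
    l = solve-∀

  -- Interchanging the two sums leaves, for each z, a correlation of f with a shifted character,
  -- which `jacobsthal` evaluates when f is a character itself.
  sum-lam-weighted : ∀ (f : Fin q → ℤ) → sum (λ w → f w * lam w) ≡ sum (λ z → s z * s (z ⊝ 𝟏) * sum (λ w → f w * s (w ⊝ z)))
  sum-lam-weighted f = begin
    sum (λ w → f w * lam w)
      ≡⟨ trans (sum-cong λ w → sym (sum-scale (f w) (λ z → s z * (s (z ⊝ 𝟏) * s (z ⊝ w)))))
           (∑-comm λ w z → f w * (s z * (s (z ⊝ 𝟏) * s (z ⊝ w)))) ⟩
    sum₂ (λ z w → f w * (s z * (s (z ⊝ 𝟏) * s (z ⊝ w))))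
      ≡⟨ sum-cong (λ z → trans (sum-cong λ w → trans (cong (λ u → f w * (s z * (s (z ⊝ 𝟏) * u))) (s-⊝-comm z w))
                                                     (l (f w) (s z) (s (z ⊝ 𝟏)) (s (w ⊝ z))))
           (sum-scale (s z * s (z ⊝ 𝟏)) (λ w → f w * s (w ⊝ z)))) ⟩
    sum (λ z → s z * s (z ⊝ 𝟏) * sum (λ w → f w * s (w ⊝ z))) ∎
    where
    l : ∀ a b c d → a * (b * (c * d)) ≡ b * c * (a * d)
    l = solve-∀

  sum-lam : sum lam ≡ 0ℤ
  sum-lam = trans (sum-cong λ w → sym (ℤ.*-identityˡ (lam w))) (trans (sum-lam-weighted (λ _ → 1ℤ))
    (trans (sum-cong λ z → trans (cong (s z * s (z ⊝ 𝟏) *_)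
        (trans (sum-cong λ w → ℤ.*-identityˡ (s (w ⊝ z))) (sum-s-shift (⊖ z)))) (ℤ.*-zeroʳ (s z * s (z ⊝ 𝟏))))
      (sum-0 {q})))

  sum-s₁-lam : sum (λ w → s (w ⊝ 𝟏) * lam w) ≡ 1ℤ
  sum-s₁-lam = trans (sum-lam-weighted (λ w → s (w ⊝ 𝟏)))
    (trans (sum-cong λ z → trans (cong (s z * s (z ⊝ 𝟏) *_) (trans (jacobsthal 𝟏 z) (cong (λ u → + q * u - 1ℤ) (δ-sym 𝟏 z))))
             (l (s z * s (z ⊝ 𝟏)) (+ q) (δ z 𝟏)))
    (trans (sum-sub (λ z → + q * (δ z 𝟏 * (s z * s (z ⊝ 𝟏)))) (λ z → s z * s (z ⊝ 𝟏)))
      (cong₂ _-_ (trans (sum-scale (+ q) (λ z → δ z 𝟏 * (s z * s (z ⊝ 𝟏))))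
        (trans (cong (+ q *_) (trans (sum-δʳ (λ z → s z * s (z ⊝ 𝟏)) 𝟏) (trans (cong (s 𝟏 *_) (s-self 𝟏)) (ℤ.*-zeroʳ (s 𝟏)))))
               (ℤ.*-zeroʳ (+ q)))) sum-s-s₁)))
    where
    l : ∀ a q d → a * (q * d - 1ℤ) ≡ q * (d * a) - a
    l = solve-∀

  β-lam : sum (λ y → β y * lam y) ≡ W + + 6
  β-lam = trans (sum-β lam) (trans
    (cong₂ (λ u w → u - + 2 * proj₁ w - + 2 * proj₂ w)
      (cong₂ _+_ (cong₂ _+_ (cong₂ _+_ sum-lam sum-s-lam) sum-s₁-lam)
        (sum-cong λ w → ℤ.*-assoc (s w) (s (w ⊝ 𝟏)) (lam w)))
      (cong₂ _,_ lam-0 lam-1))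
    (l W))
    where
    l : ∀ w → 0ℤ + 1ℤ + 1ℤ + w - + 2 * - 1ℤ - + 2 * - 1ℤ ≡ w + + 6
    l = solve-∀

  β-transform : ∀ w → sum (λ y → β y * s (y ⊝ w)) ≡
    (+ q * δ w 𝟎 - 1ℤ) + (+ q * δ w 𝟏 - 1ℤ) + lam w - + 2 * s w - + 2 * s (w ⊝ 𝟏)
  β-transform w = trans (sum-β (λ y → s (y ⊝ w))) (trans
    (cong₂ (λ u t → u - + 2 * proj₁ t - + 2 * proj₂ t)
      (cong₂ _+_ (cong₂ _+_ (cong₂ _+_ (sum-s-shift (⊖ w)) (jacobsthal-0 w)) (trans (jacobsthal 𝟏 w) (cong (λ u → + q * u - 1ℤ) (δ-sym 𝟏 w))))
        (sum-cong λ y → ℤ.*-assoc (s y) (s (y ⊝ 𝟏)) (s (y ⊝ w))))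
      (cong₂ _,_ (trans (cong s (⊕-identityˡ (⊖ w))) (s-neg w)) (s-⊝-comm 𝟏 w)))
    (l (+ q * δ w 𝟎 - 1ℤ) (+ q * δ w 𝟏 - 1ℤ) (lam w) (s w) (s (w ⊝ 𝟏))))
    where
    l : ∀ a b c d e → 0ℤ + a + b + c - + 2 * d - + 2 * e ≡ a + b + c - + 2 * d - + 2 * e
    l = solve-∀

  β-0 : β 𝟎 ≡ 0ℤ
  β-0 = trans (cong₂ (λ d e → (1ℤ - δ 𝟎 𝟏 + s (𝟎 ⊝ 𝟏)) * (1ℤ - d + e)) (δ-refl 𝟎) s-0) (ℤ.*-zeroʳ (1ℤ - δ 𝟎 𝟏 + s (𝟎 ⊝ 𝟏)))

  β-1 : β 𝟏 ≡ 0ℤ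
  β-1 = trans (cong₂ (λ d e → (1ℤ - d + e) * (1ℤ - δ 𝟏 𝟎 + s 𝟏)) (δ-refl 𝟏) (s-self 𝟏)) (ℤ.*-zeroˡ (1ℤ - δ 𝟏 𝟎 + s 𝟏))

  -- As `β` is 4 times an indicator, this is 16 times the excess of adjacent over distinct
  -- nonadjacent ordered pairs among the common neighbours of 0 and 1. `β-transform` contains `lam`,
  -- and its pairing with the product of characters in `β` yields `W`.
  β-β-s : sum₂ (λ y w → β y * β w * s (y ⊝ w)) ≡ W - + 6 * + q + + 36
  β-β-s = begin
    sum₂ (λ y w → β y * β w * s (y ⊝ w))
      ≡⟨ ∑-comm (λ y w → β y * β w * s (y ⊝ w)) ⟩
    sum₂ (λ w y → β y * β w * s (y ⊝ w))
      ≡⟨ sum-cong (λ w → trans (sum-cong λ y → l₁ (β y) (β w) (s (y ⊝ w)))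
           (trans (sum-scale (β w) (λ y → β y * s (y ⊝ w))) (trans (cong (β w *_) (β-transform w))
             (l₂ (β w) (+ q) (δ w 𝟎) (δ w 𝟏) (lam w) (s w) (s (w ⊝ 𝟏)))))) ⟩
    sum (λ w → + q * (δ w 𝟎 * β w) + + q * (δ w 𝟏 * β w) + β w * lam w
               - + 2 * β w - + 2 * (β w * s w) - + 2 * (β w * s (w ⊝ 𝟏)))
      ≡⟨ trans (sum-sub g₄ (λ w → + 2 * (β w * s (w ⊝ 𝟏)))) (cong₂ _-_
           (trans (sum-sub g₃ (λ w → + 2 * (β w * s w))) (cong₂ _-_
             (trans (sum-sub g₂ (λ w → + 2 * β w)) (cong₂ _-_
               (trans (sum-+ g₁ (λ w → β w * lam w)) (cong₂ _+_
                 (trans (sum-+ (λ w → + q * (δ w 𝟎 * β w)) (λ w → + q * (δ w 𝟏 * β w))) (cong₂ _+_ (pick 𝟎 β-0) (pick 𝟏 β-1)))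
                 β-lam))
               (trans (sum-scale (+ 2) β) (cong (+ 2 *_) β-total))))
             (trans (sum-scale (+ 2) (λ w → β w * s w)) (cong (+ 2 *_) β-s))))
           (trans (sum-scale (+ 2) (λ w → β w * s (w ⊝ 𝟏))) (cong (+ 2 *_) β-s₁))) ⟩
    0ℤ + 0ℤ + (W + + 6) - + 2 * (+ q - + 5) - + 2 * (+ q - + 5) - + 2 * (+ q - + 5)
      ≡⟨ l₃ W (+ q) ⟩
    W - + 6 * + q + + 36 ∎
    where
    g₁ g₂ g₃ g₄ : Fin q → ℤ
    g₁ w = + q * (δ w 𝟎 * β w) + + q * (δ w 𝟏 * β w)
    g₂ w = g₁ w + β w * lam w
    g₃ w = g₂ w - + 2 * β w
    g₄ w = g₃ w - + 2 * (β w * s w)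
    pick : ∀ c → β c ≡ 0ℤ → sum (λ w → + q * (δ w c * β w)) ≡ 0ℤ
    pick c h = trans (sum-scale (+ q) (λ w → δ w c * β w)) (trans (cong (+ q *_) (trans (sum-δʳ β c) h)) (ℤ.*-zeroʳ (+ q)))
    l₁ : ∀ a b c → a * b * c ≡ b * (a * c)
    l₁ = solve-∀
    l₂ : ∀ b q d e l s t → b * ((q * d - 1ℤ) + (q * e - 1ℤ) + l - + 2 * s - + 2 * t) ≡
         q * (d * b) + q * (e * b) + b * l - + 2 * b - + 2 * (b * s) - + 2 * (b * t)
    l₂ = solve-∀
    l₃ : ∀ w q → 0ℤ + 0ℤ + (w + + 6) - + 2 * (q - + 5) - + 2 * (q - + 5) - + 2 * (q - + 5) ≡ w - + 6 * q + + 36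
    l₃ = solve-∀

  -- Strong regularity, induced 4-cycles and 4-cliques

  module _ {A : Weights q} (adj : IsAdjacency A) (A-s : ∀ x y → + 2 * A x y ≡ 1ℤ - δ x y + s (x ⊝ y)) where
    open IsAdjacency adj
    private
      C : Weights q
      C = complement A
      module C = IsAdjacency (complement-adj adj)

      M : ℤ
      M = + m

      E : ℤ
      E = edges A

    C-s : ∀ x y → + 2 * C x y ≡ 1ℤ - δ x y - s (x ⊝ y)
    C-s x y = trans (l₁ (δ x y) (A x y)) (trans (cong (λ u → + 2 - + 2 * δ x y - u) (A-s x y)) (l₂ (δ x y) (s (x ⊝ y))))
      where
      l₁ : ∀ d a → + 2 * (1ℤ - d - a) ≡ + 2 - + 2 * d - + 2 * a
      l₁ = solve-∀
      l₂ : ∀ d s → + 2 - + 2 * d - (1ℤ - d + s) ≡ 1ℤ - d - s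
      l₂ = solve-∀

    A*s : ∀ x y → A x y * s (x ⊝ y) ≡ A x y
    A*s x y = begin
      A x y * s (x ⊝ y)
        ≡⟨ l₁ (A x y) (δ x y) (s (x ⊝ y)) ⟩
      A x y * (1ℤ - δ x y + s (x ⊝ y)) - A x y + A x y * δ x y
        ≡⟨ cong₂ (λ u w → A x y * u - A x y + w) (sym (A-s x y)) (Aδ≡0 x y) ⟩
      A x y * (+ 2 * A x y) - A x y + 0ℤ
        ≡⟨ l₂ (A x y) ⟩
      + 2 * (A x y * A x y) - A x y
        ≡⟨ cong (λ u → + 2 * u - A x y) (idem x y) ⟩
      + 2 * A x y - A x y
        ≡⟨ l₃ (A x y) ⟩
      A x y ∎
      where
      l₁ : ∀ a d s → a * s ≡ a * (1ℤ - d + s) - a + a * d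
      l₁ = solve-∀
      l₂ : ∀ a → a * (+ 2 * a) - a + 0ℤ ≡ + 2 * (a * a) - a
      l₂ = solve-∀
      l₃ : ∀ a → + 2 * a - a ≡ a
      l₃ = solve-∀

    C*s : ∀ x y → C x y * s (x ⊝ y) ≡ - C x y
    C*s x y = begin
      C x y * s (x ⊝ y)
        ≡⟨ l₁ (C x y) (δ x y) (s (x ⊝ y)) ⟩
      C x y * (1ℤ - δ x y + s (x ⊝ y)) - C x y + C x y * δ x y
        ≡⟨ cong₂ (λ u w → C x y * u - C x y + w) (sym (A-s x y)) (C.Aδ≡0 x y) ⟩
      C x y * (+ 2 * A x y) - C x y + 0ℤ
        ≡⟨ l₂ (C x y) (A x y) ⟩
      + 2 * (C x y * A x y) - C x y
        ≡⟨ cong (λ u → + 2 * u - C x y) (A-complement adj x y) ⟩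
      + 2 * 0ℤ - C x y
        ≡⟨ ℤ.+-identityˡ (- C x y) ⟩
      - C x y ∎
      where
      l₁ : ∀ a d s → a * s ≡ a * (1ℤ - d + s) - a + a * d
      l₁ = solve-∀
      l₂ : ∀ c a → c * (+ 2 * a) - c + 0ℤ ≡ + 2 * (c * a) - c
      l₂ = solve-∀

    sum₂-s : sum₂ (λ x y → s (x ⊝ y)) ≡ 0ℤ
    sum₂-s = trans (sum-cong λ x → trans (sum-cong λ y → s-⊝-comm x y) (sum-s-shift (⊖ x))) (sum-0 {q})

    sum₂-1-δ : sum₂ {q} (λ x y → 1ℤ - δ x y) ≡ + q * (+ q - 1ℤ)
    sum₂-1-δ = trans (sum-cong {q} λ x → trans (sum-sub {q} (λ _ → 1ℤ) (δ x))
        (cong₂ _-_ (trans (sum-const q 1ℤ) (ℤ.*-identityʳ (+ q))) (sum-δ-1 x)))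
      (sum-const q (+ q - 1ℤ))

    edges-value : + 2 * E ≡ + q * (+ q - 1ℤ)
    edges-value = trans (sym (sum₂-scale (+ 2) A)) (trans (sum₂-cong A-s) (trans (sum₂-+ (λ x y → 1ℤ - δ x y) (λ x y → s (x ⊝ y)))
      (trans (cong₂ _+_ sum₂-1-δ sum₂-s) (ℤ.+-identityʳ (+ q * (+ q - 1ℤ))))))

    sum-C : sum₂ C ≡ E
    sum-C = ℤ.*-cancelˡ-≡ (+ 2) (sum₂ C) E (trans (sym (sum₂-scale (+ 2) C)) (trans (sum₂-cong C-s)
      (trans (sum₂-sub (λ x y → 1ℤ - δ x y) (λ x y → s (x ⊝ y)))
        (trans (cong₂ _-_ sum₂-1-δ sum₂-s) (trans (ℤ.+-identityʳ (+ q * (+ q - 1ℤ))) (sym edges-value))))))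

    codegree : Weights q
    codegree x y = sum λ z → A x z * A z y

    -- The only product of two characters in the expansion is s (z - x) s (z - y), whose sum over z
    -- is given by `jacobsthal`. The codegree is therefore m - 1 on edges, m on non-edges and 2 m on
    -- the diagonal: strong regularity.
    codegree-value : ∀ x y → + 4 * codegree x y ≡ + q - + 3 + (+ q + 1ℤ) * δ x y - + 2 * s (x ⊝ y)
    codegree-value x y = begin
      + 4 * codegree x y
        ≡⟨ sym (sum-scale (+ 4) (λ z → A x z * A z y)) ⟩
      sum (λ z → + 4 * (A x z * A z y))
        ≡⟨ sum-cong (λ z → trans (l₁ (A x z) (A z y)) (trans (cong₂ _*_ (A-s x z) (A-s z y))
             (trans (cong₂ (λ a b → (1ℤ - δ x z + a) * (1ℤ - b + s (z ⊝ y))) (s-⊝-comm x z) (δ-sym z y))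
               (l₂ (δ x z) (δ y z) (s (z ⊝ x)) (s (z ⊝ y)))))) ⟩
      sum (λ z → (1ℤ - δ x z) * (1ℤ - δ y z) + (s (z ⊝ x) + s (z ⊝ y)) + s (z ⊝ x) * s (z ⊝ y)
                 - δ y z * s (z ⊝ x) - δ x z * s (z ⊝ y))
        ≡⟨ trans (sum-sub (λ z → (1ℤ - δ x z) * (1ℤ - δ y z) + (s (z ⊝ x) + s (z ⊝ y)) + s (z ⊝ x) * s (z ⊝ y) - δ y z * s (z ⊝ x))
                        (λ z → δ x z * s (z ⊝ y)))
           (cong₂ _-_
             (trans (sum-sub (λ z → (1ℤ - δ x z) * (1ℤ - δ y z) + (s (z ⊝ x) + s (z ⊝ y)) + s (z ⊝ x) * s (z ⊝ y)) (λ z → δ y z * s (z ⊝ x)))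
               (cong₂ _-_
                 (trans (sum-+ (λ z → (1ℤ - δ x z) * (1ℤ - δ y z) + (s (z ⊝ x) + s (z ⊝ y))) (λ z → s (z ⊝ x) * s (z ⊝ y)))
                   (cong₂ _+_
                     (trans (sum-+ (λ z → (1ℤ - δ x z) * (1ℤ - δ y z)) (λ z → s (z ⊝ x) + s (z ⊝ y)))
                       (cong₂ _+_ others (trans (sum-+ (λ z → s (z ⊝ x)) (λ z → s (z ⊝ y))) (cong₂ _+_ (sum-s-shift (⊖ x)) (sum-s-shift (⊖ y))))))
                     (jacobsthal x y)))
                 (trans (sum-δ (λ z → s (z ⊝ x)) y) (s-⊝-comm y x))))
             (sum-δ (λ z → s (z ⊝ y)) x)) ⟩
      + q - 1ℤ - 1ℤ + δ x y + (0ℤ + 0ℤ) + (+ q * δ x y - 1ℤ) - s (x ⊝ y) - s (x ⊝ y)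
        ≡⟨ l₃ (+ q) (δ x y) (s (x ⊝ y)) ⟩
      + q - + 3 + (+ q + 1ℤ) * δ x y - + 2 * s (x ⊝ y) ∎
      where
      l₁ : ∀ a b → + 4 * (a * b) ≡ (+ 2 * a) * (+ 2 * b)
      l₁ = solve-∀
      l₂ : ∀ d e a b → (1ℤ - d + a) * (1ℤ - e + b) ≡ (1ℤ - d) * (1ℤ - e) + (a + b) + a * b - e * a - d * b
      l₂ = solve-∀
      l₃ : ∀ q d s → q - 1ℤ - 1ℤ + d + (0ℤ + 0ℤ) + (q * d - 1ℤ) - s - s ≡ q - + 3 + (q + 1ℤ) * d - + 2 * s
      l₃ = solve-∀
      l₄ : ∀ d e → (1ℤ - d) * (1ℤ - e) ≡ 1ℤ - d - e + d * e
      l₄ = solve-∀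
      others : sum (λ z → (1ℤ - δ x z) * (1ℤ - δ y z)) ≡ + q - 1ℤ - 1ℤ + δ x y
      others = trans (sum-cong λ z → l₄ (δ x z) (δ y z)) (trans (sum-+ (λ z → 1ℤ - δ x z - δ y z) (λ z → δ x z * δ y z))
        (cong₂ _+_ (trans (sum-sub (λ z → 1ℤ - δ x z) (δ y)) (cong₂ _-_
            (trans (sum-sub (λ _ → 1ℤ) (δ x)) (cong₂ _-_ (trans (sum-const q 1ℤ) (ℤ.*-identityʳ (+ q))) (sum-δ-1 x)))
            (sum-δ-1 y)))
          (trans (sum-δ (δ y) x) (δ-sym y x))))

    A*codegree : ∀ x y → A x y * codegree x y ≡ (M - 1ℤ) * A x y
    A*codegree x y = ℤ.*-cancelˡ-≡ (+ 4) (A x y * codegree x y) ((M - 1ℤ) * A x y) (begin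
      + 4 * (A x y * codegree x y)
        ≡⟨ l₁ (A x y) (codegree x y) ⟩
      A x y * (+ 4 * codegree x y)
        ≡⟨ cong (A x y *_) (codegree-value x y) ⟩
      A x y * (+ q - + 3 + (+ q + 1ℤ) * δ x y - + 2 * s (x ⊝ y))
        ≡⟨ l₂ (A x y) (+ q) (δ x y) (s (x ⊝ y)) ⟩
      (+ q - + 3) * A x y + (+ q + 1ℤ) * (A x y * δ x y) - + 2 * (A x y * s (x ⊝ y))
        ≡⟨ cong₂ (λ u w → (+ q - + 3) * A x y + (+ q + 1ℤ) * u - + 2 * w) (Aδ≡0 x y) (A*s x y) ⟩
      (+ q - + 3) * A x y + (+ q + 1ℤ) * 0ℤ - + 2 * A x y
        ≡⟨ cong (λ t → (t - + 3) * A x y + (t + 1ℤ) * 0ℤ - + 2 * A x y) q≡ ⟩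
      (1ℤ + + 4 * M - + 3) * A x y + (1ℤ + + 4 * M + 1ℤ) * 0ℤ - + 2 * A x y
        ≡⟨ l₃ M (A x y) ⟩
      + 4 * ((M - 1ℤ) * A x y) ∎)
      where
      l₁ : ∀ a c → + 4 * (a * c) ≡ a * (+ 4 * c)
      l₁ = solve-∀
      l₂ : ∀ a q d s → a * (q - + 3 + (q + 1ℤ) * d - + 2 * s) ≡ (q - + 3) * a + (q + 1ℤ) * (a * d) - + 2 * (a * s)
      l₂ = solve-∀
      l₃ : ∀ m a → (1ℤ + + 4 * m - + 3) * a + (1ℤ + + 4 * m + 1ℤ) * 0ℤ - + 2 * a ≡ + 4 * ((m - 1ℤ) * a)
      l₃ = solve-∀

    C*codegree : ∀ x y → C x y * codegree x y ≡ M * C x y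
    C*codegree x y = ℤ.*-cancelˡ-≡ (+ 4) (C x y * codegree x y) (M * C x y) (begin
      + 4 * (C x y * codegree x y)
        ≡⟨ l₁ (C x y) (codegree x y) ⟩
      C x y * (+ 4 * codegree x y)
        ≡⟨ cong (C x y *_) (codegree-value x y) ⟩
      C x y * (+ q - + 3 + (+ q + 1ℤ) * δ x y - + 2 * s (x ⊝ y))
        ≡⟨ l₂ (C x y) (+ q) (δ x y) (s (x ⊝ y)) ⟩
      (+ q - + 3) * C x y + (+ q + 1ℤ) * (C x y * δ x y) - + 2 * (C x y * s (x ⊝ y))
        ≡⟨ cong₂ (λ u w → (+ q - + 3) * C x y + (+ q + 1ℤ) * u - + 2 * w) (C.Aδ≡0 x y) (C*s x y) ⟩
      (+ q - + 3) * C x y + (+ q + 1ℤ) * 0ℤ - + 2 * - C x y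
        ≡⟨ cong (λ t → (t - + 3) * C x y + (t + 1ℤ) * 0ℤ - + 2 * - C x y) q≡ ⟩
      (1ℤ + + 4 * M - + 3) * C x y + (1ℤ + + 4 * M + 1ℤ) * 0ℤ - + 2 * - C x y
        ≡⟨ l₃ M (C x y) ⟩
      + 4 * (M * C x y) ∎)
      where
      l₁ : ∀ a c → + 4 * (a * c) ≡ a * (+ 4 * c)
      l₁ = solve-∀
      l₂ : ∀ a q d s → a * (q - + 3 + (q + 1ℤ) * d - + 2 * s) ≡ (q - + 3) * a + (q + 1ℤ) * (a * d) - + 2 * (a * s)
      l₂ = solve-∀
      l₃ : ∀ m a → (1ℤ + + 4 * m - + 3) * a + (1ℤ + + 4 * m + 1ℤ) * 0ℤ - + 2 * - a ≡ + 4 * (m * a)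
      l₃ = solve-∀

    triangles-value : triangles A ≡ (M - 1ℤ) * E
    triangles-value = begin
      triangles A
        ≡⟨ sum₂-cong (λ x y → trans (sum-cong λ z → ℤ.*-assoc (A x y) (A y z) (A z x))
             (trans (sum-scale (A x y) (λ z → A y z * A z x))
               (trans (cong (_* codegree y x) (symm x y)) (trans (A*codegree y x) (cong ((M - 1ℤ) *_) (symm y x)))))) ⟩
      sum₂ (λ x y → (M - 1ℤ) * A x y)
        ≡⟨ sum₂-scale (M - 1ℤ) A ⟩
      (M - 1ℤ) * E ∎

    cod-pairs : ∀ {B : Weights q} k → (∀ x z → B x z * codegree x z ≡ k * B x z) →
                sum₂ (λ x z → B x z * (codegree x z * codegree x z - codegree x z)) ≡ (k * k - k) * sum₂ B
    cod-pairs {B} k h = trans (sum₂-cong λ x z → trans (l₁ (B x z) (codegree x z)) (trans (cong (λ u → u * codegree x z - u) (h x z))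
        (trans (l₂ k (B x z) (codegree x z)) (trans (cong (λ u → k * u - k * B x z) (h x z)) (l₃ k (B x z))))))
      (sum₂-scale (k * k - k) B)
      where
      l₁ : ∀ b c → b * (c * c - c) ≡ (b * c) * c - b * c
      l₁ = solve-∀
      l₂ : ∀ k b c → k * b * c - k * b ≡ k * (b * c) - k * b
      l₂ = solve-∀
      l₃ : ∀ k b → k * (k * b) - k * b ≡ (k * k - k) * b
      l₃ = solve-∀

    -- A 4-cycle is sorted by its diagonal x z; the vertices y and w are then two common neighbours
    -- of x and z, so that the codegree comes into play.
    regroup : ∀ (B B′ : Weights q) → sum₄ (quad₂ A B B′) ≡
              sum₂ (λ x z → B x z * sum₂ (λ y w → (A x y * A y z) * (A x w * A w z) * B′ y w))
    regroup B B′ = trans (sym (sum₄-swap (quad₂ A B B′)))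
      (sum₂-cong λ x z → trans (sum₂-cong λ y w → trans
          (cong₂ (λ a b → A x y * A y z * a * b * (B x z * B′ y w)) (symm z w) (symm w x))
          (l (A x y) (A y z) (A w z) (A x w) (B x z) (B′ y w)))
        (sum₂-scale (B x z) (λ y w → (A x y * A y z) * (A x w * A w z) * B′ y w)))
      where
      l : ∀ a b c d e f → a * b * c * d * (e * f) ≡ e * (a * b * (d * c) * f)
      l = solve-∀

    pairs : ∀ x z → sum₂ (λ y w → (A x y * A y z) * (A x w * A w z) * (1ℤ - δ y w)) ≡ codegree x z * codegree x z - codegree x z
    pairs x z = begin
      sum₂ (λ y w → b y * b w * (1ℤ - δ y w))
        ≡⟨ sum₂-cong (λ y w → l (b y) (b w) (δ y w)) ⟩
      sum₂ (λ y w → b y * b w - δ y w * (b y * b w))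
        ≡⟨ sum₂-sub (λ y w → b y * b w) (λ y w → δ y w * (b y * b w)) ⟩
      sum₂ (λ y w → b y * b w) - sum₂ (λ y w → δ y w * (b y * b w))
        ≡⟨ cong₂ _-_ (sum₂-product b b) (trans (sum₂-δ (λ y w → b y * b w))
             (sum-cong λ y → trans (l₂ (A x y) (A y z)) (cong₂ _*_ (idem x y) (idem y z)))) ⟩
      codegree x z * codegree x z - codegree x z ∎
      where
      b : Fin q → ℤ
      b y = A x y * A y z
      l : ∀ a b d → a * b * (1ℤ - d) ≡ a * b - d * (a * b)
      l = solve-∀
      l₂ : ∀ a b → a * b * (a * b) ≡ (a * a) * (b * b)
      l₂ = solve-∀

    -- Distinct common neighbours y, w of x and z are adjacent or not, and the number of all such
    -- pairs is fixed by the codegree.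
    quad-complement : ∀ (B : Weights q) k → (∀ x z → B x z * codegree x z ≡ k * B x z) →
                      sum₄ (quad₂ A B C) ≡ (k * k - k) * sum₂ B - sum₄ (quad₂ A B A)
    quad-complement B k h = begin
      sum₄ (quad₂ A B C)
        ≡⟨ regroup B C ⟩
      sum₂ (λ x z → B x z * sum₂ (λ y w → (A x y * A y z) * (A x w * A w z) * C y w))
        ≡⟨ sum₂-cong (λ x z → trans (cong (B x z *_) (trans
             (sum₂-cong λ y w → l (A x y * A y z * (A x w * A w z)) (δ y w) (A y w))
             (trans (sum₂-sub (λ y w → (A x y * A y z) * (A x w * A w z) * (1ℤ - δ y w)) (λ y w → (A x y * A y z) * (A x w * A w z) * A y w))
               (cong (λ u → u - sum₂ (λ y w → (A x y * A y z) * (A x w * A w z) * A y w)) (pairs x z)))))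
             (l₂ (B x z) (codegree x z * codegree x z - codegree x z) (sum₂ (λ y w → (A x y * A y z) * (A x w * A w z) * A y w)))) ⟩
      sum₂ (λ x z → B x z * (codegree x z * codegree x z - codegree x z) - B x z * sum₂ (λ y w → (A x y * A y z) * (A x w * A w z) * A y w))
        ≡⟨ trans (sum₂-sub (λ x z → B x z * (codegree x z * codegree x z - codegree x z))
                         (λ x z → B x z * sum₂ (λ y w → (A x y * A y z) * (A x w * A w z) * A y w)))
             (cong₂ _-_ (cod-pairs k h) (sym (regroup B A))) ⟩
      (k * k - k) * sum₂ B - sum₄ (quad₂ A B A) ∎
      where
      l : ∀ a d c → a * (1ℤ - d - c) ≡ a * (1ℤ - d) - a * c
      l = solve-∀
      l₂ : ∀ b p s → b * (p - s) ≡ b * p - b * s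
      l₂ = solve-∀

    -- `quad-complement` trades a nonadjacent diagonal for an adjacent one, and is applied to both
    -- diagonals in turn. The sign changes twice, so the 4-cliques return with coefficient 1.
    inducedSquares-value : inducedSquares A ≡ + 2 * (M - 1ℤ) * E + cliques₄ A
    inducedSquares-value = begin
      inducedSquares A
        ≡⟨ quad-complement C M C*codegree ⟩
      (M * M - M) * sum₂ C - sum₄ (quad₂ A C A)
        ≡⟨ cong₂ (λ u t → (M * M - M) * u - t) sum-C (trans rotated (quad-complement A (M - 1ℤ) A*codegree)) ⟩
      (M * M - M) * E - (((M - 1ℤ) * (M - 1ℤ) - (M - 1ℤ)) * E - cliques₄ A)
        ≡⟨ l M E (cliques₄ A) ⟩
      + 2 * (M - 1ℤ) * E + cliques₄ A ∎
      where
      l : ∀ m e k → (m * m - m) * e - (((m - 1ℤ) * (m - 1ℤ) - (m - 1ℤ)) * e - k) ≡ + 2 * (m - 1ℤ) * e + k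
      l = solve-∀
      l₁ : ∀ a b c d e f → a * b * c * d * (e * f) ≡ b * c * d * a * (f * e)
      l₁ = solve-∀
      rotated : sum₄ (quad₂ A C A) ≡ sum₄ (quad₂ A A C)
      rotated = trans (sum-cong λ x → sum₃-cong λ y z w → trans
          (l₁ (A x y) (A y z) (A z w) (A w x) (C x z) (A y w))
          (cong (λ u → A y z * A z w * A w x * A x y * (A y w * u)) (C.symm x z)))
        (sum₄-rotate (quad₂ A A C))

    U : Weights q
    U x z = sum₂ λ y w → (A x y * A y z) * (A x w * A w z) * s (y ⊝ w)

    -- For an edge x z the difference t = x - z is a square, so y ↦ t y + z preserves adjacency and
    -- carries 0, 1 to z, x. Hence all edges share the value computed in `β-β-s`; off the edges both
    -- sides are 0.
    A*U : ∀ x z → A x z * (+ 16 * U x z) ≡ A x z * (W - + 6 * + q + + 36)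
    A*U x z with classify (x ⊝ z)
    ... | is-zero h = trans (cong (_* (+ 16 * U x z)) A≡0) (trans (ℤ.*-zeroˡ (+ 16 * U x z))
          (sym (trans (cong (_* (W - + 6 * + q + + 36)) A≡0) (ℤ.*-zeroˡ (W - + 6 * + q + + 36)))))
      where
      A≡0 : A x z ≡ 0ℤ
      A≡0 = trans (cong (A x) (sym (⊝-≡0 h))) (irrefl x)
    ... | nonsquare h = trans (cong (_* (+ 16 * U x z)) A≡0) (trans (ℤ.*-zeroˡ (+ 16 * U x z))
          (sym (trans (cong (_* (W - + 6 * + q + + 36)) A≡0) (ℤ.*-zeroˡ (W - + 6 * + q + + 36)))))
      where
      A≡0 : A x z ≡ 0ℤ
      A≡0 = ℤ.*-cancelˡ-≡ (+ 2) (A x z) 0ℤ (trans (A-s x z) (cong₂ (λ u w → 1ℤ - u + w)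
        (δ-≢ {i = x} λ { refl → h 𝟎 (trans (⊗-zeroˡ 𝟎) (sym (⊝-self x))) }) (s-nonsquare h)))
    ... | is-square r r≢0 rr = cong (A x z *_) (begin
      + 16 * U x z
        ≡⟨ sym (sum₂-scale (+ 16) (λ y w → (A x y * A y z) * (A x w * A w z) * s (y ⊝ w))) ⟩
      sum₂ (λ y w → + 16 * ((A x y * A y z) * (A x w * A w z) * s (y ⊝ w)))
        ≡⟨ sum₂-cong (λ y w → l (A x y * A y z) (A x w * A w z) (s (y ⊝ w))) ⟩
      sum₂ (λ y w → b y * b w * s (y ⊝ w))
        ≡⟨ sym (trans (sum-affine (λ y → sum λ w → b y * b (t ⊗ w ⊕ z) * s (y ⊝ (t ⊗ w ⊕ z))))
             (sum-cong λ y → sum-affine (λ w → b y * b w * s (y ⊝ w)))) ⟩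
      sum₂ (λ y w → b (t ⊗ y ⊕ z) * b (t ⊗ w ⊕ z) * s (t ⊗ y ⊕ z ⊝ (t ⊗ w ⊕ z)))
        ≡⟨ sum₂-cong (λ y w → cong₂ _*_ (cong₂ _*_ (b-β y) (b-β w))
             (trans (cong s (solve 4 (λ t y w z → t :* y :+ z :- (t :* w :+ z) := t :* (y :- w)) refl t y w z)) (s-t (y ⊝ w)))) ⟩
      sum₂ (λ y w → β y * β w * s (y ⊝ w))
        ≡⟨ β-β-s ⟩
      W - + 6 * + q + + 36 ∎)
      where
      t = r ⊗ r
      t≢0 : t ≢ 𝟎
      t≢0 = ⊗-≢0 r≢0 r≢0
      b : Fin q → ℤ
      b y = + 4 * (A x y * A y z)
      l : ∀ a b c → + 16 * (a * b * c) ≡ + 4 * a * (+ 4 * b) * c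
      l = solve-∀
      sum-affine : ∀ (f : Fin q → ℤ) → sum (λ y → f (t ⊗ y ⊕ z)) ≡ sum f
      sum-affine f = trans (sum-mul t≢0 (λ y → f (y ⊕ z))) (sum-shift z f)
      s-t : ∀ a → s (t ⊗ a) ≡ s a
      s-t = s-square-mul r≢0
      x≡ : x ≡ t ⊕ z
      x≡ = trans (solve 2 (λ x z → x := (x :- z) :+ z) refl x z) (cong (_⊕ z) (sym rr))
      l₂ : ∀ a b → + 4 * (a * b) ≡ (+ 2 * a) * (+ 2 * b)
      l₂ = solve-∀
      diff₁ : ∀ y → x ⊝ (t ⊗ y ⊕ z) ≡ t ⊗ (𝟏 ⊝ y)
      diff₁ y = trans (cong (_⊝ (t ⊗ y ⊕ z)) x≡) (solve 3 (λ t y z → t :+ z :- (t :* y :+ z) := t :* (con 1ℤ :- y)) refl t y z)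
      diff₀ : ∀ y → t ⊗ y ⊕ z ⊝ z ≡ t ⊗ y
      diff₀ y = solve 3 (λ t y z → t :* y :+ z :- z := t :* y) refl t y z
      b-β : ∀ y → b (t ⊗ y ⊕ z) ≡ β y
      b-β y = trans (l₂ (A x (t ⊗ y ⊕ z)) (A (t ⊗ y ⊕ z) z)) (cong₂ _*_
        (trans (A-s x (t ⊗ y ⊕ z)) (cong₂ (λ u w → 1ℤ - u + w)
          (δ-⇔ {a = x} {t ⊗ y ⊕ z} {y} {𝟏}
            (λ e → sym (⊝-≡0 (integral t≢0 (trans (sym (diff₁ y)) (trans (cong (_⊝ (t ⊗ y ⊕ z)) e) (⊝-self (t ⊗ y ⊕ z)))))))
            (λ { refl → trans x≡ (cong (_⊕ z) (sym (⊗-identityʳ t))) }))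
          (trans (cong s (diff₁ y)) (trans (s-t (𝟏 ⊝ y)) (s-⊝-comm 𝟏 y)))))
        (trans (A-s (t ⊗ y ⊕ z) z) (cong₂ (λ u w → 1ℤ - u + w)
          (δ-⇔ {a = t ⊗ y ⊕ z} {z} {y} {𝟎}
            (λ e → integral t≢0 (trans (sym (diff₀ y)) (trans (cong (_⊝ z) e) (⊝-self z))))
            (λ { refl → trans (cong (_⊕ z) (⊗-zeroʳ t)) (⊕-identityˡ z) }))
          (trans (cong s (diff₀ y)) (s-t y)))))

    -- Doubling replaces the edge `A y w` of a clique by `1 - δ y w + s (y ⊝ w)`: the first part
    -- counts pairs of distinct common neighbours, the second is `U`. The factor 32 is this 2 times
    -- the 16 of `A*U`.
    cliques₄-value : + 32 * cliques₄ A ≡ + 16 * (M - 1ℤ) * (M - + 2) * E + (W - + 6 * + q + + 36) * E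
    cliques₄-value = begin
      + 32 * cliques₄ A
        ≡⟨ l₀ (cliques₄ A) ⟩
      + 16 * (+ 2 * cliques₄ A)
        ≡⟨ cong (+ 16 *_) (begin
             + 2 * cliques₄ A
               ≡⟨ cong (+ 2 *_) (regroup A A) ⟩
             + 2 * sum₂ (λ x z → A x z * sum₂ (λ y w → (A x y * A y z) * (A x w * A w z) * A y w))
               ≡⟨ sym (sum₂-scale (+ 2) (λ x z → A x z * sum₂ (λ y w → (A x y * A y z) * (A x w * A w z) * A y w))) ⟩
             sum₂ (λ x z → + 2 * (A x z * sum₂ (λ y w → (A x y * A y z) * (A x w * A w z) * A y w)))
               ≡⟨ sum₂-cong (λ x z → trans (l₁ (A x z) (sum₂ (λ y w → (A x y * A y z) * (A x w * A w z) * A y w)))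
                    (trans (cong (A x z *_) (trans (sym (sum₂-scale (+ 2) (λ y w → (A x y * A y z) * (A x w * A w z) * A y w)))
                      (trans (sum₂-cong λ y w → trans (l₂ (A x y * A y z * (A x w * A w z)) (A y w))
                               (trans (cong (A x y * A y z * (A x w * A w z) *_) (A-s y w)) (ℤ.*-distribˡ-+ (A x y * A y z * (A x w * A w z)) (1ℤ - δ y w) (s (y ⊝ w)))))
                        (trans (sum₂-+ (λ y w → (A x y * A y z) * (A x w * A w z) * (1ℤ - δ y w)) (λ y w → (A x y * A y z) * (A x w * A w z) * s (y ⊝ w)))
                          (cong (λ u → u + U x z) (pairs x z))))))
                      (ℤ.*-distribˡ-+ (A x z) (codegree x z * codegree x z - codegree x z) (U x z)))) ⟩
             sum₂ (λ x z → A x z * (codegree x z * codegree x z - codegree x z) + A x z * U x z)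
               ≡⟨ trans (sum₂-+ (λ x z → A x z * (codegree x z * codegree x z - codegree x z)) (λ x z → A x z * U x z))
                    (cong (λ u → u + sum₂ (λ x z → A x z * U x z)) (cod-pairs (M - 1ℤ) A*codegree)) ⟩
             ((M - 1ℤ) * (M - 1ℤ) - (M - 1ℤ)) * E + sum₂ (λ x z → A x z * U x z) ∎) ⟩
      + 16 * (((M - 1ℤ) * (M - 1ℤ) - (M - 1ℤ)) * E + sum₂ (λ x z → A x z * U x z))
        ≡⟨ l₃ M E (sum₂ (λ x z → A x z * U x z)) ⟩
      + 16 * (M - 1ℤ) * (M - + 2) * E + + 16 * sum₂ (λ x z → A x z * U x z)
        ≡⟨ cong (λ u → + 16 * (M - 1ℤ) * (M - + 2) * E + u) (trans (sym (sum₂-scale (+ 16) (λ x z → A x z * U x z)))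
             (trans (sum₂-cong λ x z → trans (l₄ (A x z) (U x z)) (trans (A*U x z) (ℤ.*-comm (A x z) (W - + 6 * + q + + 36))))
               (sum₂-scale (W - + 6 * + q + + 36) A))) ⟩
      + 16 * (M - 1ℤ) * (M - + 2) * E + (W - + 6 * + q + + 36) * E ∎
      where
      l₀ : ∀ k → + 32 * k ≡ + 16 * (+ 2 * k)
      l₀ = solve-∀
      l₁ : ∀ a s → + 2 * (a * s) ≡ a * (+ 2 * s)
      l₁ = solve-∀
      l₂ : ∀ p a → + 2 * (p * a) ≡ p * (+ 2 * a)
      l₂ = solve-∀
      l₃ : ∀ m e u → + 16 * (((m - 1ℤ) * (m - 1ℤ) - (m - 1ℤ)) * e + u) ≡ + 16 * (m - 1ℤ) * (m - + 2) * e + + 16 * u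
      l₃ = solve-∀
      l₄ : ∀ a u → + 16 * (a * u) ≡ a * (+ 16 * u)
      l₄ = solve-∀

  -- The adjacency matrix of `paley q` and its coefficients

  ⟨toℕ⟩-⊝ : ∀ x y → ⟨ + toℕ x - + toℕ y ⟩ ≡ x ⊝ y
  ⟨toℕ⟩-⊝ x y = trans (⟨⟩-+ (+ toℕ x) (- + toℕ y))
    (cong₂ _⊕_ (⟨⟩-toℕ x) (trans (⟨⟩-neg (+ toℕ y)) (cong ⊖_ (⟨⟩-toℕ y))))

  residue : ∀ z a → ⟨ + toℕ z * + toℕ z - a ⟩ ≡ z ⊗ z ⊝ ⟨ a ⟩
  residue z a = trans (⟨⟩-+ (+ toℕ z * + toℕ z) (- a))
    (cong₂ _⊕_ (trans (⟨⟩-* (+ toℕ z) (+ toℕ z)) (cong₂ _⊗_ (⟨⟩-toℕ z) (⟨⟩-toℕ z))) (⟨⟩-neg a))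

  IsSquareMod⇒ : ∀ x y → IsSquareMod q (+ toℕ x - + toℕ y) → ∃[ t ] t ⊗ t ≡ x ⊝ y
  IsSquareMod⇒ x y (z , q∣) = z , trans (⊝-≡0 (trans (sym (residue z (+ toℕ x - + toℕ y))) (kernel⁻¹ (+ toℕ z * + toℕ z - (+ toℕ x - + toℕ y)) q∣)))
    (⟨toℕ⟩-⊝ x y)

  IsSquareMod⇐ : ∀ x y t → t ⊗ t ≡ x ⊝ y → IsSquareMod q (+ toℕ x - + toℕ y)
  IsSquareMod⇐ x y t tt = t , kernel (+ toℕ t * + toℕ t - (+ toℕ x - + toℕ y)) (trans (residue t (+ toℕ x - + toℕ y))
    (trans (cong (_⊝ ⟨ + toℕ x - + toℕ y ⟩) (trans tt (sym (⟨toℕ⟩-⊝ x y)))) (⊝-self ⟨ + toℕ x - + toℕ y ⟩)))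

  A : Weights q
  A = adjacencyMatrix (paley q)

  -- `fromRel` joins x and y if either of their differences is a square; evenness of s makes the two
  -- conditions agree.
  nonsquare-reverse : ∀ {x y} → (∀ t → t ⊗ t ≢ x ⊝ y) → ∀ t → t ⊗ t ≢ y ⊝ x
  nonsquare-reverse {x} {y} h t tt with classify (y ⊝ x)
  ... | is-zero e = h 𝟎 (trans (⊗-zeroˡ 𝟎) (sym (trans (cong (x ⊝_) (⊝-≡0 e)) (⊝-self x))))
  ... | nonsquare h′ = h′ t tt
  ... | is-square r r≢0 rr = contradiction (trans (sym (s-nonsquare h)) (trans (s-⊝-comm x y) (trans (cong s (sym rr)) (s-square r≢0)))) λ ()

  paley-s : ∀ x y → + 2 * A x y ≡ 1ℤ - δ x y + s (x ⊝ y)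
  paley-s x y with classify (x ⊝ y)
  ... | is-zero e = trans (cong (+ 2 *_) (𝟙-no adj λ (x≢y , _) → x≢y (⊝-≡0 e)))
        (sym (cong₂ (λ u w → 1ℤ - u + w) (trans (cong (δ x) (sym (⊝-≡0 e))) (δ-refl x)) (trans (cong s e) s-0)))
    where adj = SimpleGraph.adj? (paley q) x y
  ... | is-square t t≢0 tt = trans (cong (+ 2 *_) (𝟙-yes adj (x≢y , inj₁ (IsSquareMod⇐ x y t tt))))
        (sym (cong₂ (λ u w → 1ℤ - u + w) (δ-≢ x≢y) (trans (cong s (sym tt)) (s-square t≢0))))
    where
    adj = SimpleGraph.adj? (paley q) x y
    x≢y : x ≢ y
    x≢y refl = ⊗-≢0 t≢0 t≢0 (trans tt (⊝-self x))
  ... | nonsquare h = trans (cong (+ 2 *_) (𝟙-no adj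
          λ { (_ , inj₁ sq) → h (IsSquareMod⇒ x y sq .proj₁) (IsSquareMod⇒ x y sq .proj₂)
            ; (_ , inj₂ sq) → nonsquare-reverse h (IsSquareMod⇒ y x sq .proj₁) (IsSquareMod⇒ y x sq .proj₂) }))
        (sym (cong₂ (λ u w → 1ℤ - u + w) (δ-≢ x≢y) (s-nonsquare h)))
    where
    adj = SimpleGraph.adj? (paley q) x y
    x≢y : x ≢ y
    x≢y refl = h 𝟎 (trans (⊗-zeroˡ 𝟎) (sym (⊝-self x)))

  private
    adj = adjacencyMatrix-adj (paley q)
    E = edges A
    M = + m
    P = + q * (+ q - 1ℤ)
    a = sum-two-squares .proj₁

    2E : + 2 * E ≡ P
    2E = edges-value adj paley-s

    4M : + 4 * M ≡ + q - 1ℤ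
    4M = trans (l M) (cong (λ u → u - 1ℤ) (sym q≡))
      where
      l : ∀ m → + 4 * m ≡ 1ℤ + + 4 * m - 1ℤ
      l = solve-∀

  coefficient-1 : + 4 * chromCoeff A 1 ≡ - P
  coefficient-1 = trans (l (chromCoeff A 1)) (trans (cong (+ 2 *_) (chromCoeff-1 adj)) (trans (l₂ E) (cong -_ 2E)))
    where
    l : ∀ c → + 4 * c ≡ + 2 * (+ 2 * c)
    l = solve-∀
    l₂ : ∀ e → + 2 * - e ≡ - (+ 2 * e)
    l₂ = solve-∀

  coefficient-2 : + 96 * chromCoeff A 2 ≡ + 3 * (P * P) - + 12 * P - + 2 * ((+ q - + 5) * P)
  coefficient-2 = begin
    + 96 * chromCoeff A 2
      ≡⟨ l₁ (chromCoeff A 2) ⟩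
    + 4 * (+ 24 * chromCoeff A 2)
      ≡⟨ cong (+ 4 *_) (trans (chromCoeff-2 adj) (cong (λ u → + 3 * (E * E) - + 6 * E - + 4 * u) (triangles-value adj paley-s))) ⟩
    + 4 * (+ 3 * (E * E) - + 6 * E - + 4 * ((M - 1ℤ) * E))
      ≡⟨ l₂ E M ⟩
    + 3 * (+ 2 * E * (+ 2 * E)) - + 12 * (+ 2 * E) - + 2 * ((+ 4 * M - + 4) * (+ 2 * E))
      ≡⟨ cong₂ (λ p t → + 3 * (p * p) - + 12 * p - + 2 * ((t - + 4) * p)) 2E 4M ⟩
    + 3 * (P * P) - + 12 * P - + 2 * ((+ q - 1ℤ - + 4) * P)
      ≡⟨ cong (λ t → + 3 * (P * P) - + 12 * P - + 2 * (t * P)) (l₃ (+ q)) ⟩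
    + 3 * (P * P) - + 12 * P - + 2 * ((+ q - + 5) * P) ∎
    where
    l₁ : ∀ c → + 96 * c ≡ + 4 * (+ 24 * c)
    l₁ = solve-∀
    l₂ : ∀ e m → + 4 * (+ 3 * (e * e) - + 6 * e - + 4 * ((m - 1ℤ) * e)) ≡
         + 3 * (+ 2 * e * (+ 2 * e)) - + 12 * (+ 2 * e) - + 2 * ((+ 4 * m - + 4) * (+ 2 * e))
    l₂ = solve-∀
    l₃ : ∀ q → q - 1ℤ - + 4 ≡ q - + 5
    l₃ = solve-∀

  -- The factor 1536 is 48 from `chromCoeff-3` times 32 from `cliques₄-value`. Induced 4-cycles
  -- bring in 6 times the clique count and the 4-cliques -4 times, so twice it survives, and with it
  -- the term 4 a² P.
  coefficient-3 : + 1536 * chromCoeff A 3 ≡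
    - + 4 * (P * P * P) + + 48 * (P * P) - + 128 * P + + 8 * ((+ q - + 5) * (P * P)) - + 16 * ((+ q - + 5) * P)
      + (+ q - + 5) * (+ q - + 9) * P + (+ 4 * (a * a) - + 8 * + q + + 36) * P
  coefficient-3 = begin
    + 1536 * chromCoeff A 3
      ≡⟨ l₁ (chromCoeff A 3) ⟩
    + 32 * (+ 48 * chromCoeff A 3)
      ≡⟨ cong (+ 32 *_) (trans (chromCoeff-3 adj) (cong₂ (λ t i → - (E * E * E) + + 6 * (E * E) - + 8 * E + + 4 * (E * t) - + 16 * t + + 6 * i - + 4 * K)
           (triangles-value adj paley-s) (inducedSquares-value adj paley-s))) ⟩
    + 32 * (- (E * E * E) + + 6 * (E * E) - + 8 * E + + 4 * (E * ((M - 1ℤ) * E)) - + 16 * ((M - 1ℤ) * E) + + 6 * (+ 2 * (M - 1ℤ) * E + K) - + 4 * K)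
      ≡⟨ l₂ E M K ⟩
    R (+ 2 * E) (+ 4 * M) + + 2 * (+ 32 * K)
      ≡⟨ cong (λ u → R (+ 2 * E) (+ 4 * M) + + 2 * u) (trans (cliques₄-value adj paley-s)
           (cong (λ w → + 16 * (M - 1ℤ) * (M - + 2) * E + (w - + 6 * + q + + 36) * E) (trans W-value
             (cong (λ u → u * u - + 2 * + q) (sum-two-squares .proj₂ .proj₂ .proj₂ .proj₁))))) ⟩
    R (+ 2 * E) (+ 4 * M) + + 2 * (+ 16 * (M - 1ℤ) * (M - + 2) * E + (+ 2 * a * (+ 2 * a) - + 2 * + q - + 6 * + q + + 36) * E)
      ≡⟨ cong (λ u → R (+ 2 * E) (+ 4 * M) + u) (l₃ E M a (+ q)) ⟩
    R (+ 2 * E) (+ 4 * M) + ((+ 4 * M - + 4) * (+ 4 * M - + 8) * (+ 2 * E) + (+ 4 * (a * a) - + 8 * + q + + 36) * (+ 2 * E))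
      ≡⟨ cong₂ (λ p t → R p t + ((t - + 4) * (t - + 8) * p + (+ 4 * (a * a) - + 8 * + q + + 36) * p)) 2E 4M ⟩
    R P (+ q - 1ℤ) + ((+ q - 1ℤ - + 4) * (+ q - 1ℤ - + 8) * P + (+ 4 * (a * a) - + 8 * + q + + 36) * P)
      ≡⟨ l₄ P (+ q) ((+ 4 * (a * a) - + 8 * + q + + 36) * P) ⟩
    - + 4 * (P * P * P) + + 48 * (P * P) - + 128 * P + + 8 * ((+ q - + 5) * (P * P)) - + 16 * ((+ q - + 5) * P)
      + (+ q - + 5) * (+ q - + 9) * P + (+ 4 * (a * a) - + 8 * + q + + 36) * P ∎
    where
    K = cliques₄ A
    R : ℤ → ℤ → ℤ
    R p t = - + 4 * (p * p * p) + + 48 * (p * p) - + 128 * p + + 8 * ((t - + 4) * (p * p)) - + 16 * ((t - + 4) * p)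
    l₁ : ∀ c → + 1536 * c ≡ + 32 * (+ 48 * c)
    l₁ = solve-∀
    l₂ : ∀ E M K → + 32 * (- (E * E * E) + + 6 * (E * E) - + 8 * E + + 4 * (E * ((M - 1ℤ) * E)) - + 16 * ((M - 1ℤ) * E) + + 6 * (+ 2 * (M - 1ℤ) * E + K) - + 4 * K) ≡
      - + 4 * (+ 2 * E * (+ 2 * E) * (+ 2 * E)) + + 48 * (+ 2 * E * (+ 2 * E)) - + 128 * (+ 2 * E)
        + + 8 * ((+ 4 * M - + 4) * (+ 2 * E * (+ 2 * E))) - + 16 * ((+ 4 * M - + 4) * (+ 2 * E)) + + 2 * (+ 32 * K)
    l₂ = solve-∀
    l₃ : ∀ E M a q → + 2 * (+ 16 * (M - 1ℤ) * (M - + 2) * E + (+ 2 * a * (+ 2 * a) - + 2 * q - + 6 * q + + 36) * E) ≡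
      (+ 4 * M - + 4) * (+ 4 * M - + 8) * (+ 2 * E) + (+ 4 * (a * a) - + 8 * q + + 36) * (+ 2 * E)
    l₃ = solve-∀
    l₄ : ∀ P q t → - + 4 * (P * P * P) + + 48 * (P * P) - + 128 * P + + 8 * ((q - 1ℤ - + 4) * (P * P)) - + 16 * ((q - 1ℤ - + 4) * P)
      + ((q - 1ℤ - + 4) * (q - 1ℤ - + 8) * P + t) ≡
      - + 4 * (P * P * P) + + 48 * (P * P) - + 128 * P + + 8 * ((q - + 5) * (P * P)) - + 16 * ((q - + 5) * P) + (q - + 5) * (q - + 9) * P + t
    l₄ = solve-∀

paleyCoeff : ℕ → ℕ → ℤ
paleyCoeff q = chromCoeff (adjacencyMatrix (paley q))

record PaleyCoefficients (q : ℕ) : Set where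
  P : ℤ
  P = + q * (+ q - 1ℤ)
  field
    a b g : ℤ
    two-squares : a * a + b * b ≡ + q
    a-odd : a ≡ 1ℤ + + 2 * g
    c₁ : + 4 * paleyCoeff q 1 ≡ - P
    c₂ : + 96 * paleyCoeff q 2 ≡ + 3 * (P * P) - + 12 * P - + 2 * ((+ q - + 5) * P)
    c₃ : + 1536 * paleyCoeff q 3 ≡
      - + 4 * (P * P * P) + + 48 * (P * P) - + 128 * P + + 8 * ((+ q - + 5) * (P * P)) - + 16 * ((+ q - + 5) * P)
        + (+ q - + 5) * (+ q - + 9) * P + (+ 4 * (a * a) - + 8 * + q + + 36) * P

paley-coefficients : ∀ {q} → PrimeOneModFour q → PaleyCoefficients q
paley-coefficients {q} (q-prime , q%4≡1) = record
  { a = sum-two-squares .proj₁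
  ; b = sum-two-squares .proj₂ .proj₁
  ; g = sum-two-squares .proj₂ .proj₂ .proj₁
  ; two-squares = sum-two-squares .proj₂ .proj₂ .proj₂ .proj₂ .proj₁
  ; a-odd = sum-two-squares .proj₂ .proj₂ .proj₂ .proj₂ .proj₂
  ; c₁ = coefficient-1
  ; c₂ = coefficient-2
  ; c₃ = coefficient-3
  }
  where
  q≡4m+1 : q ≡ 1 ℕ.+ 4 ℕ.* (q ℕ./ 4)
  q≡4m+1 = trans (ℕ.m≡m%n+[m/n]*n q 4) (cong₂ ℕ._+_ q%4≡1 (ℕ.*-comm (q ℕ./ 4) 4))
  open Paley (residueField q-prime) (q ℕ./ 4) q≡4m+1 (ℕ.nonTrivial⇒≢1 {{prime⇒nonTrivial q-prime}})

-- Primes q with prescribed 2-adic valuation of q − 1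

even-or-odd : ∀ n → (∃[ k ] n ≡ 2 ℕ.* k) ⊎ (∃[ k ] n ≡ 1 ℕ.+ 2 ℕ.* k)
even-or-odd zero    = inj₁ (0 , refl)
even-or-odd (suc n) with even-or-odd n
... | inj₁ (k , refl) = inj₂ (k , refl)
... | inj₂ (k , refl) = inj₁ (suc k , l k)
  where
  l : ∀ k → suc (1 ℕ.+ 2 ℕ.* k) ≡ 2 ℕ.* suc k
  l = ℕ.solve-∀

module Fermat {q : ℕ} (F : PrimeField q) where
  open FieldArith F
  open CommutativeMonoidSum (CommutativeRing.*-commutativeMonoid commutativeRing)
    using () renaming (sum to ∏; ∑-distrib-+ to ∏-distrib; sum-permute to ∏-permute; sum-cong-≗ to ∏-cong; sum-remove to ∏-remove; sum-replicate to ∏-replicate)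
  open Exponentiation (CommutativeRing.commutativeSemiring commutativeRing) public
    using (_^_; ^-homo-*; ^-assocʳ; ^-distrib-*)
  open 𝔽 using (solve; _:=_; _:+_; _:*_; _:-_; :-_; con)

  ⟨⟩-^ : ∀ x n → ⟨ + (x ℕ.^ n) ⟩ ≡ ⟨ + x ⟩ ^ n
  ⟨⟩-^ x zero    = refl
  ⟨⟩-^ x (suc n) = trans (cong ⟨_⟩ (ℤ.pos-* x (x ℕ.^ n))) (trans (⟨⟩-* (+ x) (+ (x ℕ.^ n))) (cong (⟨ + x ⟩ ⊗_) (⟨⟩-^ x n)))

  1^ : ∀ n → 𝟏 ^ n ≡ 𝟏
  1^ zero    = refl
  1^ (suc n) = trans (⊗-identityˡ (𝟏 ^ n)) (1^ n)

  private
    -- Replacing `𝟎` by `𝟏` lets the product of the units run over the whole field, where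
    -- multiplication by c is a permutation; `ratio` records that the factor c is missing at `𝟎`.
    unit : Fin q → Fin q
    unit x with x Fin.≟ 𝟎
    ... | yes _ = 𝟏
    ... | no _  = x

    ratio : Fin q → Fin q → Fin q
    ratio c x with x Fin.≟ 𝟎
    ... | yes _ = 𝟏
    ... | no _  = c

    ∏-≢0 : ∀ {n} → 𝟏 ≢ 𝟎 → (f : Fin n → Fin q) → (∀ i → f i ≢ 𝟎) → ∏ f ≢ 𝟎
    ∏-≢0 {zero}  1≢0 f h = 1≢0
    ∏-≢0 {suc n} 1≢0 f h = ⊗-≢0 (h zero) (∏-≢0 1≢0 (f ∘ suc) (h ∘ suc))

    ∏-all-but-one : ∀ {n} (f : Fin n → Fin q) i c → f i ≡ 𝟏 → (∀ j → j ≢ i → f j ≡ c) → ∏ f ≡ c ^ (n ℕ.∸ 1)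
    ∏-all-but-one {suc n} f i c fi others = trans (∏-remove {i = i} f) (trans (cong₂ _⊗_ fi
      (trans (∏-cong λ j → others (Fin.punchIn i j) (Fin.punchInᵢ≢i i j)) (∏-replicate n {c}))) (⊗-identityˡ (c ^ n)))

  fermat : ∀ {c} → c ≢ 𝟎 → c ^ (q ℕ.∸ 1) ≡ 𝟏
  fermat {c} c≢0 = sym (⊗-cancelˡ {∏ unit} (∏-≢0 1≢0 unit unit-≢0) (begin
    ∏ unit ⊗ 𝟏                       ≡⟨ ⊗-identityʳ (∏ unit) ⟩
    ∏ unit                           ≡⟨ ∏-permute unit (Perm.permutation (c ⊗_) (inv c ⊗_)
        (λ x → trans (sym (⊗-assoc c (inv c) x)) (trans (cong (_⊗ x) (⊗-inv c≢0)) (⊗-identityˡ x)))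
        (λ x → trans (solve 3 (λ c d x → d :* (c :* x) := c :* d :* x) refl c (inv c) x)
                 (trans (cong (_⊗ x) (⊗-inv c≢0)) (⊗-identityˡ x)))) ⟩
    ∏ (λ x → unit (c ⊗ x))           ≡⟨ ∏-cong scaled ⟩
    ∏ (λ x → unit x ⊗ ratio c x)     ≡⟨ ∏-distrib unit (ratio c) ⟩
    ∏ unit ⊗ ∏ (ratio c)             ≡⟨ cong (∏ unit ⊗_) (∏-all-but-one (ratio c) 𝟎 c ratio-0 ratio-≢0) ⟩
    ∏ unit ⊗ c ^ (q ℕ.∸ 1) ∎))
    where
    1≢0 : 𝟏 ≢ 𝟎
    1≢0 h = c≢0 (trans (sym (⊗-identityˡ c)) (trans (cong (_⊗ c) h) (⊗-zeroˡ c)))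
    unit-≢0 : ∀ x → unit x ≢ 𝟎
    unit-≢0 x with x Fin.≟ 𝟎
    ... | yes _  = 1≢0
    ... | no x≢0 = x≢0
    ratio-0 : ratio c 𝟎 ≡ 𝟏
    ratio-0 with 𝟎 Fin.≟ 𝟎
    ... | yes _ = refl
    ... | no ≢  = contradiction refl ≢
    ratio-≢0 : ∀ x → x ≢ 𝟎 → ratio c x ≡ c
    ratio-≢0 x x≢0 with x Fin.≟ 𝟎
    ... | yes x≡0 = contradiction x≡0 x≢0
    ... | no _    = refl
    scaled : ∀ x → unit (c ⊗ x) ≡ unit x ⊗ ratio c x
    scaled x with x Fin.≟ 𝟎 | c ⊗ x Fin.≟ 𝟎
    ... | yes _    | yes _ = sym (⊗-identityˡ 𝟏)
    ... | yes refl | no h  = contradiction (⊗-zeroʳ c) h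
    ... | no x≢0   | yes h = contradiction h (⊗-≢0 c≢0 x≢0)
    ... | no _     | no _  = ⊗-comm c x

  -- The order of z is 2^(i+1). In the step to `suc i`, the case i applied to z² shows that n is a
  -- multiple t of 2^(i+1); were t odd, z^n would be an odd power of -1.
  order-divides : 𝟏 ≢ ⊖ 𝟏 → ∀ i n z → z ^ (2 ℕ.^ i) ≡ ⊖ 𝟏 → z ^ n ≡ 𝟏 → (2 ℕ.^ suc i) ℕ.∣ n
  order-divides 1≢-1 zero n z hz hn with even-or-odd n
  ... | inj₁ (k , refl) = ℕ.divides k (ℕ.*-comm 2 k)
  ... | inj₂ (k , refl) = contradiction (trans (sym hn) (begin
    z ⊗ z ^ (2 ℕ.* k)       ≡⟨ cong (z ⊗_) (^-assocʳ z 2 k) ⟨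
    z ⊗ (z ^ 2) ^ k         ≡⟨ cong (λ u → z ⊗ u ^ k) (trans (cong₂ _⊗_ z≡ hz) (solve 0 (:- con 1ℤ :* :- con 1ℤ := con 1ℤ) refl)) ⟩
    z ⊗ 𝟏 ^ k               ≡⟨ trans (cong (z ⊗_) (1^ k)) (⊗-identityʳ z) ⟩
    z                       ≡⟨ z≡ ⟩
    ⊖ 𝟏 ∎)) 1≢-1
    where
    z≡ : z ≡ ⊖ 𝟏
    z≡ = trans (sym (⊗-identityʳ z)) hz
  order-divides 1≢-1 (suc i) n z hz hn with order-divides 1≢-1 i n (z ^ 2) (trans (^-assocʳ z 2 (2 ℕ.^ i)) hz)
      (trans (^-assocʳ z 2 n) (trans (cong (z ^_) (ℕ.*-comm 2 n)) (trans (sym (^-assocʳ z n 2)) (trans (cong (_^ 2) hn) (1^ 2)))))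
  ... | ℕ.divides t refl with even-or-odd t
  ...   | inj₁ (k , refl) = ℕ.divides k (l k (2 ℕ.^ i))
    where
    l : ∀ k e → (2 ℕ.* k) ℕ.* (2 ℕ.* e) ≡ k ℕ.* (2 ℕ.* (2 ℕ.* e))
    l = ℕ.solve-∀
  ...   | inj₂ (k , refl) = contradiction (trans (sym hn) (begin
    z ^ ((1 ℕ.+ 2 ℕ.* k) ℕ.* 2 ℕ.^ suc i)    ≡⟨ cong (z ^_) (ℕ.*-comm (1 ℕ.+ 2 ℕ.* k) (2 ℕ.^ suc i)) ⟩
    z ^ (2 ℕ.^ suc i ℕ.* (1 ℕ.+ 2 ℕ.* k))    ≡⟨ ^-assocʳ z (2 ℕ.^ suc i) (1 ℕ.+ 2 ℕ.* k) ⟨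
    (z ^ 2 ℕ.^ suc i) ^ (1 ℕ.+ 2 ℕ.* k)      ≡⟨ cong (_^ (1 ℕ.+ 2 ℕ.* k)) hz ⟩
    ⊖ 𝟏 ⊗ (⊖ 𝟏) ^ (2 ℕ.* k)                  ≡⟨ cong (⊖ 𝟏 ⊗_) (^-assocʳ (⊖ 𝟏) 2 k) ⟨
    ⊖ 𝟏 ⊗ ((⊖ 𝟏) ^ 2) ^ k                    ≡⟨ cong (λ u → ⊖ 𝟏 ⊗ u ^ k) (solve 0 (:- con 1ℤ :* (:- con 1ℤ :* con 1ℤ) := con 1ℤ) refl) ⟩
    ⊖ 𝟏 ⊗ 𝟏 ^ k                              ≡⟨ trans (cong (⊖ 𝟏 ⊗_) (1^ k)) (⊗-identityʳ (⊖ 𝟏)) ⟩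
    ⊖ 𝟏 ∎)) 1≢-1

-- The residue of y has order 2^(i+1) modulo p, and Fermat's little theorem makes it divide p - 1;
-- that p does not divide 2 separates 1 from -1.
prime-divisor-order : ∀ {p} → Prime p → ¬ (p ℕ.∣ 2) → ∀ i y → p ℕ.∣ 1 ℕ.+ y ℕ.^ (2 ℕ.^ i) → (2 ℕ.^ suc i) ℕ.∣ p ℕ.∸ 1
prime-divisor-order {p} p-prime p∤2 i y p∣ = order-divides 1≢-1 i (p ℕ.∸ 1) z z^ (fermat z≢0)
  where
  open FieldArith (residueField p-prime)
  open Fermat (residueField p-prime)
  open 𝔽 using (solve; _:=_; _:+_; _:*_; _:-_; :-_; con)
  z = ⟨ + y ⟩
  kernel-ℕ : ∀ n → ⟨ + n ⟩ ≡ 𝟎 → p ℕ.∣ n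
  kernel-ℕ n h = ∣⇒∣ᵤ (kernel (+ n) h)
  1≢-1 : 𝟏 ≢ ⊖ 𝟏
  1≢-1 h = p∤2 (kernel-ℕ 2 (trans (solve 0 (con (+ 2) := con 1ℤ :- :- con 1ℤ) refl) (trans (cong (_⊝ ⊖ 𝟏) h) (⊝-self (⊖ 𝟏)))))
  z^ : z ^ (2 ℕ.^ i) ≡ ⊖ 𝟏
  z^ = ⊝-≡0 (trans (cong (_⊝ ⊖ 𝟏) (sym (⟨⟩-^ y (2 ℕ.^ i)))) (trans
    (solve 1 (λ w → w :- :- con 1ℤ := con 1ℤ :+ w) refl ⟨ + (y ℕ.^ (2 ℕ.^ i)) ⟩)
    (trans (sym (⟨⟩-+ 1ℤ (+ (y ℕ.^ (2 ℕ.^ i))))) (kernel⁻¹ (+ (1 ℕ.+ y ℕ.^ (2 ℕ.^ i))) (∣ᵤ⇒∣ p∣)))))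
  0^ : ∀ n .{{_ : ℕ.NonZero n}} → 𝟎 ^ n ≡ 𝟎
  0^ (suc n) = ⊗-zeroˡ (𝟎 ^ n)
  z≢0 : z ≢ 𝟎
  z≢0 h = 1≢-1 (trans (solve 0 (con 1ℤ := con 0ℤ :- :- con 1ℤ) refl) (trans (cong (_⊝ ⊖ 𝟏) 0≡-1) (trans (solve 0 (:- con 1ℤ :- :- con 1ℤ := con 0ℤ) refl) 0≡-1)))
    where
    0≡-1 : 𝟎 ≡ ⊖ 𝟏
    0≡-1 = trans (sym (trans (cong (_^ (2 ℕ.^ i)) h) (0^ (2 ℕ.^ i) {{ℕ.m^n≢0 2 i}}))) z^

1+pred : ∀ {p} → Prime p → p ≡ 1 ℕ.+ (p ℕ.∸ 1)
1+pred {zero}  p-prime = contradiction (prime⇒nonTrivial p-prime) λ ()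
1+pred {suc p} _       = refl

-- Numbers congruent to 1 modulo m are closed under multiplication, so a number that is not 1 modulo
-- m has a prime factor that is not.
prime-factor-≢1 : ∀ m n .{{_ : ℕ.NonZero n}} → ¬ (∃[ t ] n ≡ 1 ℕ.+ m ℕ.* t) →
                  ∃[ p ] Prime p × p ℕ.∣ n × ¬ (m ℕ.∣ p ℕ.∸ 1)
prime-factor-≢1 m n n≢1 with go (factors) factorsPrime
  where
  open PrimeFactorisation (factorise n)
  l : ∀ m s t → (1 ℕ.+ s ℕ.* m) ℕ.* (1 ℕ.+ m ℕ.* t) ≡ 1 ℕ.+ m ℕ.* (s ℕ.+ t ℕ.+ s ℕ.* m ℕ.* t)
  l = ℕ.solve-∀
  go : ∀ ps → All Prime ps →
       (∃[ p ] Prime p × p ℕ.∣ product ps × ¬ (m ℕ.∣ p ℕ.∸ 1)) ⊎ (∃[ t ] product ps ≡ 1 ℕ.+ m ℕ.* t)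
  go []       []         = inj₂ (0 , cong suc (sym (ℕ.*-zeroʳ m)))
  go (p ∷ ps) (pp ∷ pps) with m ℕ.∣? p ℕ.∸ 1 | go ps pps
  ... | no ∤  | _ = inj₁ (p , pp , ℕ.m∣m*n (product ps) , ∤)
  ... | yes _ | inj₁ (r , rp , r∣ , ∤) = inj₁ (r , rp , ℕ.∣n⇒∣m*n p r∣ , ∤)
  ... | yes (ℕ.divides s eq) | inj₂ (t , eq′) = inj₂ (s ℕ.+ t ℕ.+ s ℕ.* m ℕ.* t , trans (cong₂ ℕ._*_ (trans (1+pred pp) (cong suc eq)) eq′) (l m s t))
... | inj₁ found = subst (λ k → ∃[ p ] Prime p × p ℕ.∣ k × ¬ (m ℕ.∣ p ℕ.∸ 1)) (sym (PrimeFactorisation.isFactorisation (factorise n))) found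
... | inj₂ (t , eq) = contradiction (t , trans (PrimeFactorisation.isFactorisation (factorise n)) eq) n≢1

-- The double factorial (2 N + 1)!!, a common multiple of all odd numbers up to 2 N + 1. It is odd,
-- hence its square is 1 modulo 8.
odd-product : ℕ → ℕ
odd-product zero    = 1
odd-product (suc k) = (1 ℕ.+ 2 ℕ.* suc k) ℕ.* odd-product k

odd-product-divisible : ∀ {k n} → k ℕ.≤ n → 1 ℕ.+ 2 ℕ.* k ℕ.∣ odd-product n
odd-product-divisible {zero}  {n} _ = ℕ.1∣ odd-product n
odd-product-divisible {suc k} {suc n} k≤n with suc k ℕ.≟ suc n
... | yes refl = ℕ.m∣m*n (odd-product k)
... | no k≢n   = ℕ.∣n⇒∣m*n (1 ℕ.+ 2 ℕ.* suc n) (odd-product-divisible (ℕ.s≤s⁻¹ (ℕ.≤∧≢⇒< k≤n k≢n)))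

odd-product-odd : ∀ n → ∃[ k ] odd-product n ≡ 1 ℕ.+ 2 ℕ.* k
odd-product-odd zero    = 0 , refl
odd-product-odd (suc n) with odd-product n | odd-product-odd n
... | _ | k , refl = suc n ℕ.+ k ℕ.+ 2 ℕ.* suc n ℕ.* k , l n k
  where
  l : ∀ n k → (1 ℕ.+ 2 ℕ.* suc n) ℕ.* (1 ℕ.+ 2 ℕ.* k) ≡ 1 ℕ.+ 2 ℕ.* (suc n ℕ.+ k ℕ.+ 2 ℕ.* suc n ℕ.* k)
  l = ℕ.solve-∀

odd-square : ∀ k → ∃[ b ] (1 ℕ.+ 2 ℕ.* k) ℕ.* (1 ℕ.+ 2 ℕ.* k) ≡ 1 ℕ.+ 8 ℕ.* b
odd-square k with even-or-odd k
... | inj₁ (j , refl) = j ℕ.+ 2 ℕ.* (j ℕ.* j) , l j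
  where
  l : ∀ j → (1 ℕ.+ 2 ℕ.* (2 ℕ.* j)) ℕ.* (1 ℕ.+ 2 ℕ.* (2 ℕ.* j)) ≡ 1 ℕ.+ 8 ℕ.* (j ℕ.+ 2 ℕ.* (j ℕ.* j))
  l = ℕ.solve-∀
... | inj₂ (j , refl) = 1 ℕ.+ 3 ℕ.* j ℕ.+ 2 ℕ.* (j ℕ.* j) , l j
  where
  l : ∀ j → (1 ℕ.+ 2 ℕ.* (1 ℕ.+ 2 ℕ.* j)) ℕ.* (1 ℕ.+ 2 ℕ.* (1 ℕ.+ 2 ℕ.* j)) ≡ 1 ℕ.+ 8 ℕ.* (1 ℕ.+ 3 ℕ.* j ℕ.+ 2 ℕ.* (j ℕ.* j))
  l = ℕ.solve-∀

-- The base is 3 modulo 8, so its square is 1 plus 8 times an odd number, and each further squaring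
-- adds exactly one factor 2. This exactness is what the factor 3 in y is for: an odd square alone
-- would be 1 modulo 8.
repeated-square : ∀ i b → ∃[ u ] (3 ℕ.+ 24 ℕ.* b) ℕ.^ (2 ℕ.^ suc i) ≡ 1 ℕ.+ 4 ℕ.* (2 ℕ.^ suc i) ℕ.* (1 ℕ.+ 2 ℕ.* u)
repeated-square zero b = 9 ℕ.* b ℕ.+ 36 ℕ.* (b ℕ.* b) , l b
  where
  l : ∀ b → (3 ℕ.+ 24 ℕ.* b) ℕ.* ((3 ℕ.+ 24 ℕ.* b) ℕ.* 1) ≡ 1 ℕ.+ 8 ℕ.* (1 ℕ.+ 2 ℕ.* (9 ℕ.* b ℕ.+ 36 ℕ.* (b ℕ.* b)))
  l = ℕ.solve-∀
repeated-square (suc i) b with repeated-square i b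
... | u , eq = u ℕ.+ 2 ℕ.^ suc i ℕ.* ((1 ℕ.+ 2 ℕ.* u) ℕ.* (1 ℕ.+ 2 ℕ.* u)) , (begin
  y ℕ.^ (2 ℕ.* 2 ℕ.^ suc i)         ≡⟨ cong (y ℕ.^_) (ℕ.*-comm 2 (2 ℕ.^ suc i)) ⟩
  y ℕ.^ (2 ℕ.^ suc i ℕ.* 2)         ≡⟨ sym (ℕ.^-*-assoc y (2 ℕ.^ suc i) 2) ⟩
  (y ℕ.^ (2 ℕ.^ suc i)) ℕ.^ 2       ≡⟨ cong (ℕ._^ 2) eq ⟩
  (1 ℕ.+ 4 ℕ.* (2 ℕ.^ suc i) ℕ.* (1 ℕ.+ 2 ℕ.* u)) ℕ.^ 2
    ≡⟨ l (2 ℕ.^ suc i) u ⟩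
  1 ℕ.+ 4 ℕ.* (2 ℕ.* 2 ℕ.^ suc i) ℕ.* (1 ℕ.+ 2 ℕ.* (u ℕ.+ 2 ℕ.^ suc i ℕ.* ((1 ℕ.+ 2 ℕ.* u) ℕ.* (1 ℕ.+ 2 ℕ.* u)))) ∎)
  where
  y = 3 ℕ.+ 24 ℕ.* b
  l : ∀ w u → (1 ℕ.+ 4 ℕ.* w ℕ.* (1 ℕ.+ 2 ℕ.* u)) ℕ.* ((1 ℕ.+ 4 ℕ.* w ℕ.* (1 ℕ.+ 2 ℕ.* u)) ℕ.* 1) ≡
      1 ℕ.+ 4 ℕ.* (2 ℕ.* w) ℕ.* (1 ℕ.+ 2 ℕ.* (u ℕ.+ w ℕ.* ((1 ℕ.+ 2 ℕ.* u) ℕ.* (1 ℕ.+ 2 ℕ.* u))))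
  l = ℕ.solve-∀

module _ {i N y n u p : ℕ} (2n≡ : 1 ℕ.+ y ℕ.^ (2 ℕ.^ suc i) ≡ 2 ℕ.* n)
         (n≡ : n ≡ 1 ℕ.+ 2 ℕ.^ suc (suc i) ℕ.* (1 ℕ.+ 2 ℕ.* u)) (p-prime : Prime p) (p∣n : p ℕ.∣ n) where
  private
    e = 2 ℕ.^ suc i

    p≢1 : p ≢ 1
    p≢1 = ℕ.nonTrivial⇒≢1 {{prime⇒nonTrivial p-prime}}

    p∣1⇒⊥ : ∀ {k} → p ℕ.∣ 1 ℕ.+ k → ¬ (p ℕ.∣ k)
    p∣1⇒⊥ {k} p∣1+k p∣k = p≢1 (ℕ.∣1⇒≡1 (ℕ.∣m+n∣m⇒∣n (subst (p ℕ.∣_) (ℕ.+-comm 1 k) p∣1+k) p∣k))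

    2∤n : ¬ (2 ℕ.∣ n)
    2∤n (ℕ.divides t eq) = ℕ.even≢odd t (e ℕ.* (1 ℕ.+ 2 ℕ.* u)) (trans (ℕ.*-comm 2 t) (trans (sym eq)
      (trans n≡ (cong suc (ℕ.*-assoc 2 e (1 ℕ.+ 2 ℕ.* u))))))

    p∤2 : ¬ (p ℕ.∣ 2)
    p∤2 p∣2 = p∣1⇒⊥ (subst (p ℕ.∣_) n≡ p∣n) (ℕ.∣m⇒∣m*n (1 ℕ.+ 2 ℕ.* u) (ℕ.∣m⇒∣m*n e p∣2))

    p∣1+y^e : p ℕ.∣ 1 ℕ.+ y ℕ.^ e
    p∣1+y^e = subst (p ℕ.∣_) (sym 2n≡) (ℕ.∣n⇒∣m*n 2 p∣n)

    y∣y^ : ∀ n .{{_ : ℕ.NonZero n}} → y ℕ.∣ y ℕ.^ n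
    y∣y^ (suc n) = ℕ.m∣m*n (y ℕ.^ n)

    p∤y : ¬ (p ℕ.∣ y)
    p∤y p∣y = p∣1⇒⊥ p∣1+y^e (ℕ.∣-trans p∣y (y∣y^ e {{ℕ.m^n≢0 2 (suc i)}}))

  -- The number n is odd and prime to y, while y is divisible by all odd numbers up to 2 N + 1,
  -- hence by every odd prime up to N.
  prime-factor-large : (∀ {k} → k ℕ.≤ N → 1 ℕ.+ 2 ℕ.* k ℕ.∣ y) → N ℕ.< p
  prime-factor-large divides-y with N ℕ.<? p | even-or-odd p
  ... | yes h | _ = h
  ... | no _  | inj₁ (j , eq) = contradiction (ℕ.∣-trans (ℕ.divides j (trans eq (ℕ.*-comm 2 j))) p∣n) 2∤n
  ... | no ≮  | inj₂ (j , eq) = contradiction (subst (ℕ._∣ y) (sym eq) (divides-y j≤N)) p∤y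
    where
    j≤N : j ℕ.≤ N
    j≤N = ℕ.≤-trans (ℕ.≤-trans (ℕ.m≤n*m j 2) (ℕ.n≤1+n (2 ℕ.* j))) (ℕ.≤-trans (ℕ.≤-reflexive (sym eq)) (ℕ.≮⇒≥ ≮))

  prime-factor-valuation : ¬ (2 ℕ.^ suc (suc (suc i)) ℕ.∣ p ℕ.∸ 1) →
                           ∃[ t ] p ≡ 1 ℕ.+ 2 ℕ.^ suc (suc i) ℕ.* (1 ℕ.+ 2 ℕ.* t)
  prime-factor-valuation ∤ = go (prime-divisor-order p-prime p∤2 (suc i) y p∣1+y^e)
    where
    l : ∀ j e → 2 ℕ.* j ℕ.* (2 ℕ.* e) ≡ j ℕ.* (2 ℕ.* (2 ℕ.* e))
    l = ℕ.solve-∀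
    go : 2 ℕ.^ suc (suc i) ℕ.∣ p ℕ.∸ 1 → ∃[ t ] p ≡ 1 ℕ.+ 2 ℕ.^ suc (suc i) ℕ.* (1 ℕ.+ 2 ℕ.* t)
    go (ℕ.divides t eq) with even-or-odd t
    ... | inj₁ (j , refl) = contradiction (ℕ.divides j (trans eq (l j e))) ∤
    ... | inj₂ (j , refl) = j , trans (1+pred p-prime) (cong suc (trans eq (ℕ.*-comm (1 ℕ.+ 2 ℕ.* j) (2 ℕ.* e))))

-- Since n - 1 is an odd multiple of 2^(i+2), n is not 1 modulo 2^(i+3), and `prime-factor-≢1`
-- applies.
prime-factor-exists : ∀ i u n → n ≡ 1 ℕ.+ 2 ℕ.^ suc (suc i) ℕ.* (1 ℕ.+ 2 ℕ.* u) →
                      ∃[ p ] Prime p × p ℕ.∣ n × ¬ (2 ℕ.^ suc (suc (suc i)) ℕ.∣ p ℕ.∸ 1)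
prime-factor-exists i u n n≡ = prime-factor-≢1 (2 ℕ.^ suc (suc (suc i))) n
    {{ℕ.≢-nonZero λ n≡0 → contradiction (trans (sym n≡0) n≡) λ ()}}
    λ (t , eq) → ℕ.even≢odd t u (sym (ℕ.*-cancelˡ-≡ (1 ℕ.+ 2 ℕ.* u) (2 ℕ.* t) (2 ℕ.^ suc (suc i)) {{ℕ.m^n≢0 2 (suc (suc i))}}
      (ℕ.suc-injective (trans (sym n≡) (trans eq (cong suc (l (2 ℕ.^ suc i) t)))))))
  where
  l : ∀ e t → 2 ℕ.* (2 ℕ.* e) ℕ.* t ≡ 2 ℕ.* e ℕ.* (2 ℕ.* t)
  l = ℕ.solve-∀

-- For y = 3 (1·3·5⋯(2N+1))², the prime divisors of (1 + y^(2^(i+1))) / 2 exceed N and are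
-- 1 mod 2^(i+2), and not all of them are 1 mod 2^(i+3).
abstract
  primes-with-valuation : ∀ i N → ∃[ p ] N ℕ.< p × Prime p × ∃[ t ] p ≡ 1 ℕ.+ 2 ℕ.^ suc (suc i) ℕ.* (1 ℕ.+ 2 ℕ.* t)
  primes-with-valuation i N with odd-product-odd N
  ... | k , M≡ with odd-square k
  ... | b , M²≡ with repeated-square i b
  ... | u , y^≡ with prime-factor-exists i u (1 ℕ.+ 2 ℕ.^ suc (suc i) ℕ.* (1 ℕ.+ 2 ℕ.* u)) refl
  ... | p , p-prime , p∣n , ∤ = p
    , prime-factor-large {i} {N} {3 ℕ.+ 24 ℕ.* b} {_} {u} 2n≡ refl p-prime p∣n
        (λ {k} h → subst (1 ℕ.+ 2 ℕ.* k ℕ.∣_) y≡ (ℕ.∣n⇒∣m*n 3 (ℕ.∣m⇒∣m*n (odd-product N) (odd-product-divisible h))))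
    , p-prime , prime-factor-valuation {i} {N} {3 ℕ.+ 24 ℕ.* b} {_} {u} 2n≡ refl p-prime p∣n ∤
    where
    l : ∀ e u → suc (1 ℕ.+ 4 ℕ.* e ℕ.* (1 ℕ.+ 2 ℕ.* u)) ≡ 2 ℕ.* (1 ℕ.+ 2 ℕ.* e ℕ.* (1 ℕ.+ 2 ℕ.* u))
    l = ℕ.solve-∀
    l₁ : ∀ b → 3 ℕ.* (1 ℕ.+ 8 ℕ.* b) ≡ 3 ℕ.+ 24 ℕ.* b
    l₁ = ℕ.solve-∀
    y≡ : 3 ℕ.* (odd-product N ℕ.* odd-product N) ≡ 3 ℕ.+ 24 ℕ.* b
    y≡ = trans (cong (λ t → 3 ℕ.* (t ℕ.* t)) M≡) (trans (cong (3 ℕ.*_) M²≡) (l₁ b))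
    2n≡ : 1 ℕ.+ (3 ℕ.+ 24 ℕ.* b) ℕ.^ (2 ℕ.^ suc i) ≡ 2 ℕ.* (1 ℕ.+ 2 ℕ.^ suc (suc i) ℕ.* (1 ℕ.+ 2 ℕ.* u))
    2n≡ = trans (cong suc y^≡) (l (2 ℕ.^ suc i) u)

-- The coefficients of the chromatic polynomials of Paley graphs

evalℤ : List ℤ → ℤ → ℤ
evalℤ []      x = 0ℤ
evalℤ (a ∷ p) x = a + x * evalℤ p x

⟦map⟧ : ∀ r (p : List ℤ) n → ⟦ map (λ a → ι a ℚ.* r) p ⟧ n ≡ ι (evalℤ p (+ n)) ℚ.* r
⟦map⟧ r []      n = sym (ℚ.*-zeroˡ r)
⟦map⟧ r (a ∷ p) n = begin
  ι a ℚ.* r ℚ.+ fromℕ n ℚ.* ⟦ map (λ a → ι a ℚ.* r) p ⟧ n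
    ≡⟨ cong (λ u → ι a ℚ.* r ℚ.+ ι (+ n) ℚ.* u) (⟦map⟧ r p n) ⟩
  ι a ℚ.* r ℚ.+ ι (+ n) ℚ.* (ι (evalℤ p (+ n)) ℚ.* r)
    ≡⟨ solve 4 (λ a r n e → a :* r :+ n :* (e :* r) := (a :+ n :* e) :* r) refl (ι a) r (ι (+ n)) (ι (evalℤ p (+ n))) ⟩
  (ι a ℚ.+ ι (+ n) ℚ.* ι (evalℤ p (+ n))) ℚ.* r
    ≡⟨ cong (ℚ._* r) (trans (cong (ι a ℚ.+_) (sym (ι-* (+ n) (evalℤ p (+ n))))) (sym (ι-+ a (+ n * evalℤ p (+ n))))) ⟩
  ι (a + + n * evalℤ p (+ n)) ℚ.* r ∎
  where open +-*-Solver using (solve; _:=_; _:+_; _:*_)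

⟦map⟧-value : ∀ d r → ι d ℚ.* r ≡ 1ℚ → ∀ p n {c} → d * c ≡ evalℤ p (+ n) → ι c ≡ ⟦ map (λ a → ι a ℚ.* r) p ⟧ n
⟦map⟧-value d r dr≡1 p n {c} h = begin
  ι c                                ≡⟨ ℚ.*-identityʳ (ι c) ⟨
  ι c ℚ.* 1ℚ                         ≡⟨ cong (ι c ℚ.*_) dr≡1 ⟨
  ι c ℚ.* (ι d ℚ.* r)                ≡⟨ solve 3 (λ c d r → c :* (d :* r) := d :* c :* r) refl (ι c) (ι d) r ⟩
  ι d ℚ.* ι c ℚ.* r                  ≡⟨ cong (ℚ._* r) (trans (sym (ι-* d c)) (cong ι h)) ⟩
  ι (evalℤ p (+ n)) ℚ.* r            ≡⟨ ⟦map⟧ r p n ⟨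
  ⟦ map (λ a → ι a ℚ.* r) p ⟧ n ∎
  where open +-*-Solver using (solve; _:=_; _:+_; _:*_)

denominator : ∀ x → ι (ℚ.↧ x) ℚ.* x ≡ ι (ℚ.↥ x)
denominator x@record{} = ℚ.toℚᵘ-injective (ℚᵘ.≃-trans (ℚ.toℚᵘ-homo-* (ι (ℚ.↧ x)) x)
  (ℚᵘ.≃-trans (ℚᵘ.*-congʳ {ℚ.toℚᵘ x} (ℚ.toℚᵘ-fromℚᵘ (ℚᵘ.mkℚᵘ (ℚ.↧ x) 0)))
    (ℚᵘ.≃-trans (ℚᵘ.*≡* (l (ℚ.↧ x) (ℚ.↥ x))) (ℚᵘ.≃-sym (ℚ.toℚᵘ-fromℚᵘ (ℚᵘ.mkℚᵘ (ℚ.↥ x) 0))))))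
  where
  l : ∀ d n → (d * n) * 1ℤ ≡ n * (1ℤ * d)
  l = solve-∀

-- The size and divisibility arguments below take place in ℤ; the common denominator d of a supposed
-- φ₃ moves there, where it enters the constant k = 4 d.
clear-denominators : (p : ℚ[X]) → Σ[ d ∈ ℕ ] ℕ.NonZero d × Σ[ L ∈ List ℤ ] (∀ n → ι (+ d) ℚ.* ⟦ p ⟧ n ≡ ι (evalℤ L (+ n)))
clear-denominators []      = 1 , _ , [] , λ n → refl
clear-denominators (x ∷ p) with clear-denominators p
... | d , d≢0 , L , h = ℚ.↧ₙ x ℕ.* d , ℕ.m*n≢0 (ℚ.↧ₙ x) d {{it}} {{d≢0}} ,
      (ℚ.↥ x * + d) ∷ map (ℚ.↧ x *_) L , λ n → begin
  ι (+ (ℚ.↧ₙ x ℕ.* d)) ℚ.* (x ℚ.+ fromℕ n ℚ.* ⟦ p ⟧ n)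
    ≡⟨ cong (ℚ._* (x ℚ.+ fromℕ n ℚ.* ⟦ p ⟧ n)) (trans (cong ι (ℤ.pos-* (ℚ.↧ₙ x) d)) (ι-* (ℚ.↧ x) (+ d))) ⟩
  ι (ℚ.↧ x) ℚ.* ι (+ d) ℚ.* (x ℚ.+ fromℕ n ℚ.* ⟦ p ⟧ n)
    ≡⟨ solve 5 (λ y d x n e → y :* d :* (x :+ n :* e) := y :* x :* d :+ n :* (y :* (d :* e))) refl
         (ι (ℚ.↧ x)) (ι (+ d)) x (fromℕ n) (⟦ p ⟧ n) ⟩
  ι (ℚ.↧ x) ℚ.* x ℚ.* ι (+ d) ℚ.+ fromℕ n ℚ.* (ι (ℚ.↧ x) ℚ.* (ι (+ d) ℚ.* ⟦ p ⟧ n))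
    ≡⟨ cong₂ (λ u w → u ℚ.* ι (+ d) ℚ.+ fromℕ n ℚ.* (ι (ℚ.↧ x) ℚ.* w)) (denominator x) (h n) ⟩
  ι (ℚ.↥ x) ℚ.* ι (+ d) ℚ.+ ι (+ n) ℚ.* (ι (ℚ.↧ x) ℚ.* ι (evalℤ L (+ n)))
    ≡⟨ cong₂ ℚ._+_ (sym (ι-* (ℚ.↥ x) (+ d))) (trans (cong (ι (+ n) ℚ.*_) (sym (ι-* (ℚ.↧ x) (evalℤ L (+ n)))))
         (sym (ι-* (+ n) (ℚ.↧ x * evalℤ L (+ n))))) ⟩
  ι (ℚ.↥ x * + d) ℚ.+ ι (+ n * (ℚ.↧ x * evalℤ L (+ n)))
    ≡⟨ sym (ι-+ (ℚ.↥ x * + d) (+ n * (ℚ.↧ x * evalℤ L (+ n)))) ⟩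
  ι (ℚ.↥ x * + d + + n * (ℚ.↧ x * evalℤ L (+ n)))
    ≡⟨ cong (λ u → ι (ℚ.↥ x * + d + + n * u)) (sym (evalℤ-scale (ℚ.↧ x) L (+ n))) ⟩
  ι (ℚ.↥ x * + d + + n * evalℤ (map (ℚ.↧ x *_) L) (+ n)) ∎
  where
  open +-*-Solver using (solve; _:=_; _:+_; _:*_)
  it : ℕ.NonZero (ℚ.↧ₙ x)
  it = _
  evalℤ-scale : ∀ k L x → evalℤ (map (k *_) L) x ≡ k * evalℤ L x
  evalℤ-scale k []      x = sym (ℤ.*-zeroʳ k)
  evalℤ-scale k (a ∷ L) x = trans (cong (λ u → k * a + x * u) (evalℤ-scale k L x)) (l k a x (evalℤ L x))
    where
    l : ∀ k a x e → k * a + x * (k * e) ≡ k * (a + x * e)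
    l = solve-∀

-- The cut is made after x³ because k (q² - q) a² is at most |k| q³ in size when a² ≤ q; all higher
-- terms are collected in x⁴ R x, a multiple of x⁴ by an integer.
record CubicPart (L : List ℤ) : Set where
  field
    l₀ l₁ l₂ l₃ : ℤ
    R : ℤ → ℤ
    expand : ∀ x → evalℤ L x ≡ l₀ + l₁ * x + l₂ * (x * x) + l₃ * (x * x * x) + x * x * x * x * R x

cubic-part : ∀ L → CubicPart L
cubic-part []                      = record { l₀ = 0ℤ ; l₁ = 0ℤ ; l₂ = 0ℤ ; l₃ = 0ℤ ; R = λ _ → 0ℤ ; expand = e }
  where
  e : ∀ x → 0ℤ ≡ 0ℤ + 0ℤ * x + 0ℤ * (x * x) + 0ℤ * (x * x * x) + x * x * x * x * 0ℤ
  e = solve-∀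
cubic-part (a ∷ [])                = record { l₀ = a ; l₁ = 0ℤ ; l₂ = 0ℤ ; l₃ = 0ℤ ; R = λ _ → 0ℤ ; expand = e a }
  where
  e : ∀ a x → a + x * 0ℤ ≡ a + 0ℤ * x + 0ℤ * (x * x) + 0ℤ * (x * x * x) + x * x * x * x * 0ℤ
  e = solve-∀
cubic-part (a ∷ b ∷ [])            = record { l₀ = a ; l₁ = b ; l₂ = 0ℤ ; l₃ = 0ℤ ; R = λ _ → 0ℤ ; expand = e a b }
  where
  e : ∀ a b x → a + x * (b + x * 0ℤ) ≡ a + b * x + 0ℤ * (x * x) + 0ℤ * (x * x * x) + x * x * x * x * 0ℤ
  e = solve-∀
cubic-part (a ∷ b ∷ c ∷ [])        = record { l₀ = a ; l₁ = b ; l₂ = c ; l₃ = 0ℤ ; R = λ _ → 0ℤ ; expand = e a b c }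
  where
  e : ∀ a b c x → a + x * (b + x * (c + x * 0ℤ)) ≡ a + b * x + c * (x * x) + 0ℤ * (x * x * x) + x * x * x * x * 0ℤ
  e = solve-∀
cubic-part (a ∷ b ∷ c ∷ d ∷ L)     = record { l₀ = a ; l₁ = b ; l₂ = c ; l₃ = d ; R = evalℤ L ; expand = λ x → e a b c d x (evalℤ L x) }
  where
  e : ∀ a b c d x r → a + x * (b + x * (c + x * (d + x * r))) ≡ a + b * x + c * (x * x) + d * (x * x * x) + x * x * x * x * r
  e = solve-∀

-- Parity of squares and the 2-adic obstruction to a linear law

parity : ∀ z → (Σ[ k ∈ ℤ ] z ≡ + 2 * k) ⊎ (Σ[ k ∈ ℤ ] z ≡ 1ℤ + + 2 * k)
parity z with z %ℕ 2 | n%ℕd<d z 2 | a≡a%ℕn+[a/ℕn]*n z 2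
... | 0           | _ | eq = inj₁ (z /ℕ 2 , trans eq (trans (ℤ.+-identityˡ (z /ℕ 2 * + 2)) (ℤ.*-comm (z /ℕ 2) (+ 2))))
... | 1           | _ | eq = inj₂ (z /ℕ 2 , trans eq (cong (λ u → 1ℤ + u) (ℤ.*-comm (z /ℕ 2) (+ 2))))
... | suc (suc _) | ℕ.s≤s (ℕ.s≤s ()) | _

odd≢even : ∀ x y → 1ℤ + + 2 * x ≢ + 2 * y
odd≢even x y h = contradiction (ℕ.∣⇒≤ (∣⇒∣ᵤ {+ 2} {1ℤ} (divides (y - x) (trans (e₁ x) (trans (cong (λ u → u - + 2 * x) h) (e₂ x y))))))
    λ { (ℕ.s≤s ()) }
  where
  e₁ : ∀ x → 1ℤ ≡ 1ℤ + + 2 * x - + 2 * x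
  e₁ = solve-∀
  e₂ : ∀ x y → + 2 * y - + 2 * x ≡ (y - x) * + 2
  e₂ = solve-∀

even-root : ∀ {z w} → z * z ≡ + 2 * w → Σ[ k ∈ ℤ ] z ≡ + 2 * k
even-root {z} {w} h with parity z
... | inj₁ even       = even
... | inj₂ (k , refl) = contradiction (trans (sym (l k)) h) (odd≢even (+ 2 * (k + k * k)) w)
  where
  l : ∀ k → (1ℤ + + 2 * k) * (1ℤ + + 2 * k) ≡ 1ℤ + + 2 * (+ 2 * (k + k * k))
  l = solve-∀

square-of-odd : ∀ g → Σ[ h ∈ ℤ ] (1ℤ + + 2 * g) * (1ℤ + + 2 * g) ≡ 1ℤ + + 8 * h
square-of-odd g with parity g
... | inj₁ (k , refl) = k + + 2 * (k * k) , l k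
  where
  l : ∀ k → (1ℤ + + 2 * (+ 2 * k)) * (1ℤ + + 2 * (+ 2 * k)) ≡ 1ℤ + + 8 * (k + + 2 * (k * k))
  l = solve-∀
... | inj₂ (k , refl) = 1ℤ + + 3 * k + + 2 * (k * k) , l k
  where
  l : ∀ k → (1ℤ + + 2 * (1ℤ + + 2 * k)) * (1ℤ + + 2 * (1ℤ + + 2 * k)) ≡ 1ℤ + + 8 * (1ℤ + + 3 * k + + 2 * (k * k))
  l = solve-∀

-- The square b² = q - a² is divisible by 8, since q and a² are both 1 modulo 8. So b is even, then
-- (b / 2)² is even, and b is divisible by 4.
sixteen-divides : ∀ {a b h q} t → a * a ≡ 1ℤ + + 8 * h → a * a + b * b ≡ q → q ≡ 1ℤ + + 8 * t →
                  Σ[ B ∈ ℤ ] b * b ≡ + 16 * B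
sixteen-divides {a} {b} {h} {q} t aa aabb q≡ with even-root {b} {+ 4 * (t - h)} b²
  where
  e : ∀ a b → b ≡ a + b - a
  e = solve-∀
  e₂ : ∀ t h → 1ℤ + + 8 * t - (1ℤ + + 8 * h) ≡ + 2 * (+ 4 * (t - h))
  e₂ = solve-∀
  b² : b * b ≡ + 2 * (+ 4 * (t - h))
  b² = trans (e (a * a) (b * b)) (trans (cong₂ _-_ (trans aabb q≡) aa) (e₂ t h))
... | k , refl with even-root {k} {t - h} k²
  where
  e : ∀ a k → + 4 * (k * k) ≡ a + + 2 * k * (+ 2 * k) - a
  e = solve-∀
  e₂ : ∀ t h → 1ℤ + + 8 * t - (1ℤ + + 8 * h) ≡ + 4 * (+ 2 * (t - h))
  e₂ = solve-∀
  k² : k * k ≡ + 2 * (t - h)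
  k² = ℤ.*-cancelˡ-≡ (+ 4) (k * k) (+ 2 * (t - h)) (trans (e (a * a) k) (trans (cong₂ _-_ (trans aabb q≡) aa) (e₂ t h)))
...   | j , refl = j * j , l j
  where
  l : ∀ j → + 2 * (+ 2 * j) * (+ 2 * (+ 2 * j)) ≡ + 16 * (j * j)
  l = solve-∀

1+4k∈Q : ∀ {p} k → Prime p → p ≡ 1 ℕ.+ 4 ℕ.* k → p ∈ PrimeOneModFour
1+4k∈Q k p-prime refl = p-prime , trans (cong (λ u → (1 ℕ.+ u) ℕ.% 4) (ℕ.*-comm 4 k)) (ℕ.[m+kn]%n≡m%n 1 k 4)

prime-one-mod-four : ∀ i N → ∃[ p ] N ℕ.< p × p ∈ PrimeOneModFour × Σ[ t ∈ ℤ ] + p ≡ 1ℤ + + (2 ℕ.^ suc (suc i)) * (1ℤ + + 2 * t)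
prime-one-mod-four i N = go (primes-with-valuation i N)
  where
  e = 2 ℕ.^ i
  go : ∃[ p ] N ℕ.< p × Prime p × ∃[ t ] p ≡ 1 ℕ.+ 2 ℕ.^ suc (suc i) ℕ.* (1 ℕ.+ 2 ℕ.* t) →
       ∃[ p ] N ℕ.< p × p ∈ PrimeOneModFour × Σ[ t ∈ ℤ ] + p ≡ 1ℤ + + (2 ℕ.^ suc (suc i)) * (1ℤ + + 2 * t)
  go (p , N<p , p-prime , t , p≡) = p , N<p , 1+4k∈Q (e ℕ.* (1 ℕ.+ 2 ℕ.* t)) p-prime (trans p≡ (cong suc (l e (1 ℕ.+ 2 ℕ.* t)))) ,
    + t , trans (cong +_ p≡) (cong (λ u → 1ℤ + u) (trans (ℤ.pos-* (2 ℕ.^ suc (suc i)) (1 ℕ.+ 2 ℕ.* t))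
      (cong (λ u → + (2 ℕ.^ suc (suc i)) * (1ℤ + u)) (ℤ.pos-* 2 t))))
    where
    l : ∀ e k → 2 ℕ.* (2 ℕ.* e) ℕ.* k ≡ 4 ℕ.* (e ℕ.* k)
    l = ℕ.solve-∀

record LinearRepresentation (k u v : ℤ) (q : ℕ) : Set where
  field
    a b h  : ℤ
    odd    : a * a ≡ 1ℤ + + 8 * h
    sum-sq : a * a + b * b ≡ + q
    linear : k * (a * a) ≡ u * + q + v

-- The points (q, b²) lie on a line.  For q ≡ 5, 9, 17 modulo 8, 16, 32 the 2-adic
-- valuations of the differences of q are 2 and 3, while those of the differences
-- of b² are 2 and at least 4.
no-linear-representation : ∀ {k} → k ≢ 0ℤ → ∀ u v N →
  ¬ (∀ q → q ∈ PrimeOneModFour → N ℕ.< q → LinearRepresentation k u v q)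
no-linear-representation {k} k≢0 u v N rep
  = three (prime-one-mod-four 0 N) (prime-one-mod-four 1 N) (prime-one-mod-four 2 N)
  where
  contradict : ∀ {q₁ q₂ q₃} t₁ t₂ t₃ → + q₁ ≡ 1ℤ + + 4 * (1ℤ + + 2 * t₁) → + q₂ ≡ 1ℤ + + 8 * (1ℤ + + 2 * t₂) →
    + q₃ ≡ 1ℤ + + 16 * (1ℤ + + 2 * t₃) →
    LinearRepresentation k u v q₁ → LinearRepresentation k u v q₂ → ¬ LinearRepresentation k u v q₃
  contradict {q₁} {q₂} {q₃} t₁ t₂ t₃ q₁≡ q₂≡ q₃≡ r₁ r₂ r₃ = odd≢even (α + β + + 2 * (α * β)) (γ * (1ℤ + + 2 * ε))
      (ℤ.*-cancelˡ-≡ (+ 32) (1ℤ + + 2 * (α + β + + 2 * (α * β))) (+ 2 * (γ * (1ℤ + + 2 * ε))) (begin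
        -- The left side of the collinearity relation is 32 times an odd number, the right side 64
        -- times an integer.
        + 32 * (1ℤ + + 2 * (α + β + + 2 * (α * β)))     ≡⟨ e₁ α β ⟩
        + 4 * (1ℤ + + 2 * α) * (+ 8 * (1ℤ + + 2 * β))   ≡⟨ cong₂ _*_ (sym D₁₂) (sym q₂₃) ⟩
        (b₁ - b₂) * (+ q₂ - + q₃)                       ≡⟨ ℤ.*-cancelˡ-≡ k _ _ {{ℤ.≢-nonZero k≢0}} collinear ⟩
        (b₂ - b₃) * (+ q₁ - + q₂)                       ≡⟨ cong₂ _*_ D₂₃ q₁₂ ⟩
        + 16 * γ * (+ 4 * (1ℤ + + 2 * ε))               ≡⟨ e₂ γ ε ⟩
        + 32 * (+ 2 * (γ * (1ℤ + + 2 * ε))) ∎))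
    where
    module r₁ = LinearRepresentation r₁
    module r₂ = LinearRepresentation r₂
    module r₃ = LinearRepresentation r₃
    b₁ b₂ b₃ α β γ ε : ℤ
    b₁ = r₁.b * r₁.b
    b₂ = r₂.b * r₂.b
    b₃ = r₃.b * r₃.b
    l₃ : ∀ t → 1ℤ + + 16 * (1ℤ + + 2 * t) ≡ 1ℤ + + 8 * (+ 2 * (1ℤ + + 2 * t))
    l₃ = solve-∀
    B₂ = sixteen-divides {r₂.a} {r₂.b} {r₂.h} (1ℤ + + 2 * t₂) r₂.odd r₂.sum-sq q₂≡
    B₃ = sixteen-divides {r₃.a} {r₃.b} {r₃.h} (+ 2 * (1ℤ + + 2 * t₃)) r₃.odd r₃.sum-sq (trans q₃≡ (l₃ t₃))
    α = t₁ - r₁.h - + 2 * B₂ .proj₁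
    β = t₂ - (1ℤ + + 2 * t₃)
    γ = B₂ .proj₁ - B₃ .proj₁
    ε = t₁ - (1ℤ + + 2 * t₂)
    e : ∀ a b → b ≡ a + b - a
    e = solve-∀
    b²≡ : ∀ {q} (r : LinearRepresentation k u v q) → LinearRepresentation.b r * LinearRepresentation.b r ≡ + q - LinearRepresentation.a r * LinearRepresentation.a r
    b²≡ r = trans (e (LinearRepresentation.a r * LinearRepresentation.a r) (LinearRepresentation.b r * LinearRepresentation.b r))
      (cong (λ w → w - LinearRepresentation.a r * LinearRepresentation.a r) (LinearRepresentation.sum-sq r))
    -- Modulo 8, b₁ = q₁ - a₁² is 5 - 1 = 4 and b₂ is 0.
    D₁₂ : b₁ - b₂ ≡ + 4 * (1ℤ + + 2 * α)
    D₁₂ = trans (cong₂ _-_ (trans (b²≡ r₁) (cong₂ _-_ q₁≡ r₁.odd)) (B₂ .proj₂)) (l t₁ r₁.h (B₂ .proj₁))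
      where
      l : ∀ t h B → 1ℤ + + 4 * (1ℤ + + 2 * t) - (1ℤ + + 8 * h) - + 16 * B ≡ + 4 * (1ℤ + + 2 * (t - h - + 2 * B))
      l = solve-∀
    D₂₃ : b₂ - b₃ ≡ + 16 * γ
    D₂₃ = trans (cong₂ _-_ (B₂ .proj₂) (B₃ .proj₂)) (l (B₂ .proj₁) (B₃ .proj₁))
      where
      l : ∀ x y → + 16 * x - + 16 * y ≡ + 16 * (x - y)
      l = solve-∀
    q₂₃ : + q₂ - + q₃ ≡ + 8 * (1ℤ + + 2 * β)
    q₂₃ = trans (cong₂ _-_ q₂≡ q₃≡) (l t₂ t₃)
      where
      l : ∀ s t → 1ℤ + + 8 * (1ℤ + + 2 * s) - (1ℤ + + 16 * (1ℤ + + 2 * t)) ≡ + 8 * (1ℤ + + 2 * (s - (1ℤ + + 2 * t)))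
      l = solve-∀
    q₁₂ : + q₁ - + q₂ ≡ + 4 * (1ℤ + + 2 * ε)
    q₁₂ = trans (cong₂ _-_ q₁≡ q₂≡) (l t₁ t₂)
      where
      l : ∀ s t → 1ℤ + + 4 * (1ℤ + + 2 * s) - (1ℤ + + 8 * (1ℤ + + 2 * t)) ≡ + 4 * (1ℤ + + 2 * (s - (1ℤ + + 2 * t)))
      l = solve-∀
    on-line : ∀ {q} (r : LinearRepresentation k u v q) → k * (LinearRepresentation.b r * LinearRepresentation.b r) ≡ (k - u) * + q - v
    on-line {q} r = trans (cong (k *_) (b²≡ r)) (trans (l k (+ q) (LinearRepresentation.a r * LinearRepresentation.a r))
      (trans (cong (λ w → k * + q - w) (LinearRepresentation.linear r)) (l′ k (+ q) u v)))
      where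
      l : ∀ k q a → k * (q - a) ≡ k * q - k * a
      l = solve-∀
      l′ : ∀ k q u v → k * q - (u * q + v) ≡ (k - u) * q - v
      l′ = solve-∀
    -- By `on-line`, differences of k b² are k - u times the differences of q, so
    -- cross-multiplication eliminates both u and v.
    collinear : k * ((b₁ - b₂) * (+ q₂ - + q₃)) ≡ k * ((b₂ - b₃) * (+ q₁ - + q₂))
    collinear = trans (l k b₁ b₂ (+ q₂ - + q₃)) (trans (cong₂ (λ x y → (x - y) * (+ q₂ - + q₃)) (on-line r₁) (on-line r₂))
      (trans (l′ (k - u) v (+ q₁) (+ q₂) (+ q₃)) (trans (cong₂ (λ x y → (x - y) * (+ q₁ - + q₂)) (sym (on-line r₂)) (sym (on-line r₃)))
        (sym (l k b₂ b₃ (+ q₁ - + q₂))))))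
      where
      l : ∀ k x y z → k * ((x - y) * z) ≡ (k * x - k * y) * z
      l = solve-∀
      l′ : ∀ w v x y z → (w * x - v - (w * y - v)) * (y - z) ≡ (w * y - v - (w * z - v)) * (x - y)
      l′ = solve-∀
    e₁ : ∀ α β → + 32 * (1ℤ + + 2 * (α + β + + 2 * (α * β))) ≡ + 4 * (1ℤ + + 2 * α) * (+ 8 * (1ℤ + + 2 * β))
    e₁ = solve-∀
    e₂ : ∀ γ ε → + 16 * γ * (+ 4 * (1ℤ + + 2 * ε)) ≡ + 32 * (+ 2 * (γ * (1ℤ + + 2 * ε)))
    e₂ = solve-∀

  Found : ℕ → Set
  Found i = ∃[ p ] N ℕ.< p × p ∈ PrimeOneModFour × Σ[ t ∈ ℤ ] + p ≡ 1ℤ + + (2 ℕ.^ suc (suc i)) * (1ℤ + + 2 * t)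
  three : Found 0 → Found 1 → ¬ Found 2
  three (q₁ , N<q₁ , Q₁ , t₁ , q₁≡) (q₂ , N<q₂ , Q₂ , t₂ , q₂≡) (q₃ , N<q₃ , Q₃ , t₃ , q₃≡) =
    contradict t₁ t₂ t₃ q₁≡ q₂≡ q₃≡ (rep q₁ Q₁ N<q₁) (rep q₂ Q₂ N<q₂) (rep q₃ Q₃ N<q₃)

small-multiple : ∀ n z k → z ≡ + n * k → ℤ.∣ z ∣ ℕ.< n → z ≡ 0ℤ
small-multiple n z k eq z<n = go ℤ.∣ k ∣ refl
  where
  go : ∀ j → ℤ.∣ k ∣ ≡ j → z ≡ 0ℤ
  go zero    ∣k∣ = trans eq (trans (cong (+ n *_) (ℤ.∣i∣≡0⇒i≡0 {k} ∣k∣)) (ℤ.*-zeroʳ (+ n)))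
  go (suc j) ∣k∣ = contradiction z<n (ℕ.≤⇒≯ (ℕ.≤-trans (ℕ.m≤m*n n (suc j)) (ℕ.≤-reflexive
    (sym (trans (cong ℤ.∣_∣ eq) (trans (ℤ.abs-* (+ n) k) (cong (n ℕ.*_) ∣k∣)))))))

-- If k (q² − q) a² = f₀ + f₁ q + f₂ q² + f₃ q³ + q⁴ R with 0 ≤ a² ≤ q and q large, then R = 0 by size,
-- f₀ = 0 modulo q, and f₁ + f₂ + f₃ = 0 modulo q − 1.
reduce-to-linear : ∀ k f₀ f₁ f₂ f₃ q a b R →
  k * (+ q * (+ q - 1ℤ) * (a * a)) ≡ f₀ + f₁ * + q + f₂ * (+ q * + q) + f₃ * (+ q * + q * + q) + + q * + q * + q * + q * R →
  a * a + b * b ≡ + q →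
  suc (ℤ.∣ k ∣ ℕ.+ ℤ.∣ f₀ ∣ ℕ.+ ℤ.∣ f₁ ∣ ℕ.+ ℤ.∣ f₂ ∣ ℕ.+ ℤ.∣ f₃ ∣) ℕ.< q →
  k * (a * a) ≡ f₃ * + q + (f₂ + f₃)
reduce-to-linear k f₀ f₁ f₂ f₃ (suc p) a b R eq aabb (ℕ.s≤s B<p) = result
  where
  q = suc p
  B = ℤ.∣ k ∣ ℕ.+ ℤ.∣ f₀ ∣ ℕ.+ ℤ.∣ f₁ ∣ ℕ.+ ℤ.∣ f₂ ∣ ℕ.+ ℤ.∣ f₃ ∣
  A = a * a
  q³ = q ℕ.* q ℕ.* q
  instance
    p≢0 : ℕ.NonZero p
    p≢0 = ℕ.>-nonZero (ℕ.≤-<-trans ℕ.z≤n B<p)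
  A≤q : ℤ.∣ A ∣ ℕ.≤ q
  A≤q = subst (ℤ.∣ A ∣ ℕ.≤_) (ℤ.+-injective (trans (ℤ.pos-+ ℤ.∣ A ∣ ℤ.∣ b * b ∣) (trans (cong₂ _+_ (square-abs a) (square-abs b)) aabb)))
    (ℕ.m≤m+n ℤ.∣ A ∣ ℤ.∣ b * b ∣)
    where
    square-abs : ∀ z → + ℤ.∣ z * z ∣ ≡ z * z
    square-abs (+ n)         = trans (cong +_ (ℤ.abs-* (+ n) (+ n))) (ℤ.pos-* n n)
    square-abs ℤ.-[1+ n ]    = refl
  bound : ∀ f {m} → m ℕ.≤ q³ → ∀ z → ℤ.∣ z ∣ ≡ ℤ.∣ f ∣ ℕ.* m → ℤ.∣ z ∣ ℕ.≤ ℤ.∣ f ∣ ℕ.* q³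
  bound f m≤ z eq = ℕ.≤-trans (ℕ.≤-reflexive eq) (ℕ.*-monoʳ-≤ ℤ.∣ f ∣ m≤)
  abs-qq : ℤ.∣ + q * + q ∣ ≡ q ℕ.* q
  abs-qq = ℤ.abs-* (+ q) (+ q)
  abs-qqq : ℤ.∣ + q * + q * + q ∣ ≡ q³
  abs-qqq = trans (ℤ.abs-* (+ q * + q) (+ q)) (cong (ℕ._* q) abs-qq)
  q≤q³ : q ℕ.≤ q³
  q≤q³ = ℕ.m≤n*m q (q ℕ.* q)
  qq≤q³ : q ℕ.* q ℕ.≤ q³
  qq≤q³ = ℕ.m≤m*n (q ℕ.* q) q
  -- By `eq` this equals q⁴ R, yet its absolute value is at most B q³, because a² ≤ q gives |k q (q
  -- - 1) a²| ≤ |k| q³. With B < q it must vanish.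
  Y : ℤ
  Y = k * (+ q * (+ q - 1ℤ) * A) - f₀ - f₁ * + q - f₂ * (+ q * + q) - f₃ * (+ q * + q * + q)
  Y≡ : Y ≡ + q * + q * + q * + q * R
  Y≡ = trans (cong (λ u → u - f₀ - f₁ * + q - f₂ * (+ q * + q) - f₃ * (+ q * + q * + q)) eq)
    (l f₀ (f₁ * + q) (f₂ * (+ q * + q)) (f₃ * (+ q * + q * + q)) (+ q * + q * + q * + q * R))
    where
    l : ∀ a b c d e → a + b + c + d + e - a - b - c - d ≡ e
    l = solve-∀
  Y-bound : ℤ.∣ Y ∣ ℕ.≤ B ℕ.* q³
  Y-bound = ℕ.≤-trans
    (−-bound (K - f₀ - f₁ * + q - f₂ * (+ q * + q)) (f₃ * (+ q * + q * + q))
      (−-bound (K - f₀ - f₁ * + q) (f₂ * (+ q * + q))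
        (−-bound (K - f₀) (f₁ * + q)
          (−-bound K f₀ first (bound f₀ {1} (ℕ.s≤s ℕ.z≤n) f₀ (sym (ℕ.*-identityʳ ℤ.∣ f₀ ∣))))
          (bound f₁ q≤q³ (f₁ * + q) (ℤ.abs-* f₁ (+ q))))
        (bound f₂ qq≤q³ (f₂ * (+ q * + q)) (trans (ℤ.abs-* f₂ (+ q * + q)) (cong (ℤ.∣ f₂ ∣ ℕ.*_) abs-qq))))
      (bound f₃ ℕ.≤-refl (f₃ * (+ q * + q * + q)) (trans (ℤ.abs-* f₃ (+ q * + q * + q)) (cong (ℤ.∣ f₃ ∣ ℕ.*_) abs-qqq))))
    (ℕ.≤-reflexive (l ℤ.∣ k ∣ ℤ.∣ f₀ ∣ ℤ.∣ f₁ ∣ ℤ.∣ f₂ ∣ ℤ.∣ f₃ ∣ q³))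
    where
    l : ∀ a b c d e q → a ℕ.* q ℕ.+ b ℕ.* q ℕ.+ c ℕ.* q ℕ.+ d ℕ.* q ℕ.+ e ℕ.* q ≡ (a ℕ.+ b ℕ.+ c ℕ.+ d ℕ.+ e) ℕ.* q
    l = ℕ.solve-∀
    K = k * (+ q * (+ q - 1ℤ) * A)
    −-bound : ∀ x y {s t} → ℤ.∣ x ∣ ℕ.≤ s → ℤ.∣ y ∣ ℕ.≤ t → ℤ.∣ x - y ∣ ℕ.≤ s ℕ.+ t
    −-bound x y hx hy = ℕ.≤-trans (ℤ.∣i-j∣≤∣i∣+∣j∣ x y) (ℕ.+-mono-≤ hx hy)
    first : ℤ.∣ k * (+ q * (+ q - 1ℤ) * A) ∣ ℕ.≤ ℤ.∣ k ∣ ℕ.* q³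
    first = bound k {q ℕ.* p ℕ.* ℤ.∣ A ∣} (ℕ.*-mono-≤ (ℕ.*-monoʳ-≤ q (ℕ.n≤1+n p)) A≤q) K
      (trans (ℤ.abs-* k (+ q * (+ q - 1ℤ) * A)) (cong (ℤ.∣ k ∣ ℕ.*_)
        (trans (ℤ.abs-* (+ q * (+ q - 1ℤ)) A) (cong (ℕ._* ℤ.∣ A ∣) (ℤ.abs-* (+ q) (+ q - 1ℤ))))))
  Y≡0 : Y ≡ 0ℤ
  Y≡0 = go ℤ.∣ R ∣ refl
    where
    abs-Y : ℤ.∣ Y ∣ ≡ q³ ℕ.* (q ℕ.* ℤ.∣ R ∣)
    abs-Y = trans (cong ℤ.∣_∣ Y≡) (trans (ℤ.abs-* (+ q * + q * + q * + q) R)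
      (trans (cong (ℕ._* ℤ.∣ R ∣) (trans (ℤ.abs-* (+ q * + q * + q) (+ q)) (cong (ℕ._* q) abs-qqq))) (ℕ.*-assoc q³ q ℤ.∣ R ∣)))
    go : ∀ r → ℤ.∣ R ∣ ≡ r → Y ≡ 0ℤ
    go zero    ∣R∣ = ℤ.∣i∣≡0⇒i≡0 (trans abs-Y (trans (cong (λ r → q³ ℕ.* (q ℕ.* r)) ∣R∣) (trans (cong (q³ ℕ.*_) (ℕ.*-zeroʳ q)) (ℕ.*-zeroʳ q³))))
    go (suc r) ∣R∣ = contradiction (ℕ.<-trans B<p (ℕ.n<1+n p)) (ℕ.≤⇒≯ (ℕ.*-cancelˡ-≤ q³ (ℕ.≤-trans
      (ℕ.*-monoʳ-≤ q³ (ℕ.≤-trans (ℕ.m≤m*n q (suc r)) (ℕ.≤-reflexive (cong (q ℕ.*_) (sym ∣R∣)))))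
      (ℕ.≤-trans (ℕ.≤-reflexive (sym abs-Y)) (ℕ.≤-trans Y-bound (ℕ.≤-reflexive (ℕ.*-comm B q³)))))))
  f₀≡0 : f₀ ≡ 0ℤ
  f₀≡0 = small-multiple q f₀ (k * ((+ q - 1ℤ) * A) - f₁ - f₂ * + q - f₃ * (+ q * + q))
    (trans (l k (+ q) A f₀ f₁ f₂ f₃) (trans (cong (λ u → + q * (k * ((+ q - 1ℤ) * A) - f₁ - f₂ * + q - f₃ * (+ q * + q)) - u) Y≡0)
      (ℤ.+-identityʳ _)))
    (ℕ.≤-<-trans f₀≤B (ℕ.<-trans B<p (ℕ.n<1+n p)))
    where
    l : ∀ k q A f₀ f₁ f₂ f₃ → f₀ ≡ q * (k * ((q - 1ℤ) * A) - f₁ - f₂ * q - f₃ * (q * q)) -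
        (k * (q * (q - 1ℤ) * A) - f₀ - f₁ * q - f₂ * (q * q) - f₃ * (q * q * q))
    l = solve-∀
    f₀≤B : ℤ.∣ f₀ ∣ ℕ.≤ B
    f₀≤B = ℕ.≤-trans (ℕ.m≤n+m ℤ.∣ f₀ ∣ ℤ.∣ k ∣) (ℕ.≤-trans (ℕ.m≤m+n _ ℤ.∣ f₁ ∣) (ℕ.≤-trans (ℕ.m≤m+n _ ℤ.∣ f₂ ∣) (ℕ.m≤m+n _ ℤ.∣ f₃ ∣)))
  quadratic : k * ((+ q - 1ℤ) * A) - f₁ - f₂ * + q - f₃ * (+ q * + q) ≡ 0ℤ
  quadratic = ℤ.*-cancelˡ-≡ (+ q) _ 0ℤ (trans (l k (+ q) A f₀ f₁ f₂ f₃) (trans (cong₂ _+_ Y≡0 f₀≡0) (sym (ℤ.*-zeroʳ (+ q)))))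
    where
    l : ∀ k q A f₀ f₁ f₂ f₃ → q * (k * ((q - 1ℤ) * A) - f₁ - f₂ * q - f₃ * (q * q)) ≡
        (k * (q * (q - 1ℤ) * A) - f₀ - f₁ * q - f₂ * (q * q) - f₃ * (q * q * q)) + f₀
    l = solve-∀
  f₁₂₃≡0 : f₁ + f₂ + f₃ ≡ 0ℤ
  f₁₂₃≡0 = small-multiple p (f₁ + f₂ + f₃) (k * A - f₂ - f₃ * (+ q + 1ℤ))
    (trans (l k (+ q) A f₁ f₂ f₃) (trans (cong (λ u → (+ q - 1ℤ) * (k * A - f₂ - f₃ * (+ q + 1ℤ)) - u) quadratic) (ℤ.+-identityʳ _)))
    (ℕ.≤-<-trans (ℕ.≤-trans (ℕ.≤-trans (ℤ.∣i+j∣≤∣i∣+∣j∣ (f₁ + f₂) f₃) (ℕ.+-monoˡ-≤ ℤ.∣ f₃ ∣ (ℤ.∣i+j∣≤∣i∣+∣j∣ f₁ f₂)))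
      (ℕ.≤-trans (ℕ.m≤n+m _ (ℤ.∣ k ∣ ℕ.+ ℤ.∣ f₀ ∣)) (ℕ.≤-reflexive (l′ ℤ.∣ k ∣ ℤ.∣ f₀ ∣ ℤ.∣ f₁ ∣ ℤ.∣ f₂ ∣ ℤ.∣ f₃ ∣)))) B<p)
    where
    l : ∀ k q A f₁ f₂ f₃ → f₁ + f₂ + f₃ ≡ (q - 1ℤ) * (k * A - f₂ - f₃ * (q + 1ℤ)) -
        (k * ((q - 1ℤ) * A) - f₁ - f₂ * q - f₃ * (q * q))
    l = solve-∀
    l′ : ∀ a b c d e → a ℕ.+ b ℕ.+ (c ℕ.+ d ℕ.+ e) ≡ a ℕ.+ b ℕ.+ c ℕ.+ d ℕ.+ e
    l′ = ℕ.solve-∀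
  result : k * A ≡ f₃ * + q + (f₂ + f₃)
  result = trans (l (k * A) f₂ f₃ (+ q)) (trans (cong (λ u → u + (f₃ * + q + (f₂ + f₃)))
    (ℤ.*-cancelˡ-≡ (+ p) (k * A - f₂ - f₃ * (+ q + 1ℤ)) 0ℤ
      (trans (l′ k (+ q) A f₁ f₂ f₃) (trans (cong₂ _+_ quadratic f₁₂₃≡0) (sym (ℤ.*-zeroʳ (+ p)))))))
    (ℤ.+-identityˡ (f₃ * + q + (f₂ + f₃))))
    where
    l : ∀ A f₂ f₃ q → A ≡ A - f₂ - f₃ * (q + 1ℤ) + (f₃ * q + (f₂ + f₃))
    l = solve-∀
    l′ : ∀ k q A f₁ f₂ f₃ → (q - 1ℤ) * (k * A - f₂ - f₃ * (q + 1ℤ)) ≡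
        (k * ((q - 1ℤ) * A) - f₁ - f₂ * q - f₃ * (q * q)) + (f₁ + f₂ + f₃)
    l′ = solve-∀

-- The family of chromatic polynomials of Paley graphs

χ : ℕ → ℚ[X]
χ q = chromaticPolynomial (paley q)

χ-coeff : ∀ q r → coeffFromTop (χ q) q r ≡ ι (paleyCoeff q r)
χ-coeff q = chromaticPolynomial-coeff (paley q)

-- Obtained by expanding `c₁` and `c₂`: 1, then - q (q - 1) / 4, then (3 q⁴ - 8 q³ + 3 q² + 2 q) /
-- 96. Beyond depth 2 the empty list is a default value.
coefficientPolynomial : ℕ → ℚ[X]
coefficientPolynomial 0 = map (λ a → ι a ℚ.* 1ℚ) (1ℤ ∷ [])
coefficientPolynomial 1 = map (λ a → ι a ℚ.* (1ℤ ℚ./ 4)) (0ℤ ∷ 1ℤ ∷ - 1ℤ ∷ [])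
coefficientPolynomial 2 = map (λ a → ι a ℚ.* (1ℤ ℚ./ 96)) (0ℤ ∷ + 2 ∷ + 3 ∷ - + 8 ∷ + 3 ∷ [])
coefficientPolynomial (suc (suc (suc r))) = []

χ-top : ∀ {q} → q ∈ PrimeOneModFour → ∀ r → r ℕ.≤ 2 → ι (paleyCoeff q r) ≡ ⟦ coefficientPolynomial r ⟧ q
χ-top {q} q∈Q 0 _ = ⟦map⟧-value 1ℤ 1ℚ refl (1ℤ ∷ []) q
  (trans (cong (1ℤ *_) (chromCoeff-lead (adjacencyMatrix (paley q)))) (sym (cong (λ u → 1ℤ + u) (ℤ.*-zeroʳ (+ q)))))
χ-top {q} q∈Q 1 _ = ⟦map⟧-value (+ 4) (1ℤ ℚ./ 4) refl (0ℤ ∷ 1ℤ ∷ - 1ℤ ∷ []) q (trans c₁ (l (+ q)))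
  where
  open PaleyCoefficients (paley-coefficients q∈Q)
  l : ∀ q → - (q * (q - 1ℤ)) ≡ 0ℤ + q * (1ℤ + q * (- 1ℤ + q * 0ℤ))
  l = solve-∀
χ-top {q} q∈Q 2 _ = ⟦map⟧-value (+ 96) (1ℤ ℚ./ 96) refl (0ℤ ∷ + 2 ∷ + 3 ∷ - + 8 ∷ + 3 ∷ []) q (trans c₂ (l (+ q)))
  where
  open PaleyCoefficients (paley-coefficients q∈Q)
  l : ∀ q → + 3 * (q * (q - 1ℤ) * (q * (q - 1ℤ))) - + 12 * (q * (q - 1ℤ)) - + 2 * ((q - + 5) * (q * (q - 1ℤ))) ≡
      0ℤ + q * (+ 2 + q * (+ 3 + q * (- + 8 + q * (+ 3 + q * 0ℤ))))
  l = solve-∀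
χ-top q∈Q (suc (suc (suc r))) (ℕ.s≤s (ℕ.s≤s ()))

⟦X⟧ : ∀ q → ⟦ X ⟧ q ≡ fromℕ q
⟦X⟧ q = trans (ℚ.+-identityˡ (fromℕ q ℚ.* (1ℚ ℚ.+ fromℕ q ℚ.* 0ℚ)))
  (trans (cong (λ u → fromℕ q ℚ.* (1ℚ ℚ.+ u)) (ℚ.*-zeroʳ (fromℕ q))) (ℚ.*-identityʳ (fromℕ q)))

χ-two-level : IsTwoLevelPolynomial PrimeOneModFour X (λ _ → [ 2 ]) χ
χ-two-level = record
  { Q-infinite = λ N → case prime-one-mod-four 0 N of λ (p , N<p , p∈Q , _) → p , N<p , p∈Q
  ; degree     = λ {q} _ → q , ⟦X⟧ q , chromaticPolynomial-degree (paley q)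
  ; φ          = coefficientPolynomial
  ; agrees     = agrees
  }
  where
  agrees : ∀ {q d} → q ∈ PrimeOneModFour → ⟦ X ⟧ q ≡ fromℕ d → ∀ r → [ r ] ≤± [ 2 ] → coeffFromTop (χ q) d r ≡ ⟦ coefficientPolynomial r ⟧ q
  agrees {q} {d} q∈Q d≡ r [ r≤2 ]≤ = subst (λ d → coeffFromTop (χ q) d r ≡ ⟦ coefficientPolynomial r ⟧ q)
    (ℤ.+-injective (ι-injective {+ q} {+ d} (trans (sym (⟦X⟧ q)) d≡)))
    (trans (χ-coeff q r) (χ-top q∈Q r r≤2))

c₃-not-polynomial : ¬ (Σ[ φ₃ ∈ ℚ[X] ] ∃[ N ] ∀ q → q ∈ PrimeOneModFour → N ℕ.≤ q → coeffFromTop (χ q) q 3 ≡ ⟦ φ₃ ⟧ q)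
c₃-not-polynomial (φ₃ , N , hyp) with clear-denominators φ₃
... | d , d≢0 , L , cleared = no-linear-representation {k} k≢0 f₃ (f₂ + f₃) (N ℕ.+ suc B) representation
  where
  open CubicPart (cubic-part L)
  D k f₀ f₁ f₂ f₃ : ℤ
  D = + d
  k = + 4 * D
  -- Apart from its term in a², 1536 c₃ is x⁴ r - 43 x³ + 79 x² - 33 x with `r` as below.
  -- Subtracting D times this from 1536 times the expansion of `L` gives `f₀` to `f₃`.
  f₀ = + 1536 * l₀
  f₁ = + 1536 * l₁ + + 33 * D
  f₂ = + 1536 * l₂ - + 79 * D
  f₃ = + 1536 * l₃ + + 43 * D
  -- `reduce-to-linear` asks q to exceed `suc B`; the threshold adds N to stay in the range of the
  -- hypothesis on `φ₃`.
  B = ℤ.∣ k ∣ ℕ.+ ℤ.∣ f₀ ∣ ℕ.+ ℤ.∣ f₁ ∣ ℕ.+ ℤ.∣ f₂ ∣ ℕ.+ ℤ.∣ f₃ ∣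
  k≢0 : k ≢ 0ℤ
  k≢0 h = ℕ.≢-nonZero⁻¹ d {{d≢0}} (ℤ.+-injective (ℤ.*-cancelˡ-≡ (+ 4) D 0ℤ h))
  representation : ∀ q → q ∈ PrimeOneModFour → N ℕ.+ suc B ℕ.< q → LinearRepresentation k f₃ (f₂ + f₃) q
  representation q q∈Q large = record
    { a = a ; b = b ; h = square-of-odd g .proj₁
    ; odd = trans (cong (λ z → z * z) a-odd) (square-of-odd g .proj₂)
    ; sum-sq = two-squares
    ; linear = reduce-to-linear k f₀ f₁ f₂ f₃ q a b R′ expanded two-squares (ℕ.≤-<-trans (ℕ.m≤n+m (suc B) N) large)
    }
    where
    open PaleyCoefficients (paley-coefficients q∈Q) using (a; b; g; two-squares; a-odd; c₃)
    x c r R′ : ℤ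
    x = + q
    c = paleyCoeff q 3
    r = - + 4 * (x * x) + + 20 * x - + 19
    R′ = + 1536 * R x - D * r
    scaled : D * c ≡ evalℤ L x
    scaled = ι-injective (trans (ι-* D c) (trans (cong (ι D ℚ.*_) (trans (sym (χ-coeff q 3))
      (hyp q q∈Q (ℕ.≤-trans (ℕ.m≤m+n N (suc B)) (ℕ.<⇒≤ large))))) (cleared q)))
    G : ℤ → ℤ → ℤ
    G x A = - + 4 * (x * (x - 1ℤ) * (x * (x - 1ℤ)) * (x * (x - 1ℤ))) + + 48 * (x * (x - 1ℤ) * (x * (x - 1ℤ))) - + 128 * (x * (x - 1ℤ))
      + + 8 * ((x - + 5) * (x * (x - 1ℤ) * (x * (x - 1ℤ)))) - + 16 * ((x - + 5) * (x * (x - 1ℤ)))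
      + (x - + 5) * (x - + 9) * (x * (x - 1ℤ)) + (+ 4 * A - + 8 * x + + 36) * (x * (x - 1ℤ))
    expanded : k * (x * (x - 1ℤ) * (a * a)) ≡ f₀ + f₁ * x + f₂ * (x * x) + f₃ * (x * x * x) + x * x * x * x * R′
    expanded = begin
      k * (x * (x - 1ℤ) * (a * a))
        ≡⟨ e₁ D x (a * a) ⟩
      D * G x (a * a) - D * (x * x * x * x * r - + 43 * (x * x * x) + + 79 * (x * x) - + 33 * x)
        ≡⟨ cong (λ u → u - D * (x * x * x * x * r - + 43 * (x * x * x) + + 79 * (x * x) - + 33 * x))
             (trans (cong (D *_) (sym c₃)) (trans (e₂ D c) (cong (+ 1536 *_) (trans scaled (expand x))))) ⟩
      + 1536 * (l₀ + l₁ * x + l₂ * (x * x) + l₃ * (x * x * x) + x * x * x * x * R x)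
        - D * (x * x * x * x * r - + 43 * (x * x * x) + + 79 * (x * x) - + 33 * x)
        ≡⟨ e₃ D x (x * x) (x * x * x) (x * x * x * x) l₀ l₁ l₂ l₃ (R x) r ⟩
      f₀ + f₁ * x + f₂ * (x * x) + f₃ * (x * x * x) + x * x * x * x * R′ ∎
      where
      e₁ : ∀ D x A → + 4 * D * (x * (x - 1ℤ) * A) ≡
        D * (- + 4 * (x * (x - 1ℤ) * (x * (x - 1ℤ)) * (x * (x - 1ℤ))) + + 48 * (x * (x - 1ℤ) * (x * (x - 1ℤ))) - + 128 * (x * (x - 1ℤ))
          + + 8 * ((x - + 5) * (x * (x - 1ℤ) * (x * (x - 1ℤ)))) - + 16 * ((x - + 5) * (x * (x - 1ℤ)))
          + (x - + 5) * (x - + 9) * (x * (x - 1ℤ)) + (+ 4 * A - + 8 * x + + 36) * (x * (x - 1ℤ)))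
        - D * (x * x * x * x * (- + 4 * (x * x) + + 20 * x - + 19) - + 43 * (x * x * x) + + 79 * (x * x) - + 33 * x)
      e₁ = solve-∀
      e₂ : ∀ D c → D * (+ 1536 * c) ≡ + 1536 * (D * c)
      e₂ = solve-∀
      e₃ : ∀ D x x² x³ x⁴ l₀ l₁ l₂ l₃ R r →
        + 1536 * (l₀ + l₁ * x + l₂ * x² + l₃ * x³ + x⁴ * R) - D * (x⁴ * r - + 43 * x³ + + 79 * x² - + 33 * x) ≡
        + 1536 * l₀ + (+ 1536 * l₁ + + 33 * D) * x + (+ 1536 * l₂ - + 79 * D) * x² + (+ 1536 * l₃ + + 43 * D) * x³
          + x⁴ * (+ 1536 * R - D * r)
      e₃ = solve-∀

theorem2p9 : Σ[ χ ∈ (ℕ → ℚ[X]) ]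
    (∀ q → q ∈ PrimeOneModFour → IsChromaticPolynomial (paley q) (χ q))
    × IsTwoLevelPolynomial PrimeOneModFour X (λ _ → [ 2 ]) χ
    × ¬ (Σ[ φ₃ ∈ ℚ[X] ] ∃[ N ] ∀ q → q ∈ PrimeOneModFour → N ≤ q →
    coeffFromTop (χ q) q 3 ≡ ⟦ φ₃ ⟧ q)
theorem2p9 = χ , (λ q _ → chromaticPolynomial-correct (paley q)) , χ-two-level , c₃-not-polynomial
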